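{- For every positive integer $g$, \[c_g=\prod_{\substack{\text{prime powers } p^n\\ (p-1)p^{n-1}\le 2g<(p-1)p^n}} p^n.\] In particular $c_1=12$. Moreover, there is an effectively computable absolute constant $C$ such that $c_g\le C\cdot(7.4)^g\le C\cdot 8^g$ for all $g$.
   Context: For a positive integer $g$, $c_g$ is defined as the least common multiple of all positive integers $n$ such that, for all but at most one odd prime $p$, the symplectic group $\mathrm{Sp}_{2g}(\mathbb{F}_p)$ contains an element of order $n$. -}

module Defs where

open import Data.Nat using (ℕ; zero; suc; _+_; _*_; _∸_; _^_; _≤_; _<_; _≤?_; _<?_; _≟_; NonZero)
open import Data.Nat.DivMod using (_%_)
open import Data.Nat.Divisibility using (_∣_)
open import Data.Nat.Primality using (Prime; prime?; prime⇒nonZero)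
open import Data.Fin using (Fin; toℕ)
open import Data.List using (List; upTo; map; concatMap)
open import Data.Nat.ListAction using (product)
open import Data.Bool using (if_then_else_)
open import Data.Product using (Σ; _×_; ∃)
open import Relation.Nullary using (¬_; does)
open import Relation.Nullary.Decidable using (_×-dec_)
open import Relation.Binary.PropositionalEquality using (_≡_; _≢_)

-- square matrices of size m with natural-number entries, read modulo p
Mat : ℕ → Set
Mat m = Fin m → Fin m → ℕ

sumF : ∀ {m} → (Fin m → ℕ) → ℕ
sumF {zero}  f = 0
sumF {suc m} f = f Fin.zero + sumF (λ i → f (Fin.suc i))
  where import Data.Fin as Fin

_⊗_ : ∀ {m} → Mat m → Mat m → Mat m
(A ⊗ B) i j = sumF (λ k → A i k * B k j)

transpose : ∀ {m} → Mat m → Mat m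
transpose A i j = A j i

idM : ∀ {m} → Mat m
idM i j = if does (toℕ i ≟ toℕ j) then 1 else 0

matPow : ∀ {m} → Mat m → ℕ → Mat m
matPow M zero    = idM
matPow M (suc k) = M ⊗ matPow M k

-- standard symplectic form J = [[0, I], [-I, 0]] on F_p^(2g), indices 0..2g-1,
-- with -1 represented by p ∸ 1
Jform : (p g : ℕ) → Mat (g + g)
Jform p g i j =
  if does (toℕ j ≟ toℕ i + g) then 1
  else (if does (toℕ i ≟ toℕ j + g) then p ∸ 1 else 0)

_≈[_]_ : ∀ {m} → Mat m → (p : ℕ) → .{{NonZero p}} → Mat m → Set
A ≈[ p ] B = ∀ i j → A i j % p ≡ B i j % p

InSp : (p g : ℕ) → .{{NonZero p}} → Mat (g + g) → Set
InSp p g M = (transpose M ⊗ (Jform p g ⊗ M)) ≈[ p ] Jform p g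

HasOrder : ∀ {m} (p : ℕ) → .{{NonZero p}} → Mat m → ℕ → Set
HasOrder p M n =
  (1 ≤ n) × (matPow M n ≈[ p ] idM) × (∀ k → 1 ≤ k → k < n → ¬ (matPow M k ≈[ p ] idM))

SpHasOrder : (p g : ℕ) → .{{NonZero p}} → ℕ → Set
SpHasOrder p g n = Σ (Mat (g + g)) λ M → InSp p g M × HasOrder p M n

Admissible : ℕ → ℕ → Set
Admissible g n =
  (1 ≤ n) ×
  ∃ λ q → ∀ p → (pp : Prime p) → ¬ (2 ∣ p) → p ≢ q →
    SpHasOrder p g {{prime⇒nonZero pp}} n

IsLcmOf : (ℕ → Set) → ℕ → Set
IsLcmOf P c = (∀ n → P n → n ∣ c) × (∀ m → (∀ n → P n → n ∣ m) → c ∣ m)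

-- the product over prime powers p^n (n ≥ 1) with (p-1)p^(n-1) ≤ 2g < (p-1)p^n.
-- Any such p^n satisfies p ≤ 2g+1 and n ≤ 2g+1, so the ranges below are exhaustive.
ppTerm : ℕ → ℕ → ℕ → ℕ
ppTerm g p n =
  if does (prime? p ×-dec (1 ≤? n) ×-dec ((p ∸ 1) * p ^ (n ∸ 1) ≤? 2 * g)
            ×-dec (2 * g <? (p ∸ 1) * p ^ n))
  then p ^ n else 1

formula : ℕ → ℕ
formula g = product (concatMap (λ p → map (ppTerm g p) (upTo (2 * g + 2))) (upTo (2 * g + 2)))

-- Upper bound: if M ∈ Sp_2g(𝔽_p) has order divisible by r = ℓ^a, a cyclic subspace of dimension d ≤ 2g carries a free action of ⟨M⟩,
-- so r ∣ p^d − 1. For odd ℓ choose, by Dirichlet's theorem, p in the class of a primitive root mod r, whence φ(r) ∣ d. For ℓ = 2 take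
-- p = 3 or 11: the symplectic form pairs two such subspaces, of dimensions divisible by 2^(a−2).
-- Lower bound: block shifts of the discrete wave operator (u, v) ↦ (v, Sv − u) realise every ℓ^a with φ(ℓ^a) ≤ 2g.
-- Growth: log c_g ≤ ψ(2g) + small, and ψ(x) = x + o(x) by the elementary (Selberg) proof, while log 7.4 > 2.
-- Logarithms are rational: additive functions whose increments at n are 1/n up to 1/n², built from harmonic sums.
module Submission where

open import Data.Bool using (Bool; true; false; not; _∧_; if_then_else_)
open import Data.Empty using (⊥; ⊥-elim)
open import Data.Fin as Fin using (Fin; toℕ; fromℕ<; inject₁; fromℕ; funToFin; finToFun; _↑ˡ_; _↑ʳ_)
import Data.Fin.Properties as FinP
open import Data.List using (List; []; _∷_; _++_; length; filter; applyUpTo; map; concatMap; upTo; allFin)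
open import Data.List.Membership.Propositional using (_∈_; _∉_)
open import Data.List.Membership.Propositional.Properties using (∈-map⁺; ∈-map⁻; ∈-allFin; ∈-∃++; ∈-filter⁺; ∈-filter⁻; ∈-applyUpTo⁺; ∈-applyUpTo⁻; ∈-++⁺ˡ; ∈-++⁺ʳ; ∈-++⁻)
open import Data.List.Properties using (length-++; length-applyUpTo; length-map; length-tabulate)
open import Data.List.Relation.Unary.All as All using (All; []; _∷_)
open import Data.List.Relation.Unary.AllPairs using ([]; _∷_)
open import Data.List.Relation.Unary.Any using (here; there)
open import Data.List.Relation.Unary.Unique.Propositional using (Unique)
import Data.List.Relation.Unary.Unique.Propositional.Properties as UniqueP
open import Data.Nat as N using (ℕ; zero; suc; z≤n; s≤s; z<s; NonZero)
open import Data.Nat.Coprimality using (Coprime; coprime-divisor)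
open import Data.Nat.DivMod
open import Data.Nat.Divisibility
open import Data.Nat.GCD using (gcd; gcd-GCD; gcd[m,n]∣m; gcd[m,n]∣n; module Bézout)
open import Data.Nat.Induction using (<-rec)
open import Data.Nat.ListAction using (product)
open import Data.Nat.Primality
open import Data.Nat.Properties as P using (*-cancelʳ-<; *-cancelʳ-≤; *-cancelˡ-<; *-identityʳ; *-monoʳ-≤; *-monoˡ-≤; *-suc; +-monoʳ-≤; +-monoˡ-≤; +-suc; 1+n≰n; <-trans; <⇒≢; <⇒≱; ^-distribˡ-+-*; ^-monoʳ-<; ^-monoˡ-≤; allUpTo?; anyUpTo?; m+[n∸m]≡n; m<m+n; m<n+m; m^n≢0; m∸n+n≡m; m∸n≤m; m≤m*n; m≤m+n; m≤n*m; m≤n+m; m≤n⇒m<n∨m≡n; m≤n⇒m≤1+n; n<1+n; n≢0⇒n>0; n≤1+n; ∸-monoˡ-≤; ≤-pred; ≤∧≢⇒<; ≮⇒≥)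
open import Data.Nat.Tactic.RingSolver using (solve-∀)
open import Data.Product using (_×_; _,_; ∃) renaming (proj₁ to fst; proj₂ to snd)
open import Data.Sum using (_⊎_; inj₁; inj₂; [_,_]′)
open import Function using (case_of_; _∘_)
open import Relation.Binary.PropositionalEquality hiding (J)
open import Relation.Nullary using (¬_; Dec; yes; no; does; ¬?)
open import Relation.Nullary.Decidable using (_×-dec_; _→-dec_; toWitness; toWitnessFalse)

open N using () renaming (_≤_ to _≦_)

-- No rational-valued completely additive function has increments 1/n up to 1/n² for all n: by Erdős
-- it would be the real logarithm, which is irrational at 2. So every logarithm here works only
-- below some `N`, chosen after the numbers to be compared, and each asymptotic statement is an
-- explicit inequality whose constants are fixed before `N` and the logarithm. Dirichlet's theorem
-- is obtained for a generator a of a cyclic group of units. Selberg's formula in a class shows that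
-- if few primes lie in the class c, then a dense class b forces c/b to be as dense as possible. An
-- empty class a would turn this into a chain of dense classes through all higher powers of a,
-- ending at the class 1, which the same principle makes sparse. For 2 the unit group is not cyclic,
-- and the order of p modulo 2^a is at most half of the required 2^(a-1). The primes p ≡ 3 mod 8
-- reach that half, and -2 is a square for them, so Y⁴ + 1 splits into two quadratic factors
-- exchanged up to a unit by Y ↦ Y⁻¹; a symplectic map that has one has the other.

module Nat where
 open import Defs public
 open import Data.Nat public using (_+_; _*_; _∸_; _^_; _≤_; _<_)
 open import Data.Nat.Properties public

infixr 4 _»_ _⋙_

_»_ : ∀ {A : Set} {x y z : A} → x ≡ y → y ≡ z → x ≡ z
_»_ = trans

_⋙_ : ∀ {l m n} → l ≦ m → m ≦ n → l ≦ n
_⋙_ = P.≤-trans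

-- Rational arithmetic with sealed operations, and reflective solvers for identities and
-- inequalities

module Rationals where
 open import Data.Integer as ℤ using (ℤ; -[1+_]) renaming (+_ to pos)
 import Data.Integer.Properties as ℤP
 import Data.Rational as ℚ
 import Data.Rational.Properties as ℚP
 import Data.Rational.Unnormalised as ℚᵘ
 import Data.Rational.Unnormalised.Properties as ℚᵘP
 import Data.List.Properties as ListP
 open import Data.Vec using (Vec; []; _∷_; lookup; map)
 open import Data.Vec.N-ary using (N-ary; _$ⁿ_)
 open import Data.Bool using (Bool; true; false; T; if_then_else_)
 open import Data.Unit using (⊤)
 open import Data.Bool using (T)
 infixl 6 _+_ _-_
 infixl 7 _*_
 infix  8 -_
 infix  4 _≤_ _<_ _≤?_
 infix  9 #_
 -- The rationals with sealed operations: terms never unfold, and heads stay rigid for unification.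
 Q : Set
 Q = ℚ.ℚ
 abstract
  _+_ _*_ : Q -> Q -> Q
  _+_ = ℚ._+_
  _*_ = ℚ._*_
  -_ : Q -> Q
  -_ = ℚ.-_
  fromℤ : ℤ -> Q
  fromℤ i = i ℚ./ 1
  #_ : ℕ -> Q
  # n = fromℤ (pos n)
  _≤_ : Q -> Q -> Set
  _≤_ = ℚ._≤_
  inv : ℕ -> Q
  -- The default 1/0 = 0 keeps 0 ≤ `inv n` ≤ 1 true for every n.
  inv zero    = ℚ.0ℚ
  inv (suc n) = (pos 1) ℚ./ suc n
 _-_ : Q -> Q -> Q
 a - b = a + - b
 -- Strictness is a refutation, so a strict bound is literally a function into the empty type; this
 -- suits the many arguments by contradiction.
 _<_ : Q -> Q -> Set
 a < b = ¬ (b ≤ a)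
 abstract
  +-comm : ∀ a b -> a + b ≡ b + a
  +-comm = ℚP.+-comm
  +-assoc : ∀ a b c -> (a + b) + c ≡ a + (b + c)
  +-assoc = ℚP.+-assoc
  *-comm : ∀ a b -> a * b ≡ b * a
  *-comm = ℚP.*-comm
  *-assoc : ∀ a b c -> (a * b) * c ≡ a * (b * c)
  *-assoc = ℚP.*-assoc
  *-distribˡ-+ : ∀ a b c -> a * (b + c) ≡ a * b + a * c
  *-distribˡ-+ = ℚP.*-distribˡ-+
  +-inverseʳ : ∀ a -> a + - a ≡ fromℤ (pos 0)
  +-inverseʳ = ℚP.+-inverseʳ
  +-identityˡ : ∀ a -> fromℤ (pos 0) + a ≡ a
  +-identityˡ = ℚP.+-identityˡ
  *-identityˡ : ∀ a -> fromℤ (pos 1) * a ≡ a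
  *-identityˡ = ℚP.*-identityˡ
  #-fromℤ : ∀ n -> # n ≡ fromℤ (pos n)
  #-fromℤ n = refl
  private
   fromℤ-ᵘ : ∀ i -> ℚ.toℚᵘ (fromℤ i) ℚᵘ.≃ ℚᵘ.mkℚᵘ i 0
   fromℤ-ᵘ i = ℚP.toℚᵘ-fromℚᵘ (ℚᵘ.mkℚᵘ i 0)
  fromℤ-+ : ∀ i j -> fromℤ (i ℤ.+ j) ≡ fromℤ i + fromℤ j
  fromℤ-+ i j = ℚP.toℚᵘ-injective (ℚᵘP.≃-trans (fromℤ-ᵘ (i ℤ.+ j)) (ℚᵘP.≃-sym
   (ℚᵘP.≃-trans (ℚP.toℚᵘ-homo-+ (fromℤ i) (fromℤ j))
   (ℚᵘP.≃-trans (ℚᵘP.+-cong (fromℤ-ᵘ i) (fromℤ-ᵘ j))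
    (ℚᵘ.*≡* (cong (ℤ._* pos 1) (cong₂ ℤ._+_ (ℤP.*-identityʳ i) (ℤP.*-identityʳ j))))))))
  fromℤ-* : ∀ i j -> fromℤ (i ℤ.* j) ≡ fromℤ i * fromℤ j
  fromℤ-* i j = ℚP.toℚᵘ-injective (ℚᵘP.≃-trans (fromℤ-ᵘ (i ℤ.* j)) (ℚᵘP.≃-sym
   (ℚᵘP.≃-trans (ℚP.toℚᵘ-homo-* (fromℤ i) (fromℤ j))
   (ℚᵘP.≃-trans (ℚᵘP.*-cong (fromℤ-ᵘ i) (fromℤ-ᵘ j)) (ℚᵘ.*≡* refl)))))
  ≤-refl : ∀ {a} -> a ≤ a
  ≤-refl = ℚP.≤-refl
  ≤-reflexive : ∀ {a b} -> a ≡ b -> a ≤ b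
  ≤-reflexive = ℚP.≤-reflexive
  ≤-trans : ∀ {a b c} -> a ≤ b -> b ≤ c -> a ≤ c
  ≤-trans = ℚP.≤-trans
  ≤-antisym : ∀ {a b} -> a ≤ b -> b ≤ a -> a ≡ b
  ≤-antisym = ℚP.≤-antisym
  ≤-total : ∀ a b -> a ≤ b ⊎ b ≤ a
  ≤-total = ℚP.≤-total
  _≤?_ : ∀ a b -> Dec (a ≤ b)
  _≤?_ = ℚP._≤?_
  +-mono-≤ : ∀ {a b c d} -> a ≤ b -> c ≤ d -> a + c ≤ b + d
  +-mono-≤ = ℚP.+-mono-≤
  *≤ʳ : ∀ {c a b} -> # 0 ≤ c -> a ≤ b -> c * a ≤ c * b
  *≤ʳ {c} h = ℚP.*-monoˡ-≤-nonNeg c {{ℚ.nonNegative h}}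
  *-cancelˡ-≤ : ∀ {c a b} -> # 0 < c -> c * a ≤ c * b -> a ≤ b
  *-cancelˡ-≤ {c} h = ℚP.*-cancelˡ-≤-pos c {{ℚ.positive (ℚP.≰⇒> h)}}
  #-mono : ∀ {m n} -> m ≦ n -> # m ≤ # n
  #-mono {m} {n} h = ℚP.toℚᵘ-cancel-≤ (ℚᵘP.≤-respˡ-≃ (ℚᵘP.≃-sym (fromℤ-ᵘ (pos m)))
   (ℚᵘP.≤-respʳ-≃ (ℚᵘP.≃-sym (fromℤ-ᵘ (pos n)))
    (ℚᵘ.*≤* (ℤP.*-monoʳ-≤-nonNeg (pos 1) (ℤ.+≤+ h)))))
  #-cancel : ∀ {m n} -> # m ≤ # n -> m ≦ n
  #-cancel {m} {n} h with ℚᵘP.≤-respˡ-≃ (fromℤ-ᵘ (pos m)) (ℚᵘP.≤-respʳ-≃ (fromℤ-ᵘ (pos n)) (ℚP.toℚᵘ-mono-≤ h))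
  ... | ℚᵘ.*≤* e = ℤP.drop‿+≤+ (subst₂ ℤ._≤_ (ℤP.*-identityʳ (pos m)) (ℤP.*-identityʳ (pos n)) e)
  inv-inverse : ∀ n -> # (suc n) * inv (suc n) ≡ # 1
  inv-inverse n = ℚP.toℚᵘ-injective (ℚᵘP.≃-trans (ℚP.toℚᵘ-homo-* (# (suc n)) (inv (suc n)))
   (ℚᵘP.≃-trans (ℚᵘP.*-cong (fromℤ-ᵘ (pos (suc n))) (ℚP.toℚᵘ-fromℚᵘ (ℚᵘ.mkℚᵘ (pos 1) n)))
    (ℚᵘ.*≡* (trans (ℤP.*-identityʳ _) (trans (ℤP.*-identityʳ _) (sym (trans (ℤP.*-identityˡ _) (ℤP.*-identityˡ (pos (suc n))))))))))
  inv-zero : inv 0 ≡ # 0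
  inv-zero = refl
  inv≥0 : ∀ n -> # 0 ≤ inv n
  inv≥0 zero    = ℚP.≤-refl
  inv≥0 (suc n) = ℚP.nonNegative⁻¹ (inv (suc n)) {{ℚP.normalize-nonNeg 1 (suc n)}}
 <⇒≤ : ∀ {a b} -> a < b -> a ≤ b
 <⇒≤ {a} {b} h with ≤-total a b
 ... | inj₁ e = e
 ... | inj₂ e = ⊥-elim (h e)
 infixr 4 _≫_
 _≫_ : ∀ {a b c} -> a ≤ b -> b ≤ c -> a ≤ c
 _≫_ = ≤-trans
 eq≤ : ∀ {a b} -> a ≡ b -> a ≤ b
 eq≤ = ≤-reflexive
 eq≥ : ∀ {a b} -> a ≡ b -> b ≤ a
 eq≥ e = ≤-reflexive (sym e)
 ≰⇒> : ∀ {a b} -> ¬ (a ≤ b) -> b < a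
 ≰⇒> h = h
 #-< : ∀ {m n} -> m N.< n -> # m < # n
 #-< h e = <⇒≱ h (#-cancel e)
 module Solver where
  infixl 6 _:+_ _:-_
  infixl 7 _:*_
  infix  8 ⊝_
  infix  5 _≼_
  data Expr (n : ℕ) : Set where
   var     : Fin n -> Expr n
   con     : ℕ -> Expr n
   _:+_ _:*_ : Expr n -> Expr n -> Expr n
   ⊝_      : Expr n -> Expr n
  _:-_ : ∀ {n} -> Expr n -> Expr n -> Expr n
  a :- b = a :+ ⊝ b
  eval : ∀ {n} -> Vec Q n -> Expr n -> Q
  eval ρ (var i) = lookup ρ i
  eval ρ (con k) = # k
  eval ρ (a :+ b) = eval ρ a + eval ρ b
  eval ρ (a :* b) = eval ρ a * eval ρ b
  eval ρ (⊝ a)   = - eval ρ a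
  Mono : Set
  Mono = List ℕ
  Poly : Set
  Poly = List (Mono × ℤ)
  insertVar : ℕ -> Mono -> Mono
  insertVar i []      = i ∷ []
  insertVar i (j ∷ m) = if i N.≤ᵇ j then i ∷ j ∷ m else j ∷ insertVar i m
  mulMono : Mono -> Mono -> Mono
  mulMono []      m = m
  mulMono (i ∷ l) m = insertVar i (mulMono l m)
  ltMono : Mono -> Mono -> Bool
  ltMono []      []      = false
  ltMono []      (_ ∷ _) = true
  ltMono (_ ∷ _) []      = false
  ltMono (i ∷ l) (j ∷ m) = if i N.<ᵇ j then true else (if j N.<ᵇ i then false else ltMono l m)
  -- Zero coefficients are dropped at once, so a polynomial that cancels identically normalises to
  -- the empty list and `isZero` can be a syntactic test.
  consTerm : Mono -> ℤ -> Poly -> Poly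
  consTerm m (pos 0) p = p
  consTerm m c     p = (m , c) ∷ p
  insertTerm : Mono -> ℤ -> Poly -> Poly
  insertTerm m c [] = consTerm m c []
  insertTerm m c ((m′ , c′) ∷ p) with ListP.≡-dec N._≟_ m m′
  ... | yes _ = consTerm m (c ℤ.+ c′) p
  ... | no  _ = if ltMono m m′ then consTerm m c ((m′ , c′) ∷ p) else (m′ , c′) ∷ insertTerm m c p
  addPoly : Poly -> Poly -> Poly
  addPoly []            q = q
  addPoly ((m , c) ∷ p) q = insertTerm m c (addPoly p q)
  mulTerm : Mono -> ℤ -> Poly -> Poly
  mulTerm m c []             = []
  mulTerm m c ((m′ , c′) ∷ p) = insertTerm (mulMono m m′) (c ℤ.* c′) (mulTerm m c p)
  mulPoly : Poly -> Poly -> Poly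
  mulPoly []            q = []
  mulPoly ((m , c) ∷ p) q = addPoly (mulTerm m c q) (mulPoly p q)
  norm : ∀ {n} -> Expr n -> Poly
  norm (var i) = (toℕ i ∷ [] , pos 1) ∷ []
  norm (con k) = consTerm [] (pos k) []
  norm (a :+ b) = addPoly (norm a) (norm b)
  norm (a :* b) = mulPoly (norm a) (norm b)
  norm (⊝ a)   = mulTerm [] -[1+ 0 ] (norm a)
  0Q 1Q : Q
  0Q = fromℤ (pos 0)
  1Q = fromℤ (pos 1)
  +-identityʳ : ∀ a -> a + 0Q ≡ a
  +-identityʳ a = trans (+-comm a 0Q) (+-identityˡ a)
  *-distribʳ-+ : ∀ a b c -> (b + c) * a ≡ b * a + c * a
  *-distribʳ-+ a b c = trans (*-comm (b + c) a)
   (trans (*-distribˡ-+ a b c) (cong₂ _+_ (*-comm a b) (*-comm a c)))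
  +-cancelˡ : ∀ a {b c} -> a + b ≡ a + c -> b ≡ c
  +-cancelˡ a {b} {c} e = trans (sym (lem b)) (trans (cong (\ z -> (- a) + z) e) (lem c))
   where
   lem : ∀ x -> - a + (a + x) ≡ x
   lem x = trans (sym (+-assoc (- a) a x))
    (trans (cong (_+ x) (trans (+-comm (- a) a) (+-inverseʳ a))) (+-identityˡ x))
  *-zeroʳ : ∀ a -> a * 0Q ≡ 0Q
  *-zeroʳ a = +-cancelˡ (a * 0Q) (trans (sym (*-distribˡ-+ a 0Q 0Q))
   (trans (cong (a *_) (+-identityˡ 0Q)) (sym (+-identityʳ (a * 0Q)))))
  *-zeroˡ : ∀ a -> 0Q * a ≡ 0Q
  *-zeroˡ a = trans (*-comm 0Q a) (*-zeroʳ a)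
  neg-unique : ∀ a -> fromℤ -[1+ 0 ] * a ≡ - a
  neg-unique a = +-cancelˡ a (trans
   (trans (cong (_+ fromℤ -[1+ 0 ] * a) (sym (*-identityˡ a)))
    (trans (sym (*-distribʳ-+ a 1Q (fromℤ -[1+ 0 ])))
     (trans (cong (_* a) (sym (fromℤ-+ (pos 1) -[1+ 0 ]))) (*-zeroˡ a)))) (sym (+-inverseʳ a)))
  *-exchange : ∀ a b c d -> (a * b) * (c * d) ≡ (a * c) * (b * d)
  *-exchange a b c d = trans (*-assoc a b (c * d)) (trans (cong (a *_)
   (trans (sym (*-assoc b c d)) (trans (cong (_* d) (*-comm b c)) (*-assoc c b d)))) (sym (*-assoc a c (b * d))))
  +-swap : ∀ a b c -> a + (b + c) ≡ b + (a + c)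
  +-swap a b c = trans (sym (+-assoc a b c)) (trans (cong (_+ c) (+-comm a b)) (+-assoc b a c))
  at : ∀ {n} -> Vec Q n -> ℕ -> Q
  at []      _       = 0Q
  at (x ∷ ρ) zero    = x
  at (x ∷ ρ) (suc i) = at ρ i
  at-lookup : ∀ {n} (ρ : Vec Q n) i -> at ρ (toℕ i) ≡ lookup ρ i
  at-lookup (x ∷ ρ) Fin.zero    = refl
  at-lookup (x ∷ ρ) (Fin.suc i) = at-lookup ρ i
  isZero : Poly -> Bool
  isZero []      = true
  isZero (_ ∷ _) = false
  isNonneg : Poly -> Bool
  isNonneg []                = true
  isNonneg (([] , pos _) ∷ []) = true
  isNonneg _                 = false
  module _ {n} (ρ : Vec Q n) where
   evalM : Mono -> Q
   evalM []      = 1Q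
   evalM (i ∷ m) = at ρ i * evalM m
   evalP : Poly -> Q
   evalP []            = 0Q
   evalP ((m , c) ∷ p) = fromℤ c * evalM m + evalP p
   insertVar-sound : ∀ i m -> evalM (insertVar i m) ≡ at ρ i * evalM m
   insertVar-sound i []      = refl
   insertVar-sound i (j ∷ m) with i N.≤ᵇ j
   ... | true  = refl
   ... | false = trans (cong (at ρ j *_) (insertVar-sound i m))
    (trans (sym (*-assoc (at ρ j) (at ρ i) (evalM m)))
     (trans (cong (_* evalM m) (*-comm (at ρ j) (at ρ i))) (*-assoc (at ρ i) (at ρ j) (evalM m))))
   mulMono-sound : ∀ l m -> evalM (mulMono l m) ≡ evalM l * evalM m
   mulMono-sound []      m = sym (*-identityˡ (evalM m))
   mulMono-sound (i ∷ l) m = trans (insertVar-sound i (mulMono l m))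
    (trans (cong (at ρ i *_) (mulMono-sound l m)) (sym (*-assoc (at ρ i) (evalM l) (evalM m))))
   consTerm-sound : ∀ m c p -> evalP (consTerm m c p) ≡ fromℤ c * evalM m + evalP p
   consTerm-sound m (pos zero)   p = sym (trans (cong (_+ evalP p) (*-zeroˡ (evalM m))) (+-identityˡ (evalP p)))
   consTerm-sound m (pos (suc c))  p = refl
   consTerm-sound m (-[1+ c ]) p = refl
   insertTerm-sound : ∀ m c p -> evalP (insertTerm m c p) ≡ fromℤ c * evalM m + evalP p
   insertTerm-sound m c [] = consTerm-sound m c []
   insertTerm-sound m c ((m′ , c′) ∷ p) with ListP.≡-dec N._≟_ m m′
   ... | yes refl = trans (consTerm-sound m (c ℤ.+ c′) p)
    (trans (cong (\ x -> x * evalM m + evalP p) (fromℤ-+ c c′))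
     (trans (cong (_+ evalP p) (*-distribʳ-+ (evalM m) (fromℤ c) (fromℤ c′)))
      (+-assoc (fromℤ c * evalM m) (fromℤ c′ * evalM m) (evalP p))))
   ... | no  _ with ltMono m m′
   ...   | true  = consTerm-sound m c ((m′ , c′) ∷ p)
   ...   | false = trans (cong ((fromℤ c′ * evalM m′) +_) (insertTerm-sound m c p))
    (+-swap (fromℤ c′ * evalM m′) (fromℤ c * evalM m) (evalP p))
   addPoly-sound : ∀ p q -> evalP (addPoly p q) ≡ evalP p + evalP q
   addPoly-sound []            q = sym (+-identityˡ (evalP q))
   addPoly-sound ((m , c) ∷ p) q = trans (insertTerm-sound m c (addPoly p q))
    (trans (cong ((fromℤ c * evalM m) +_) (addPoly-sound p q)) (sym (+-assoc (fromℤ c * evalM m) (evalP p) (evalP q))))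
   mulTerm-sound : ∀ m c p -> evalP (mulTerm m c p) ≡ (fromℤ c * evalM m) * evalP p
   mulTerm-sound m c []             = sym (*-zeroʳ (fromℤ c * evalM m))
   mulTerm-sound m c ((m′ , c′) ∷ p) = trans (insertTerm-sound (mulMono m m′) (c ℤ.* c′) (mulTerm m c p))
    (trans (cong₂ _+_
     (trans (cong₂ _*_ (fromℤ-* c c′) (mulMono-sound m m′))
      (*-exchange (fromℤ c) (fromℤ c′) (evalM m) (evalM m′)))
     (mulTerm-sound m c p)) (sym (*-distribˡ-+ (fromℤ c * evalM m) (fromℤ c′ * evalM m′) (evalP p))))
   mulPoly-sound : ∀ p q -> evalP (mulPoly p q) ≡ evalP p * evalP q
   mulPoly-sound []            q = sym (*-zeroˡ (evalP q))
   mulPoly-sound ((m , c) ∷ p) q = trans (addPoly-sound (mulTerm m c q) (mulPoly p q))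
    (trans (cong₂ _+_ (mulTerm-sound m c q) (mulPoly-sound p q)) (sym (*-distribʳ-+ (evalP q) (fromℤ c * evalM m) (evalP p))))
   norm-sound : ∀ e -> evalP (norm e) ≡ eval ρ e
   norm-sound (var i) = trans (+-identityʳ _) (trans (*-identityˡ _)
    (trans (*-comm (at ρ (toℕ i)) 1Q) (trans (*-identityˡ _) (at-lookup ρ i))))
   norm-sound (con k) = trans (consTerm-sound [] (pos k) [])
    (trans (+-identityʳ _) (trans (*-comm (fromℤ (pos k)) 1Q)
     (trans (*-identityˡ _) (sym (#-fromℤ k)))))
   norm-sound (a :+ b) = trans (addPoly-sound (norm a) (norm b)) (cong₂ _+_ (norm-sound a) (norm-sound b))
   norm-sound (a :* b) = trans (mulPoly-sound (norm a) (norm b)) (cong₂ _*_ (norm-sound a) (norm-sound b))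
   norm-sound (⊝ a)   = trans (mulTerm-sound [] -[1+ 0 ] (norm a))
    (trans (cong (_* evalP (norm a)) (trans (*-comm (fromℤ -[1+ 0 ]) 1Q) (*-identityˡ _)))
     (trans (neg-unique (evalP (norm a))) (cong -_ (norm-sound a))))
   nonneg-sound : ∀ p -> T (isNonneg p) -> # 0 ≤ evalP p
   nonneg-sound []                 _ = ≤-reflexive (#-fromℤ 0)
   nonneg-sound (([] , pos k) ∷ [])  _ = ≤-trans (#-mono {0} {k} N.z≤n) (≤-reflexive (sym (trans (+-identityʳ _) (trans (*-comm (fromℤ (pos k)) 1Q) (trans (*-identityˡ _) (sym (#-fromℤ k)))))))
  Curry : ∀ n -> (Vec Q n -> Set) -> Set
  Curry zero    P = P []
  Curry (suc n) P = ∀ {x} -> Curry n (\ ρ -> P (x ∷ ρ))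
  curryⁿ : ∀ n {P : Vec Q n -> Set} -> (∀ ρ -> P ρ) -> Curry n P
  curryⁿ zero    f = f []
  curryⁿ (suc n) f = curryⁿ n (\ ρ -> f (_ ∷ ρ))
  vars : ∀ n -> Vec (Expr n) n
  vars n = Data.Vec.tabulate var
   where import Data.Vec
  diff0 : ∀ {x y} -> x - y ≡ 0Q -> x ≡ y
  diff0 {x} {y} e = +-cancelˡ (- y) (trans (+-comm (- y) x)
   (trans e (sym (trans (+-comm (- y) y) (+-inverseʳ y)))))
  infix 4 _:=_
  data Eqn (n : ℕ) : Set where
   _:=_ : Expr n -> Expr n -> Eqn n
  eqn-check : ∀ {n} -> Eqn n -> Bool
  eqn-check (a := b) = isZero (norm (a :- b))
  ⟦_⟧ᵉ : ∀ {n} -> Eqn n -> Vec Q n -> Set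
  ⟦ a := b ⟧ᵉ ρ = eval ρ a ≡ eval ρ b
  eqn-sound : ∀ {n} (e : Eqn n) -> T (eqn-check e) -> ∀ ρ -> ⟦ e ⟧ᵉ ρ
  eqn-sound (a := b) t ρ with norm (a :- b) | norm-sound ρ (a :- b)
  ... | [] | e = diff0 (sym e)
  -- The test is an implicit argument of type `T …` that is filled in by evaluation, so a false
  -- identity is a type error. `Curry` makes the variables implicit; they are recovered from the
  -- goal.
  ring : ∀ n (f : N-ary n (Expr n) (Eqn n)) {_ : T (eqn-check (f $ⁿ vars n))} ->
      Curry n ⟦ f $ⁿ vars n ⟧ᵉ
  ring n f {t} = curryⁿ n (eqn-sound (f $ⁿ vars n) t)
  infixr 5 _·_
  infixr 4 _▸_ ⊢_
  -- The weight in k · i only serves the certificate; it does not change the meaning of the hypothesis i.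
  data Ineq (n : ℕ) : Set where
   _≼_ : Expr n -> Expr n -> Ineq n
   _·_ : ℕ -> Ineq n -> Ineq n
  data Problem (n : ℕ) : Set where
   ⊢_  : Ineq n -> Problem n
   _▸_ : Ineq n -> Problem n -> Problem n
  c0 c1 c2 c3 c4 : ∀ {n} -> Expr n
  c0 = con 0
  c1 = con 1
  c2 = con 2
  c3 = con 3
  c4 = con 4
  slack : ∀ {n} -> Ineq n -> Expr n
  slack (l ≼ r) = r :- l
  slack (k · i) = con k :* slack i
  residue : ∀ {n} -> Problem n -> Expr n
  residue (⊢ i)   = slack i
  residue (h ▸ p) = residue p :- slack h
  ⟦_⟧ⁱ ⟦_⟧ᵍ : ∀ {n} -> Ineq n -> Vec Q n -> Set
  ⟦ a ≼ b ⟧ⁱ ρ = eval ρ a ≤ eval ρ b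
  ⟦ k · i ⟧ⁱ ρ = ⟦ i ⟧ⁱ ρ
  ⟦ a ≼ b ⟧ᵍ ρ = eval ρ a ≤ eval ρ b
  -- A weight on the goal may be 0 and cannot be divided out, so a weighted goal is read as the
  -- trivial statement.
  ⟦ k · i ⟧ᵍ ρ = ⊤
  ⟦_⟧ᵖ : ∀ {n} -> Problem n -> Vec Q n -> Set
  ⟦ ⊢ i ⟧ᵖ   ρ = ⟦ i ⟧ᵍ ρ
  ⟦ h ▸ p ⟧ᵖ ρ = ⟦ h ⟧ⁱ ρ -> ⟦ p ⟧ᵖ ρ
  ≤-shift : ∀ {a b} c -> a ≤ b -> a + c ≤ b + c
  ≤-shift c h = +-mono-≤ h ≤-refl
  sub-nonneg : ∀ {a b} -> a ≤ b -> # 0 ≤ b - a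
  sub-nonneg {a} {b} h = ≤-trans (≤-reflexive (trans (#-fromℤ 0) (sym (+-inverseʳ a)))) (≤-shift (- a) h)
  add-back : ∀ x y -> (x - y) + y ≡ x
  add-back x y = trans (+-assoc x (- y) y)
   (trans (cong (x +_) (trans (+-comm (- y) y) (+-inverseʳ y))) (+-identityʳ x))
  nonneg-sub : ∀ {a b} -> # 0 ≤ b - a -> a ≤ b
  nonneg-sub {a} {b} h = ≤-trans (≤-reflexive (sym (trans (cong (_+ a) (#-fromℤ 0)) (+-identityˡ a)))) (≤-trans (≤-shift a h) (≤-reflexive (add-back b a)))
  slack-nonneg : ∀ {n} (i : Ineq n) ρ -> ⟦ i ⟧ⁱ ρ -> # 0 ≤ eval ρ (slack i)
  slack-nonneg (l ≼ r) ρ h = sub-nonneg h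
  slack-nonneg (k · i) ρ h = ≤-trans (≤-reflexive (trans (#-fromℤ 0) (sym (*-zeroʳ (# k))))) (*≤ʳ (#-mono {0} {k} N.z≤n) (≤-trans (≤-reflexive (sym (#-fromℤ 0))) (slack-nonneg i ρ h)))
  problem-sound : ∀ {n} (p : Problem n) ρ -> # 0 ≤ eval ρ (residue p) -> ⟦ p ⟧ᵖ ρ
  problem-sound (⊢ (a ≼ b)) ρ h = nonneg-sub h
  problem-sound (⊢ (k · i)) ρ h = _
  problem-sound (i ▸ p) ρ h e = problem-sound p ρ (≤-trans (≤-trans (≤-reflexive (trans (#-fromℤ 0) (sym (+-identityˡ 0Q)))) (≤-trans (≤-reflexive (cong₂ _+_ (sym (#-fromℤ 0)) (sym (#-fromℤ 0)))) (+-mono-≤ h (slack-nonneg i ρ e)))) (≤-reflexive (add-back (eval ρ (residue p)) _)))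
  lin-sound : ∀ {n} (p : Problem n) -> T (isNonneg (norm (residue p))) -> ∀ ρ -> ⟦ p ⟧ᵖ ρ
  lin-sound p t ρ = problem-sound p ρ (≤-trans (nonneg-sound ρ (norm (residue p)) t) (≤-reflexive (norm-sound ρ (residue p))))
  -- A Farkas certificate: the slack of the goal minus the weighted slacks of the hypotheses must
  -- normalise to a constant ≥ 0. Products of variables count as independent monomials, so a
  -- nonlinear step is made by supplying the needed products as hypotheses.
  lin : ∀ n (f : N-ary n (Expr n) (Problem n)) {_ : T (isNonneg (norm (residue (f $ⁿ vars n))))} ->
     Curry n ⟦ f $ⁿ vars n ⟧ᵖ
  lin n f {t} = curryⁿ n (lin-sound (f $ⁿ vars n) t)
 open Solver using (_:+_; _:*_; _:-_; ⊝_; con; _:=_; _≼_; _·_; _▸_; ⊢_; ring; lin; c0; c1; c2; c3; c4) public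
 0≤# : ∀ n -> # 0 ≤ # n
 0≤# n = #-mono N.z≤n
 *≥0 : ∀ {a b} -> # 0 ≤ a -> # 0 ≤ b -> # 0 ≤ a * b
 *≥0 {a} {b} ha hb = ≤-trans (≤-reflexive (ring 1 (\ a -> con 0 := a :* con 0))) (*≤ʳ ha hb)
 +-nonneg : ∀ {a b} -> # 0 ≤ a -> # 0 ≤ b -> # 0 ≤ a + b
 +-nonneg = lin 2 (\ a b -> 1 · (con 0 ≼ a) ▸ 1 · (con 0 ≼ b) ▸ ⊢ (con 0 ≼ a :+ b))
 *≤ˡ : ∀ {c a b} -> # 0 ≤ c -> a ≤ b -> a * c ≤ b * c
 *≤ˡ {c} {a} {b} hc h = subst₂ _≤_ (*-comm c a) (*-comm c b) (*≤ʳ hc h)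
 *-mono-≤ : ∀ {a b c d} -> # 0 ≤ a -> # 0 ≤ d -> a ≤ b -> c ≤ d -> a * c ≤ b * d
 *-mono-≤ ha hd h k = ≤-trans (*≤ʳ ha k) (*≤ˡ hd h)
 #-+ : ∀ m n -> # (m N.+ n) ≡ # m + # n
 #-+ m n = trans (#-fromℤ (m N.+ n)) (trans (fromℤ-+ (pos m) (pos n)) (sym (cong₂ _+_ (#-fromℤ m) (#-fromℤ n))))
 #-* : ∀ m n -> # (m N.* n) ≡ # m * # n
 #-* m n = trans (#-fromℤ (m N.* n)) (trans (cong fromℤ (ℤP.pos-* m n))
  (trans (fromℤ-* (pos m) (pos n)) (sym (cong₂ _*_ (#-fromℤ m) (#-fromℤ n)))))
 #-suc : ∀ n -> # (suc n) ≡ # n + # 1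
 #-suc n = trans (#-+ 1 n) (+-comm (# 1) (# n))
 #-pos : ∀ n -> # 0 < # (suc n)
 #-pos n = #-< (N.s≤s N.z≤n)
 inv-≤-of : ∀ n {x y} -> x ≤ # (suc n) * y -> x * inv (suc n) ≤ y
 inv-≤-of n {x} {y} h = *-cancelˡ-≤ (#-pos n) (≤-trans (≤-reflexive (trans (ring 3 (\ n x i -> n :* (x :* i) := (n :* i) :* x))
  (trans (cong (_* x) (inv-inverse n)) (ring 1 (\ x -> con 1 :* x := x))))) h)
 ≤-inv-of : ∀ n {x y} -> # (suc n) * y ≤ x -> y ≤ x * inv (suc n)
 ≤-inv-of n {x} {y} h = *-cancelˡ-≤ (#-pos n) (≤-trans h (≤-reflexive (sym (trans (ring 3 (\ n x i -> n :* (x :* i) := (n :* i) :* x))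
  (trans (cong (_* x) (inv-inverse n)) (ring 1 (\ x -> con 1 :* x := x)))))))
 inv-1 : inv 1 ≡ # 1
 inv-1 = trans (ring 1 (\ x -> x := con 1 :* x)) (inv-inverse 0)
 inv-* : ∀ m n -> inv (suc m N.* suc n) ≡ inv (suc m) * inv (suc n)
 inv-* m n = trans (sym (ring 1 (\ x -> x :* con 1 := x))) (trans (cong (inv mn *_) e)
  (trans (ring 5 (\ z a i b j -> z :* (a :* i :* (b :* j)) := (a :* b :* z) :* (i :* j)))
   (trans (cong (_* (inv (suc m) * inv (suc n))) (trans (cong (_* inv mn) (sym (#-* (suc m) (suc n)))) (inv-inverse _))) (ring 1 (\ x -> con 1 :* x := x)))))
  where
  mn = suc m N.* suc n
  e : # 1 ≡ # (suc m) * inv (suc m) * (# (suc n) * inv (suc n))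
  e = sym (trans (cong₂ _*_ (inv-inverse m) (inv-inverse n)) (ring 0 (con 1 :* con 1 := con 1)))
 inv-antimono : ∀ {m n} -> suc m ≦ n -> inv n ≤ inv (suc m)
 inv-antimono {m} {suc n} h = ≤-trans (≤-reflexive (ring 1 (\ x -> x := con 1 :* x))) (inv-≤-of n (≤-trans (≤-reflexive (sym (inv-inverse m))) (*≤ˡ (inv≥0 (suc m)) (#-mono h))))
 inv≤1 : ∀ n -> inv n ≤ # 1
 inv≤1 zero    = ≤-trans (≤-reflexive inv-zero) (#-mono N.z≤n)
 inv≤1 (suc n) = ≤-trans (inv-antimono {0} (N.s≤s N.z≤n)) (≤-reflexive inv-1)
 <-≤-trans : ∀ {a b c} -> a < b -> b ≤ c -> a < c
 <-≤-trans h k e = h (≤-trans k e)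
 ≤-<-trans : ∀ {a b c} -> a ≤ b -> b < c -> a < c
 ≤-<-trans h k e = k (≤-trans e h)
 ∣_∣ : Q -> Q
 ∣ a ∣ with # 0 ≤? a
 ... | yes _ = a
 ... | no  _ = - a
 ≤∣∣ : ∀ a -> a ≤ ∣ a ∣
 ≤∣∣ a with # 0 ≤? a
 ... | yes _ = ≤-refl
 ... | no  h = lin 1 (\ a -> 2 · (a ≼ con 0) ▸ ⊢ (a ≼ ⊝ a)) (<⇒≤ h)
 -≤∣∣ : ∀ a -> - a ≤ ∣ a ∣
 -≤∣∣ a with # 0 ≤? a
 ... | yes h = lin 1 (\ a -> 2 · (con 0 ≼ a) ▸ ⊢ (⊝ a ≼ a)) h
 ... | no  _ = ≤-refl
 ∣∣≤ : ∀ {a b} -> a ≤ b -> - a ≤ b -> ∣ a ∣ ≤ b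
 ∣∣≤ {a} h k with # 0 ≤? a
 ... | yes _ = h
 ... | no  _ = k
 0≤∣∣ : ∀ a -> # 0 ≤ ∣ a ∣
 0≤∣∣ a = lin 2 (\ a b -> 1 · (a :- b ≼ con 0) ▸ 1 · (⊝ a :- b ≼ con 0) ▸ ⊢ (con 0 ≼ con 2 :* b)) (≤-sub (≤∣∣ a)) (≤-sub (-≤∣∣ a)) |>half
  where
  ≤-sub : ∀ {x y} -> x ≤ y -> x - y ≤ # 0
  ≤-sub = lin 2 (\ x y -> 1 · (x ≼ y) ▸ ⊢ (x :- y ≼ con 0))
  _|>half : ∀ {x} -> # 0 ≤ # 2 * x -> # 0 ≤ x
  h |>half = *-cancelˡ-≤ (#-pos 1) (≤-trans (≤-reflexive (ring 0 (con 2 :* con 0 := con 0))) h)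

-- Finite sums, floor division and the hyperbola method

module Sums where
 open Rationals
 open import Data.Bool using (T)
 open ≡-Reasoning
 S : ℕ -> (ℕ -> Q) -> Q
 S zero    f = # 0
 S (suc n) f = S n f + f (suc n)
 S-cong : ∀ n {f g} -> (∀ i -> 1 ≦ i -> i ≦ n -> f i ≡ g i) -> S n f ≡ S n g
 S-cong zero    h = refl
 S-cong (suc n) h = cong₂ _+_ (S-cong n (\ i a b -> h i a (m≤n⇒m≤1+n b))) (h (suc n) z<s P.≤-refl)
 S-ext : ∀ n {f g} -> (∀ i -> f i ≡ g i) -> S n f ≡ S n g
 S-ext n h = S-cong n (\ i _ _ -> h i)
 S-mono : ∀ n {f g} -> (∀ i -> 1 ≦ i -> i ≦ n -> f i ≤ g i) -> S n f ≤ S n g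
 S-mono zero    h = ≤-refl
 S-mono (suc n) h = +-mono-≤ (S-mono n (\ i a b -> h i a (m≤n⇒m≤1+n b))) (h (suc n) z<s P.≤-refl)
 S-zero : ∀ n -> S n (\ _ -> # 0) ≡ # 0
 S-zero zero    = refl
 S-zero (suc n) = cong (_+ # 0) (S-zero n) » ring 0 (c0 :+ c0 := c0)
 S-zero′ : ∀ n {f} -> (∀ i -> 1 ≦ i -> i ≦ n -> f i ≡ # 0) -> S n f ≡ # 0
 S-zero′ n h = S-cong n h » S-zero n
 S-nonneg : ∀ n {f} -> (∀ i -> 1 ≦ i -> i ≦ n -> # 0 ≤ f i) -> # 0 ≤ S n f
 S-nonneg n h = eq≥ (S-zero n) ≫ S-mono n h
 S-+ : ∀ n f g -> S n (\ i -> f i + g i) ≡ S n f + S n g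
 S-+ zero    f g = ring 0 (c0 := c0 :+ c0)
 S-+ (suc n) f g = cong (_+ (f (suc n) + g (suc n))) (S-+ n f g) » ring 4 (\ a b c d -> (a :+ b) :+ (c :+ d) := (a :+ c) :+ (b :+ d))
 S-*ˡ : ∀ n c f -> S n (\ i -> c * f i) ≡ c * S n f
 S-*ˡ zero    c f = ring 1 (\ c -> c0 := c :* c0)
 S-*ˡ (suc n) c f = cong (_+ c * f (suc n)) (S-*ˡ n c f) » ring 3 (\ c a b -> c :* a :+ c :* b := c :* (a :+ b))
 S-*ʳ : ∀ n c f -> S n (\ i -> f i * c) ≡ S n f * c
 S-*ʳ n c f = S-ext n (\ i -> *-comm (f i) c) » S-*ˡ n c f » *-comm c (S n f)
 S-neg : ∀ n f -> S n (\ i -> - f i) ≡ - S n f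
 S-neg zero    f = ring 0 (c0 := ⊝ c0)
 S-neg (suc n) f = cong (_+ - f (suc n)) (S-neg n f) » ring 2 (\ a b -> ⊝ a :+ ⊝ b := ⊝ (a :+ b))
 S-- : ∀ n f g -> S n (\ i -> f i - g i) ≡ S n f - S n g
 S-- n f g = S-+ n f (\ i -> - g i) » cong (S n f +_) (S-neg n g)
 S-const : ∀ n c -> S n (\ _ -> c) ≡ # n * c
 S-const zero    c = ring 1 (\ c -> c0 := c0 :* c)
 S-const (suc n) c = cong (_+ c) (S-const n c) » ring 2 (\ n c -> n :* c :+ c := (n :+ c1) :* c) » cong (_* c) (sym (#-suc n))
 S-swap : ∀ m n (f : ℕ -> ℕ -> Q) -> S m (\ i -> S n (\ j -> f i j)) ≡ S n (\ j -> S m (\ i -> f i j))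
 S-swap zero    n f = sym (S-zero n)
 S-swap (suc m) n f = cong (_+ S n (f (suc m))) (S-swap m n f) » sym (S-+ n (\ j -> S m (\ i -> f i j)) (f (suc m)))
 S-telescope : ∀ n (f : ℕ -> Q) -> S n (\ i -> f (suc i) - f i) ≡ f (suc n) - f 1
 S-telescope zero    f = ring 1 (\ a -> c0 := a :- a)
 S-telescope (suc n) f = cong (_+ (f (suc (suc n)) - f (suc n))) (S-telescope n f) » ring 3 (\ a b c -> (a :- b) :+ (c :- a) := c :- b)
 -- Summation by parts with the differences on the weight `f`. It takes the place of integration
 -- against log t and 1/t.
 S-abel : ∀ m (f g : ℕ -> Q) -> S (suc m) (\ i -> f i * g i) ≡
  f (suc m) * S (suc m) g - S m (\ i -> (f (suc i) - f i) * S i g)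
 S-abel zero    f g = ring 2 (\ a b -> c0 :+ a :* b := a :* (c0 :+ b) :- c0)
 S-abel (suc m) f g = cong (_+ f (suc (suc m)) * g (suc (suc m))) (S-abel m f g) » ring 5 (\ a s r b t -> (a :* s :- r) :+ b :* t := b :* (s :+ t) :- (r :+ (b :- a) :* s))
 S-split : ∀ m n f -> S (m N.+ n) f ≡ S m f + S n (\ i -> f (m N.+ i))
 S-split m zero    f = cong (\ k -> S k f) (P.+-identityʳ m) » ring 1 (\ a -> a := a :+ c0)
 S-split m (suc n) f = cong (\ k -> S k f) (+-suc m n) » cong₂ _+_ (S-split m n f) (cong f (sym (+-suc m n))) » +-assoc _ _ _
 S-mono-range : ∀ {m n} {f} -> m ≦ n -> (∀ i -> # 0 ≤ f i) -> S m f ≤ S n f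
 S-mono-range {m} {n} {f} h p = lin 2 (\ a b -> c0 ≼ b ▸ ⊢ a ≼ a :+ b) (S-nonneg (n N.∸ m) (\ i _ _ -> p (m N.+ i))) ≫ eq≤ (sym (S-split m (n N.∸ m) f) » cong (\ k -> S k f) (m+[n∸m]≡n h))
 when : Bool -> Q -> Q
 when b x = if b then x else # 0
 when-nonneg : ∀ b {x} -> # 0 ≤ x -> # 0 ≤ when b x
 when-nonneg true  h = h
 when-nonneg false h = ≤-refl
 when-≤ : ∀ b {x} -> # 0 ≤ x -> when b x ≤ x
 when-≤ true  h = ≤-refl
 when-≤ false h = h
 is-yes : ∀ {P : Set} (d : Dec P) -> P -> does d ≡ true
 is-yes (yes _) p = refl
 is-yes (no ¬p) p = ⊥-elim (¬p p)
 is-no : ∀ {P : Set} (d : Dec P) -> ¬ P -> does d ≡ false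
 is-no (yes p) ¬p = ⊥-elim (¬p p)
 is-no (no _)  ¬p = refl
 does-⇔ : ∀ {P R : Set} (d : Dec P) (e : Dec R) -> (P -> R) -> (R -> P) -> does d ≡ does e
 does-⇔ (yes p) e f g = sym (is-yes e (f p))
 does-⇔ (no ¬p) e f g = sym (is-no e (\ r -> ¬p (g r)))
 S-delta : ∀ N k (f : ℕ -> Q) -> 1 ≦ k -> k ≦ N -> S N (\ i -> when (does (i N.≟ k)) (f i)) ≡ f k
 S-delta zero    (suc k) f 1≤k ()
 S-delta (suc N) k f 1≤k k≤N with suc N N.≟ k
 ... | yes refl = cong₂ _+_ (S-zero′ N (\ i _ i≤N ->
     cong (\ b -> when b (f i)) (is-no (i N.≟ suc N) (\ { refl -> 1+n≰n i≤N })))) (cong (\ b -> when b (f (suc N))) (is-yes (suc N N.≟ suc N) refl)) » ring 1 (\ a -> c0 :+ a := a)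
 ... | no  ne   = cong₂ _+_ (S-delta N k f 1≤k (≤-pred (≤∧≢⇒< k≤N (\ e -> ne (sym e))))) (cong (\ b -> when b (f (suc N))) (is-no (suc N N.≟ k) ne)) » ring 1 (\ a -> a :+ c0 := a)
 S-delta-none : ∀ N k (f : ℕ -> Q) -> ¬ (1 ≦ k × k ≦ N) -> S N (\ i -> when (does (i N.≟ k)) (f i)) ≡ # 0
 S-delta-none N k f h = S-zero′ N (\ i a b ->
  cong (\ c -> when c (f i)) (is-no (i N.≟ k) (\ { refl -> h (a , b) })))
 -- Trades a variable range for an indicator on a fixed range, so that double sums can be
 -- interchanged.
 S-extend : ∀ n N f -> n ≦ N -> S n f ≡ S N (\ i -> when (does (i N.≤? n)) (f i))
 S-extend n zero    f z≤n = refl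
 S-extend n (suc N) f h with n N.≟ suc N
 ... | yes refl = S-cong (suc N) (\ i _ b -> sym (cong (\ c -> when c (f i)) (is-yes (i N.≤? suc N) b)))
 ... | no  ne   = S-extend n N f n≤N » ring 1 (\ a -> a := a :+ c0) » cong (S N (\ i -> when (does (i N.≤? n)) (f i)) +_) (sym (cong (\ c -> when c (f (suc N))) (is-no (suc N N.≤? n) (\ e -> <⇒≱ e n≤N))))
  where n≤N = ≤-pred (≤∧≢⇒< h ne)
 -- Floor division, with the junk value x ÷ 0 = 0.
 infixl 7 _÷_
 _÷_ : ℕ -> ℕ -> ℕ
 x ÷ zero  = 0
 x ÷ suc d = x / suc d
 ÷-upper : ∀ {x d m} -> 1 ≦ d -> m ≦ x ÷ d -> d N.* m ≦ x
 ÷-upper {x} {suc d} {m} _ h = *-monoʳ-≤ (suc d) h ⋙ P.≤-reflexive (P.*-comm (suc d) (x / suc d)) ⋙ m/n*n≤m x (suc d)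
 ÷-lower : ∀ {x d m} -> 1 ≦ d -> d N.* m ≦ x -> m ≦ x ÷ d
 ÷-lower {x} {suc d} {m} _ h = P.≤-reflexive (sym (m*n/n≡m m (suc d))) ⋙ /-monoˡ-≤ (suc d) (P.≤-reflexive (P.*-comm m (suc d)) ⋙ h)
 ÷-unique : ∀ {x d q} -> 1 ≦ d -> (∀ m -> d N.* m ≦ x -> m ≦ q) -> d N.* q ≦ x -> x ÷ d ≡ q
 ÷-unique {x} {d} {q} 1≤d h k = P.≤-antisym (h (x ÷ d) (÷-upper 1≤d P.≤-refl)) (÷-lower 1≤d k)
 ÷-mono : ∀ {x y} d -> x ≦ y -> x ÷ d ≦ y ÷ d
 ÷-mono zero    h = z≤n
 ÷-mono (suc d) h = /-monoˡ-≤ (suc d) h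
 ÷-anti : ∀ {x d e} -> 1 ≦ d -> d ≦ e -> x ÷ e ≦ x ÷ d
 ÷-anti {x} {d} {e} 1≤d h = ÷-lower 1≤d (*-monoˡ-≤ (x ÷ e) h ⋙ ÷-upper (1≤d ⋙ h) P.≤-refl)
 ÷-≤ : ∀ x d -> x ÷ d ≦ x
 ÷-≤ x zero    = z≤n
 ÷-≤ x (suc d) = m/n≤m x (suc d)
 ÷-1 : ∀ x -> x ÷ 1 ≡ x
 ÷-1 x = ÷-unique z<s (\ m h -> P.≤-reflexive (sym (P.*-identityˡ m)) ⋙ h)
  (P.≤-reflexive (P.*-identityˡ x))
 ÷-÷ : ∀ x d e -> x ÷ d ÷ e ≡ x ÷ (d N.* e)
 ÷-÷ x zero    zero    = refl
 ÷-÷ x zero    (suc e) = refl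
 ÷-÷ x (suc d) zero    = cong (x ÷_) (sym (P.*-zeroʳ d))
 ÷-÷ x (suc d) (suc e) = m/n/o≡m/[n*o] x (suc d) (suc e)
 ÷-pos : ∀ {x d} -> 1 ≦ d -> d ≦ x -> 1 ≦ x ÷ d
 ÷-pos {x} {d} 1≤d h = ÷-lower 1≤d (P.≤-reflexive (*-identityʳ d) ⋙ h)
 ÷-self-zero : ∀ {x d} -> x N.< d -> x ÷ d ≡ 0
 ÷-self-zero {x} {suc d} h = m<n⇒m/n≡0 h
 <-÷ : ∀ x {d} -> 1 ≦ d -> x N.< d N.* suc (x ÷ d)
 <-÷ x 1≤d = P.≰⇒> (\ h -> 1+n≰n (÷-lower 1≤d h))
 -- Dirichlet convolution at k, with a function of divisor and cofactor in place of a product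
 -- f(d)g(e).
 Div : ℕ -> (ℕ -> ℕ -> Q) -> Q
 Div k h = S k (\ d -> when (does (d ∣? k)) (h d (k ÷ d)))
 ÷-exact : ∀ {d q} -> 1 ≦ d -> (q N.* d) ÷ d ≡ q
 ÷-exact {suc d} {q} _ = m*n/n≡m q (suc d)
 S-÷-suc : ∀ N d f -> 1 ≦ d ->
  S (suc N ÷ d) f ≡ S (N ÷ d) f + when (does (d ∣? suc N)) (f (suc N ÷ d))
 S-÷-suc N d f 1≤d with d ∣? suc N
 ... | yes (divides zero    ())
 ... | yes (divides (suc q) e) = cong (\ k -> S k f) s≡ » cong₂ _+_ (cong (\ k -> S k f) (sym n≡)) (cong f (sym s≡))
  where
  s≡ : suc N ÷ d ≡ suc q
  s≡ = cong (_÷ d) e » ÷-exact 1≤d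
  n≡ : N ÷ d ≡ q
  n≡ = ÷-unique 1≤d
   (\ m h -> ≤-pred (*-cancelʳ-< d m (suc q) (P.<-≤-trans (s≤s (P.≤-reflexive (P.*-comm m d) ⋙ h)) (P.≤-reflexive e))))
   (≤-pred (P.<-≤-trans (P.<-≤-trans (m<n+m (d N.* q) 1≤d)
    (P.≤-reflexive (cong (d N.+_) (P.*-comm d q)))) (P.≤-reflexive (sym e))))
 ... | no ¬d = cong (\ k -> S k f) eq » ring 1 (\ a -> a := a :+ c0)
  where
  eq : suc N ÷ d ≡ N ÷ d
  eq = ÷-unique 1≤d
   (\ m h -> ÷-lower 1≤d (≤-pred (≤∧≢⇒< h (\ e -> ¬d (divides m (sym e » P.*-comm d m))))))
   (m≤n⇒m≤1+n (÷-upper 1≤d P.≤-refl))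
 -- Both sides run over the lattice points with d·m ≤ N. Passing to N + 1 adds on the left exactly
 -- the points with d·m = N + 1, one for each divisor of N + 1.
 hyperbola : ∀ N (h : ℕ -> ℕ -> Q) -> S N (\ d -> S (N ÷ d) (h d)) ≡ S N (\ k -> Div k h)
 hyperbola zero    h = refl
 hyperbola (suc N) h = begin
  S N (\ d -> S (suc N ÷ d) (h d)) + S (suc N ÷ suc N) (h (suc N))
   ≡⟨ S-cong (suc N) (\ d 1≤d _ -> S-÷-suc N d (h d) 1≤d) ⟩
  S (suc N) (\ d -> S (N ÷ d) (h d) + when (does (d ∣? suc N)) (h d (suc N ÷ d)))
   ≡⟨ S-+ (suc N) _ _ ⟩
  (S N (\ d -> S (N ÷ d) (h d)) + S (N ÷ suc N) (h (suc N))) + Div (suc N) h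
   ≡⟨ cong (_+ Div (suc N) h) (cong₂ _+_ (hyperbola N h) (cong (\ k -> S k (h (suc N))) (÷-self-zero {N} P.≤-refl)) » ring 1 (\ a -> a :+ c0 := a)) ⟩
  S N (\ k -> Div k h) + Div (suc N) h ∎
 hyperbola-swap : ∀ N (h : ℕ -> ℕ -> Q) ->
  S N (\ d -> S (N ÷ d) (\ m -> h d m)) ≡ S N (\ m -> S (N ÷ m) (\ d -> h d m))
 hyperbola-swap N h = begin
  S N (\ d -> S (N ÷ d) (h d))
   ≡⟨ S-ext N (\ d -> S-extend (N ÷ d) N (h d) (÷-≤ N d)) ⟩
  S N (\ d -> S N (\ m -> when (does (m N.≤? N ÷ d)) (h d m)))
   ≡⟨ S-swap N N _ ⟩
  S N (\ m -> S N (\ d -> when (does (m N.≤? N ÷ d)) (h d m)))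
   ≡⟨ S-cong N (\ m 1≤m _ -> S-cong N (\ d 1≤d _ -> cong (\ b -> when b (h d m))
      (does-⇔ (m N.≤? N ÷ d) (d N.≤? N ÷ m) (flip 1≤d 1≤m) (flip 1≤m 1≤d)))) ⟩
  S N (\ m -> S N (\ d -> when (does (d N.≤? N ÷ m)) (h d m)))
   ≡⟨ S-ext N (\ m -> sym (S-extend (N ÷ m) N (\ d -> h d m) (÷-≤ N m))) ⟩
  S N (\ m -> S (N ÷ m) (\ d -> h d m)) ∎
  where
  flip : ∀ {d m} -> 1 ≦ d -> 1 ≦ m -> m ≦ N ÷ d -> d ≦ N ÷ m
  flip {d} {m} 1≤d 1≤m h = ÷-lower 1≤m (P.≤-reflexive (P.*-comm m d) ⋙ ÷-upper 1≤d h)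

-- Additive functions, the Möbius function and the von Mangoldt function

module Arithmetic where
 open Rationals
 open Sums
 open import Data.Nat.Primality.Factorisation
 open import Data.List.Relation.Binary.Permutation.Propositional using (_↭_; refl; prep; swap) renaming (trans to ↭-trans)
 open import Data.List.Relation.Binary.Permutation.Propositional.Properties using (↭-length)
 open ≡-Reasoning
 when-0 : ∀ b -> when b (# 0) ≡ # 0
 when-0 true  = refl
 when-0 false = refl
 when-neg : ∀ b {x} -> when b (- x) ≡ - when b x
 when-neg true  = refl
 when-neg false = ring 0 (c0 := ⊝ c0)
 prime≥2 : ∀ {p} -> Prime p -> 2 ≦ p
 prime≥2 {zero}        pp = ⊥-elim (¬prime[0] pp)
 prime≥2 {suc zero}    pp = ⊥-elim (¬prime[1] pp)
 prime≥2 {suc (suc p)} pp = s≤s z<s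
 prime≥1 : ∀ {p} -> Prime p -> 1 ≦ p
 prime≥1 pp = z<s ⋙ prime≥2 pp
 *-≥1 : ∀ {m n} -> 1 ≦ m -> 1 ≦ n -> 1 ≦ m N.* n
 *-≥1 {suc m} {suc n} _ _ = s≤s z≤n
 prime-induction : ∀ (P : ℕ -> Set) -> P 1 -> (∀ p n -> Prime p -> 1 ≦ n -> P n -> P (p N.* n)) ->
  ∀ n -> 1 ≦ n -> P n
 prime-induction P base step (suc n) _ =
  subst P (sym (PrimeFactorisation.isFactorisation f)) (go (factors f) (PrimeFactorisation.factorsPrime f))
  where
  f = factorise (suc n)
  go : ∀ ps -> All Prime ps -> P (product ps)
  go []       []         = base
  go (p ∷ ps) (pp ∷ pps) = step p (product ps) pp (productOfPrimes≥1 pps) (go ps pps)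
 fs : ℕ -> List ℕ
 fs zero    = []
 fs (suc n) = factors (factorise (suc n))
 fs-cons : ∀ {p n} -> Prime p -> 1 ≦ n -> fs (p N.* n) ↭ p ∷ fs n
 fs-cons {suc p} {suc n} pp _ = factorisationUnique (factorise (suc p N.* suc n)) (record
  { factors         = suc p ∷ factors f
  ; isFactorisation = cong (suc p N.*_) (PrimeFactorisation.isFactorisation f)
  ; factorsPrime    = pp ∷ PrimeFactorisation.factorsPrime f })
  where f = factorise (suc n)
 fs-cons {zero} pp _ = ⊥-elim (¬prime[0] pp)
 sumL : (ℕ -> Q) -> List ℕ -> Q
 sumL h []       = # 0
 sumL h (p ∷ ps) = h p + sumL h ps
 sumL-↭ : ∀ h {ps qs} -> ps ↭ qs -> sumL h ps ≡ sumL h qs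
 sumL-↭ h refl          = refl
 sumL-↭ h (prep x r)    = cong (h x +_) (sumL-↭ h r)
 sumL-↭ h (swap x y r)  = cong (\ s -> h x + (h y + s)) (sumL-↭ h r) » ring 3 (\ a b c -> a :+ (b :+ c) := b :+ (a :+ c))
 sumL-↭ h (↭-trans r s) = sumL-↭ h r » sumL-↭ h s
 abstract
  -- Completely additive by construction, whatever the values on primes. It is sealed so that no
  -- factorisation is computed during type checking.
  additive : (ℕ -> Q) -> ℕ -> Q
  additive h n = sumL h (fs n)
  additive-1 : ∀ h -> additive h 1 ≡ # 0
  additive-1 h = refl
  additive-cons : ∀ h {p n} -> Prime p -> 1 ≦ n -> additive h (p N.* n) ≡ h p + additive h n
  additive-cons h pp 1≤n = sumL-↭ h (fs-cons pp 1≤n)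
 additive-prime : ∀ h {p} -> Prime p -> additive h p ≡ h p
 additive-prime h {p} pp = cong (additive h) (sym (*-identityʳ p)) » additive-cons h pp z<s » cong (h p +_) (additive-1 h) » ring 1 (\ a -> a :+ c0 := a)
 additive-* : ∀ h m n -> 1 ≦ m -> 1 ≦ n -> additive h (m N.* n) ≡ additive h m + additive h n
 additive-* h m n 1≤m 1≤n = prime-induction (\ m -> additive h (m N.* n) ≡ additive h m + additive h n) (cong (additive h) (P.*-identityˡ n) » ring 1 (\ a -> a := c0 :+ a) » cong (_+ additive h n) (sym (additive-1 h)))
  (\ p m pp 1≤m ih -> cong (additive h) (P.*-assoc p m n) » additive-cons h pp (*-≥1 1≤m 1≤n) » cong (h p +_) ih » sym (+-assoc (h p) (additive h m) (additive h n)) » cong (_+ additive h n) (sym (additive-cons h pp 1≤m)))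
  m 1≤m
 sign : ℕ -> Q
 sign zero    = # 1
 sign (suc n) = - sign n
 ∣sign∣ : ∀ n -> sign n ≤ # 1 × - # 1 ≤ sign n
 ∣sign∣ zero    = ≤-refl , lin 0 (⊢ ⊝ c1 ≼ c1)
 ∣sign∣ (suc n) with ∣sign∣ n
 ... | a , b = lin 1 (\ s -> ⊝ c1 ≼ s ▸ ⊢ ⊝ s ≼ c1) b , lin 1 (\ s -> s ≼ c1 ▸ ⊢ ⊝ c1 ≼ ⊝ s) a
 -- Testing only r ≤ n makes the property decidable and loses nothing for n ≥ 1.
 SquareFree : ℕ -> Set
 SquareFree n = ∀ {r} -> r N.< suc n -> Prime r -> ¬ (r N.* r ∣ n)
 squareFree? : ∀ n -> Dec (SquareFree n)
 squareFree? n = allUpTo? (\ r -> prime? r →-dec ¬? (r N.* r ∣? n)) (suc n)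
 abstract
  μ : ℕ -> Q
  μ n = when (does (squareFree? n)) (sign (length (fs n)))
  ∣μ∣≤1 : ∀ n -> ∣ μ n ∣ ≤ # 1
  ∣μ∣≤1 n with does (squareFree? n) | ∣sign∣ (length (fs n))
  ... | true  | a , b = ∣∣≤ a (lin 1 (\ s -> ⊝ c1 ≼ s ▸ ⊢ ⊝ s ≼ c1) b)
  ... | false | _     = ∣∣≤ (#-mono z≤n) (lin 0 (⊢ ⊝ c0 ≼ c1))
  μ-1 : μ 1 ≡ # 1
  μ-1 = cong (\ b -> when b (# 1)) (is-yes (squareFree? 1) sf)
   where
   sf : SquareFree 1
   sf {r} _ pr d = <⇒≱ (P.<-≤-trans (s≤s z<s) (P.*-mono-≤ (prime≥2 pr) (prime≥2 pr))) (∣⇒≤ d)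
  μ-div : ∀ {p e} -> Prime p -> 1 ≦ e -> p ∣ e -> μ (p N.* e) ≡ # 0
  μ-div {p} {e} pp 1≤e d = cong (\ b -> when b (sign (length (fs (p N.* e))))) (is-no (squareFree? (p N.* e))
   (\ sf -> sf (s≤s (m≤m*n p e {{N.>-nonZero 1≤e}})) pp (*-monoʳ-∣ p d)))
  μ-nondiv : ∀ {p e} -> Prime p -> 1 ≦ e -> ¬ (p ∣ e) -> μ (p N.* e) ≡ - μ e
  μ-nondiv {p} {e} pp 1≤e ¬d = cong₂ when (does-⇔ (squareFree? (p N.* e)) (squareFree? e) to from) (cong sign (↭-length (fs-cons pp 1≤e))) » when-neg (does (squareFree? e))
   where
   to : SquareFree (p N.* e) -> SquareFree e
   to sf {r} _ pr d = sf {r} (s≤s (m≤m*n r r {{prime⇒nonZero pr}} ⋙ (∣⇒≤ {{N.>-nonZero (*-≥1 (prime≥1 pp) 1≤e)}} rr∣))) pr rr∣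
    where
    rr∣ : r N.* r ∣ p N.* e
    rr∣ = ∣n⇒∣m*n p d
   from : SquareFree e -> SquareFree (p N.* e)
   from sf {r} _ pr d with euclidsLemma p e pr (∣-trans (m∣m*n r) d)
   ... | inj₁ r∣p with prime⇒irreducible pp r∣p
   ...   | inj₁ refl = ¬prime[1] pr
   ...   | inj₂ refl = ¬d (*-cancelˡ-∣ p {{prime⇒nonZero pp}} d)
   from sf {r} _ pr d | inj₂ (divides q refl) with euclidsLemma p q pr (*-cancelʳ-∣ r {{prime⇒nonZero pr}} (subst (r N.* r ∣_) (sym (P.*-assoc p q r)) d))
   ...   | inj₂ r∣q = sf (s≤s (∣⇒≤ {{N.>-nonZero 1≤e}} (n∣m*n q))) pr (*-monoˡ-∣ r r∣q)
   ...   | inj₁ r∣p with prime⇒irreducible pp r∣p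
   ...     | inj₁ refl = ¬prime[1] pr
   ...     | inj₂ refl = ¬d (n∣m*n q)
 S-vanish : ∀ n N {f} -> n ≦ N -> (∀ i -> n N.< i -> i ≦ N -> f i ≡ # 0) -> S n f ≡ S N f
 S-vanish n N {f} h v = S-extend n N f h » S-cong N go
  where
  go : ∀ i -> 1 ≦ i -> i ≦ N -> when (does (i N.≤? n)) (f i) ≡ f i
  go i _ i≤N = case i N.≤? n of \ where
   (yes q) -> cong (\ b -> when b (f i)) (is-yes (i N.≤? n) q)
   (no ¬q) -> cong (\ b -> when b (f i)) (is-no (i N.≤? n) ¬q) » sym (v i (P.≰⇒> ¬q) i≤N)
 S-shift : ∀ n (f : ℕ -> Q) -> S (suc n) f ≡ f 1 + S n (\ i -> f (suc i))
 S-shift n f = S-split 1 n f » cong (_+ S n (\ i -> f (suc i))) (ring 1 (\ a -> c0 :+ a := a))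
 S-multiples : ∀ p m (f : ℕ -> Q) -> 1 ≦ p ->
  S (p N.* m) (\ d -> when (does (p ∣? d)) (f d)) ≡ S m (\ e -> f (p N.* e))
 S-multiples p zero    f 1≤p = cong (\ k -> S k (\ d -> when (does (p ∣? d)) (f d))) (P.*-zeroʳ p)
 S-multiples p@(suc p-1) (suc m) f 1≤p = begin
  S (p N.* suc m) g                             ≡⟨ cong (\ k -> S k g) (*-suc p m » P.+-comm p (p N.* m)) ⟩
  S (p N.* m N.+ p) g                           ≡⟨ S-split (p N.* m) p g ⟩
  S (p N.* m) g + S p (\ i -> g (p N.* m N.+ i)) ≡⟨ cong₂ _+_ (S-multiples p m f 1≤p) (S-cong p only) ⟩
  S m (\ e -> f (p N.* e)) + S p (\ i -> when (does (i N.≟ p)) (f (p N.* m N.+ i)))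
   ≡⟨ cong (S m (\ e -> f (p N.* e)) +_) (S-delta p p (\ i -> f (p N.* m N.+ i)) 1≤p P.≤-refl) ⟩
  S m (\ e -> f (p N.* e)) + f (p N.* m N.+ p)
   ≡⟨ cong (\ k -> S m (\ e -> f (p N.* e)) + f k) (P.+-comm (p N.* m) p » sym (*-suc p m)) ⟩
  S (suc m) (\ e -> f (p N.* e)) ∎
  where
  g = \ d -> when (does (p ∣? d)) (f d)
  only : ∀ i -> 1 ≦ i -> i ≦ p -> g (p N.* m N.+ i) ≡ when (does (i N.≟ p)) (f (p N.* m N.+ i))
  only i 1≤i i≤p = cong (\ b -> when b (f (p N.* m N.+ i))) (does-⇔ (p ∣? (p N.* m N.+ i)) (i N.≟ p)
   (\ d -> P.≤-antisym i≤p (∣⇒≤ {{N.>-nonZero 1≤i}} (∣m+n∣m⇒∣n d (m∣m*n m))))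
   (\ { refl -> ∣m∣n⇒∣m+n (m∣m*n m) ∣-refl }))
 when-split : ∀ b x -> x ≡ when b x + when (not b) x
 when-split true  x = ring 1 (\ a -> a := a :+ c0)
 when-split false x = ring 1 (\ a -> a := c0 :+ a)
 coprime-prime : ∀ {p d m} -> Prime p -> ¬ (p ∣ d) -> d ∣ p N.* m -> d ∣ m
 coprime-prime {p} {d} pp ¬p c = coprime-divisor cop c
  where
  cop : Coprime d p
  cop (a , b) with prime⇒irreducible pp b
  ... | inj₁ e    = e
  ... | inj₂ refl = ⊥-elim (¬p a)
 -- Divisors of pm are split according to p. Those divisible by p are pe with e ∣ m, where μ(pe) is
 -- -μ(e) or 0 as p does or does not stay away from e; those prime to p already divide m. The two
 -- halves cancel.
 ∑μ-prime : ∀ p m -> Prime p -> 1 ≦ m -> Div (p N.* m) (\ d _ -> μ d) ≡ # 0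
 ∑μ-prime p m pp 1≤m = begin
  S n f ≡⟨ trans (S-ext n (\ d -> when-split (does (p ∣? d)) (f d))) (S-+ n _ _) ⟩
  S n (\ d -> when (does (p ∣? d)) (f d)) + S n (\ d -> when (not (does (p ∣? d))) (f d))
   ≡⟨ cong₂ _+_ (S-multiples p m f (prime≥1 pp) » S-cong m mult) (sym (S-vanish m n (m≤n*m m p {{prime⇒nonZero pp}}) big) » S-cong m small) ⟩
  S m (\ d -> - g d) + S m g ≡⟨ cong (_+ S m g) (S-neg m g) ⟩
  - S m g + S m g ≡⟨ ring 1 (\ a -> ⊝ a :+ a := c0) ⟩
  # 0 ∎
  where
  n = p N.* m
  f = \ d -> when (does (d ∣? n)) (μ d)
  g = \ d -> when (does (d ∣? m)) (when (not (does (p ∣? d))) (μ d))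
  mult : ∀ e -> 1 ≦ e -> e ≦ m -> f (p N.* e) ≡ - g e
  mult e 1≤e _ = case p ∣? e of \ where
   (yes d) -> cong₂ when (refl {x = does (p N.* e ∣? n)}) (μ-div pp 1≤e d) » when-0 (does (p N.* e ∣? n)) » sym (cong (\ b -> - when (does (e ∣? m)) (when (not b) (μ e))) (is-yes (p ∣? e) d) » cong -_ (when-0 (does (e ∣? m))) » ring 0 (⊝ c0 := c0))
   (no ¬d) -> cong₂ when (does-⇔ (p N.* e ∣? n) (e ∣? m) (*-cancelˡ-∣ p {{prime⇒nonZero pp}}) (*-monoʳ-∣ p)) (μ-nondiv pp 1≤e ¬d) » when-neg (does (e ∣? m)) » cong (\ b -> - when (does (e ∣? m)) (when (not b) (μ e))) (sym (is-no (p ∣? e) ¬d))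
  big : ∀ d -> m N.< d -> d ≦ n -> when (not (does (p ∣? d))) (f d) ≡ # 0
  big d m<d _ = case p ∣? d of \ where
   (yes q) -> cong (\ b -> when (not b) (f d)) (is-yes (p ∣? d) q)
   (no ¬q) -> cong₂ (\ b c -> when (not b) (when c (μ d))) (is-no (p ∣? d) ¬q)
    (is-no (d ∣? n) (\ c -> <⇒≱ m<d (∣⇒≤ {{N.>-nonZero 1≤m}} (coprime-prime pp ¬q c)))) » refl
  small : ∀ d -> 1 ≦ d -> d ≦ m -> when (not (does (p ∣? d))) (f d) ≡ g d
  small d _ _ = case p ∣? d of \ where
   (yes q) -> cong (\ b -> when (not b) (f d)) (is-yes (p ∣? d) q) » sym (cong (\ b -> when (does (d ∣? m)) (when (not b) (μ d))) (is-yes (p ∣? d) q) » when-0 (does (d ∣? m)))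
   (no ¬q) -> cong (\ b -> when (not b) (f d)) (is-no (p ∣? d) ¬q) » cong (\ b -> when b (μ d)) (does-⇔ (d ∣? n) (d ∣? m) (coprime-prime pp ¬q) (∣n⇒∣m*n p)) » cong (\ b -> when (does (d ∣? m)) (when (not b) (μ d))) (sym (is-no (p ∣? d) ¬q))
 ∑μ-1 : Div 1 (\ d _ -> μ d) ≡ # 1
 ∑μ-1 = cong (# 0 +_) (cong (\ b -> when b (μ 1)) (is-yes (1 ∣? 1) ∣-refl)) » cong (# 0 +_) μ-1 » ring 0 (c0 :+ c1 := c1)
 ∑μ : ∀ n -> 2 ≦ n -> Div n (\ d _ -> μ d) ≡ # 0
 ∑μ n 2≤n = prime-induction (\ n -> 2 ≦ n -> Div n (\ d _ -> μ d) ≡ # 0)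
  (\ { (s≤s ()) }) (\ p m pp 1≤m _ _ -> ∑μ-prime p m pp 1≤m) n (z<s ⋙ 2≤n) 2≤n
 n<p^n : ∀ {p} -> 2 ≦ p -> ∀ n -> n N.< p N.^ n
 n<p^n 2≤p zero    = s≤s z≤n
 n<p^n {p} 2≤p (suc n) = P.<-≤-trans (s≤s (n<p^n 2≤p n))
  (P.+-mono-≤ (z<s ⋙ n<p^n 2≤p n) (P.≤-refl {p N.^ n}) ⋙ P.≤-reflexive (cong (p N.^ n N.+_) (sym (P.+-identityʳ (p N.^ n)))) ⋙ *-monoˡ-≤ (p N.^ n) 2≤p)
 p≤p^k : ∀ {p k} -> 1 ≦ p -> 1 ≦ k -> p ≦ p N.^ k
 p≤p^k {p} {suc k} 1≤p _ = m≤m*n p (p N.^ k) {{m^n≢0 p k {{N.>-nonZero 1≤p}}}}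
 ^-≥1 : ∀ {p} k -> 1 ≦ p -> 1 ≦ p N.^ k
 ^-≥1 {p} k 1≤p = N.>-nonZero⁻¹ (p N.^ k) {{m^n≢0 p k {{N.>-nonZero 1≤p}}}}
 prime-∣-^ : ∀ {p q} k -> Prime p -> Prime q -> q ∣ p N.^ k -> q ≡ p
 prime-∣-^ zero    pp pq d = ⊥-elim (¬prime[1] (subst Prime (∣1⇒≡1 d) pq))
 prime-∣-^ {p} {q} (suc k) pp pq d with euclidsLemma p (p N.^ k) pq d
 ... | inj₂ d′ = prime-∣-^ k pp pq d′
 ... | inj₁ d′ with prime⇒irreducible pp d′
 ...   | inj₁ refl = ⊥-elim (¬prime[1] pq)
 ...   | inj₂ e    = e
 -- Λ belongs to an arbitrary weight `h` on the primes. The logarithms used below are approximate as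
 -- functions but exactly additive, and additivity alone makes `∑Λ`, that is Λ ∗ 1 = log, an exact
 -- identity.
 module VonMangoldt (h : ℕ -> Q) where
  pk? : ∀ p k n -> Dec (Prime p × p N.^ k ≡ n)
  pk? p k n = prime? p ×-dec (p N.^ k N.≟ n)
  abstract
   Λ : ℕ -> Q
   Λ n = S n (\ p -> S n (\ k -> when (does (pk? p k n)) (h p)))
   -- p^k = n forces p ≤ n and k ≤ n, so any larger range serves equally; sums over n then live on
   -- one fixed box.
   Λ-range : ∀ {n N} -> n ≦ N -> Λ n ≡ S N (\ p -> S N (\ k -> when (does (pk? p k n)) (h p)))
   Λ-range {n} {N} n≤N = S-cong n (\ p 1≤p _ -> S-vanish n N n≤N (\ k n<k _ ->
     cong (\ b -> when b (h p)) (is-no (pk? p k n) (\ { (pp , refl) -> <⇒≱ n<k (P.<⇒≤ (n<p^n (prime≥2 pp) k)) })))) » S-vanish n N n≤N (\ p n<p _ -> S-zero′ N (\ k 1≤k _ ->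
     cong (\ b -> when b (h p)) (is-no (pk? p k n) (\ { (pp , refl) -> <⇒≱ n<p (p≤p^k (prime≥1 pp) 1≤k) }))))
   Λ-nonneg : (∀ p -> Prime p -> # 0 ≤ h p) -> ∀ n -> # 0 ≤ Λ n
   Λ-nonneg h≥0 n = S-nonneg n (\ p _ _ -> S-nonneg n (\ k _ _ -> go p k (pk? p k n)))
    where
    go : ∀ p k (d : Dec (Prime p × p N.^ k ≡ n)) -> # 0 ≤ when (does d) (h p)
    go p k (yes (pp , _)) = h≥0 p pp
    go p k (no _)         = ≤-refl
  Λ-sum : ∀ N (f : ℕ -> Q) -> S N (\ n -> Λ n * f n) ≡
   S N (\ p -> S N (\ k -> when (does (prime? p ×-dec (p N.^ k N.≤? N))) (h p * f (p N.^ k))))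
  Λ-sum N f = begin
   S N (\ n -> Λ n * f n)
    ≡⟨ S-cong N (\ n _ n≤N -> cong (_* f n) (Λ-range n≤N) » sym (S-*ʳ N (f n) _) » S-ext N (\ p -> sym (S-*ʳ N (f n) _))) ⟩
   S N (\ n -> S N (\ p -> S N (\ k -> when (does (pk? p k n)) (h p) * f n)))
    ≡⟨ trans (S-swap N N _) (S-ext N (\ p -> S-swap N N _)) ⟩
   S N (\ p -> S N (\ k -> S N (\ n -> when (does (pk? p k n)) (h p) * f n)))
    ≡⟨ S-ext N (\ p -> S-cong N (\ k 1≤k _ -> inner p k)) ⟩
   S N (\ p -> S N (\ k -> when (does (prime? p ×-dec (p N.^ k N.≤? N))) (h p * f (p N.^ k)))) ∎
   where
   mul : ∀ b x y -> when b x * y ≡ when b (x * y)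
   mul true  x y = refl
   mul false x y = ring 1 (\ a -> c0 :* a := c0)
   inner : ∀ p k -> S N (\ n -> when (does (pk? p k n)) (h p) * f n) ≡
    when (does (prime? p ×-dec (p N.^ k N.≤? N))) (h p * f (p N.^ k))
   inner p k with prime? p
   ... | no ¬pp = S-zero′ N (\ n _ _ -> ring 1 (\ a -> c0 :* a := c0))
   ... | yes pp = case p N.^ k N.≤? N of \ where
    (yes le) -> S-ext N (\ n -> mul _ (h p) (f n) » cong (\ b -> when b (h p * f n)) (does-⇔ (p N.^ k N.≟ n) (n N.≟ p N.^ k) sym sym)) » S-delta N (p N.^ k) (\ n -> h p * f n) (^-≥1 k (prime≥1 pp)) le » cong (\ b -> when b (h p * f (p N.^ k))) (sym (is-yes (p N.^ k N.≤? N) le))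
    (no nle) -> S-ext N (\ n -> mul _ (h p) (f n) » cong (\ b -> when b (h p * f n)) (does-⇔ (p N.^ k N.≟ n) (n N.≟ p N.^ k) sym sym)) » S-delta-none N (p N.^ k) (\ n -> h p * f n) (\ { (_ , le) -> nle le }) » cong (\ b -> when b (h p * f (p N.^ k))) (sym (is-no (p N.^ k N.≤? N) nle))
  valuations : ℕ -> ℕ -> Q
  valuations N n = S N (\ p -> S N (\ k -> when (does (prime? p ×-dec (p N.^ k ∣? n))) (h p)))
  valuations-additive : ∀ N n -> 1 ≦ n -> n ≦ N -> valuations N n ≡ additive h n
  valuations-additive N = prime-induction (\ n -> n ≦ N -> valuations N n ≡ additive h n) base step
   where
   base : 1 ≦ N -> valuations N 1 ≡ additive h 1
   base _ = S-zero′ N (\ p _ _ -> S-zero′ N (\ k 1≤k _ -> cong (\ b -> when b (h p))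
    (is-no (prime? p ×-dec (p N.^ k ∣? 1)) (\ { (pp , d) ->
     <⇒≱ (P.<-≤-trans (prime≥2 pp) (p≤p^k (prime≥1 pp) 1≤k)) (∣⇒≤ d) })))) » sym (additive-1 h)
   step : ∀ q n -> Prime q -> 1 ≦ n -> (n ≦ N -> valuations N n ≡ additive h n) ->
    q N.* n ≦ N -> valuations N (q N.* n) ≡ additive h (q N.* n)
   step q n pq 1≤n ih qn≤N = begin
    valuations N (q N.* n) ≡⟨ S-cong N (\ p _ _ -> row p) ⟩
    S N (\ p -> I p n + when (does (p N.≟ q)) (h p)) ≡⟨ S-+ N _ _ ⟩
    valuations N n + S N (\ p -> when (does (p N.≟ q)) (h p))
     ≡⟨ cong₂ _+_ (ih n≤N) (S-delta N q h (prime≥1 pq) (m≤m*n q n {{N.>-nonZero 1≤n}} ⋙ qn≤N)) ⟩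
    additive h n + h q ≡⟨ trans (+-comm (additive h n) (h q)) (sym (additive-cons h pq 1≤n)) ⟩
    additive h (q N.* n) ∎
    where
    n≤N : n ≦ N
    n≤N = m≤n*m n q {{prime⇒nonZero pq}} ⋙ qn≤N
    I : ℕ -> ℕ -> Q
    I p m = S N (\ k -> when (does (prime? p ×-dec (p N.^ k ∣? m))) (h p))
    row-ne : ∀ p -> ¬ (p ≡ q) -> I p (q N.* n) ≡ I p n
    row-ne p ne = S-ext N (\ k -> cong (\ b -> when b (h p)) (does-⇔ (prime? p ×-dec (p N.^ k ∣? (q N.* n))) (prime? p ×-dec (p N.^ k ∣? n))
     (\ { (pp , d) -> pp , coprime-prime pq (\ e -> ne (sym (prime-∣-^ k pp pq e))) d })
     (\ { (pp , d) -> pp , ∣n⇒∣m*n q d })))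
    -- Multiplication by q turns q^k ∣ n into q^(k+1) ∣ qn. The exponent 1 is the new contribution,
    -- and the top exponent adds nothing because n ≤ `suc N` < q^(`suc N`).
    row-eq : ∀ N -> n ≦ N -> 1 ≦ N -> S N (\ k -> when (does (prime? q ×-dec (q N.^ k ∣? (q N.* n)))) (h q)) ≡
     S N (\ k -> when (does (prime? q ×-dec (q N.^ k ∣? n))) (h q)) + h q
    row-eq (suc N) n≤N _ = begin
     S (suc N) (\ k -> F k (q N.* n)) ≡⟨ S-shift N _ ⟩
     F 1 (q N.* n) + S N (\ k -> F (suc k) (q N.* n))
      ≡⟨ cong₂ _+_ (cong (\ b -> when b (h q)) (is-yes (prime? q ×-dec (q N.^ 1 ∣? (q N.* n))) (pq , *-monoʳ-∣ q (1∣ n)))) (S-ext N (\ k -> cong (\ b -> when b (h q)) (does-⇔ (prime? q ×-dec (q N.^ suc k ∣? (q N.* n))) (prime? q ×-dec (q N.^ k ∣? n))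
         (\ { (_ , d) -> pq , *-cancelˡ-∣ q {{prime⇒nonZero pq}} d }) (\ { (_ , d) -> pq , *-monoʳ-∣ q d })))) ⟩
     h q + S N (\ k -> F k n)
      ≡⟨ ring 2 (\ a b -> a :+ b := (b :+ c0) :+ a) ⟩
     (S N (\ k -> F k n) + # 0) + h q
      ≡⟨ cong (\ z -> (S N (\ k -> F k n) + z) + h q) (sym (cong (\ b -> when b (h q)) (is-no (prime? q ×-dec (q N.^ suc N ∣? n))
         (\ { (_ , d) -> <⇒≱ (P.≤-<-trans n≤N (n<p^n (prime≥2 pq) (suc N))) (∣⇒≤ {{N.>-nonZero 1≤n}} d) })))) ⟩
     S (suc N) (\ k -> F k n) + h q ∎
     where
     F : ℕ -> ℕ -> Q
     F k m = when (does (prime? q ×-dec (q N.^ k ∣? m))) (h q)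
    row : ∀ p -> I p (q N.* n) ≡ I p n + when (does (p N.≟ q)) (h p)
    row p = case p N.≟ q of \ where
     (yes refl) -> row-eq N n≤N (1≤n ⋙ n≤N) » cong (\ b -> I q n + when b (h q)) (sym (is-yes (q N.≟ q) refl))
     (no  ne)   -> row-ne p ne » ring 1 (\ a -> a := a :+ c0) » cong (\ b -> I p n + when b (h p)) (sym (is-no (p N.≟ q) ne))
  ∑Λ : ∀ n -> 1 ≦ n -> Div n (\ d _ -> Λ d) ≡ additive h n
  ∑Λ n 1≤n = begin
   S n (\ d -> when (does (d ∣? n)) (Λ d)) ≡⟨ S-ext n (\ d -> mul (does (d ∣? n)) (Λ d)) ⟩
   S n (\ d -> Λ d * when (does (d ∣? n)) (# 1)) ≡⟨ Λ-sum n _ ⟩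
   S n (\ p -> S n (\ k -> when (does (prime? p ×-dec (p N.^ k N.≤? n))) (h p * when (does (p N.^ k ∣? n)) (# 1))))
    ≡⟨ S-ext n (\ p -> S-ext n (\ k -> cell p k)) ⟩
   valuations n n ≡⟨ valuations-additive n n 1≤n P.≤-refl ⟩
   additive h n ∎
   where
   mul : ∀ b x -> when b x ≡ x * when b (# 1)
   mul true  x = ring 1 (\ a -> a := a :* c1)
   mul false x = ring 1 (\ a -> c0 := a :* c0)
   cell : ∀ p k -> when (does (prime? p ×-dec (p N.^ k N.≤? n))) (h p * when (does (p N.^ k ∣? n)) (# 1)) ≡
    when (does (prime? p ×-dec (p N.^ k ∣? n))) (h p)
   cell p k with prime? p
   ... | no _ = refl
   ... | yes pp = case p N.^ k ∣? n of \ where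
    (yes d) -> cong₂ (\ b c -> when b (h p * when c (# 1))) (is-yes (p N.^ k N.≤? n) (∣⇒≤ {{N.>-nonZero 1≤n}} d)) (is-yes (p N.^ k ∣? n) d) » ring 1 (\ a -> a :* c1 := a) » cong (\ c -> when c (h p)) (sym (is-yes (p N.^ k ∣? n) d))
    (no ¬d) -> cong (\ c -> when (does (p N.^ k N.≤? n)) (h p * when c (# 1))) (is-no (p N.^ k ∣? n) ¬d) » (cong (when (does (p N.^ k N.≤? n))) (ring 1 (\ a -> a :* c0 := c0)) » when-0 (does (p N.^ k N.≤? n))) » cong (\ c -> when c (h p)) (sym (is-no (p N.^ k ∣? n) ¬d))

-- Approximate logarithms, the bounds of Chebyshev and Mertens, Selberg's formula

module Logarithm where
 open Rationals
 open Sums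
 open Arithmetic
 open ≡-Reasoning
 inv-cancel : ∀ {n} -> 1 ≦ n -> # n * inv n ≡ # 1
 inv-cancel {suc n} _ = inv-inverse n
 inv-diff : ∀ n -> 1 ≦ n -> inv n - inv (suc n) ≡ inv n * inv (suc n)
 inv-diff n 1≤n = ring 2 (\ a b -> a :- b := c1 :* a :- c1 :* b) » cong₂ (\ u v -> u * inv n - v * inv (suc n)) (sym (inv-inverse n)) (sym (inv-cancel 1≤n)) » cong (\ u -> u * inv (suc n) * inv n - # n * inv n * inv (suc n)) (#-suc n) » ring 3 (\ n a b -> (n :+ c1) :* b :* a :- n :* a :* b := a :* b)
 inv≤2inv : ∀ n -> 1 ≦ n -> inv n ≤ # 2 * inv (suc n)
 inv≤2inv n 1≤n = lin 3 (\ a b c -> a :- b ≼ c ▸ c ≼ c1 :* b ▸ ⊢ a ≼ c2 :* b) (eq≤ (inv-diff n 1≤n)) (*≤ˡ (inv≥0 (suc n)) (inv≤1 n))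
 inv-mul-≥1 : ∀ {m n} -> 1 ≦ m -> 1 ≦ n -> inv (m N.* n) ≡ inv m * inv n
 inv-mul-≥1 {suc m} {suc n} _ _ = inv-* m n
 mono-steps : ∀ (f : ℕ -> Q) {m n} -> m ≦ n -> (∀ i -> m ≦ i -> i N.< n -> f i ≤ f (suc i)) -> f m ≤ f n
 mono-steps f {m} {zero}  z≤n _ = ≤-refl
 mono-steps f {m} {suc n} h step with m N.≟ suc n
 ... | yes refl = ≤-refl
 ... | no  ne   = mono-steps f m≤n (\ i a b -> step i a (m≤n⇒m≤1+n b)) ≫ step n m≤n P.≤-refl
  where m≤n = ≤-pred (≤∧≢⇒< h ne)
 infix 4 _±_
 _±_ : Q -> Q -> Set
 a ± b = (- b ≤ a) × (a ≤ b)
 ±-abs : ∀ {a b} -> ∣ a ∣ ≤ b -> a ± b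
 ±-abs {a} h = lin 2 (\ a b -> ⊝ a ≼ b ▸ ⊢ ⊝ b ≼ a) ((-≤∣∣ a) ≫ h) , ≤-trans (≤∣∣ a) h
 abs-± : ∀ {a b} -> a ± b -> ∣ a ∣ ≤ b
 abs-± (l , u) = ∣∣≤ u (lin 2 (\ a b -> ⊝ b ≼ a ▸ ⊢ ⊝ a ≼ b) l)
 -- 2(bd - ac) = (b - a)(d + c) + (b + a)(d - c), and likewise 2(bd + ac) = (b + a)(d + c) + (b -
 -- a)(d - c); no case distinction on signs arises.
 ±-* : ∀ {a b c d} -> a ± b -> c ± d -> # 0 ≤ b -> # 0 ≤ d -> a * c ± b * d
 ±-* {a} {b} {c} {d} (la , ua) (lc , uc) hb hd = lower , upper
  where
  p : # 0 ≤ (b - a) * (d + c)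
  p = *≥0 (lin 2 (\ a b -> a ≼ b ▸ ⊢ c0 ≼ b :- a) ua) (lin 2 (\ c d -> ⊝ d ≼ c ▸ ⊢ c0 ≼ d :+ c) lc)
  q : # 0 ≤ (b + a) * (d + c)
  q = *≥0 (lin 2 (\ a b -> ⊝ b ≼ a ▸ ⊢ c0 ≼ b :+ a) la) (lin 2 (\ c d -> ⊝ d ≼ c ▸ ⊢ c0 ≼ d :+ c) lc)
  r : # 0 ≤ (b + a) * (d - c)
  r = *≥0 (lin 2 (\ a b -> ⊝ b ≼ a ▸ ⊢ c0 ≼ b :+ a) la) (lin 2 (\ c d -> c ≼ d ▸ ⊢ c0 ≼ d :- c) uc)
  s : # 0 ≤ (b - a) * (d - c)
  s = *≥0 (lin 2 (\ a b -> a ≼ b ▸ ⊢ c0 ≼ b :- a) ua) (lin 2 (\ c d -> c ≼ d ▸ ⊢ c0 ≼ d :- c) uc)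
  half : ∀ {x y} -> # 2 * x ≤ # 2 * y -> x ≤ y
  half = *-cancelˡ-≤ (#-pos 1)
  upper : a * c ≤ b * d
  upper = half (lin 4 (\ a b c d -> c0 ≼ (b :- a) :* (d :+ c) ▸ c0 ≼ (b :+ a) :* (d :- c) ▸
   ⊢ c2 :* (a :* c) ≼ c2 :* (b :* d)) p r)
  lower : - (b * d) ≤ a * c
  lower = half (lin 4 (\ a b c d -> c0 ≼ (b :+ a) :* (d :+ c) ▸ c0 ≼ (b :- a) :* (d :- c) ▸
   ⊢ c2 :* ⊝ (b :* d) ≼ c2 :* (a :* c)) q s)
 S-± : ∀ n {f g} -> (∀ i -> 1 ≦ i -> i ≦ n -> f i ± g i) -> S n f ± S n g
 S-± n {f} {g} h = ≤-trans (eq≥ (S-neg n g)) (S-mono n (\ i a b -> fst (h i a b))) , S-mono n (\ i a b -> snd (h i a b))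
 H : ℕ -> Q
 H n = S n inv
 -- The substitute for the real logarithm: exactly additive, with increments controlled only up to
 -- 1/n² and only below `N`. All later bounds hold for every system, with constants independent of
 -- it.
 record LogSystem (N : ℕ) : Set where
  field
   h        : ℕ -> Q
   h-nonneg : ∀ p -> Prime p -> # 0 ≤ h p
   step-≥   : ∀ n -> 1 ≦ n -> n N.< N -> inv n - inv n * inv n ≤ additive h (suc n) - additive h n
   step-≤   : ∀ n -> 1 ≦ n -> n N.< N -> additive h (suc n) - additive h n ≤ inv n + inv n * inv n
 module Log (N : ℕ) (4≤N : 4 ≦ N) (sys : LogSystem N) where
  open LogSystem sys
  open VonMangoldt h public
  lg : ℕ -> Q
  lg = additive h
  Δ : ℕ -> Q
  Δ i = lg (suc i) - lg i
  lg-* : ∀ m n -> 1 ≦ m -> 1 ≦ n -> lg (m N.* n) ≡ lg m + lg n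
  lg-* = additive-* h
  lg-1 : lg 1 ≡ # 0
  lg-1 = additive-1 h
  Λ≥0 : ∀ n -> # 0 ≤ Λ n
  Λ≥0 = Λ-nonneg h-nonneg
  ψ : ℕ -> Q
  ψ x = S x Λ
  ψ≥0 : ∀ x -> # 0 ≤ ψ x
  ψ≥0 x = S-nonneg x (\ i _ _ -> Λ≥0 i)
  ψ-mono : ∀ {x y} -> x ≦ y -> ψ x ≤ ψ y
  ψ-mono h = S-mono-range h Λ≥0
  inv-sq≤ : ∀ n -> inv n * inv n ≤ inv n
  inv-sq≤ n = *≤ʳ (inv≥0 n) (inv≤1 n) ≫ eq≤ (ring 1 (\ a -> a :* c1 := a))
  Δ≥0 : ∀ n -> 1 ≦ n -> n N.< N -> # 0 ≤ Δ n
  Δ≥0 n a b = lin 3 (\ i s d -> s ≼ i ▸ i :- s ≼ d ▸ ⊢ c0 ≼ d) (inv-sq≤ n) (step-≥ n a b)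
  Δ≤2inv : ∀ n -> 1 ≦ n -> n N.< N -> Δ n ≤ # 2 * inv n
  Δ≤2inv n a b = lin 3 (\ i s d -> s ≼ i ▸ d ≼ i :+ s ▸ ⊢ d ≼ c2 :* i) (inv-sq≤ n) (step-≤ n a b)
  lg-mono : ∀ {m n} -> 1 ≦ m -> m ≦ n -> n ≦ N -> lg m ≤ lg n
  lg-mono 1≤m m≤n n≤N = mono-steps lg m≤n (\ i a b ->
   lin 2 (\ x y -> c0 ≼ y :- x ▸ ⊢ x ≼ y) (Δ≥0 i (1≤m ⋙ a) (P.<-≤-trans b n≤N)))
  lg≥0 : ∀ {n} -> 1 ≦ n -> n ≦ N -> # 0 ≤ lg n
  lg≥0 1≤n n≤N = eq≥ lg-1 ≫ lg-mono z<s 1≤n n≤N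
  lg≤id : ∀ n -> 1 ≦ n -> n ≦ N -> lg n ≤ # n
  lg≤id 1 _ _ = eq≤ lg-1 ≫ #-mono z≤n
  lg≤id 2 _ h = lin 3 (\ a b i -> a :- b ≼ c2 :* i ▸ b ≼ c0 ▸ 2 · (i ≼ c1) ▸ ⊢ a ≼ c2)
   (Δ≤2inv 1 z<s h) (eq≤ lg-1) (inv≤1 1)
  lg≤id (suc n@(suc (suc k))) _ h = lin 4 (\ a b i m -> a :- b ≼ c2 :* i ▸ b ≼ m ▸ c2 :* i ≼ c1 ▸ ⊢ a ≼ m :+ c1)
    (Δ≤2inv n z<s h) (lg≤id n z<s (P.<⇒≤ h)) (*≤ˡ (inv≥0 n) (#-mono {2} {n} (s≤s z<s)) ≫ eq≤ (inv-cancel {n} z<s)) ≫ eq≥ (#-suc n)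
  A : ℕ -> Q
  A n = H n - lg n
  -- 1/n - 1/(n+1) is at least 1/(2n²), so the error 1/n² of one increment is at most two such
  -- differences; this makes the errors telescope.
  A-step : ∀ n -> 1 ≦ n -> n N.< N -> A (suc n) - A n ± # 3 * (inv n - inv (suc n))
  A-step n 1≤n n<N =
    lin 5 (\ a b s l m -> 2 · (a :* b ≼ a :- b) ▸ a :* a ≼ a :* (c2 :* b) ▸ l :- m ≼ a :+ a :* a ▸
     ⊢ ⊝ (c3 :* (a :- b)) ≼ (s :+ b :- l) :- (s :- m)) e≥ sq (step-≤ n 1≤n n<N)
   , lin 5 (\ a b s l m -> 4 · (a :* b ≼ a :- b) ▸ a :* a ≼ a :* (c2 :* b) ▸ a :- a :* a ≼ l :- m ▸ 2 · (c0 ≼ a :* b) ▸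
     ⊢ (s :+ b :- l) :- (s :- m) ≼ c3 :* (a :- b)) e≥ sq (step-≥ n 1≤n n<N) pos
   where
   e≥ = eq≥ (inv-diff n 1≤n)
   sq = *≤ʳ (inv≥0 n) (inv≤2inv n 1≤n)
   pos = *≥0 (inv≥0 n) (inv≥0 (suc n))
  -- Euler's constant for a logarithm that ends at `N`: the value of H - log at the last index plays
  -- the role of the limit.
  γ : Q
  γ = A N
  A-close : ∀ {m n} -> 1 ≦ m -> m ≦ n -> n ≦ N -> A n - A m ± # 3 * inv m
  A-close {m} {n} 1≤m m≤n n≤N =
    lin 4 (\ a n i b -> a :- c3 :* i ≼ n :- c3 :* b ▸ 3 · (c0 ≼ b) ▸ ⊢ ⊝ (c3 :* i) ≼ n :- a) up (inv≥0 n)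
   , lin 4 (\ a n i b -> ⊝ a :- c3 :* i ≼ ⊝ n :- c3 :* b ▸ 3 · (c0 ≼ b) ▸ ⊢ n :- a ≼ c3 :* i) down (inv≥0 n)
   where
   up : A m - # 3 * inv m ≤ A n - # 3 * inv n
   up = mono-steps (\ i -> A i - # 3 * inv i) m≤n (\ i a b ->
    lin 4 (\ a b i c -> ⊝ (c3 :* (i :- c)) ≼ b :- a ▸ ⊢ a :- c3 :* i ≼ b :- c3 :* c)
     (fst (A-step i (1≤m ⋙ a) (P.<-≤-trans b n≤N))))
   down : - A m - # 3 * inv m ≤ - A n - # 3 * inv n
   down = mono-steps (\ i -> - A i - # 3 * inv i) m≤n (\ i a b ->
    lin 4 (\ a b i c -> b :- a ≼ c3 :* (i :- c) ▸ ⊢ ⊝ a :- c3 :* i ≼ ⊝ b :- c3 :* c)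
     (snd (A-step i (1≤m ⋙ a) (P.<-≤-trans b n≤N))))
  1≤N : 1 ≦ N
  1≤N = z<s ⋙ 4≤N
  A-1 : A 1 ≡ # 1
  A-1 = cong₂ (\ i l -> # 0 + i - l) inv-1 lg-1 » ring 0 (c0 :+ c1 :- c0 := c1)
  A-bound : ∀ {n} -> 1 ≦ n -> n ≦ N -> A n ± # 4
  A-bound {n} 1≤n n≤N = lin 3 (\ a b i -> ⊝ (c3 :* i) ≼ a :- b ▸ 3 · (i ≼ c1) ▸ c1 ≼ b ▸ ⊢ ⊝ c4 ≼ a) (fst c) (inv≤1 1) (eq≥ A-1)
        , lin 3 (\ a b i -> a :- b ≼ c3 :* i ▸ 3 · (i ≼ c1) ▸ b ≼ c1 ▸ ⊢ a ≼ c4) (snd c) (inv≤1 1) (eq≤ A-1)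
   where c = A-close z<s 1≤n n≤N
  -- |H(n) − log n − γ| ≤ 3/n, the error term of Euler's constant.
  H-γ : ∀ {n} -> 1 ≦ n -> n ≦ N -> A n - γ ± # 3 * inv n
  H-γ {n} 1≤n n≤N = lin 3 (\ a g i -> g :- a ≼ i ▸ ⊢ ⊝ i ≼ a :- g) (snd c)
          , lin 3 (\ a g i -> ⊝ i ≼ g :- a ▸ ⊢ a :- g ≼ i) (fst c)
   where c = A-close 1≤n n≤N P.≤-refl
  T′ : ℕ -> Q
  T′ x = S x lg
  Δ-times : ∀ i -> 1 ≦ i -> i N.< N -> Δ i * # i - # 1 ± inv i
  Δ-times i 1≤i i<N =
    lin 3 (\ d n j -> (j :- j :* j) :* n ≼ d :* n ▸ c1 ≼ n :* j ▸ j :* (n :* j) ≼ j :* c1 ▸ ⊢ ⊝ j ≼ d :* n :- c1) (*≤ˡ (0≤# i) (step-≥ i 1≤i i<N)) (eq≥ c) (*≤ʳ (inv≥0 i) (eq≤ c))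
   , lin 3 (\ d n j -> d :* n ≼ (j :+ j :* j) :* n ▸ n :* j ≼ c1 ▸ j :* (n :* j) ≼ j :* c1 ▸ ⊢ d :* n :- c1 ≼ j) (*≤ˡ (0≤# i) (step-≤ i 1≤i i<N)) (eq≤ c) (*≤ʳ (inv≥0 i) (eq≤ c))
   where c = inv-cancel 1≤i
  H-mono : ∀ {m n} -> m ≦ n -> H m ≤ H n
  H-mono h = S-mono-range h inv≥0
  S-one : ∀ n -> S n (\ _ -> # 1) ≡ # n
  S-one n = S-const n (# 1) » ring 1 (\ a -> a :* c1 := a)
  H≤id : ∀ n -> H n ≤ # n
  H≤id n = S-mono n (\ i _ _ -> inv≤1 i) ≫ eq≤ (S-one n)
  Δ-sum : ∀ m -> suc m ≦ N -> T′ (suc m) ≡ # (suc m) * lg (suc m) - S m (\ i -> Δ i * # i)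
  Δ-sum m _ = S-ext (suc m) (\ i -> ring 1 (\ a -> a := a :* c1)) » S-abel m lg (\ _ -> # 1) » cong₂ _-_ (cong (lg (suc m) *_) (S-one (suc m)) » *-comm _ _) (S-ext m (\ i -> cong (Δ i *_) (S-one i)))
  -- Stirling's formula for log x!. Summation by parts leaves ∑ i·Δ i, whose terms are 1 up to 1/i,
  -- hence the harmonic sum in the error.
  T-approx : ∀ x -> 1 ≦ x -> x ≦ N -> T′ x - (# x * lg x - # x) ± # 1 + H x
  T-approx (suc m) _ x≤N =
    lin 6 (\ t x l n h s -> x :* l :- s ≼ t ▸ s :- n ≼ h ▸ n :+ c1 ≼ x ▸ c0 ≼ c2 ▸
      ⊢ ⊝ (c1 :+ h) ≼ t :- (x :* l :- x)) (eq≥ e) s≤ (eq≥ (#-suc m)) (#-mono z≤n) |> (\ z -> lin 2 (\ a b -> a ≼ b ▸ ⊢ ⊝ (c1 :+ b) ≼ ⊝ (c1 :+ a)) H≤ ≫ z)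
   , lin 6 (\ t x l n h s -> t ≼ x :* l :- s ▸ ⊝ h ≼ s :- n ▸ x ≼ n :+ c1 ▸
      ⊢ t :- (x :* l :- x) ≼ c1 :+ h) (eq≤ e) s≥ (eq≤ (#-suc m)) |> (\ z -> z ≫ lin 2 (\ a b -> a ≼ b ▸ ⊢ c1 :+ a ≼ c1 :+ b) H≤)
   where
   _|>_ : ∀ {A B : Set} -> A -> (A -> B) -> B
   z |> f = f z
   e = Δ-sum m x≤N
   H≤ : H m ≤ H (suc m)
   H≤ = H-mono (n≤1+n m)
   bd : S m (\ i -> Δ i * # i - # 1) ± H m
   bd = S-± m (\ i 1≤i i≤m -> Δ-times i 1≤i (P.<-≤-trans (s≤s i≤m) x≤N))
   eq : S m (\ i -> Δ i * # i - # 1) ≡ S m (\ i -> Δ i * # i) - # m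
   eq = S-- m (\ i -> Δ i * # i) (\ _ -> # 1) » cong (\ z -> S m (\ i -> Δ i * # i) - z) (S-one m)
   s≤ : S m (\ i -> Δ i * # i) - # m ≤ H m
   s≤ = eq≥ eq ≫ snd bd
   s≥ : - H m ≤ S m (\ i -> Δ i * # i) - # m
   s≥ = fst bd ≫ eq≤ eq
  T-ψ : ∀ x -> T′ x ≡ S x (\ m -> ψ (x ÷ m))
  T-ψ x = begin
   S x lg                                ≡⟨ S-cong x (\ k 1≤k _ -> sym (∑Λ k 1≤k)) ⟩
   S x (\ k -> Div k (\ d _ -> Λ d))       ≡⟨ sym (hyperbola x (\ d _ -> Λ d)) ⟩
   S x (\ d -> S (x ÷ d) (\ _ -> Λ d))     ≡⟨ hyperbola-swap x (\ d _ -> Λ d) ⟩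
   S x (\ m -> S (x ÷ m) (\ d -> Λ d))     ∎
  T-Λ : ∀ x -> T′ x ≡ S x (\ d -> Λ d * # (x ÷ d))
  T-Λ x = begin
   S x lg                                ≡⟨ S-cong x (\ k 1≤k _ -> sym (∑Λ k 1≤k)) ⟩
   S x (\ k -> Div k (\ d _ -> Λ d))       ≡⟨ sym (hyperbola x (\ d _ -> Λ d)) ⟩
   S x (\ d -> S (x ÷ d) (\ _ -> Λ d))     ≡⟨ S-ext x (\ d -> S-const (x ÷ d) (Λ d) » *-comm _ _) ⟩
   S x (\ d -> Λ d * # (x ÷ d))           ∎
  S-double : ∀ y (f : ℕ -> Q) -> S (2 N.* y) f ≡ S y (\ i -> f (2 N.* i N.∸ 1) + f (2 N.* i))
  S-double zero    f = refl
  S-double (suc y) f = begin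
   S (2 N.* suc y) f               ≡⟨ cong (\ k -> S k f) e ⟩
   S (suc (suc (2 N.* y))) f       ≡⟨ cong (\ z -> z + f (suc (2 N.* y)) + f (suc (suc (2 N.* y)))) (S-double y f) ⟩
   S y (\ i -> f (2 N.* i N.∸ 1) + f (2 N.* i)) + f (suc (2 N.* y)) + f (suc (suc (2 N.* y)))
    ≡⟨ trans (+-assoc _ _ _) (cong (\ k -> S y (\ i -> f (2 N.* i N.∸ 1) + f (2 N.* i)) + (f (k N.∸ 1) + f k)) (sym e)) ⟩
   S (suc y) (\ i -> f (2 N.* i N.∸ 1) + f (2 N.* i)) ∎
   where
   e : 2 N.* suc y ≡ suc (suc (2 N.* y))
   e = *-suc 2 y
  -- The factors 2i - 1 and 2i of (2y)! are both at most 2·i, so (2y)! ≤ 4^y (y!)². This is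
  -- Chebyshev's estimate in logarithmic form.
  T-double : ∀ y -> 2 N.* y ≦ N -> T′ (2 N.* y) ≤ # 2 * (# y * lg 2) + # 2 * T′ y
  T-double y h = eq≤ (S-double y lg) ≫ S-mono y cell ≫ eq≤ (S-*ˡ y (# 2) (\ i -> lg 2 + lg i) » cong (# 2 *_) (S-+ y (\ _ -> lg 2) lg » cong (_+ T′ y) (S-const y (lg 2))) » ring 2 (\ a b -> c2 :* (a :+ b) := c2 :* a :+ c2 :* b))
   where
   cell : ∀ i -> 1 ≦ i -> i ≦ y -> lg (2 N.* i N.∸ 1) + lg (2 N.* i) ≤ # 2 * (lg 2 + lg i)
   cell i 1≤i i≤y = lin 4 (\ a b c d -> a ≼ b ▸ 2 · (b ≼ c :+ d) ▸ ⊢ a :+ b ≼ c2 :* (c :+ d))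
    (lg-mono (∸-monoˡ-≤ 1 (*-monoʳ-≤ 2 1≤i)) (m∸n≤m (2 N.* i) 1) (*-monoʳ-≤ 2 i≤y ⋙ h)) (eq≤ (lg-* 2 i z<s 1≤i))
  halves : ∀ x -> x ≡ 2 N.* (x ÷ 2) ⊎ x ≡ suc (2 N.* (x ÷ 2))
  halves x with m≤n⇒m<n∨m≡n (÷-upper {x} {2} z<s P.≤-refl)
  ... | inj₂ e = inj₁ (sym e)
  ... | inj₁ l = inj₂ (P.≤-antisym (≤-pred ((<-÷ x {2} z<s) ⋙ P.≤-reflexive (*-suc 2 (x ÷ 2)))) l)
  2≤N : 2 ≦ N
  2≤N = s≤s z<s ⋙ 4≤N
  lg2≤2 : lg 2 ≤ # 2
  lg2≤2 = lg≤id 2 z<s 2≤N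
  T-half : ∀ x -> 1 ≦ x -> x ≦ N -> T′ x - # 2 * T′ (x ÷ 2) ≤ # 3 * # x
  T-half x 1≤x x≤N = case halves x of \ where
    (inj₁ e) -> lin 4 (\ t a y l -> t ≼ c2 :* (y :* l) :+ c2 :* a ▸ 2 · (y :* l ≼ y :* c2) ▸ ⊢ t :- c2 :* a ≼ c4 :* y) (subst (\ z -> T′ z ≤ # 2 * (# y * lg 2) + # 2 * T′ y) (sym e) (T-double y (P.≤-reflexive (sym e) ⋙ x≤N))) (*≤ʳ (0≤# y) lg2≤2) ≫ lin 2 (\ x y -> 2 · (c2 :* y ≼ x) ▸ c0 ≼ x ▸ ⊢ c4 :* y ≼ c3 :* x) (eq≥ (#-* 2 y) ≫ eq≤ (cong #_ (sym e))) (0≤# x)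
    (inj₂ e) -> lin 5 (\ t a y l m -> t ≼ c2 :* (y :* l) :+ c2 :* a :+ m ▸ 2 · (y :* l ≼ y :* c2) ▸ ⊢ t :- c2 :* a ≼ c4 :* y :+ m) (subst (\ z -> T′ z ≤ # 2 * (# y * lg 2) + # 2 * T′ y + lg z) (sym e) (+-mono-≤ (T-double y ((n≤1+n _ ⋙ P.≤-reflexive (sym e)) ⋙ x≤N)) ≤-refl)) (*≤ʳ (0≤# y) lg2≤2) ≫ lin 3 (\ x y m -> 2 · (c2 :* y ≼ x) ▸ m ≼ x ▸ ⊢ c4 :* y :+ m ≼ c3 :* x) (eq≥ (#-* 2 y) ≫ #-mono (n≤1+n _ ⋙ P.≤-reflexive (sym e))) (lg≤id x 1≤x x≤N)
   where y = x ÷ 2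
  floor-drop : ∀ x d -> 1 ≦ d -> 2 N.* (x ÷ 2 ÷ d) ≦ x ÷ d
  floor-drop x d 1≤d = ÷-lower 1≤d (P.≤-reflexive (sym (P.*-assoc d 2 (x ÷ 2 ÷ d)) » cong (N._* (x ÷ 2 ÷ d)) (P.*-comm d 2) » P.*-assoc 2 d (x ÷ 2 ÷ d)) ⋙ *-monoʳ-≤ 2 (÷-upper 1≤d P.≤-refl) ⋙ ÷-upper {x} {2} z<s P.≤-refl)
  -- ⌊x/d⌋ - 2⌊x/2d⌋ is nonnegative by `floor-drop`, and it is at least 1 for x/2 < d ≤ x, which are
  -- exactly the d counted on the left.
  ψ-half : ∀ x -> ψ x - ψ (x ÷ 2) ≤ T′ x - # 2 * T′ (x ÷ 2)
  ψ-half x = eq≤ (cong (\ z -> ψ x - z) (S-extend y x Λ y≤x) » sym (S-- x Λ _)) ≫ S-mono x cell ≫ eq≤ (S-- x _ _ » cong₂ _-_ (sym (T-Λ x)) (S-*ˡ x (# 2) _ » cong (# 2 *_) (sym (S-vanish y x y≤x big) » sym (T-Λ y))))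
   where
   y = x ÷ 2
   y≤x = ÷-≤ x 2
   big : ∀ d -> y N.< d -> d ≦ x -> Λ d * # (y ÷ d) ≡ # 0
   big d y<d _ = cong (\ k -> Λ d * # k) (÷-self-zero y<d) » ring 1 (\ a -> a :* c0 := c0)
   cell : ∀ d -> 1 ≦ d -> d ≦ x -> Λ d - when (does (d N.≤? y)) (Λ d) ≤ Λ d * # (x ÷ d) - # 2 * (Λ d * # (y ÷ d))
   cell d 1≤d d≤x = case d N.≤? y of \ where
    (yes q) -> eq≤ (cong (\ b -> Λ d - when b (Λ d)) (is-yes (d N.≤? y) q) » ring 1 (\ a -> a :- a := c0)) ≫ lin 3 (\ l a b -> l :* (c2 :* b) ≼ l :* a ▸ ⊢ c0 ≼ l :* a :- c2 :* (l :* b)) (*≤ʳ (Λ≥0 d) (eq≥ (#-* 2 (y ÷ d)) ≫ #-mono (floor-drop x d 1≤d)))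
    (no ¬q) -> eq≤ (cong (\ b -> Λ d - when b (Λ d)) (is-no (d N.≤? y) ¬q)) ≫ lin 2 (\ l a -> l :* c1 ≼ l :* a ▸ ⊢ l :- c0 ≼ l :* a :- c2 :* (l :* c0)) (*≤ʳ (Λ≥0 d) (#-mono (÷-pos 1≤d d≤x))) ≫ eq≤ (cong (\ k -> Λ d * # (x ÷ d) - # 2 * (Λ d * # k)) (sym (÷-self-zero (P.≰⇒> ¬q))))
  -- Repeated halving: 3x + 3x/2 + 3x/4 + ... ≤ 6x.
  ψ≤6 : ∀ x -> x ≦ N -> ψ x ≤ # 6 * # x
  ψ≤6 = <-rec (\ x -> x ≦ N -> ψ x ≤ # 6 * # x) \ where
    zero    rec _ -> lin 0 (⊢ c0 ≼ con 6 :* c0)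
    x@(suc x-1) rec x≤N -> lin 4 (\ a b x y -> a :- b ≼ c3 :* x ▸ b ≼ con 6 :* y ▸ 3 · (c2 :* y ≼ x) ▸ ⊢ a ≼ con 6 :* x)
     (ψ-half x ≫ T-half x z<s x≤N)
     (rec {x ÷ 2} (half< x-1) ((÷-≤ x 2) ⋙ x≤N)) (eq≥ (#-* 2 (x ÷ 2)) ≫ #-mono (÷-upper {x} {2} z<s P.≤-refl))
   where
   half< : ∀ m -> suc m ÷ 2 N.< suc m
   half< m = *-cancelˡ-< 2 (suc m ÷ 2) (suc m) (P.≤-<-trans (÷-upper {suc m} {2} z<s P.≤-refl)
    (P.<-≤-trans (m<m+n (suc m) z<s) (P.≤-reflexive (cong (suc m N.+_) (sym (P.+-identityʳ (suc m)))))))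
  ÷-upperQ : ∀ x d -> 1 ≦ d -> # (x ÷ d) ≤ # x * inv d
  ÷-upperQ x (suc d) _ = ≤-inv-of d (eq≥ (#-* (suc d) (x ÷ suc d)) ≫ #-mono (÷-upper z<s P.≤-refl))
  ÷-lowerQ : ∀ x d -> 1 ≦ d -> # x * inv d ≤ # (x ÷ d) + # 1
  ÷-lowerQ x (suc d) _ = inv-≤-of d (#-mono (P.<⇒≤ (<-÷ x {suc d} z<s)) ≫ eq≤ ((#-* (suc d) (suc (x ÷ suc d))) » cong (# (suc d) *_) (#-suc (x ÷ suc d))))
  M : ℕ -> Q
  M x = S x (\ n -> Λ n * inv n)
  M-T-≥ : ∀ x -> T′ x ≤ # x * M x
  M-T-≥ x = eq≤ (T-Λ x) ≫ S-mono x (\ d 1≤d _ -> *≤ʳ (Λ≥0 d) (÷-upperQ x d 1≤d)) ≫ eq≤ (S-ext x (\ d -> ring 3 (\ l x i -> l :* (x :* i) := x :* (l :* i))) » S-*ˡ x (# x) _)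
  M-T-≤ : ∀ x -> # x * M x ≤ T′ x + ψ x
  M-T-≤ x = eq≤ (sym (S-*ˡ x (# x) _) » S-ext x (\ d -> ring 3 (\ l x i -> x :* (l :* i) := l :* (x :* i)))) ≫ S-mono x (\ d 1≤d _ -> *≤ʳ (Λ≥0 d) (÷-lowerQ x d 1≤d)) ≫ eq≤ (S-ext x (\ d -> ring 2 (\ l a -> l :* (a :+ c1) := l :* a :+ l)) » S-+ x _ _ » cong (_+ ψ x) (sym (T-Λ x)))
  -- T(x) = ∑ Λ(d)⌊x/d⌋ is compared with x∑ Λ(d)/d; dropping the floors costs at most ψ(x) ≤ 6x, and
  -- Stirling evaluates T(x).
  mertens : ∀ x -> 1 ≦ x -> x ≦ N -> M x - lg x ± # 7
  mertens x@(suc x-1) 1≤x x≤N =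
    *-cancelˡ-≤ (#-pos x-1) (lin 5 (\ x m l t h -> t ≼ x :* m ▸ ⊝ (c1 :+ h) ≼ t :- (x :* l :- x) ▸ h ≼ x ▸ 5 · (c1 ≼ x) ▸ 
     ⊢ x :* (⊝ con 7) ≼ x :* (m :- l)) (M-T-≥ x) (fst ta) (H≤id x) (#-mono 1≤x))
   , *-cancelˡ-≤ (#-pos x-1) (lin 6 (\ x m l t h p -> x :* m ≼ t :+ p ▸ t :- (x :* l :- x) ≼ c1 :+ h ▸ h ≼ x ▸ c1 ≼ x ▸ p ≼ con 6 :* x ▸
     ⊢ x :* (m :- l) ≼ x :* con 7) (M-T-≤ x) (snd ta) (H≤id x) (#-mono 1≤x) (ψ≤6 x x≤N))
   where ta = T-approx x 1≤x x≤N
  Div-cong : ∀ k (f g : ℕ -> ℕ -> Q) -> (∀ d e -> 1 ≦ d -> d N.* e ≡ k -> f d e ≡ g d e) -> Div k f ≡ Div k g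
  Div-cong k f g eq = S-cong k (\ d 1≤d _ -> case d ∣? k of \ where
    (yes p) -> cong (when (does (d ∣? k))) (eq d (k ÷ d) 1≤d (exact d 1≤d p))
    (no ¬p) -> cong (\ b -> when b (f d (k ÷ d))) (is-no (d ∣? k) ¬p) » cong (\ b -> when b (g d (k ÷ d))) (sym (is-no (d ∣? k) ¬p)))
   where
   exact : ∀ d -> 1 ≦ d -> d ∣ k -> d N.* (k ÷ d) ≡ k
   exact d 1≤d (divides q refl) = cong (d N.*_) (÷-exact 1≤d) » P.*-comm d q
  Div-*ʳ : ∀ k c (f : ℕ -> ℕ -> Q) -> Div k (\ d e -> f d e * c) ≡ Div k f * c
  Div-*ʳ k c f = S-ext k (\ d -> mul (does (d ∣? k))) » S-*ʳ k c _
   where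
   mul : ∀ b {x} -> when b (x * c) ≡ when b x * c
   mul Data.Bool.true  = refl
   mul Data.Bool.false = ring 1 (\ a -> c0 := c0 :* a)
  möbius-inversion : ∀ n (G : ℕ -> Q) -> 1 ≦ n -> S n (\ d -> μ d * S (n ÷ d) (\ j -> G (d N.* j))) ≡ G 1
  möbius-inversion n@(suc n-1) G _ = begin
   S n (\ d -> μ d * S (n ÷ d) (\ j -> G (d N.* j)))     ≡⟨ S-ext n (\ d -> sym (S-*ˡ (n ÷ d) (μ d) _)) ⟩
   S n (\ d -> S (n ÷ d) (\ j -> μ d * G (d N.* j)))     ≡⟨ hyperbola n _ ⟩
   S n (\ k -> Div k (\ d j -> μ d * G (d N.* j)))       ≡⟨ S-ext n (\ k -> Div-cong k _ (\ d _ -> μ d * G k) (\ d e _ q -> cong (\ z -> μ d * G z) q) » Div-*ʳ k (G k) (\ d _ -> μ d)) ⟩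
   S n (\ k -> Div k (\ d _ -> μ d) * G k)               ≡⟨ S-shift n-1 _ ⟩
   Div 1 (\ d _ -> μ d) * G 1 + S n-1 (\ k -> Div (suc k) (\ d _ -> μ d) * G (suc k))
    ≡⟨ cong₂ (\ a b -> a * G 1 + b) ∑μ-1 (S-zero′ n-1 (\ k 1≤k _ -> cong (_* G (suc k)) (∑μ (suc k) (s≤s 1≤k)) » ring 1 (\ a -> c0 :* a := c0))) ⟩
   # 1 * G 1 + # 0                                     ≡⟨ ring 1 (\ a -> c1 :* a :+ c0 := a) ⟩
   G 1 ∎
  lg-sum : ∀ n (G : ℕ -> Q) -> S n (\ m -> lg m * G m) ≡ S n (\ e -> Λ e * S (n ÷ e) (\ j -> G (e N.* j)))
  lg-sum n G = begin
   S n (\ m -> lg m * G m) ≡⟨ S-cong n (\ m 1≤m _ -> cong (_* G m) (sym (∑Λ m 1≤m)) » sym (Div-*ʳ m (G m) (\ d _ -> Λ d)) » Div-cong m (\ d _ -> Λ d * G m) _ (\ d e _ q -> cong (\ z -> Λ d * G z) (sym q))) ⟩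
   S n (\ m -> Div m (\ d e -> Λ d * G (d N.* e))) ≡⟨ sym (hyperbola n _) ⟩
   S n (\ d -> S (n ÷ d) (\ e -> Λ d * G (d N.* e))) ≡⟨ S-ext n (\ d -> S-*ˡ (n ÷ d) (Λ d) _) ⟩
   S n (\ e -> Λ e * S (n ÷ e) (\ j -> G (e N.* j))) ∎
  -- The identity μ ∗ log = Λ in summed form: log is expanded as Λ ∗ 1, the sums over d and e are
  -- exchanged, and Möbius inversion removes d.
  μ-lg : ∀ x (F : ℕ -> Q) -> S x (\ d -> μ d * S (x ÷ d) (\ m -> lg m * F (d N.* m))) ≡ S x (\ k -> Λ k * F k)
  μ-lg x F = begin
   S x (\ d -> μ d * S (x ÷ d) (\ m -> lg m * F (d N.* m)))
    ≡⟨ S-ext x (\ d -> cong (μ d *_) (lg-sum (x ÷ d) (\ m -> F (d N.* m))) » sym (S-*ˡ (x ÷ d) (μ d) _)) ⟩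
   S x (\ d -> S (x ÷ d) (\ e -> μ d * (Λ e * S (x ÷ d ÷ e) (\ j -> F (d N.* (e N.* j))))))
    ≡⟨ hyperbola-swap x _ ⟩
   S x (\ e -> S (x ÷ e) (\ d -> μ d * (Λ e * S (x ÷ d ÷ e) (\ j -> F (d N.* (e N.* j))))))
    ≡⟨ S-ext x (\ e -> S-ext (x ÷ e) (\ d -> ring 3 (\ a b c -> a :* (b :* c) := b :* (a :* c)) » cong (\ z -> Λ e * (μ d * z)) (cong (\ k -> S k (\ j -> F (d N.* (e N.* j)))) ((÷-÷ x d e) » cong (x ÷_) (P.*-comm d e) » sym (÷-÷ x e d)) » S-ext (x ÷ e ÷ d) (\ j -> cong F (sym (P.*-assoc d e j) » cong (N._* j) (P.*-comm d e) » P.*-assoc e d j)))) » S-*ˡ (x ÷ e) (Λ e) _) ⟩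
   S x (\ e -> Λ e * S (x ÷ e) (\ d -> μ d * S (x ÷ e ÷ d) (\ j -> F (e N.* (d N.* j)))))
    ≡⟨ S-cong x (\ e 1≤e e≤x -> cong (Λ e *_) (möbius-inversion (x ÷ e) (\ k -> F (e N.* k)) (÷-pos 1≤e e≤x) » cong F (*-identityʳ e))) ⟩
   S x (\ e -> Λ e * F e) ∎
  -- log(x/d) = log(x/dm) + log m. On the first summand Möbius inversion leaves only dm = 1, and on
  -- the second μ ∗ log = Λ applies.
  tatuzawa-iseki : ∀ x (F : ℕ -> Q) -> 1 ≦ x ->
   S x (\ d -> μ d * ((lg x - lg d) * S (x ÷ d) (\ m -> F (d N.* m)))) ≡ lg x * F 1 + S x (\ k -> Λ k * F k)
  tatuzawa-iseki x F 1≤x = begin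
   S x (\ d -> μ d * ((lg x - lg d) * S (x ÷ d) (\ m -> F (d N.* m))))
    ≡⟨ S-cong x (\ d 1≤d _ -> cong (μ d *_) (split d 1≤d) » *-distribˡ-+ (μ d) _ _) ⟩
   S x (\ d -> μ d * S (x ÷ d) (\ m -> G (d N.* m)) + μ d * S (x ÷ d) (\ m -> lg m * F (d N.* m)))
    ≡⟨ S-+ x _ _ ⟩
   S x (\ d -> μ d * S (x ÷ d) (\ m -> G (d N.* m))) + S x (\ d -> μ d * S (x ÷ d) (\ m -> lg m * F (d N.* m)))
    ≡⟨ cong₂ _+_ (möbius-inversion x G 1≤x) (μ-lg x F) ⟩
   (lg x - lg 1) * F 1 + S x (\ k -> Λ k * F k)
    ≡⟨ cong (_+ S x (\ k -> Λ k * F k)) (cong (\ z -> (lg x - z) * F 1) lg-1 » ring 2 (\ a b -> (a :- c0) :* b := a :* b)) ⟩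
   lg x * F 1 + S x (\ k -> Λ k * F k) ∎
   where
   G : ℕ -> Q
   G k = (lg x - lg k) * F k
   split : ∀ d -> 1 ≦ d -> (lg x - lg d) * S (x ÷ d) (\ m -> F (d N.* m)) ≡
    S (x ÷ d) (\ m -> G (d N.* m)) + S (x ÷ d) (\ m -> lg m * F (d N.* m))
   split d 1≤d = sym (S-*ˡ (x ÷ d) (lg x - lg d) _) » S-cong (x ÷ d) (\ m 1≤m _ ->
    ring 4 (\ x d m f -> (x :- d) :* f := (x :- (d :+ m)) :* f :+ m :* f) » cong (\ z -> (lg x - z) * F (d N.* m) + lg m * F (d N.* m)) (sym (lg-* d m 1≤d 1≤m))) » S-+ (x ÷ d) _ _
  log-sum : ∀ x -> 1 ≦ x -> x ≦ N -> S x (\ d -> lg x - lg d) ≤ # 2 * # x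
  log-sum x@(suc m) 1≤x x≤N = eq≤ (S-- x (\ _ -> lg x) lg » cong₂ _-_ (S-const x (lg x)) (Δ-sum m x≤N) » ring 2 (\ a b -> a :- (a :- b) := b)) ≫ S-mono m (\ i 1≤i i≤m -> Δi≤2 i 1≤i (P.<-≤-trans (s≤s i≤m) x≤N)) ≫ eq≤ (S-const m (# 2) » *-comm _ _) ≫ *≤ʳ (0≤# 2) (#-mono (n≤1+n m))
   where
   Δi≤2 : ∀ i -> 1 ≦ i -> i N.< N -> Δ i * # i ≤ # 2
   Δi≤2 i 1≤i i<N = *≤ˡ (0≤# i) (Δ≤2inv i 1≤i i<N) ≫ eq≤ (ring 2 (\ a n -> c2 :* a :* n := c2 :* (n :* a)) » cong (# 2 *_) (inv-cancel 1≤i) » ring 0 (c2 :* c1 := c2))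
  -- Summation by parts lowers the square to a single logarithm, since i·Δ i ≤ 2; `log-sum`
  -- finishes.
  log²-sum : ∀ x -> 1 ≦ x -> x ≦ N -> S x (\ d -> (lg x - lg d) * (lg x - lg d)) ≤ # 8 * # x
  log²-sum x@(suc m) 1≤x x≤N = eq≤ (S-ext x (\ d -> ring 1 (\ a -> a := a :* c1)) » S-abel m (\ d -> (lg x - lg d) * (lg x - lg d)) (\ _ -> # 1) » cong₂ _-_ (ring 2 (\ a s -> (a :- a) :* (a :- a) :* s := c0)) (S-ext m (\ i -> cong (((lg x - lg (suc i)) * (lg x - lg (suc i)) - (lg x - lg i) * (lg x - lg i)) *_) (S-one i) » ring 4 (\ x a b n -> ((x :- a) :* (x :- a) :- (x :- b) :* (x :- b)) :* n := ⊝ ((a :- b) :* n :* ((x :- b) :+ (x :- a)))))) » cong (\ z -> # 0 - z) (S-neg m _) » ring 1 (\ a -> c0 :- ⊝ a := a)) ≫ S-mono m cell ≫ eq≤ (S-*ˡ m (# 4) (\ i -> lg x - lg i)) ≫ lin 3 (\ s t x -> 4 · (s ≼ t) ▸ 4 · (t ≼ c2 :* x) ▸ ⊢ c4 :* s ≼ con 8 :* x) (lin 2 (\ a b -> c0 ≼ b ▸ ⊢ a ≼ a :+ b) (eq≤ (ring 1 (\ a -> c0 := a :- a)))) (log-sum x 1≤x x≤N)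
   where
   cell : ∀ i -> 1 ≦ i -> i ≦ m -> Δ i * # i * ((lg x - lg i) + (lg x - lg (suc i))) ≤ # 4 * (lg x - lg i)
   cell i 1≤i i≤m = *-mono-≤ (*≥0 (Δ≥0 i 1≤i i<N) (0≤# i)) nn Δi≤2 two ≫ eq≤ (ring 1 (\ a -> c2 :* (c2 :* a) := c4 :* a))
    where
    i<N = P.<-≤-trans (s≤s i≤m) x≤N
    Δi≤2 : Δ i * # i ≤ # 2
    Δi≤2 = *≤ˡ (0≤# i) (Δ≤2inv i 1≤i i<N) ≫ eq≤ (ring 2 (\ a n -> c2 :* a :* n := c2 :* (n :* a)) » cong (# 2 *_) (inv-cancel 1≤i) » ring 0 (c2 :* c1 := c2))
    nn : # 0 ≤ # 2 * (lg x - lg i)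
    nn = lin 2 (\ x i -> 2 · (i ≼ x) ▸ ⊢ c0 ≼ c2 :* (x :- i)) (lg-mono 1≤i (m≤n⇒m≤1+n i≤m) x≤N)
    two : (lg x - lg i) + (lg x - lg (suc i)) ≤ # 2 * (lg x - lg i)
    two = lin 3 (\ x i j -> i ≼ j ▸ ⊢ (x :- i) :+ (x :- j) ≼ c2 :* (x :- i)) (lg-mono 1≤i (n≤1+n i) i<N)
  module Selberg (x : ℕ) (1≤x : 1 ≦ x) (x≤N : x ≦ N) where
   -- The constant that cancels the terms linear in x/d when `F` is summed over the multiples of d:
   -- the 1 comes from Stirling's formula, γ from the harmonic sum.
   κ : Q
   κ = γ + # 1
   F : ℕ -> Q
   F d = ψ (x ÷ d) - # x * inv d + κ
   γ-bound : γ ± # 4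
   γ-bound = A-bound 1≤N P.≤-refl
   F-sum : ∀ d -> 1 ≦ d -> S (x ÷ d) (\ m -> F (d N.* m)) ≡ T′ (x ÷ d) - # x * inv d * H (x ÷ d) + κ * # (x ÷ d)
   F-sum d 1≤d = S-+ y _ _ » cong₂ _+_ (S-- y _ _ » cong₂ _-_ (S-ext y (\ m -> cong ψ (sym (÷-÷ x d m))) » sym (T-ψ y)) (S-cong y (\ m 1≤m _ -> cong (# x *_) (inv-mul-≥1 1≤d 1≤m) » sym (*-assoc (# x) (inv d) (inv m))) » S-*ˡ y (# x * inv d) inv)) (S-const y κ » *-comm _ _)
    where y = x ÷ d
   lg-floor : ∀ d -> 1 ≦ d -> d ≦ x -> lg (x ÷ d) ≤ lg x - lg d
   lg-floor d 1≤d d≤x = lin 4 (\ a b c e -> a :+ b ≼ c ▸ c ≼ e ▸ ⊢ b ≼ e :- a) (eq≥ (lg-* d (x ÷ d) 1≤d (÷-pos 1≤d d≤x)))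
    (lg-mono (*-≥1 1≤d (÷-pos 1≤d d≤x)) (÷-upper 1≤d P.≤-refl) x≤N)
   -- With y = x/d and n = ⌊y⌋, T(n) ≈ n log n - n and y·H(n) ≈ y(log n + γ). Adding κn leaves (n -
   -- y)(log n + γ), which is at most log n + 4 in size, and bounded errors.
   F-sum-bound : ∀ d -> 1 ≦ d -> d ≦ x -> S (x ÷ d) (\ m -> F (d N.* m)) ± # 2 * (lg x - lg d) + # 19
   F-sum-bound d 1≤d d≤x = subst (_± # 2 * (lg x - lg d) + # 19) (sym (F-sum d 1≤d))
    (lower , upper)
    where
    n = x ÷ d
    1≤n = ÷-pos 1≤d d≤x
    n≤N = (÷-≤ x d) ⋙ x≤N
    y = # x * inv d
    l = lg n
    ta = T-approx n 1≤n n≤N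
    y≥n : # n ≤ y
    y≥n = ÷-upperQ x d 1≤d
    y≤n+1 : y ≤ # n + # 1
    y≤n+1 = ÷-lowerQ x d 1≤d
    fl : l ≤ lg x - lg d
    fl = lg-floor d 1≤d d≤x
    hl : H n - l ≤ # 4
    hl = snd (A-bound 1≤n n≤N)
    e₁ : (# n - y) * (l + γ) ± # 1 * (l + # 4)
    e₁ = ±-* (lin 2 (\ n y -> y ≼ n :+ c1 ▸ ⊢ ⊝ c1 ≼ n :- y) y≤n+1 , lin 2 (\ n y -> n ≼ y ▸ ⊢ n :- y ≼ c1) y≥n)
     ( lin 2 (\ l g -> ⊝ c4 ≼ g ▸ 2 · (c0 ≼ l) ▸ ⊢ ⊝ (l :+ c4) ≼ l :+ g) (fst γ-bound) (lg≥0 1≤n n≤N)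
     , lin 2 (\ l g -> g ≼ c4 ▸ ⊢ l :+ g ≼ l :+ c4) (snd γ-bound))
     (0≤# 1) (lin 1 (\ l -> c0 ≼ l ▸ ⊢ c0 ≼ l :+ c4) (lg≥0 1≤n n≤N))
    -- y · 3/n ≤ 6, since y ≤ n + 1 ≤ 2n.
    yi : y * (# 3 * inv n) ≤ # 6
    yi = *≤ˡ (*≥0 (0≤# 3) (inv≥0 n)) y≤n+1 ≫ lin 2 (\ n i -> 3 · (n :* i ≼ c1) ▸ 3 · (i ≼ c1) ▸ ⊢ (n :+ c1) :* (c3 :* i) ≼ con 6) (eq≤ (inv-cancel 1≤n)) (inv≤1 n)
    y≥0 : # 0 ≤ y
    y≥0 = *≥0 (0≤# x) (inv≥0 d)
    e₂ : y * (A n - γ) ± # 6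
    e₂ = lin 3 (\ y a i -> y :* ⊝ i ≼ y :* a ▸ y :* i ≼ con 6 ▸ ⊢ ⊝ con 6 ≼ y :* a) (*≤ʳ y≥0 (fst (H-γ 1≤n n≤N))) yi
      , ≤-trans (*≤ʳ y≥0 (snd (H-γ 1≤n n≤N))) yi
    lower : - (# 2 * (lg x - lg d) + # 19) ≤ T′ n - y * H n + κ * # n
    lower = lin 8 (\ t y h n l g a b -> ⊝ (c1 :+ h) ≼ t :- (n :* l :- n) ▸ ⊝ (c1 :* (l :+ c4)) ≼ (n :- y) :* (l :+ g) ▸
      y :* ((h :- l) :- g) ≼ con 6 ▸ 2 · (l ≼ a :- b) ▸ h :- l ≼ c4 ▸
      ⊢ ⊝ (c2 :* (a :- b) :+ con 19) ≼ t :- y :* h :+ (g :+ c1) :* n) (fst ta) (fst e₁) (snd e₂) fl hl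
    upper : T′ n - y * H n + κ * # n ≤ # 2 * (lg x - lg d) + # 19
    upper = lin 8 (\ t y h n l g a b -> t :- (n :* l :- n) ≼ c1 :+ h ▸ (n :- y) :* (l :+ g) ≼ c1 :* (l :+ c4) ▸
      ⊝ con 6 ≼ y :* ((h :- l) :- g) ▸ 2 · (l ≼ a :- b) ▸ h :- l ≼ c4 ▸
      ⊢ t :- y :* h :+ (g :+ c1) :* n ≼ c2 :* (a :- b) :+ con 19) (snd ta) (snd e₁) (fst e₂) fl hl
   l≥0 : ∀ d -> 1 ≦ d -> d ≦ x -> # 0 ≤ lg x - lg d
   l≥0 d 1≤d d≤x = lin 2 (\ a b -> a ≼ b ▸ ⊢ c0 ≼ b :- a) (lg-mono 1≤d d≤x x≤N)
   -- 54 = 2·8 + 19·2, from `log²-sum` and `log-sum` applied to the bound of `F-sum-bound` times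
   -- log(x/d).
   raw : lg x * F 1 + S x (\ k -> Λ k * F k) ± # 54 * # x
   raw = subst (_± # 54 * # x) (tatuzawa-iseki x F 1≤x)
    ( ≤-trans (lin 2 (\ a b -> a ≼ b ▸ ⊢ ⊝ b ≼ ⊝ a) total) (fst bd) , ≤-trans (snd bd) total)
    where
    B : ℕ -> Q
    B d = # 2 * ((lg x - lg d) * (lg x - lg d)) + # 19 * (lg x - lg d)
    bd : S x (\ d -> μ d * ((lg x - lg d) * S (x ÷ d) (\ m -> F (d N.* m)))) ± S x B
    bd = S-± x (\ d 1≤d d≤x -> subst (μ d * ((lg x - lg d) * S (x ÷ d) (\ m -> F (d N.* m))) ±_) (ring 1 (\ l -> c1 :* (l :* (c2 :* l :+ con 19)) := c2 :* (l :* l) :+ con 19 :* l))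
      (±-* (±-abs (∣μ∣≤1 d)) (±-* (pm (l≥0 d 1≤d d≤x)) (F-sum-bound d 1≤d d≤x) (l≥0 d 1≤d d≤x) (p19 (l≥0 d 1≤d d≤x))) (0≤# 1) (*≥0 (l≥0 d 1≤d d≤x) (p19 (l≥0 d 1≤d d≤x)))))
     where
     pm : ∀ {a} -> # 0 ≤ a -> a ± a
     pm h = lin 1 (\ a -> 2 · (c0 ≼ a) ▸ ⊢ ⊝ a ≼ a) h , ≤-refl
     p19 : ∀ {a} -> # 0 ≤ a -> # 0 ≤ # 2 * a + # 19
     p19 = lin 1 (\ a -> 2 · (c0 ≼ a) ▸ ⊢ c0 ≼ c2 :* a :+ con 19)
    total : S x B ≤ # 54 * # x
    total = eq≤ (S-+ x _ _ » cong₂ _+_ (S-*ˡ x (# 2) _) (S-*ˡ x (# 19) _)) ≫ lin 3 (\ s t x -> 2 · (s ≼ con 8 :* x) ▸ 19 · (t ≼ c2 :* x) ▸ ⊢ c2 :* s :+ con 19 :* t ≼ con 54 :* x) (log²-sum x 1≤x x≤N) (log-sum x 1≤x x≤N)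
  R : ℕ -> Q
  R n = ψ n - # n
  -- Removing κ from `F` costs κ log x and κψ(x), and replacing x/k by its floor costs another ψ(x).
  -- All of this is O(x).
  selberg : ∀ x -> 1 ≦ x -> x ≦ N -> lg x * R x + S x (\ k -> Λ k * R (x ÷ k)) ± # 100 * # x
  selberg x 1≤x x≤N =
    lin 8 (\ r f s a k l p X -> ⊝ (con 54 :* X) ≼ f :+ a ▸ f ≼ r :+ l :* k ▸ a ≼ s :+ k :* p ▸ l :* k ≼ l :* con 5 ▸ k :* p ≼ con 5 :* p ▸ 5 · (l ≼ X) ▸ 5 · (p ≼ con 6 :* X) ▸ 11 · (c0 ≼ X) ▸ ⊢ ⊝ (con 100 :* X) ≼ r :+ s)
     (fst raw) (eq≤ F1) S≤ lk≤ kp≤ (lg≤id x 1≤x x≤N) (ψ≤6 x x≤N) (0≤# x)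
   , lin 8 (\ r f s a k l p X -> f :+ a ≼ con 54 :* X ▸ r :+ l :* k ≼ f ▸ s :+ k :* p :- p ≼ a ▸ ⊝ (l :* con 5) ≼ l :* k ▸ ⊝ (con 5 :* p) ≼ k :* p ▸ 5 · (l ≼ X) ▸ 6 · (p ≼ con 6 :* X) ▸ 5 · (c0 ≼ X) ▸ ⊢ r :+ s ≼ con 100 :* X)
     (snd raw) (eq≥ F1) S≥ lk≥ kp≥ (lg≤id x 1≤x x≤N) (ψ≤6 x x≤N) (0≤# x)
   where
   open Selberg x 1≤x x≤N
   κ± : κ ± # 5
   κ± = lin 1 (\ g -> ⊝ c4 ≼ g ▸ ⊢ ⊝ con 5 ≼ g :+ c1) (fst γ-bound) , lin 1 (\ g -> g ≼ c4 ▸ ⊢ g :+ c1 ≼ con 5) (snd γ-bound)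
   lgx≥0 = lg≥0 1≤x x≤N
   F1 : lg x * F 1 ≡ lg x * R x + lg x * κ
   F1 = cong₂ (\ a b -> lg x * (ψ a - # x * b + κ)) (÷-1 x) inv-1 » ring 4 (\ l p x k -> l :* (p :- x :* c1 :+ k) := l :* (p :- x) :+ l :* k)
   lk≤ = *≤ʳ lgx≥0 (snd κ±)
   lk≥ : - (lg x * # 5) ≤ lg x * κ
   lk≥ = eq≤ (ring 1 (\ l -> ⊝ (l :* con 5) := l :* ⊝ con 5)) ≫ *≤ʳ lgx≥0 (fst κ±)
   kp≤ = *≤ˡ (ψ≥0 x) (snd κ±)
   kp≥ : - (# 5 * ψ x) ≤ κ * ψ x
   kp≥ = eq≤ (ring 1 (\ l -> ⊝ (con 5 :* l) := (⊝ con 5) :* l)) ≫ *≤ˡ (ψ≥0 x) (fst κ±)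
   S≤ : S x (\ k -> Λ k * F k) ≤ S x (\ k -> Λ k * R (x ÷ k)) + κ * ψ x
   S≤ = S-mono x (\ k 1≤k _ -> *≤ʳ (Λ≥0 k) (lin 4 (\ p y n c -> n ≼ y ▸ ⊢ p :- y :+ c ≼ (p :- n) :+ c) (÷-upperQ x k 1≤k)) ≫ eq≤ (ring 3 (\ l r c -> l :* (r :+ c) := l :* r :+ c :* l))) ≫ eq≤ (S-+ x _ _ » cong (S x (\ k -> Λ k * R (x ÷ k)) +_) (S-*ˡ x κ Λ))
   S≥ : S x (\ k -> Λ k * R (x ÷ k)) + κ * ψ x - ψ x ≤ S x (\ k -> Λ k * F k)
   S≥ = eq≤ (cong (\ z -> S x (\ k -> Λ k * R (x ÷ k)) + z - ψ x) (sym (S-*ˡ x κ Λ)) » cong (_- ψ x) (sym (S-+ x _ _)) » sym (S-- x _ Λ)) ≫ S-mono x (\ k 1≤k _ -> eq≤ (ring 3 (\ l r c -> l :* r :+ c :* l :- l := l :* (r :+ c :- c1))) ≫ *≤ʳ (Λ≥0 k) (lin 4 (\ p y n c -> y ≼ n :+ c1 ▸ ⊢ (p :- n) :+ c :- c1 ≼ p :- y :+ c) (÷-lowerQ x k 1≤k)))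

-- Second-order consequences of Selberg's formula for the remainder ψ(x) - x

module SelbergFormula where
 open Rationals
 open Sums
 open Arithmetic
 open Logarithm
 open ≡-Reasoning
 ∣∣-elim : ∀ (P : Q -> Set) a -> P a -> P (- a) -> P ∣ a ∣
 ∣∣-elim P a p n with # 0 ≤? a
 ... | yes _ = p
 ... | no  _ = n
 ∣∣-* : ∀ {c a b} -> c * a ± b -> c * ∣ a ∣ ≤ b
 ∣∣-* {c} {a} {b} (l , u) = ∣∣-elim (\ z -> c * z ≤ b) a u (lin 3 (\ c a b -> ⊝ b ≼ c :* a ▸ ⊢ c :* ⊝ a ≼ b) l)
 module Iteration (N : ℕ) (4≤N : 4 ≦ N) (sys : LogSystem N) where
  open Log N 4≤N sys public
  R-bound : ∀ x -> x ≦ N -> R x ± # 6 * # x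
  R-bound x x≤N = lin 2 (\ p x -> c0 ≼ p ▸ 5 · (c0 ≼ x) ▸ ⊢ ⊝ (con 6 :* x) ≼ p :- x) (ψ≥0 x) (0≤# x)
         , lin 2 (\ p x -> p ≼ con 6 :* x ▸ c0 ≼ x ▸ ⊢ p :- x ≼ con 6 :* x) (ψ≤6 x x≤N) (0≤# x)
  T≤ : ∀ x -> x ≦ N -> T′ x ≤ # x * lg x
  T≤ x x≤N = S-mono x (\ i 1≤i i≤x -> lg-mono 1≤i i≤x x≤N) ≫ eq≤ (S-const x (lg x))
  Λ*Λ : ℕ -> Q
  Λ*Λ n = Div n (\ d e -> Λ d * Λ e)
  Λ*Λ≥0 : ∀ n -> # 0 ≤ Λ*Λ n
  Λ*Λ≥0 n = S-nonneg n (\ d _ _ -> when-nonneg (does (d Data.Nat.Divisibility.∣? n)) (*≥0 (Λ≥0 d) (Λ≥0 (n ÷ d))))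
   where import Data.Nat.Divisibility
  -- Selberg's function, equal to μ ∗ log² as `Λ₂-möbius` shows in summed form. Its summatory
  -- function is 2x log x + O(x) by elementary means, while that of Λ is still to be found.
  Λ₂ : ℕ -> Q
  Λ₂ n = Λ n * lg n + Λ*Λ n
  Λ*Λ-sum : ∀ x (f : ℕ -> Q) -> S x (\ n -> Λ*Λ n * f n) ≡ S x (\ k -> Λ k * S (x ÷ k) (\ j -> Λ j * f (k N.* j)))
  Λ*Λ-sum x f = begin
   S x (\ n -> Λ*Λ n * f n) ≡⟨ S-ext x (\ n -> sym (Div-*ʳ n (f n) (\ d e -> Λ d * Λ e)) » Div-cong n _ (\ d e -> Λ d * (Λ e * f (d N.* e)))
     (\ d e _ q -> *-assoc (Λ d) (Λ e) (f n) » cong (\ z -> Λ d * (Λ e * f z)) (sym q))) ⟩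
   S x (\ n -> Div n (\ d e -> Λ d * (Λ e * f (d N.* e)))) ≡⟨ sym (hyperbola x _) ⟩
   S x (\ k -> S (x ÷ k) (\ j -> Λ k * (Λ j * f (k N.* j)))) ≡⟨ S-ext x (\ k -> S-*ˡ (x ÷ k) (Λ k) _) ⟩
   S x (\ k -> Λ k * S (x ÷ k) (\ j -> Λ j * f (k N.* j))) ∎
  Λ*Λ-ψ : ∀ x -> S x Λ*Λ ≡ S x (\ k -> Λ k * ψ (x ÷ k))
  Λ*Λ-ψ x = S-ext x (\ n -> ring 1 (\ a -> a := a :* c1)) » Λ*Λ-sum x (\ _ -> # 1) » S-ext x (\ k -> cong (Λ k *_) (S-ext (x ÷ k) (\ j -> ring 1 (\ a -> a :* c1 := a))))
  Z : ℕ -> Q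
  Z x = lg x * ψ x + S x (\ k -> Λ k * ψ (x ÷ k))
  Z-approx : ∀ x -> 1 ≦ x -> x ≦ N -> Z x - # 2 * (# x * lg x) ± # 103 * # x
  Z-approx x 1≤x x≤N =
    lin 6 (\ l p s x t h -> ⊝ (con 100 :* x) ≼ l :* (p :- x) :+ (s :- t) ▸ ⊝ (c1 :+ h) ≼ t :- (x :* l :- x) ▸ h ≼ x ▸ c1 ≼ x ▸
     ⊢ ⊝ (con 103 :* x) ≼ l :* p :+ s :- c2 :* (x :* l)) (fst sel) (fst ta) (H≤id x) (#-mono 1≤x)
   , lin 6 (\ l p s x t h -> l :* (p :- x) :+ (s :- t) ≼ con 100 :* x ▸ t :- (x :* l :- x) ≼ c1 :+ h ▸ h ≼ x ▸ 3 · (c1 ≼ x) ▸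
     ⊢ l :* p :+ s :- c2 :* (x :* l) ≼ con 103 :* x) (snd sel) (snd ta) (H≤id x) (#-mono 1≤x)
   where
   ta = T-approx x 1≤x x≤N
   e : S x (\ k -> Λ k * R (x ÷ k)) ≡ S x (\ k -> Λ k * ψ (x ÷ k)) - T′ x
   e = S-ext x (\ k -> ring 3 (\ a b c -> a :* (b :- c) := a :* b :- a :* c)) » S-- x _ _ » cong (\ z -> S x (\ k -> Λ k * ψ (x ÷ k)) - z) (sym (T-Λ x))
   sel : lg x * (ψ x - # x) + (S x (\ k -> Λ k * ψ (x ÷ k)) - T′ x) ± # 100 * # x
   sel = subst (\ z -> lg x * R x + z ± # 100 * # x) e (selberg x 1≤x x≤N)
  Λlog-abel : ∀ m (f : ℕ -> Q) -> S (suc m) (\ n -> f n * (lg (suc m) - lg n)) ≡ S m (\ i -> Δ i * S i f)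
  Λlog-abel m f = S-ext (suc m) (\ n -> *-comm (f n) (lg (suc m) - lg n)) » S-abel m (\ n -> lg (suc m) - lg n) f » cong₂ _-_ (ring 2 (\ a s -> (a :- a) :* s := c0)) (S-ext m (\ i -> ring 4 (\ l a b s -> ((l :- a) :- (l :- b)) :* s := ⊝ ((a :- b) :* s))) » S-neg m _) » ring 1 (\ a -> c0 :- ⊝ a := a)
  Λlog≤ : ∀ x -> 1 ≦ x -> x ≦ N -> S x (\ n -> Λ n * (lg x - lg n)) ≤ # 12 * # x
  Λlog≤ (suc m) _ x≤N = eq≤ (Λlog-abel m Λ) ≫ S-mono m cell ≫ eq≤ (S-const m (# 12) » *-comm _ _) ≫ *≤ʳ (0≤# 12) (#-mono (n≤1+n m))
   where
   cell : ∀ i -> 1 ≦ i -> i ≦ m -> Δ i * ψ i ≤ # 12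
   cell i 1≤i i≤m = *-mono-≤ (Δ≥0 i 1≤i i<N) (*≥0 (0≤# 6) (0≤# i)) (Δ≤2inv i 1≤i i<N) (ψ≤6 i (P.<⇒≤ i<N)) ≫ lin 2 (\ n j -> 12 · (n :* j ≼ c1) ▸ ⊢ c2 :* j :* (con 6 :* n) ≼ con 12) (eq≤ (inv-cancel 1≤i))
    where i<N = P.<-≤-trans (s≤s i≤m) x≤N
  Λlog≥0 : ∀ x -> 1 ≦ x -> x ≦ N -> # 0 ≤ S x (\ n -> Λ n * (lg x - lg n))
  Λlog≥0 x 1≤x x≤N = S-nonneg x (\ n 1≤n n≤x -> *≥0 (Λ≥0 n) (lin 2 (\ a b -> a ≼ b ▸ ⊢ c0 ≼ b :- a) (lg-mono 1≤n n≤x x≤N)))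
  Λ₂-approx : ∀ x -> 1 ≦ x -> x ≦ N -> S x Λ₂ - # 2 * (# x * lg x) ± # 115 * # x
  Λ₂-approx x 1≤x x≤N =
    lin 6 (\ w l p s d x -> l :* p :- d :+ s ≼ w ▸ ⊝ (con 103 :* x) ≼ l :* p :+ s :- c2 :* (x :* l) ▸ d ≼ con 12 :* x ▸
     ⊢ ⊝ (con 115 :* x) ≼ w :- c2 :* (x :* l)) (eq≥ e) (fst z) (Λlog≤ x 1≤x x≤N)
   , lin 6 (\ w l p s d x -> w ≼ l :* p :- d :+ s ▸ l :* p :+ s :- c2 :* (x :* l) ≼ con 103 :* x ▸ c0 ≼ d ▸ 12 · (c0 ≼ x) ▸
     ⊢ w :- c2 :* (x :* l) ≼ con 115 :* x) (eq≤ e) (snd z) (Λlog≥0 x 1≤x x≤N) (0≤# x)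
   where
   z = Z-approx x 1≤x x≤N
   e : S x Λ₂ ≡ lg x * ψ x - S x (\ n -> Λ n * (lg x - lg n)) + S x (\ k -> Λ k * ψ (x ÷ k))
   e = S-+ x _ _ » cong₂ _+_ (S-ext x (\ n -> ring 3 (\ a l m -> a :* m := l :* a :- a :* (l :- m))) » S-- x _ _ » cong (_- S x (\ n -> Λ n * (lg x - lg n))) (S-*ˡ x (lg x) Λ)) (Λ*Λ-ψ x)
  module _ (x : ℕ) (1≤x : 1 ≦ x) (2x≤N : 2 N.* x ≦ N) where
   private
    x≤N : x ≦ N
    x≤N = m≤m+n x _ ⋙ 2x≤N
    m : ℕ -> ℕ
    m k = x ÷ k
    -- The rounding defect between log(x/k) and log⌊x/k⌋. Its upper bound compares x with k(⌊x/k⌋ +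
    -- 1) ≤ 2x, which is why 2x ≤ `N` is assumed.
    θ : ℕ -> Q
    θ k = lg x - lg k - lg (m k)
    1≤m : ∀ {k} -> 1 ≦ k -> k ≦ x -> 1 ≦ m k
    1≤m = ÷-pos
    m≤N : ∀ k -> m k ≦ N
    m≤N k = (÷-≤ x k) ⋙ x≤N
    θ≥0 : ∀ k -> 1 ≦ k -> k ≦ x -> # 0 ≤ θ k
    θ≥0 k 1≤k k≤x = lin 4 (\ a b c e -> a :+ b ≼ c ▸ c ≼ e ▸ ⊢ c0 ≼ e :- a :- b) (eq≥ (lg-* k (m k) 1≤k (1≤m 1≤k k≤x))) (lg-mono (*-≥1 1≤k (1≤m 1≤k k≤x)) (÷-upper 1≤k P.≤-refl) x≤N)
    suc≤2 : ∀ {n} -> 1 ≦ n -> suc n ≦ 2 N.* n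
    suc≤2 {n} h = +-monoˡ-≤ n h ⋙ P.≤-reflexive (cong (n N.+_) (sym (P.+-identityʳ n)))
    θ≤ : ∀ k -> 1 ≦ k -> k ≦ x -> θ k ≤ # 2 * inv (m k)
    θ≤ k 1≤k k≤x = lin 6 (\ l a k s m i -> l ≼ a ▸ a ≼ k :+ s ▸ s :- m ≼ c2 :* i ▸ ⊢ l :- k :- m ≼ c2 :* i)
     (lg-mono 1≤x (P.<⇒≤ (<-÷ x 1≤k)) top) (eq≤ (lg-* k (suc (m k)) 1≤k z<s))
     (Δ≤2inv (m k) 1≤mk (suc≤2 1≤mk ⋙ *-monoʳ-≤ 2 (÷-≤ x k) ⋙ 2x≤N))
     where
     1≤mk = 1≤m 1≤k k≤x
     top : k N.* suc (m k) ≦ N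
     top = *-monoʳ-≤ k (suc≤2 1≤mk) ⋙ P.≤-reflexive (sym (P.*-assoc k 2 (m k)) » cong (N._* m k) (P.*-comm k 2) » P.*-assoc 2 k (m k)) ⋙ *-monoʳ-≤ 2 (÷-upper {x} {k} 1≤k P.≤-refl) ⋙ 2x≤N
    U V Θ D : Q
    U = S x (\ k -> Λ k * lg k * R (m k))
    V = S x (\ k -> Λ k * (lg (m k) * R (m k)))
    Θ = S x (\ k -> Λ k * (θ k * R (m k)))
    D = S x (\ k -> Λ k * S (m k) (\ j -> Λ j * R (m k ÷ j)))
    Θ± : Θ ± # 12 * ψ x
    Θ± = subst (Θ ±_) (S-ext x (\ k -> *-comm (Λ k) (# 12)) » S-*ˡ x (# 12) Λ) (S-± x (\ k 1≤k k≤x -> subst (Λ k * (θ k * R (m k)) ±_) refl (±-* (self (Λ≥0 k)) (tR k 1≤k k≤x) (Λ≥0 k) (0≤# 12))))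
     where
     self : ∀ {a} -> # 0 ≤ a -> a ± a
     self h = lin 1 (\ a -> 2 · (c0 ≼ a) ▸ ⊢ ⊝ a ≼ a) h , ≤-refl
     tR : ∀ k -> 1 ≦ k -> k ≦ x -> θ k * R (m k) ± # 12
     tR k 1≤k k≤x = subst (θ k * R (m k) ±_) (ring 2 (\ i n -> c2 :* i :* (con 6 :* n) := con 12 :* (n :* i)) » cong (# 12 *_) (inv-cancel (1≤m 1≤k k≤x)) » ring 0 (con 12 :* c1 := con 12))
      (±-* (lin 2 (\ t i -> c0 ≼ t ▸ 2 · (c0 ≼ i) ▸ ⊢ ⊝ (c2 :* i) ≼ t) (θ≥0 k 1≤k k≤x) (inv≥0 (m k)) , θ≤ k 1≤k k≤x)
       (R-bound (m k) (m≤N k)) (*≥0 (0≤# 2) (inv≥0 (m k))) (*≥0 (0≤# 6) (0≤# (m k))))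
    split : lg x * S x (\ k -> Λ k * R (m k)) ≡ U + V + Θ
    split = sym (S-*ˡ x (lg x) _) » S-ext x (\ k -> ring 5 (\ x a k m r -> x :* (a :* r) := (a :* k :* r :+ a :* (m :* r)) :+ a :* ((x :- k :- m) :* r))) » S-+ x _ _ » cong (_+ Θ) (S-+ x _ _)
    VD : V + D ± # 100 * T′ x
    VD = subst₂ _±_ (S-+ x _ _) (S-ext x (\ k -> ring 2 (\ a n -> a :* (con 100 :* n) := con 100 :* (a :* n))) » S-*ˡ x (# 100) _ » cong (# 100 *_) (sym (T-Λ x))) (S-± x (\ k 1≤k k≤x -> subst (_± Λ k * (# 100 * # (m k))) (*-distribˡ-+ (Λ k) _ _)
      (scale (Λ≥0 k) (selberg (m k) (1≤m 1≤k k≤x) (m≤N k)))))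
     where
     scale : ∀ {c a b} -> # 0 ≤ c -> a ± b -> c * a ± c * b
     scale h (l , u) = ≤-trans (eq≤ (ring 2 (\ c b -> ⊝ (c :* b) := c :* ⊝ b))) (*≤ʳ h l) , *≤ʳ h u
    main : lg x * lg x * R x + U - D ± # 200 * (# x * lg x) + # 72 * # x
    main = lin 10 (\ l r s u v a d t p x -> l :* (⊝ (con 100 :* x)) ≼ l :* (l :* r :+ s) ▸ l :* s ≼ u :+ v :+ a ▸ v :+ d ≼ con 100 :* t ▸ a ≼ con 12 :* p ▸ 100 · (t ≼ x :* l) ▸ 12 · (p ≼ con 6 :* x) ▸
          ⊢ ⊝ (con 200 :* (x :* l) :+ con 72 :* x) ≼ l :* l :* r :+ u :- d) (*≤ʳ lgx (fst sel)) (eq≤ split) (snd VD) (snd Θ±) (T≤ x x≤N) (ψ≤6 x x≤N)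
       , lin 10 (\ l r s u v a d t p x -> l :* (l :* r :+ s) ≼ l :* (con 100 :* x) ▸ u :+ v :+ a ≼ l :* s ▸ ⊝ (con 100 :* t) ≼ v :+ d ▸ ⊝ (con 12 :* p) ≼ a ▸ 100 · (t ≼ x :* l) ▸ 12 · (p ≼ con 6 :* x) ▸
          ⊢ l :* l :* r :+ u :- d ≼ con 200 :* (x :* l) :+ con 72 :* x) (*≤ʳ lgx (snd sel)) (eq≥ split) (fst VD) (fst Θ±) (T≤ x x≤N) (ψ≤6 x x≤N)
     where
     lgx = lg≥0 1≤x x≤N
     sel = selberg x 1≤x x≤N
    r : ℕ -> Q
    r n = ∣ R (m n) ∣
    U± : U ± S x (\ n -> Λ n * lg n * r n)
    U± = S-± x (\ k 1≤k k≤x -> ±-* (lin 1 (\ a -> 2 · (c0 ≼ a) ▸ ⊢ ⊝ a ≼ a) (nn k 1≤k k≤x) , ≤-refl) (±-abs ≤-refl) (nn k 1≤k k≤x) (0≤∣∣ _))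
     where
     nn : ∀ k -> 1 ≦ k -> k ≦ x -> # 0 ≤ Λ k * lg k
     nn k 1≤k k≤x = *≥0 (Λ≥0 k) (lg≥0 1≤k (k≤x ⋙ x≤N))
    D± : D ± S x (\ n -> Λ*Λ n * r n)
    D± = subst (D ±_) (sym (Λ*Λ-sum x r)) (S-± x (\ k 1≤k k≤x -> ±-* (self (Λ≥0 k)) (S-± (m k) (\ j 1≤j j≤m -> subst (\ z -> Λ j * R z ± Λ j * r (k N.* j)) (sym (÷-÷ x k j)) (±-* (self (Λ≥0 j)) (±-abs ≤-refl) (Λ≥0 j) (0≤∣∣ _))))
      (Λ≥0 k) (S-nonneg (m k) (\ j _ _ -> *≥0 (Λ≥0 j) (0≤∣∣ _)))))
     where
     self : ∀ {a} -> # 0 ≤ a -> a ± a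
     self h = lin 1 (\ a -> 2 · (c0 ≼ a) ▸ ⊢ ⊝ a ≼ a) h , ≤-refl
   -- Selberg's formula is multiplied by log x and inserted once more at each x/k. The sum over
   -- Λ(k)R(x/k) becomes one weighted by Λ log and one by Λ ∗ Λ, and in absolute value these weights
   -- add up to `Λ₂`.
   iterated : lg x * lg x * ∣ R x ∣ ≤ S x (\ n -> Λ₂ n * ∣ R (x ÷ n) ∣) + (# 200 * (# x * lg x) + # 72 * # x)
   iterated = (∣∣-*
     ( lin 6 (\ a u d e s t -> ⊝ e ≼ a :+ u :- d ▸ u ≼ s ▸ ⊝ t ≼ d ▸ ⊢ ⊝ (s :+ t :+ e) ≼ a) (fst main) (snd U±) (fst D±)
     , lin 6 (\ a u d e s t -> a :+ u :- d ≼ e ▸ ⊝ s ≼ u ▸ d ≼ t ▸ ⊢ a ≼ s :+ t :+ e) (snd main) (fst U±) (snd D±))) ≫ eq≤ (cong (_+ (# 200 * (# x * lg x) + # 72 * # x)) (sym (S-+ x _ _) » S-ext x (\ n -> ring 3 (\ a b r -> a :* r :+ b :* r := (a :+ b) :* r))))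
  D₂ : ℕ -> Q
  D₂ y = S y (\ n -> Λ₂ n - # 2 * lg n)
  D₂-bound : ∀ y -> 1 ≦ y -> y ≦ N -> D₂ y ± # 121 * # y
  D₂-bound y 1≤y y≤N = subst (_± # 121 * # y) (sym (S-- y _ _ » cong (\ z -> S y Λ₂ - z) (S-*ˡ y (# 2) lg)))
   ( lin 5 (\ w t y l h -> ⊝ (con 115 :* y) ≼ w :- c2 :* (y :* l) ▸ 2 · (t :- (y :* l :- y) ≼ c1 :+ h) ▸ 2 · (h ≼ y) ▸ 6 · (c1 ≼ y) ▸ ⊢ ⊝ (con 121 :* y) ≼ w :- c2 :* t)
     (fst wa) (snd ta) (H≤id y) (#-mono 1≤y)
   , lin 5 (\ w t y l h -> w :- c2 :* (y :* l) ≼ con 115 :* y ▸ 2 · (⊝ (c1 :+ h) ≼ t :- (y :* l :- y)) ▸ 2 · (h ≼ y) ▸ 2 · (c1 ≼ y) ▸ ⊢ w :- c2 :* t ≼ con 121 :* y)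
     (snd wa) (fst ta) (H≤id y) (#-mono 1≤y))
   where
   wa = Λ₂-approx y 1≤y y≤N
   ta = T-approx y 1≤y y≤N
  ∣∣-diff : ∀ {a b c} -> a - b ± c -> ∣ a ∣ - ∣ b ∣ ± c
  ∣∣-diff {a} {b} {c} (l , u) =
    lin 3 (\ a b c -> b ≼ a :+ c ▸ ⊢ ⊝ c ≼ a :- b) (∣∣≤ (lin 4 (\ a b c z -> ⊝ c ≼ a :- b ▸ a ≼ z ▸ ⊢ b ≼ z :+ c) l (≤∣∣ a)) (lin 4 (\ a b c z -> a :- b ≼ c ▸ ⊝ a ≼ z ▸ ⊢ ⊝ b ≼ z :+ c) u (-≤∣∣ a)))
   , lin 3 (\ a b c -> a ≼ b :+ c ▸ ⊢ a :- b ≼ c) (∣∣≤ (lin 4 (\ a b c z -> a :- b ≼ c ▸ b ≼ z ▸ ⊢ a ≼ z :+ c) u (≤∣∣ b)) (lin 4 (\ a b c z -> ⊝ c ≼ a :- b ▸ ⊝ b ≼ z ▸ ⊢ ⊝ a ≼ z :+ c) l (-≤∣∣ b)))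
  -- `Λ₂` is replaced by its mean 2 log n. Summation by parts sets the accumulated difference `D₂`,
  -- which is O(n), against the variation of |R(x/n)| in n.
  second-order : ∀ x -> 1 ≦ x -> 2 N.* x ≦ N ->
   lg x * lg x * ∣ R x ∣ ≤ # 2 * S x (\ n -> lg n * ∣ R (x ÷ n) ∣) + # 1300 * (# x * lg x + # x)
  second-order x@(suc k) 1≤x 2x≤N =
   lin 9 (\ a s b d e q x l h -> a ≼ s :+ (con 200 :* (x :* l) :+ con 72 :* x) ▸ s ≼ c2 :* b :+ (d :+ e) ▸ d ≼ con 6 :* (con 121 :* x) ▸ e ≼ con 121 :* q ▸ 121 · (q ≼ x :* l :+ x :* h) ▸ 121 · (x :* (h :- l) ≼ x :* c4) ▸ 858 · (c0 ≼ x :* l) ▸ 18 · (c0 ≼ x) ▸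
    ⊢ a ≼ c2 :* b :+ con 1300 :* (x :* l :+ x))
    (iterated x 1≤x 2x≤N) smooth dx ≤-refl p-sum (*≤ʳ (0≤# x) (snd (A-bound 1≤x x≤N))) (*≥0 (0≤# x) (lg≥0 1≤x x≤N)) (0≤# x)
   where
   x≤N : x ≦ N
   x≤N = m≤m+n x _ ⋙ 2x≤N
   r p : ℕ -> Q
   r n = ∣ R (x ÷ n) ∣
   -- A monotone control function: |R(x/n)| changes by at most the decrease of ψ(x/n) + ⌊x/n⌋.
   p n = ψ (x ÷ n) + # (x ÷ n)
   p-drop : ∀ i -> 1 ≦ i -> r (suc i) - r i ± p i - p (suc i)
   p-drop i 1≤i = ∣∣-diff
    ( lin 4 (\ a b c d -> c ≼ a ▸ c ≼ a ▸ 0 · (d ≼ b) ▸ ⊢ ⊝ ((b :+ a) :- (d :+ c)) ≼ (d :- c) :- (b :- a)) n≤ n≤ ψ≤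
    , lin 4 (\ a b c d -> 2 · (d ≼ b) ▸ ⊢ (d :- c) :- (b :- a) ≼ (b :+ a) :- (d :+ c)) ψ≤)
    where
    n≤ : # (x ÷ suc i) ≤ # (x ÷ i)
    n≤ = #-mono (÷-anti 1≤i (n≤1+n i))
    ψ≤ : ψ (x ÷ suc i) ≤ ψ (x ÷ i)
    ψ≤ = ψ-mono (÷-anti 1≤i (n≤1+n i))
   p-pos : ∀ i -> 1 ≦ i -> # 0 ≤ p i - p (suc i)
   p-pos i 1≤i = lin 4 (\ a b c d -> c ≼ a ▸ d ≼ b ▸ ⊢ c0 ≼ (b :+ a) :- (d :+ c)) (#-mono (÷-anti {x} 1≤i (n≤1+n i))) (ψ-mono (÷-anti {x} 1≤i (n≤1+n i)))
   err : S k (\ i -> (r (suc i) - r i) * D₂ i) ± S k (\ i -> (p i - p (suc i)) * (# 121 * # i))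
   err = S-± k (\ i 1≤i i≤k -> ±-* (p-drop i 1≤i) (D₂-bound i 1≤i (m≤n⇒m≤1+n i≤k ⋙ x≤N)) (p-pos i 1≤i) (*≥0 (0≤# 121) (0≤# i)))
   pS : S k (\ i -> (p i - p (suc i)) * (# 121 * # i)) ≡ # 121 * (S x p - p x * # x)
   pS = S-ext k (\ i -> ring 3 (\ a b n -> (a :- b) :* (con 121 :* n) := con 121 :* ⊝ ((b :- a) :* n))) » S-*ˡ k (# 121) _ » cong (# 121 *_) (S-neg k _ » ring 3 (\ s a b -> ⊝ s := (a :* b :- s) :- a :* b) » cong (_- p x * # x) (cong₂ _-_ (cong (p x *_) (sym (S-one x))) (S-ext k (\ i -> cong ((p (suc i) - p i) *_) (sym (S-one i)))) » sym (S-abel k p (\ _ -> # 1)) » S-ext x (\ i -> ring 1 (\ a -> a :* c1 := a))))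
   smooth : S x (\ n -> Λ₂ n * r n) ≤ # 2 * S x (\ n -> lg n * r n) + (r x * D₂ x + # 121 * S x p)
   smooth = eq≤ (S-ext x (\ n -> ring 3 (\ a l r -> a :* r := c2 :* (l :* r) :+ r :* (a :- c2 :* l))) » S-+ x _ _ » cong₂ _+_ (S-*ˡ x (# 2) _) (S-abel k r (\ n -> Λ₂ n - # 2 * lg n))) ≫ lin 6 (\ s a e t u b -> ⊝ u ≼ e ▸ u ≼ con 121 :* (t :- b) ▸ 121 · (c0 ≼ b) ▸ ⊢ c2 :* s :+ (a :- e) ≼ c2 :* s :+ (a :+ con 121 :* t))
     (fst err) (eq≤ pS) (*≥0 (+-nonneg (ψ≥0 (x ÷ x)) (0≤# (x ÷ x))) (0≤# x))
   r1 : r x ≤ # 6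
   r1 = eq≤ (cong (\ z -> ∣ R z ∣) (÷-unique {x} {x} {1} 1≤x (\ m h -> P.*-cancelˡ-≤ x (h ⋙ P.≤-reflexive (sym (*-identityʳ x)))) (P.≤-reflexive (*-identityʳ x)))) ≫ abs-± (R-bound 1 1≤N) ≫ lin 0 (⊢ con 6 :* c1 ≼ con 6)
   dx : r x * D₂ x ≤ # 6 * (# 121 * # x)
   dx = snd (±-* {r x} {# 6} (lin 1 (\ r -> c0 ≼ r ▸ ⊢ ⊝ con 6 ≼ r) (0≤∣∣ (R (x ÷ x))) , r1) (D₂-bound x 1≤x x≤N) (0≤# 6) (*≥0 (0≤# 121) (0≤# x)))
   p-sum : S x p ≤ # x * lg x + # x * H x
   p-sum = eq≤ (S-+ x _ _) ≫ +-mono-≤ (eq≥ (T-ψ x) ≫ T≤ x x≤N) (S-mono x (\ i 1≤i _ -> ÷-upperQ x i 1≤i) ≫ eq≤ (S-*ˡ x (# x) inv))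
  S-Δ : ∀ m -> S m Δ ≡ lg (suc m)
  S-Δ m = S-telescope m lg » cong (\ z -> lg (suc m) - z) lg-1 » ring 1 (\ a -> a :- c0 := a)
  lg-inv-sum : ∀ x -> 1 ≦ x -> x ≦ N -> # 2 * S x (\ n -> lg n * inv n) ≤ lg x * lg x + # 16 * lg x + # 8
  lg-inv-sum x@(suc k) 1≤x x≤N = lin 5 (\ s l h e z -> 2 · (s ≼ l :* h :- e) ▸ 2 · (l :* (h :- l) ≼ l :* c4) ▸ l :* l :- z :* z :- con 8 :* c1 :- con 8 :* l ≼ c2 :* e ▸ z :* z ≼ c0 ▸
    ⊢ c2 :* s ≼ l :* l :+ con 16 :* l :+ con 8) (eq≤ (S-abel k lg inv)) (*≤ʳ (lg≥0 1≤x x≤N) (snd (A-bound 1≤x x≤N))) lower (eq≤ (cong (\ z -> z * z) lg-1 » ring 0 (c0 :* c0 := c0)))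
   where
   cell : ∀ i -> 1 ≦ i -> i ≦ k -> (lg (suc i) * lg (suc i) - lg i * lg i) - # 8 * (- inv (suc i) - - inv i) - # 8 * Δ i ≤ # 2 * (Δ i * H i)
   cell i 1≤i i≤k = lin 5 (\ a b h j c -> 2 · ((a :- b) :* (⊝ c4) ≼ (a :- b) :* (h :- b)) ▸ (a :- b) :* (a :- b) ≼ c2 :* j :* (c2 :* j) ▸ 4 · (j :* j ≼ j :* (c2 :* c)) ▸ 8 · (j :* c ≼ j :- c) ▸
     ⊢ (a :* a :- b :* b) :- con 8 :* (⊝ c :- ⊝ j) :- con 8 :* (a :- b) ≼ c2 :* ((a :- b) :* h)) (*≤ʳ (Δ≥0 i 1≤i i<N) (fst (A-bound 1≤i (P.<⇒≤ i<N)))) (*-mono-≤ (Δ≥0 i 1≤i i<N) (*≥0 (0≤# 2) (inv≥0 i)) (Δ≤2inv i 1≤i i<N) (Δ≤2inv i 1≤i i<N)) (*≤ʳ (inv≥0 i) (inv≤2inv i 1≤i)) (eq≥ (inv-diff i 1≤i))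
    where i<N = P.<-≤-trans (s≤s i≤k) x≤N
   lower : lg x * lg x - lg 1 * lg 1 - # 8 * # 1 - # 8 * lg x ≤ # 2 * S k (\ i -> Δ i * H i)
   lower = lin 4 (\ a b i l -> 8 · (c0 ≼ i) ▸ ⊢ a :- b :- con 8 :* c1 :- con 8 :* l ≼ (a :- b) :- con 8 :* (⊝ i :- ⊝ c1) :- con 8 :* l) (inv≥0 x) ≫ eq≥ (S-- k _ _ » cong₂ _-_ (S-- k _ _ » cong₂ _-_ (S-telescope k (\ i -> lg i * lg i)) (S-*ˡ k (# 8) _ » cong (# 8 *_) (S-telescope k (\ i -> - inv i) » cong (\ z -> - inv x - - z) inv-1))) (S-*ˡ k (# 8) Δ » cong (# 8 *_) (S-Δ k))) ≫ S-mono k cell ≫ eq≤ (S-*ˡ k (# 2) _)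
  -- The second sum in `Z` does not decrease with x, so the difference of `Z-approx` at y′ and y
  -- bounds log y·(ψ(y′) - ψ(y)) alone: an interval holds at most about twice the expected amount of
  -- primes.
  ψ-lipschitz : ∀ y y′ -> 1 ≦ y -> y ≦ y′ -> y′ ≦ 2 N.* y -> 2 N.* y ≦ N ->
   lg y * (ψ y′ - ψ y) ≤ # 2 * ((# y′ - # y) * lg y) + # 210 * # y′
  ψ-lipschitz y y′ 1≤y y≤y′ y′≤2y 2y≤N =
   lin 8 (\ l p a b s c n d -> a :* b :+ c :- c2 :* (d :* a) ≼ con 103 :* d ▸ ⊝ (con 103 :* n) ≼ l :* p :+ s :- c2 :* (n :* l) ▸ l :* b ≼ a :* b ▸ s ≼ c ▸ 2 · (d :* (a :- l) ≼ d :* c2) ▸ 103 · (n ≼ d) ▸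
    ⊢ l :* (b :- p) ≼ c2 :* ((d :- n) :* l) :+ con 210 :* d)
    (snd (Z-approx y′ 1≤y′ y′≤N)) (fst (Z-approx y 1≤y y≤N)) (*≤ˡ (ψ≥0 y′) (lg-mono 1≤y y≤y′ y′≤N)) s≤s′ (*≤ʳ (0≤# y′) (lin 4 (\ a m t l -> a ≼ m ▸ m ≼ t :+ l ▸ t ≼ c2 ▸ ⊢ a :- l ≼ c2) (lg-mono 1≤y′ y′≤2y 2y≤N) (eq≤ (lg-* 2 y z<s 1≤y)) lg2≤2)) (#-mono y≤y′)
   where
   1≤y′ = 1≤y ⋙ y≤y′
   y′≤N = y′≤2y ⋙ 2y≤N
   y≤N = y≤y′ ⋙ y′≤N
   s≤s′ : S y (\ k -> Λ k * ψ (y ÷ k)) ≤ S y′ (\ k -> Λ k * ψ (y′ ÷ k))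
   s≤s′ = S-mono y (\ k _ _ -> *≤ʳ (Λ≥0 k) (ψ-mono (÷-mono k y≤y′))) ≫ S-mono-range y≤y′ (\ k -> *≥0 (Λ≥0 k) (ψ≥0 (y′ ÷ k)))
  R-lipschitz : ∀ y y′ -> 1 ≦ y -> y ≦ y′ -> y′ ≦ 2 N.* y -> 2 N.* y ≦ N ->
   lg y * ∣ R y′ ∣ ≤ lg y * ∣ R y ∣ + ((# y′ - # y) * lg y + # 210 * # y′)
  R-lipschitz y y′ 1≤y y≤y′ y′≤2y 2y≤N = ∣∣-elim (\ z -> lg y * z ≤ lg y * ∣ R y ∣ + ((# y′ - # y) * lg y + # 210 * # y′)) (R y′) (lin 6 (\ l p a n b z -> l :* (a :- p) ≼ c2 :* ((b :- n) :* l) :+ con 210 :* b ▸ l :* (p :- n) ≼ l :* z ▸ ⊢ l :* (a :- b) ≼ l :* z :+ ((b :- n) :* l :+ con 210 :* b))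
    (ψ-lipschitz y y′ 1≤y y≤y′ y′≤2y 2y≤N) (*≤ʳ ly (≤∣∣ (R y)))) (lin 6 (\ l p a n b z -> l :* ⊝ (p :- n) ≼ l :* z ▸ l :* p ≼ l :* a ▸ 210 · (c0 ≼ b) ▸ ⊢ l :* ⊝ (a :- b) ≼ l :* z :+ ((b :- n) :* l :+ con 210 :* b)) (*≤ʳ ly (-≤∣∣ (R y))) (*≤ʳ ly (ψ-mono y≤y′)) (0≤# y′))
   where ly = lg≥0 1≤y (y≤y′ ⋙ y′≤2y ⋙ 2y≤N)
  -- A discrete version of ∫ R(t)/t² dt. By Mertens it stays bounded, so R cannot keep one sign and
  -- a size comparable to t over a long range.
  B : ℕ -> Q
  B k = S k (\ i -> R i * (inv i - inv (suc i)))
  B-bound : ∀ k -> suc k ≦ N -> B k ± # 18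
  B-bound k x≤N = subst (_± # 18) (sym e)
   ( lin 4 (\ m p l h -> ⊝ con 7 ≼ m :- l ▸ p ≼ con 6 ▸ h :- l ≼ c4 ▸ ⊢ ⊝ con 18 ≼ (m :- p) :- (h :- c1)) (fst me) pi≤ (snd ab)
   , lin 4 (\ m p l h -> m :- l ≼ con 7 ▸ c0 ≼ p ▸ ⊝ c4 ≼ h :- l ▸ ⊢ (m :- p) :- (h :- c1) ≼ con 18) (snd me) pi≥ (fst ab))
   where
   x = suc k
   me = mertens x z<s x≤N
   ab = A-bound {x} z<s x≤N
   pi≥ : # 0 ≤ inv x * ψ x
   pi≥ = *≥0 (inv≥0 x) (ψ≥0 x)
   pi≤ : inv x * ψ x ≤ # 6
   pi≤ = *≤ʳ (inv≥0 x) (ψ≤6 x x≤N) ≫ lin 2 (\ i n -> 6 · (n :* i ≼ c1) ▸ ⊢ i :* (con 6 :* n) ≼ con 6) (eq≤ (inv-cancel {x} z<s))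
   Mabel : M x ≡ inv x * ψ x - S k (\ i -> (inv (suc i) - inv i) * ψ i)
   Mabel = S-ext x (\ n -> *-comm (Λ n) (inv n)) » S-abel k inv Λ
   hS : S k (\ i -> # i * (inv i - inv (suc i))) ≡ H x - # 1
   hS = S-cong k (\ i 1≤i _ -> ring 3 (\ n a b -> n :* (a :- b) := n :* a :- ((n :+ c1) :* b) :+ b) » cong₂ (\ u v -> u - v + inv (suc i)) (inv-cancel 1≤i) (cong (_* inv (suc i)) (sym (#-suc i)) » inv-inverse i) » ring 1 (\ b -> c1 :- c1 :+ b := b)) » ring 1 (\ s -> s := (c1 :+ s) :- c1) » cong (_- # 1) (cong (_+ S k (\ i -> inv (suc i))) (sym inv-1) » sym (S-shift k inv))
   e : B k ≡ (M x - inv x * ψ x) - (H x - # 1)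
   e = S-ext k (\ i -> ring 4 (\ p n a b -> (p :- n) :* (a :- b) := ⊝ ((b :- a) :* p) :- n :* (a :- b))) » S-- k _ _ » cong₂ _-_ (S-neg k _ » ring 2 (\ s u -> ⊝ s := (u :- s) :- u) » cong (_- inv x * ψ x) (sym Mabel)) hS

-- Intervals on which the remainder is small, and the saving they give

module BlockDescent where
 open Rationals
 open Sums
 open Arithmetic
 open Logarithm
 open SelbergFormula
 open ≡-Reasoning
 S-range-mono : ∀ {u v} (f g : ℕ -> Q) -> u ≦ v -> (∀ i -> u N.< i -> i ≦ v -> f i ≤ g i) -> S v f - S u f ≤ S v g - S u g
 S-range-mono {u} {v} f g u≤v h = lin 4 (\ a b c d -> d :- c ≼ b :- a ▸ ⊢ a :- c ≼ b :- d)
  (mono-steps (\ i -> S i g - S i f) u≤v (\ i u≤i i<v -> lin 4 (\ a b c d -> c ≼ d ▸ ⊢ b :- a ≼ (b :+ d) :- (a :+ c)) (h (suc i) (s≤s u≤i) i<v)))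
 find-last : ∀ (P : ℕ -> Set) -> (∀ j -> Dec (P j)) -> P 0 -> ∀ n -> ¬ P n -> ∃ \ J -> P J × ¬ P (suc J)
 find-last P P? p0 zero    ¬p = ⊥-elim (¬p p0)
 find-last P P? p0 (suc n) ¬p with P? n
 ... | yes p = n , p , ¬p
 ... | no ¬q = find-last P P? p0 n ¬q
 2^>n : ∀ n -> n N.< 2 N.^ n
 2^>n = n<p^n P.≤-refl
 module Contract (N : ℕ) (4≤N : 4 ≦ N) (sys : LogSystem N) where
  open Iteration N 4≤N sys public
  -- log 2 = log 4 - log 2 ≥ log 3 - log 2 ≥ 1/2 - 1/4. This is the use of 4 ≤ `N`.
  4lg2≥1 : # 1 ≤ # 4 * lg 2
  4lg2≥1 = lin 4 (\ l a b i -> 4 · (i :- i :* i ≼ a :- l) ▸ 4 · (c0 ≼ b :- a) ▸ 4 · (b ≼ l :+ l) ▸ c1 ≼ c2 :* i ▸ 2 · (i :* (c2 :* i) ≼ i :* c1) ▸ ⊢ c1 ≼ c4 :* l)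
   (step 2 z<s (P.<-≤-trans (s≤s (s≤s z<s)) 4≤N)) (Δ≥0 3 z<s 4≤N) (eq≤ (lg-* 2 2 z<s z<s)) (eq≥ c) (*≤ʳ (inv≥0 2) (eq≤ c))
   where
   step = LogSystem.step-≥ sys
   c : # 2 * inv 2 ≡ # 1
   c = inv-inverse 1
  lg-2^ : ∀ m -> lg (2 N.^ m) ≡ # m * lg 2
  lg-2^ zero    = lg-1 » ring 1 (\ a -> c0 := c0 :* a)
  lg-2^ (suc m) = lg-* 2 (2 N.^ m) z<s (^-≥1 m z<s) » cong (lg 2 +_) (lg-2^ m) » ring 2 (\ l m -> l :+ m :* l := (m :+ c1) :* l) » cong (_* lg 2) (sym (#-suc m))
  -- A threshold log y ≥ k is met by y = 2^(4k); the exponents `4 * …` in later constants all come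
  -- from here.
  lg-2^≥ : ∀ k -> # k ≤ lg (2 N.^ (4 N.* k))
  lg-2^≥ k = lin 2 (\ k l -> k :* c1 ≼ k :* (c4 :* l) ▸ ⊢ k ≼ c4 :* k :* l) (*≤ʳ (0≤# k) 4lg2≥1) ≫ eq≥ (lg-2^ (4 N.* k) » cong (_* lg 2) (#-* 4 k))
  lg-^ : ∀ b m -> 1 ≦ b -> lg (b N.^ m) ≡ # m * lg b
  lg-^ b zero    1≤b = lg-1 » ring 1 (\ a -> c0 := c0 :* a)
  lg-^ b (suc m) 1≤b = lg-* b (b N.^ m) 1≤b (^-≥1 m 1≤b) » cong (lg b +_) (lg-^ b m 1≤b) » ring 2 (\ l m -> l :+ m :* l := (m :+ c1) :* l) » cong (_* lg b) (sym (#-suc m))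
  H-lg : ∀ {u v} -> 1 ≦ u -> u ≦ N -> 1 ≦ v -> v ≦ N -> lg v - lg u ≤ H v - H u + # 8
  H-lg 1≤u u≤N 1≤v v≤N = lin 4 (\ l u h a -> ⊝ c4 ≼ h :- l ▸ a :- u ≼ c4 ▸ ⊢ l :- u ≼ h :- a :+ con 8) (fst (A-bound 1≤v v≤N)) (snd (A-bound 1≤u u≤N))
  -- When sR(i) ≥ i/D throughout, each term of D·s·`B` beats a term of the harmonic sum. 36 is twice
  -- the bound 18 on `B`, and 8 is the price of exchanging H for log at both ends.
  sum-range : ∀ D s {c b} -> s ± # 1 -> c ≦ b -> suc b ≦ N -> (∀ i -> suc c ≦ i -> i ≦ b -> # i ≤ # D * (s * R i)) ->
   lg (suc b) - lg (suc c) ≤ # 36 * # D + # 8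
  sum-range D s {c} {b} s± c≤b b<N h = H-lg {suc c} {suc b} z<s (s≤s c≤b ⋙ b<N) z<s b<N ≫ lin 6 (\ d s c h a z -> d :* c :- a ≼ d :* s :- h ▸ d :* s ≼ d :* con 18 ▸ d :* (⊝ con 18) ≼ d :* c ▸ 0 · (z ≼ z) ▸ ⊢ h :- a :+ con 8 ≼ con 36 :* d :+ con 8)
    (mono-steps (\ j -> # D * (s * B j) - H (suc j)) c≤b stp) (*≤ʳ (0≤# D) (snd (sB b b<N))) (*≤ʳ (0≤# D) (fst (sB c (s≤s c≤b ⋙ b<N)))) (≤-refl {# 0})
   where
   sB : ∀ k -> suc k ≦ N -> s * B k ± # 18
   sB k k<N = subst (s * B k ±_) (ring 0 (c1 :* con 18 := con 18)) (±-* s± (B-bound k k<N) (0≤# 1) (0≤# 18))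
   stp : ∀ j -> c ≦ j -> j N.< b -> # D * (s * B j) - H (suc j) ≤ # D * (s * B (suc j)) - H (suc (suc j))
   stp j c≤j j<b = lin 8 (\ d s t r a b h n -> n :* (a :- b) ≼ d :* (s :* r) :* (a :- b) ▸ c1 ≼ n :* a ▸ (n :+ c1) :* b ≼ c1 ▸
     ⊢ d :* (s :* t) :- h ≼ d :* (s :* (t :+ r :* (a :- b))) :- (h :+ b)) (*≤ˡ (lin 2 (\ a b -> b ≼ a ▸ ⊢ c0 ≼ a :- b) (inv-antimono {j} (n≤1+n (suc j)))) (h (suc j) (s≤s c≤j) j<b)) (eq≥ (inv-inverse j)) (eq≤ (cong (_* inv (suc (suc j))) (sym (#-suc (suc j))) » inv-inverse (suc j)))
  module _ (D : ℕ) (1≤D : 1 ≦ D) where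
   Small : ℕ -> Set
   Small y = # D * ∣ R y ∣ ≤ # y
   -- ψ never decreases, so R falls by at most 1 per step although it may jump upwards. Only the
   -- passage from + to - has to go through small values.
   R-suc : ∀ y -> # 0 ≤ R y -> - # 1 ≤ R (suc y)
   R-suc y h = lin 3 (\ p n l -> c0 ≼ p :- n ▸ c0 ≼ l ▸ ⊢ ⊝ c1 ≼ (p :+ l) :- (n :+ c1)) h (Λ≥0 (suc y)) ≫ eq≤ (cong (\ z -> ψ (suc y) - z) (sym (#-suc y)))
   find-small : ∀ a q -> D ≦ a -> 1 ≦ q -> q N.* (q N.* a) ≦ N -> # 36 * # D + # 8 < lg q ->
    ∃ \ y -> a ≦ y × y N.< q N.* (q N.* a) × Small y
   find-small a q D≤a 1≤q b≤N big with anyUpTo? (\ y -> (a N.≤? y) ×-dec (# D * ∣ R y ∣ ≤? # y)) (q N.* (q N.* a))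
   ... | yes (y , y<b , a≤y , sm) = y , a≤y , y<b , sm
   -- The sign at the midpoint c = qa decides. If R(c) ≥ 0, then R stays nonnegative on [c, b); if
   -- R(c) < 0, then R is negative on all of [a, c). Either half has logarithmic length log q, too
   -- long for `sum-range`.
   ... | no none = ⊥-elim (case # 0 ≤? R c of \ where
     (yes pos) -> contra c b 1≤c (m≤n*m c q {{N.>-nonZero 1≤q}}) b≤N b≡qc (# 1) (lin 0 (⊢ ⊝ c1 ≼ c1) , ≤-refl)
       (\ i c≤i i<b -> sgn+ i (a≤c ⋙ c≤i) i<b (prop c i a≤c c≤i i<b pos))
     (no  neg) -> contra a c 1≤a a≤c c≤N refl (- # 1) (≤-refl , lin 0 (⊢ ⊝ c1 ≼ c1))
       (\ i a≤i i<c -> sgn- i a≤i (P.<-≤-trans i<c c≤b) (\ p -> neg (prop i c a≤i (P.<⇒≤ i<c) c<b p))))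
    where
    b c : ℕ
    b = q N.* (q N.* a)
    c = q N.* a
    1≤a = 1≤D ⋙ D≤a
    a≤c : a ≦ c
    a≤c = m≤n*m a q {{N.>-nonZero 1≤q}}
    1≤c = 1≤a ⋙ a≤c
    c≤b : c ≦ b
    c≤b = m≤n*m c q {{N.>-nonZero 1≤q}}
    c≤N = c≤b ⋙ b≤N
    b≡qc : b ≡ q N.* c
    b≡qc = refl
    2≤q : 2 ≦ q
    2≤q = ≤∧≢⇒< 1≤q (\ e -> big (eq≤ (cong lg (sym e) » lg-1) ≫ lin 1 (\ d -> 36 · (c0 ≼ d) ▸ ⊢ c0 ≼ con 36 :* d :+ con 8) (0≤# D)))
    c<b : c N.< b
    c<b = P.<-≤-trans (m<m+n c 1≤c) (P.≤-reflexive (cong (c N.+_) (sym (P.+-identityʳ c))) ⋙ *-monoˡ-≤ c 2≤q)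
    large : ∀ y -> a ≦ y -> y N.< b -> # y ≤ # D * ∣ R y ∣
    large y a≤y y<b = <⇒≤ (\ sm -> none (y , y<b , a≤y , sm))
    neg1 : ∀ y -> a ≦ y -> y N.< b -> - # 1 ≤ R y -> # 0 ≤ R y
    neg1 y a≤y y<b h = case # 0 ≤? R y of \ where
     (yes p) -> p
     (no ¬p) -> ⊥-elim (none (y , y<b , a≤y , ≤-trans (*≤ʳ (0≤# D) (∣∣≤ {R y} {# 1} ((<⇒≤ ¬p) ≫ 0≤# 1) (lin 1 (\ r -> ⊝ c1 ≼ r ▸ ⊢ ⊝ r ≼ c1) h))) (eq≤ (ring 1 (\ d -> d :* c1 := d)) ≫ #-mono (D≤a ⋙ a≤y))))
    prop : ∀ y z -> a ≦ y -> y ≦ z -> z N.< b -> # 0 ≤ R y -> # 0 ≤ R z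
    prop y zero    a≤y z≤n z<b p = p
    prop y (suc z) a≤y y≤z z<b p with y N.≟ suc z
    ... | yes refl = p
    ... | no  ne   = neg1 (suc z) (a≤y ⋙ y≤z) z<b (R-suc z (prop y z a≤y (≤-pred (≤∧≢⇒< y≤z ne)) (<-trans (n<1+n z) z<b) p))
    sgn+ : ∀ i -> a ≦ i -> i N.< b -> # 0 ≤ R i -> # i ≤ # D * (# 1 * R i)
    sgn+ i a≤i i<b p = large i a≤i i<b ≫ *≤ʳ (0≤# D) (∣∣≤ (eq≤ (ring 1 (\ r -> r := c1 :* r))) (lin 1 (\ r -> 2 · (c0 ≼ r) ▸ ⊢ ⊝ r ≼ c1 :* r) p))
    sgn- : ∀ i -> a ≦ i -> i N.< b -> ¬ (# 0 ≤ R i) -> # i ≤ # D * (- # 1 * R i)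
    sgn- i a≤i i<b p = large i a≤i i<b ≫ *≤ʳ (0≤# D) (∣∣≤ (lin 1 (\ r -> 2 · (r ≼ c0) ▸ ⊢ r ≼ (⊝ c1) :* r) (<⇒≤ p)) (eq≤ (ring 1 (\ r -> ⊝ r := (⊝ c1) :* r))))
    contra : ∀ u v -> 1 ≦ u -> u ≦ v -> v ≦ N -> v ≡ q N.* u -> ∀ s -> s ± # 1 -> (∀ i -> u ≦ i -> i N.< v -> # i ≤ # D * (s * R i)) -> ⊥
    contra (suc u) (suc v) 1≤u (s≤s u≤v) v≤N e s s± h = big (lin 3 (\ l u v -> l :+ u ≼ v ▸ ⊢ l ≼ v :- u) (eq≤ (sym (lg-* q (suc u) 1≤q z<s) » cong lg (sym e))) ≫ sum-range D s s± u≤v v≤N (\ i u<i i≤v -> h i u<i (s≤s i≤v)))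
   -- The 3 collects |R(y)| ≤ y/D, the length y/D of the interval, and the Lipschitz error
   -- 210·y′/log y, which is at most y′/D by the condition on log y.
   good-interval : ∀ y y′ -> 1 ≦ y -> 2 ≦ D -> Small y -> # 210 * # D ≤ lg y -> 2 N.* y ≦ N -> y ≦ y′ -> y′ ≦ y N.+ y ÷ D ->
    # D * ∣ R y′ ∣ ≤ # 3 * # y′
   good-interval y y′ 1≤y 2≤D sm lgy 2y≤N y≤y′ y′≤ = *-cancelˡ-≤ lg>0 (lin 6 (\ l d a r n b -> d :* (l :* a) ≼ d :* (l :* r :+ ((b :- n) :* l :+ con 210 :* b)) ▸ l :* (d :* r) ≼ l :* n ▸ l :* (d :* (b :- n)) ≼ l :* n ▸ con 210 :* d :* b ≼ l :* b ▸ 2 · (l :* n ≼ l :* b) ▸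
     ⊢ l :* (d :* a) ≼ l :* (c3 :* b)) (*≤ʳ (0≤# D) (R-lipschitz y y′ 1≤y y≤y′ y′≤2y 2y≤N)) (*≤ʳ ly sm) (*≤ʳ ly Dd) (*≤ˡ (0≤# y′) lgy) (*≤ʳ ly (#-mono y≤y′)))
    where
    y≤N = m≤m+n y _ ⋙ 2y≤N
    ly = lg≥0 1≤y y≤N
    lg>0 : lg y ≤ # 0 -> ⊥
    lg>0 h = #-pos 0 (lin 2 (\ d l -> con 210 :* d ≼ l ▸ l ≼ c0 ▸ 210 · (c1 ≼ d) ▸ ⊢ c1 ≼ c0) lgy h (#-mono 1≤D))
    y′≤2y : y′ ≦ 2 N.* y
    y′≤2y = y′≤ ⋙ +-monoʳ-≤ y (÷-≤ y D) ⋙ P.≤-reflexive (cong (y N.+_) (sym (P.+-identityʳ y)))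
    Dd : # D * (# y′ - # y) ≤ # y
    Dd = *≤ʳ (0≤# D) (lin 3 (\ a b c -> a ≼ b :+ c ▸ ⊢ a :- b ≼ c) (#-mono y′≤ ≫ eq≤ (#-+ y (y ÷ D)))) ≫ eq≥ (#-* D (y ÷ D)) ≫ #-mono (÷-upper 1≤D P.≤-refl)
   module Blocks (2≤D : 2 ≦ D) (q : ℕ) (1≤q : 1 ≦ q) (qbig : # 36 * # D + # 8 < lg q)
          (x : ℕ) (1≤x : 1 ≦ x) (2x≤N : 2 N.* x ≦ N) (α β : Q) (0≤β : # 0 ≤ β) (4≤Dα : # 4 ≤ # D * α)
          (hyp : ∀ n -> 1 ≦ n -> n ≦ x -> ∣ R n ∣ ≤ α * # n + β) where
    x≤N : x ≦ N
    x≤N = m≤m+n x _ ⋙ 2x≤N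
    κ : ℕ
    κ = 4 N.* (D N.* suc D)
    -- A block must contain the range up to q²a searched by `find-small` and also the end of the
    -- good interval, which lies below 2y; hence the extra factor 2.
    ratio : ℕ
    ratio = 2 N.* (q N.* q)
    -- `f` gives the terms of the sum in `second-order`, `g` the bound that the current estimate
    -- implies for them, and `h` the saving still to be exploited.
    f g h : ℕ -> Q
    f n = lg n * ∣ R (x ÷ n) ∣
    g n = lg n * (α * (# x * inv n) + β)
    h n = g n - f n
    0≤α : # 0 ≤ α
    0≤α = *-cancelˡ-≤ {# D} (\ e -> #-pos 0 (#-mono 1≤D ≫ e)) (eq≤ (ring 1 (\ d -> d :* c0 := c0)) ≫ 0≤# 4 ≫ 4≤Dα)
    h≥0 : ∀ n -> 1 ≦ n -> n ≦ x -> # 0 ≤ h n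
    h≥0 n 1≤n n≤x = lin 3 (\ l a b -> l :* a ≼ l :* b ▸ ⊢ c0 ≼ l :* b :- l :* a) (*≤ʳ (lg≥0 1≤n (n≤x ⋙ x≤N))
     (hyp (x ÷ n) (÷-pos 1≤n n≤x) (÷-≤ x n) ≫ +-mono-≤ (*≤ʳ 0≤α (÷-upperQ x n 1≤n)) ≤-refl))
    h-mono : ∀ {u v} -> u ≦ v -> v ≦ x -> S u h ≤ S v h
    h-mono u≤v v≤x = mono-steps (\ i -> S i h) u≤v (\ i _ i<v -> lin 2 (\ a b -> c0 ≼ b ▸ ⊢ a ≼ a :+ b) (h≥0 (suc i) z<s (i<v ⋙ v≤x)))
    -- When x/n falls in the good interval, |R(x/n)| is at most 3x/(nD), while the current estimate
    -- allows 4x/(nD) or more, so n saves x log n/(nD). With log n ≥ ½ log x, and a proportion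
    -- 1/(2(D+1)) of the n ≤ v = x/y concerned, the total is x log x/κ.
    block : ∀ a -> 2 N.* D ≦ a -> # 210 * # D ≤ lg a -> (ratio N.* a) N.* (ratio N.* a) ≦ x ->
     # x * lg x ≤ # κ * (S (x ÷ a) h - S (x ÷ (ratio N.* a)) h)
    block a 2D≤a lga aa≤x = final ≫ *≤ʳ (0≤# κ) (lin 4 (\ s v u b -> v ≼ s ▸ b ≼ u ▸ ⊢ v :- u ≼ s :- b)
      (h-mono (÷-anti 1≤a a≤y) (÷-≤ x a)) (h-mono (÷-anti {x} z<s z<a″) (÷-≤ x (suc z))))
     where
     a″ = ratio N.* a
     1≤a : 1 ≦ a
     1≤a = (1≤D ⋙ m≤m+n D _) ⋙ 2D≤a
     1≤ratio : 1 ≦ ratio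
     1≤ratio = *-≥1 {2} z<s (*-≥1 1≤q 1≤q)
     1≤a″ : 1 ≦ a″
     1≤a″ = *-≥1 1≤ratio 1≤a
     a″≤x : a″ ≦ x
     a″≤x = m≤m*n a″ a″ {{N.>-nonZero 1≤a″}} ⋙ aa≤x
     b≡ : 2 N.* (q N.* (q N.* a)) ≡ a″
     b≡ = cong (2 N.*_) (sym (P.*-assoc q q a)) » sym (P.*-assoc 2 (q N.* q) a)
     b≤a″ : q N.* (q N.* a) ≦ a″
     b≤a″ = m≤m+n _ _ ⋙ P.≤-reflexive b≡
     found = find-small a q (m≤m+n D _ ⋙ 2D≤a) 1≤q (b≤a″ ⋙ a″≤x ⋙ x≤N) qbig
     y = fst found
     a≤y = fst (snd found)
     y<b = fst (snd (snd found))
     small = snd (snd (snd found))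
     z = y N.+ y ÷ D
     1≤y = 1≤a ⋙ a≤y
     y≤x : y ≦ x
     y≤x = (P.<⇒≤ y<b) ⋙ b≤a″ ⋙ a″≤x
     y÷D<y : y ÷ D N.< y
     y÷D<y = *-cancelˡ-< 2 (y ÷ D) y (P.≤-<-trans (*-monoˡ-≤ (y ÷ D) 2≤D) (P.≤-<-trans (÷-upper {y} {D} 1≤D P.≤-refl)
      (P.<-≤-trans (m<m+n y 1≤y) (P.≤-reflexive (cong (y N.+_) (sym (P.+-identityʳ y)))))))
     sucz≤2y : suc z ≦ 2 N.* y
     sucz≤2y = P.≤-reflexive (sym (+-suc y (y ÷ D))) ⋙ +-monoʳ-≤ y y÷D<y ⋙ P.≤-reflexive (cong (y N.+_) (sym (P.+-identityʳ y)))
     z<a″ : suc z ≦ a″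
     z<a″ = sucz≤2y ⋙ *-monoʳ-≤ 2 (P.<⇒≤ y<b) ⋙ P.≤-reflexive b≡
     v u : ℕ
     v = x ÷ y
     u = x ÷ suc z
     u≤v : u ≦ v
     u≤v = ÷-anti 1≤y (m≤m+n y (y ÷ D) ⋙ n≤1+n z)
     2D≤v : 2 N.* D ≦ v
     2D≤v = 2D≤a ⋙ m≤n*m a ratio {{N.>-nonZero 1≤ratio}} ⋙ ÷-lower 1≤y (*-monoˡ-≤ a″ ((P.<⇒≤ y<b) ⋙ b≤a″) ⋙ aa≤x)
     1≤v = (1≤D ⋙ m≤m+n D _) ⋙ 2D≤v
     D+1y : suc D N.* y ≦ D N.* suc z
     D+1y = +-monoˡ-≤ (D N.* y) (P.<⇒≤ (<-÷ y 1≤D)) ⋙ P.≤-reflexive (P.+-comm (D N.* suc (y ÷ D)) (D N.* y) » sym (P.*-distribˡ-+ D y (suc (y ÷ D))) » cong (D N.*_) (+-suc y (y ÷ D)))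
     u-bound : suc D N.* u ≦ D N.* suc v
     u-bound = *-cancelʳ-≤ _ _ y {{N.>-nonZero 1≤y}} (P.≤-reflexive (P.*-assoc (suc D) u y » cong (suc D N.*_) (P.*-comm u y) » sym (P.*-assoc (suc D) y u)) ⋙ *-monoˡ-≤ u D+1y ⋙ P.≤-reflexive (P.*-assoc D (suc z) u) ⋙ *-monoʳ-≤ D (÷-upper {x} {suc z} z<s P.≤-refl ⋙ (P.<⇒≤ (<-÷ x 1≤y))) ⋙ P.≤-reflexive (cong (D N.*_) (P.*-comm y (suc v)) » sym (P.*-assoc D (suc v) y)))
     -- Between u = x/(z+1) and v = x/y lies a fixed proportion of [1, v], because z + 1 exceeds y(1
     -- + 1/D); v ≥ 2D absorbs the rounding.
     spread : # v ≤ # 2 * (# (suc D) * (# v - # u))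
     spread = lin 4 (\ v u d a -> 2 · (a :* u ≼ d :* (v :+ c1)) ▸ 2 · ((d :+ c1) :* v ≼ a :* v) ▸ c2 :* d ≼ v ▸ ⊢ v ≼ c2 :* (a :* (v :- u))) (eq≥ (#-* (suc D) u) ≫ #-mono u-bound ≫ eq≤ ((#-* D (suc v)) » cong (# D *_) (#-suc v))) (eq≤ (cong (_* # v) (sym (#-suc D)))) (eq≥ (#-* 2 D) ≫ #-mono 2D≤v)
     point : ∀ n -> u N.< n -> n ≦ v -> lg x * # x * inv v ≤ # 2 * (# D * h n)
     point n u<n n≤v = lin 9 (\ l X v n i d a b r -> l :* (X :* v) ≼ c2 :* n :* (X :* i) ▸ 2 · (n :* (d :* r) ≼ n :* (c3 :* (X :* i))) ▸ 2 · (n :* (X :* i) :* c4 ≼ n :* (X :* i) :* (d :* a)) ▸ 2 · (c0 ≼ d :* (n :* b)) ▸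
       ⊢ l :* X :* v ≼ c2 :* (d :* (n :* (a :* (X :* i) :+ b) :- n :* r))) (*-mono-≤ (lg≥0 1≤x x≤N) (*≥0 (0≤# x) (inv≥0 n)) 2lgn (*≤ʳ (0≤# x) (inv-anti n v 1≤n n≤v))) (*≤ʳ lgn (good-interval y (x ÷ n) 1≤y 2≤D small (lga ≫ lg-mono 1≤a a≤y (y≤x ⋙ x≤N)) (*-monoʳ-≤ 2 y≤x ⋙ 2x≤N) y≤xn xn≤z ≫ *≤ʳ (0≤# 3) (÷-upperQ x n 1≤n))) (*≤ʳ (*≥0 lgn (*≥0 (0≤# x) (inv≥0 n))) 4≤Dα) (*≥0 (0≤# D) (*≥0 lgn 0≤β))
      where
      1≤n : 1 ≦ n
      1≤n = z<s ⋙ u<n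
      n≤x = n≤v ⋙ (÷-≤ x y)
      lgn = lg≥0 1≤n (n≤x ⋙ x≤N)
      inv-anti : ∀ n v -> 1 ≦ n -> n ≦ v -> inv v ≤ inv n
      inv-anti (suc n) v _ h = inv-antimono h
      yn≤x : y N.* n ≦ x
      yn≤x = ÷-upper 1≤y n≤v
      y≤xn : y ≦ x ÷ n
      y≤xn = ÷-lower 1≤n (P.≤-reflexive (P.*-comm n y) ⋙ yn≤x)
      x<zn : x N.< suc z N.* n
      x<zn = P.<-≤-trans (<-÷ x {suc z} z<s) (*-monoʳ-≤ (suc z) u<n)
      xn≤z : x ÷ n ≦ z
      xn≤z = ≤-pred (P.≰⇒> (\ e -> <⇒≱ x<zn (P.≤-reflexive (P.*-comm (suc z) n) ⋙ ÷-upper 1≤n e)))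
      -- x < (z+1)n and z + 1 ≤ `a″` with `a″`² ≤ x, so n carries at least half of log x.
      2lgn : lg x ≤ # 2 * lg n
      2lgn = lin 5 (\ l z a n b -> 2 · (l ≼ z) ▸ 2 · (z ≼ a :+ n) ▸ 2 · (a ≼ b) ▸ b :+ b ≼ l ▸ ⊢ l ≼ c2 :* n)
       (lg-mono 1≤x (P.<⇒≤ x<zn) (*-monoˡ-≤ n sucz≤2y ⋙ P.≤-reflexive (P.*-assoc 2 y n) ⋙ *-monoʳ-≤ 2 yn≤x ⋙ 2x≤N)) (eq≤ (lg-* (suc z) n z<s 1≤n)) (lg-mono z<s z<a″ (a″≤x ⋙ x≤N)) (eq≥ (lg-* a″ a″ 1≤a″ 1≤a″) ≫ lg-mono (*-≥1 1≤a″ 1≤a″) aa≤x x≤N)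
     ranged : (# v - # u) * (lg x * # x * inv v) ≤ # 2 * (# D * (S v h - S u h))
     ranged = eq≤ (ring 3 (\ v u c -> (v :- u) :* c := v :* c :- u :* c) » sym (cong₂ _-_ (S-const v _) (S-const u _))) ≫ S-range-mono (\ _ -> lg x * # x * inv v) (\ n -> # 2 * (# D * h n)) u≤v point ≫ eq≤ (cong₂ _-_ (S-*ˡ v (# 2) _ » cong (# 2 *_) (S-*ˡ v (# D) h)) (S-*ˡ u (# 2) _ » cong (# 2 *_) (S-*ˡ u (# D) h)) » ring 3 (\ d a b -> c2 :* (d :* a) :- c2 :* (d :* b) := c2 :* (d :* (a :- b))))
     final : # x * lg x ≤ # κ * (S v h - S u h)
     final = lin 8 (\ X l i v u d a s -> v :* (l :* X :* i) ≼ c2 :* (a :* (v :- u)) :* (l :* X :* i) ▸ l :* X :* c1 ≼ l :* X :* (v :* i) ▸ c2 :* a :* ((v :- u) :* (l :* X :* i)) ≼ c2 :* a :* (c2 :* (d :* s)) ▸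
        ⊢ X :* l ≼ c4 :* (d :* a) :* s) (*≤ˡ (*≥0 lX (inv≥0 v)) spread) (*≤ʳ lX (eq≥ (inv-cancel 1≤v))) (*≤ʳ (*≥0 (0≤# 2) (0≤# (suc D))) ranged) ≫ eq≤ (cong (_* (S v h - S u h)) (sym ((#-* 4 (D N.* suc D)) » cong (# 4 *_) (#-* D (suc D)))))
      where lX = *≥0 (lg≥0 1≤x x≤N) (0≤# x)
    module Gain (a : ℕ) (2D≤a : 2 N.* D ≦ a) (lga : # 210 * # D ≤ lg a) where
     1≤a : 1 ≦ a
     1≤a = (1≤D ⋙ m≤m+n D _) ⋙ 2D≤a
     1≤ratio : 1 ≦ ratio
     1≤ratio = *-≥1 {2} z<s (*-≥1 1≤q 1≤q)
     level : ℕ -> ℕ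
     level zero    = a
     level (suc j) = ratio N.* level j
     level≥ : ∀ j -> a ≦ level j
     level≥ zero    = P.≤-refl
     level≥ (suc j) = level≥ j ⋙ m≤n*m (level j) ratio {{N.>-nonZero 1≤ratio}}
     level-suc : ∀ j -> level j ≦ level (suc j)
     level-suc j = m≤n*m (level j) ratio {{N.>-nonZero 1≤ratio}}
     gains : ∀ j -> level j N.* level j ≦ x -> # j * (# x * lg x) ≤ # κ * (S (x ÷ a) h - S (x ÷ level j) h)
     gains zero    _  = eq≤ (ring 3 (\ x k s -> c0 :* x := k :* (s :- s)))
     gains (suc j) le = eq≤ (cong (_* (# x * lg x)) (#-suc j)) ≫ lin 6 (\ j X k s a b -> j :* X ≼ k :* (s :- a) ▸ X ≼ k :* (a :- b) ▸ ⊢ (j :+ c1) :* X ≼ k :* (s :- b))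
      (gains j (P.*-mono-≤ (level-suc j) (level-suc j) ⋙ le))
      (block (level j) (2D≤a ⋙ level≥ j) (lga ≫ lg-mono 1≤a (level≥ j) lj≤N) le)
      where
      lj≤N : level j ≦ N
      lj≤N = m≤m*n (level j) (level j) {{N.>-nonZero (1≤a ⋙ level≥ j)}} ⋙ P.*-mono-≤ (level-suc j) (level-suc j) ⋙ le ⋙ x≤N
     gain : ∀ j -> level j N.* level j ≦ x -> # j * (# x * lg x) ≤ # κ * S x h
     gain j le = gains j le ≫ *≤ʳ (0≤# κ) (lin 3 (\ a b c -> a ≼ b ▸ c0 ≼ c ▸ ⊢ a :- c ≼ b) (h-mono (÷-≤ x a) P.≤-refl) (S-nonneg (x ÷ level j) (\ n 1≤n n≤ -> h≥0 n 1≤n (n≤ ⋙ (÷-≤ x (level j))))))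
     lg-level : ∀ j -> lg (level j) ≡ lg a + # j * lg ratio
     lg-level zero    = ring 2 (\ a r -> a := a :+ c0 :* r)
     lg-level (suc j) = lg-* ratio (level j) 1≤ratio (1≤a ⋙ level≥ j) » cong (lg ratio +_) (lg-level j) » ring 3 (\ r a j -> r :+ (a :+ j :* r) := a :+ (j :+ c1) :* r) » cong (\ z -> lg a + z * lg ratio) (sym (#-suc j))
     level-big : 2 ≦ ratio -> ∀ j -> j N.< level j
     level-big 2≤r zero    = 1≤a
     level-big 2≤r (suc j) = P.<-≤-trans (s≤s (level-big 2≤r j)) (+-monoˡ-≤ (level j) (1≤a ⋙ level≥ j) ⋙ P.≤-reflexive (cong (level j N.+_) (sym (P.+-identityʳ (level j)))) ⋙ *-monoˡ-≤ (level j) 2≤r)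

-- The prime number theorem with arbitrarily small linear error

module PrimeNumberTheorem where
 open Rationals
 open Sums
 open Arithmetic
 open Logarithm
 open SelbergFormula
 open BlockDescent
 open ≡-Reasoning
 module Descent (D : ℕ) (2≤D : 2 ≦ D) where
  1≤D : 1 ≦ D
  1≤D = z<s ⋙ 2≤D
  -- Sealed, because these powers of 2 are far too large to be evaluated.
  abstract
   q a : ℕ
   q = 2 N.^ (4 N.* (36 N.* D N.+ 9))
   a = 2 N.^ (4 N.* (210 N.* D))
   q-def : q ≡ 2 N.^ (4 N.* (36 N.* D N.+ 9))
   q-def = refl
   a-def : a ≡ 2 N.^ (4 N.* (210 N.* D))
   a-def = refl
  1≤q : 1 ≦ q
  1≤q = subst (1 N.≤_) (sym q-def) (^-≥1 (4 N.* (36 N.* D N.+ 9)) z<s)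
  2D≤a : 2 N.* D ≦ a
  2D≤a = subst (2 N.* D N.≤_) (sym a-def) (*-monoˡ-≤ D {2} {4 N.* 210} (s≤s z<s) ⋙ P.≤-reflexive (P.*-assoc 4 210 D) ⋙ (P.<⇒≤ (2^>n (4 N.* (210 N.* D)))))
  module _ (N : ℕ) (4≤N : 4 ≦ N) (sys : LogSystem N) where
   open Contract N 4≤N sys
   qbig : # 36 * # D + # 8 < lg q
   qbig = subst (\ z -> # 36 * # D + # 8 < lg z) (sym q-def) (\ h -> #-pos 0 (lin 2 (\ d l -> con 36 :* d :+ con 9 ≼ l ▸ l ≼ con 36 :* d :+ con 8 ▸ ⊢ c1 ≼ c0) (eq≥ ((#-+ (36 N.* D) 9) » cong (_+ # 9) (#-* 36 D)) ≫ lg-2^≥ (36 N.* D N.+ 9)) h))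
   lga : # 210 * # D ≤ lg a
   lga = subst (\ z -> # 210 * # D ≤ lg z) (sym a-def) (eq≥ (#-* 210 D) ≫ lg-2^≥ (210 N.* D))
  ratio : ℕ
  ratio = 2 N.* (q N.* q)
  -- `W` is κ·ratio, the reciprocal of the total saving. In `c` the square of the ratio leaves room
  -- for the first level whose square exceeds x, as used in `nextN`.
  W c : ℕ
  W = 4 N.* (D N.* suc D) N.* ratio
  c = 2 N.* (ratio N.* ratio)
  -- B is quantified before `N` and the logarithm; the later choice of a fresh logarithm for each g
  -- depends on this uniformity.
  PNT : Q -> Set
  PNT α = ∃ \ B -> ∀ N (4≤N : 4 ≦ N) (sys : LogSystem N) x -> 1 ≦ x -> c N.* x ≦ N ->
   ∣ Iteration.R N 4≤N sys x ∣ ≤ α * # x + # B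
  2≤ratio : 2 ≦ ratio
  2≤ratio = m≤m*n 2 (q N.* q) {{N.>-nonZero (*-≥1 1≤q 1≤q)}}
  1≤ratio : 1 ≦ ratio
  1≤ratio = z<s ⋙ 2≤ratio
  1≤W : 1 ≦ W
  1≤W = *-≥1 (*-≥1 {4} z<s (*-≥1 1≤D z<s)) 1≤ratio
  2≤c : 2 ≦ c
  2≤c = m≤m*n 2 (ratio N.* ratio) {{N.>-nonZero (*-≥1 1≤ratio 1≤ratio)}}
  -- About log x/(2·ratio) blocks each save x log x/κ, so the total saving is proportional to x log²
  -- x with a factor that does not involve α. Half of the gain 1/W absorbs lower-order terms, and α
  -- drops by the fixed amount 1/(2W).
  step : ∀ α -> # 4 ≤ # D * α -> α ≤ # 11 -> PNT α -> PNT (α - inv (2 N.* W))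
  step α 4≤Dα α≤11 (β , hyp) = B′ , bound
   where
   C₂ K₁ X₀ B′ : ℕ
   K₁ = 2 N.* a N.+ 2 N.* ratio
   -- 1476 = 1300 + 16·11: the remainder of `second-order`, and the 16 log x of `lg-inv-sum`
   -- multiplied by α ≤ 11.
   C₂ = W N.* (1476 N.+ 2 N.* β) N.+ K₁
   X₀ = 2 N.^ (4 N.* (4 N.* C₂)) N.* (a N.* a)
   -- Below `X₀` Chebyshev's 6x suffices; the additional `X₀` compensates the subtracted x/(2W).
   B′ = 6 N.* X₀ N.+ X₀
   bound : ∀ N (4≤N : 4 ≦ N) (sys : LogSystem N) x -> 1 ≦ x -> c N.* x ≦ N ->
    ∣ Iteration.R N 4≤N sys x ∣ ≤ (α - inv (2 N.* W)) * # x + # B′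
   bound N 4≤N sys x 1≤x cx≤N = case X₀ N.≤? x of \ where
     (yes big) -> large big
     (no  few) -> abs-± (R-bound x x≤N) ≫ lin 5 (\ X a i b y -> 6 · (X ≼ y) ▸ con 6 :* y :+ y ≼ b ▸ X ≼ y ▸ i :* X ≼ c1 :* X ▸ c0 ≼ a :* X ▸ ⊢ con 6 :* X ≼ (a :- i) :* X :+ b) (#-mono (P.<⇒≤ (P.≰⇒> few))) (eq≤ (cong (_+ # X₀) (sym (#-* 6 X₀)) » sym (#-+ (6 N.* X₀) X₀))) (#-mono (P.<⇒≤ (P.≰⇒> few))) (*≤ˡ (0≤# x) (inv≤1 (2 N.* W))) (*≥0 0≤α (0≤# x))
    where
    open Contract N 4≤N sys
    2x≤N : 2 N.* x ≦ N
    2x≤N = *-monoˡ-≤ x 2≤c ⋙ cx≤N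
    x≤N : x ≦ N
    x≤N = m≤m+n x _ ⋙ 2x≤N
    hyp′ : ∀ n -> 1 ≦ n -> n ≦ x -> ∣ R n ∣ ≤ α * # n + # β
    hyp′ n 1≤n n≤x = hyp N 4≤N sys n 1≤n (*-monoʳ-≤ c n≤x ⋙ cx≤N)
    open Blocks D 1≤D 2≤D q 1≤q (qbig N 4≤N sys) x 1≤x 2x≤N α (# β) (0≤# β) 4≤Dα hyp′ using (0≤α; κ; f; g; h; module Gain)
    open Gain a 2D≤a (lga N 4≤N sys) using (level; gain; lg-level; level-big; level≥; 1≤a)
    X l r : Q
    X = # x
    l = lg x
    r = ∣ R x ∣
    l≥0 : # 0 ≤ l
    l≥0 = lg≥0 1≤x x≤N
    sumf : S x f ≡ S x g - S x h
    sumf = S-ext x (\ n -> ring 2 (\ a b -> a := b :- (b :- a))) » S-- x g h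
    sumg : S x g ≡ α * X * S x (\ n -> lg n * inv n) + # β * T′ x
    sumg = S-ext x (\ n -> ring 5 (\ l a X i b -> l :* (a :* (X :* i) :+ b) := a :* X :* (l :* i) :+ b :* l)) » S-+ x _ _ » cong₂ _+_ (S-*ˡ x (α * X) _) (S-*ˡ x (# β) lg)
    2g≤ : # 2 * S x g ≤ α * X * (l * l + # 16 * l + # 8) + # 2 * # β * (X * l)
    2g≤ = *≤ʳ (0≤# 2) (eq≤ sumg) ≫ lin 7 (\ a X s b t u v -> a :* X :* (c2 :* s) ≼ a :* X :* u ▸ 2 · (b :* t ≼ b :* v) ▸ ⊢ c2 :* (a :* X :* s :+ b :* t) ≼ a :* X :* u :+ c2 :* b :* v) (*≤ʳ (*≥0 0≤α (0≤# x)) (lg-inv-sum x 1≤x x≤N)) (*≤ʳ (0≤# β) (T≤ x x≤N))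
    large : X₀ ≦ x -> r ≤ (α - inv (2 N.* W)) * X + # B′
    large big = *-cancelˡ-≤ {# (2 N.* W)} 2W>0 (2Wr ≫ eq≥ (ring 4 (\ w a i X -> w :* ((a :- i) :* X) := (w :* a :- w :* i) :* X) » cong (\ z -> (# (2 N.* W) * α - z) * X) (inv-cancel 1≤2W))) ≫ lin 2 (\ a b -> c0 ≼ b ▸ ⊢ a ≼ a :+ b) (0≤# B′)
     where
     1≤2W : 1 ≦ 2 N.* W
     1≤2W = *-≥1 {2} z<s 1≤W
     2W>0 : # 0 < # (2 N.* W)
     2W>0 e = #-pos 0 (#-mono 1≤2W ≫ e)
     a²≤x : level 0 N.* level 0 ≦ x
     a²≤x = m≤n*m (a N.* a) (2 N.^ (4 N.* (4 N.* C₂))) {{N.>-nonZero (^-≥1 (4 N.* (4 N.* C₂)) z<s)}} ⋙ big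
     pow≤x : 2 N.^ (4 N.* (4 N.* C₂)) ≦ x
     pow≤x = m≤m*n (2 N.^ (4 N.* (4 N.* C₂))) (a N.* a) {{N.>-nonZero (*-≥1 1≤a 1≤a)}} ⋙ big
     last = find-last (\ j -> level j N.* level j ≦ x) (\ j -> level j N.* level j N.≤? x) a²≤x x
      (\ e -> <⇒≱ (level-big 2≤ratio x) (m≤m*n (level x) (level x) {{N.>-nonZero (1≤a ⋙ level≥ x)}} ⋙ e))
     J₀ : ℕ
     J₀ = fst last
     J≤ = fst (snd last)
     J> = snd (snd last)
     l≥4C : # 4 * # C₂ ≤ l
     l≥4C = eq≥ (#-* 4 C₂) ≫ lg-2^≥ (4 N.* C₂) ≫ lg-mono (^-≥1 (4 N.* (4 N.* C₂)) z<s) pow≤x x≤N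
     nextN : level (suc J₀) N.* level (suc J₀) ≦ N
     nextN = P.≤-reflexive (shuffle ratio (level J₀)) ⋙ *-monoʳ-≤ (ratio N.* ratio) J≤ ⋙ *-monoˡ-≤ x (m≤m+n (ratio N.* ratio) _) ⋙ cx≤N
      where
      shuffle : ∀ r l -> (r N.* l) N.* (r N.* l) ≡ (r N.* r) N.* (l N.* l)
      shuffle r l = P.*-assoc r l (r N.* l) » cong (r N.*_) (sym (P.*-assoc l r l) » cong (N._* l) (P.*-comm l r) » P.*-assoc r l l) » sym (P.*-assoc r r (l N.* l))
     1≤next : 1 ≦ level (suc J₀)
     1≤next = 1≤a ⋙ level≥ (suc J₀)
     ra≤N : ratio N.* a ≦ N
     ra≤N = *-monoʳ-≤ ratio (level≥ J₀) ⋙ m≤m*n (level (suc J₀)) (level (suc J₀)) {{N.>-nonZero 1≤next}} ⋙ nextN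
     -- Maximality of `J₀` gives log x ≤ 2 log level(`J₀` + 1). This bounds the number of blocks
     -- from below by log x/(2·ratio) up to a constant, log ratio being replaced by ratio.
     l≤ : l ≤ # K₁ + # 2 * # J₀ * # ratio
     l≤ = lin 6 (\ l n a j b r -> l ≼ n :+ n ▸ 2 · (n ≼ a :+ (j :+ c1) :* b) ▸ 2 · ((j :+ c1) :* b ≼ (j :+ c1) :* r) ▸ ⊢ l ≼ c2 :* a :+ c2 :* r :+ c2 :* j :* r)
       (lg-mono 1≤x (P.<⇒≤ (P.≰⇒> J>)) nextN ≫ eq≤ (lg-* (level (suc J₀)) (level (suc J₀)) 1≤next 1≤next)) (eq≤ (lg-level (suc J₀) » cong (\ z -> lg a + z * lg ratio) (#-suc J₀))) (*≤ʳ (+-nonneg (0≤# J₀) (0≤# 1)) (lg≤id ratio 1≤ratio (m≤m*n ratio a {{N.>-nonZero 1≤a}} ⋙ ra≤N))) ≫ lin 5 (\ l a r j k -> 2 · (l ≼ a) ▸ c2 :* a :+ c2 :* r ≼ k ▸ ⊢ c2 :* l :+ c2 :* r :+ c2 :* j :* r ≼ k :+ c2 :* j :* r)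
       (lg≤id a 1≤a (m≤n*m a ratio {{N.>-nonZero 1≤ratio}} ⋙ ra≤N)) (eq≤ (cong₂ _+_ (sym (#-* 2 a)) (sym (#-* 2 ratio)) » sym (#-+ (2 N.* a) (2 N.* ratio))))
     w : Q
     w = # κ * # ratio
     w≥0 : # 0 ≤ w
     w≥0 = *≥0 (0≤# κ) (0≤# ratio)
     Xl≥0 : # 0 ≤ X * l
     Xl≥0 = *≥0 (0≤# x) l≥0
     h₁ : w * (l * l * r) ≤ w * (# 2 * (S x g - S x h) + # 1300 * (X * l + X))
     h₁ = *≤ʳ w≥0 (second-order x 1≤x 2x≤N ≫ eq≤ (cong (\ z -> # 2 * z + # 1300 * (X * l + X)) sumf))
     main₁ : w * (l * l * r) ≤ (w * α - # 1) * (X * (l * l)) + (w * (# 1476 + # 2 * # β) + # K₁) * (X * l + X)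
     main₁ = lin 12 (\ k R l r G H X a b K J w -> k :* R :* (l :* l :* r) ≼ k :* R :* (c2 :* (G :- H) :+ con 1300 :* (X :* l :+ X)) ▸ k :* R :* (c2 :* G) ≼ k :* R :* (a :* X :* (l :* l :+ con 16 :* l :+ con 8) :+ c2 :* b :* (X :* l)) ▸
        2 · (R :* (J :* (X :* l)) ≼ R :* (k :* H)) ▸ X :* l :* l ≼ X :* l :* (K :+ c2 :* J :* R) ▸ k :* R :* (con 16 :* (X :* l) :+ con 8 :* X) :* a ≼ k :* R :* (con 16 :* (X :* l) :+ con 8 :* X) :* con 11 ▸ c0 ≼ k :* R :* X :* (con 88 :+ c2 :* b) :+ K :* X ▸ 0 · (w ≼ w) ▸
        ⊢ k :* R :* (l :* l :* r) ≼ (k :* R :* a :- c1) :* (X :* (l :* l)) :+ (k :* R :* (con 1476 :+ c2 :* b) :+ K) :* (X :* l :+ X))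
       h₁ (*≤ʳ w≥0 2g≤) (*≤ʳ (0≤# ratio) (gain J₀ J≤)) (*≤ʳ Xl≥0 l≤) (*≤ʳ (*≥0 w≥0 (+-nonneg (*≥0 (0≤# 16) Xl≥0) (*≥0 (0≤# 8) (0≤# x)))) α≤11)
       (+-nonneg (*≥0 (*≥0 w≥0 (0≤# x)) (+-nonneg (0≤# 88) (*≥0 (0≤# 2) (0≤# β)))) (*≥0 (0≤# K₁) (0≤# x))) (≤-refl {# 0})
     C≡ : w * (# 1476 + # 2 * # β) + # K₁ ≡ # C₂
     C≡ = sym ((#-+ (W N.* (1476 N.+ 2 N.* β)) K₁) » cong (_+ # K₁) ((#-* W (1476 N.+ 2 N.* β)) » cong₂ _*_ (#-* κ ratio) ((#-+ 1476 (2 N.* β)) » cong (# 1476 +_) (#-* 2 β))))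
     1≤C : # 1 ≤ # C₂
     1≤C = #-mono (*-≥1 1≤W z<s ⋙ m≤m+n _ K₁)
     l≥1 : # 1 ≤ l
     l≥1 = lin 2 (\ c l -> 4 · (c1 ≼ c) ▸ c4 :* c ≼ l ▸ ⊢ c1 ≼ l) 1≤C l≥4C
     2Wr : # (2 N.* W) * r ≤ (# (2 N.* W) * α - # 1) * X
     2Wr = *-cancelˡ-≤ {l * l} (\ e -> #-pos 0 ((eq≤ (ring 0 (c1 := c1 :* c1)) ≫ *-mono-≤ (0≤# 1) l≥0 l≥1 l≥1) ≫ e)) (eq≤ (cong (\ z -> l * l * (z * r)) 2W≡) ≫ lin 6 (\ w l r a X C -> 2 · (w :* (l :* l :* r) ≼ (w :* a :- c1) :* (X :* (l :* l)) :+ C :* (X :* l :+ X)) ▸ X :* l :* (c4 :* C) ≼ X :* l :* l ▸ 2 · (C :* X :* c1 ≼ C :* X :* l) ▸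
         ⊢ l :* l :* (c2 :* w :* r) ≼ l :* l :* ((c2 :* w :* a :- c1) :* X))
        (main₁ ≫ eq≤ (cong (\ z -> (w * α - # 1) * (X * (l * l)) + z * (X * l + X)) C≡)) (*≤ʳ Xl≥0 l≥4C) (*≤ʳ (*≥0 (0≤# C₂) (0≤# x)) l≥1) ≫ eq≤ (cong (\ z -> l * l * ((z * α - # 1) * X)) (sym 2W≡)))
      where
      2W≡ : # (2 N.* W) ≡ # 2 * w
      2W≡ = (#-* 2 W) » cong (# 2 *_) (#-* κ ratio)
  -- Chebyshev's 6 is below 4/D + 7, and 7·2W steps of size 1/(2W) remove the 7. On the way α stays
  -- between 4/D and 11.
  pnt : PNT (# 4 * inv D)
  pnt = subst PNT (ring 2 (\ d e -> c4 :* d :+ c0 :* e := c4 :* d)) (down (7 N.* (2 N.* W)) 0 (P.+-identityʳ _))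
   where
   η : Q
   η = inv (2 N.* W)
   2Wη : # (2 N.* W) * η ≡ # 1
   2Wη = inv-cancel (*-≥1 {2} z<s 1≤W)
   7≡ : # (7 N.* (2 N.* W)) * η ≡ # 7
   7≡ = cong (_* η) (#-* 7 (2 N.* W)) » *-assoc (# 7) _ η » cong (# 7 *_) 2Wη » ring 0 (con 7 :* c1 := con 7)
   top : PNT (# 4 * inv D + # (7 N.* (2 N.* W)) * η)
   top = 0 , \ N 4≤N sys x 1≤x cx≤N -> abs-± (Iteration.R-bound N 4≤N sys x (m≤n*m x c {{N.>-nonZero (z<s ⋙ 2≤c)}} ⋙ cx≤N)) ≫ lin 3 (\ X d e -> c0 ≼ d :* X ▸ con 6 :* X ≼ e :* X ▸ ⊢ con 6 :* X ≼ (d :+ e) :* X :+ c0) (*≥0 (*≥0 (0≤# 4) (inv≥0 D)) (0≤# x)) (*≤ˡ (0≤# x) (#-mono {6} {7} (n≤1+n 6) ≫ eq≥ 7≡))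
   down : ∀ n k -> n N.+ k ≡ 7 N.* (2 N.* W) -> PNT (# 4 * inv D + # k * η)
   down zero    k refl = top
   down (suc n) k e    = subst PNT (cong (\ z -> # 4 * inv D + z * η - η) (#-suc k) » ring 3 (\ d k e -> c4 :* d :+ (k :+ c1) :* e :- e := c4 :* d :+ k :* e))
    (step α 4≤Dα α≤11 (down n (suc k) (+-suc n k » e)))
    where
    α = # 4 * inv D + # (suc k) * η
    4≤Dα : # 4 ≤ # D * α
    4≤Dα = lin 4 (\ d i k e -> 4 · (c1 ≼ d :* i) ▸ c0 ≼ d :* (k :* e) ▸ ⊢ c4 ≼ d :* (c4 :* i :+ k :* e)) (eq≥ (inv-cancel 1≤D)) (*≥0 (0≤# D) (*≥0 (0≤# (suc k)) (inv≥0 (2 N.* W))))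
    α≤11 : α ≤ # 11
    α≤11 = lin 4 (\ d k w e -> 4 · (d ≼ c1) ▸ k :* e ≼ w :* e ▸ w :* e ≼ con 7 ▸ ⊢ c4 :* d :+ k :* e ≼ con 11) (inv≤1 D) (*≤ˡ (inv≥0 (2 N.* W)) (#-mono (s≤s (m≤n+m k n) ⋙ P.≤-reflexive e))) (eq≤ 7≡)

-- Selberg's formula in residue classes

module Progressions where
 open Rationals
 open Sums
 open Arithmetic
 open Logarithm
 open SelbergFormula
 open BlockDescent
 open ≡-Reasoning
 abel-bound : ∀ n (f g : ℕ -> Q) κ -> 1 ≦ n -> # 0 ≤ κ -> (∀ i -> 1 ≦ i -> i ≦ n -> S i g ± κ) -> # 0 ≤ f 1 ->
  (∀ i -> 1 ≦ i -> i N.< n -> f i ≤ f (suc i)) -> S n (\ i -> f i * g i) ± # 2 * κ * f n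
 abel-bound (suc m) f g κ _ 0≤κ hg f1 mono = subst (_± # 2 * κ * f (suc m)) (sym (S-abel m f g))
  ( lin 5 (\ a b k t u -> ⊝ (t :* k) ≼ a ▸ b ≼ (t :- u) :* k ▸ c0 ≼ u :* k ▸ ⊢ ⊝ (c2 :* k :* t) ≼ a :- b) (fst top) (snd rest) (*≥0 f1 0≤κ)
  , lin 5 (\ a b k t u -> a ≼ t :* k ▸ ⊝ ((t :- u) :* k) ≼ b ▸ c0 ≼ u :* k ▸ ⊢ a :- b ≼ c2 :* k :* t) (snd top) (fst rest) (*≥0 f1 0≤κ))
  where
  f≥0 : # 0 ≤ f (suc m)
  f≥0 = f1 ≫ mono-steps f z<s mono
  self : ∀ {x} -> # 0 ≤ x -> x ± x
  self h = lin 1 (\ a -> 2 · (c0 ≼ a) ▸ ⊢ ⊝ a ≼ a) h , ≤-refl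
  top : f (suc m) * S (suc m) g ± f (suc m) * κ
  top = ±-* (self f≥0) (hg (suc m) z<s P.≤-refl) f≥0 0≤κ
  d≥0 : ∀ i -> 1 ≦ i -> i ≦ m -> # 0 ≤ f (suc i) - f i
  d≥0 i 1≤i i≤m = lin 2 (\ a b -> a ≼ b ▸ ⊢ c0 ≼ b :- a) (mono i 1≤i (s≤s i≤m))
  rest : S m (\ i -> (f (suc i) - f i) * S i g) ± (f (suc m) - f 1) * κ
  rest = subst (S m (\ i -> (f (suc i) - f i) * S i g) ±_) (S-*ʳ m κ _ » cong (_* κ) (S-telescope m f)) (S-± m (\ i 1≤i i≤m -> ±-* (self (d≥0 i 1≤i i≤m)) (hg i 1≤i (m≤n⇒m≤1+n i≤m)) (d≥0 i 1≤i i≤m) 0≤κ))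
 module Residues (k : ℕ) {{nz : NonZero k}} where
  1≤k : 1 ≦ k
  1≤k = N.>-nonZero⁻¹ k
  infix 4 _≡ₖ_
  _≡ₖ_ : ℕ -> ℕ -> Set
  m ≡ₖ n = m % k ≡ n % k
  *-congₖ : ∀ {m m′ n n′} -> m ≡ₖ m′ -> n ≡ₖ n′ -> m N.* n ≡ₖ m′ N.* n′
  *-congₖ {m} {m′} {n} {n′} e f = %-distribˡ-* m n k » cong₂ (\ x y -> (x N.* y) % k) e f » sym (%-distribˡ-* m′ n′ k)
  cls : ℕ -> ℕ -> Bool
  cls c n = does (n % k N.≟ c % k)
  ind : ℕ -> ℕ -> Q
  ind c n = when (cls c n) (# 1)
  ind≥0 : ∀ c n -> # 0 ≤ ind c n
  ind≥0 c n = when-nonneg (cls c n) (0≤# 1)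
  ind≤1 : ∀ c n -> ind c n ≤ # 1
  ind≤1 c n = when-≤ (cls c n) (0≤# 1)
  ind-cong : ∀ {c c′ n n′} -> (n ≡ₖ c -> n′ ≡ₖ c′) -> (n′ ≡ₖ c′ -> n ≡ₖ c) -> ind c n ≡ ind c′ n′
  ind-cong {c} {c′} {n} {n′} f g = cong (\ b -> when b (# 1)) (does-⇔ (n % k N.≟ c % k) (n′ % k N.≟ c′ % k) f g)
  ind-0 : ∀ {c n} -> ¬ (n ≡ₖ c) -> ind c n ≡ # 0
  ind-0 {c} {n} h = cong (\ b -> when b (# 1)) (is-no (n % k N.≟ c % k) h)
  ind-1 : ∀ {c n} -> n ≡ₖ c -> ind c n ≡ # 1
  ind-1 {c} {n} h = cong (\ b -> when b (# 1)) (is-yes (n % k N.≟ c % k) h)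
  period : ∀ c -> S k (ind c) ≡ # 1
  period c = S-cong k only » S-delta k c₀ (\ _ -> # 1) (fst (snd rep)) (fst (snd (snd rep)))
   where
   rep : ∃ \ c₀ -> 1 ≦ c₀ × c₀ ≦ k × (c₀ % k ≡ c % k)
   rep with c % k in e
   ... | zero  = k , 1≤k , P.≤-refl , n%n≡0 k
   ... | suc r = suc r , s≤s z≤n , P.<⇒≤ r<k , m<n⇒m%n≡m r<k
    where
    r<k : suc r N.< k
    r<k = subst (N._< k) e (m%n<n c k)
   c₀ = fst rep
   inj : ∀ i j -> 1 ≦ i -> i ≦ k -> 1 ≦ j -> j ≦ k -> i % k ≡ j % k -> i ≡ j
   inj i j 1≤i i≤k 1≤j j≤k e with i N.≟ k | j N.≟ k
   ... | yes refl | yes refl = refl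
   ... | no  i≢k  | no  j≢k  = sym (m<n⇒m%n≡m (≤∧≢⇒< i≤k i≢k)) » e » m<n⇒m%n≡m (≤∧≢⇒< j≤k j≢k)
   ... | yes refl | no  j≢k  = ⊥-elim (<⇒≢ 1≤j (sym (n%n≡0 k) » e » m<n⇒m%n≡m (≤∧≢⇒< j≤k j≢k)))
   ... | no  i≢k  | yes refl = ⊥-elim (<⇒≢ 1≤i (sym (n%n≡0 k) » sym e » m<n⇒m%n≡m (≤∧≢⇒< i≤k i≢k)))
   only : ∀ i -> 1 ≦ i -> i ≦ k -> ind c i ≡ when (does (i N.≟ c₀)) (# 1)
   only i 1≤i i≤k = cong (\ b -> when b (# 1)) (does-⇔ (i % k N.≟ c % k) (i N.≟ c₀)
    (\ e -> inj i c₀ 1≤i i≤k (fst (snd rep)) (fst (snd (snd rep))) (e » sym (snd (snd (snd rep)))))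
    (\ { refl -> snd (snd (snd rep)) }))
  count-blocks : ∀ c q r -> S (q N.* k N.+ r) (ind c) ≡ # q + S r (ind c)
  count-blocks c zero    r = ring 1 (\ a -> a := c0 :+ a)
  count-blocks c (suc q) r = begin
   S (k N.+ q N.* k N.+ r) (ind c)                         ≡⟨ cong (\ z -> S z (ind c)) (P.+-assoc k (q N.* k) r) ⟩
   S (k N.+ (q N.* k N.+ r)) (ind c)                       ≡⟨ S-split k (q N.* k N.+ r) (ind c) ⟩
   S k (ind c) + S (q N.* k N.+ r) (\ i -> ind c (k N.+ i)) ≡⟨ cong₂ _+_ (period c) (S-ext (q N.* k N.+ r) (\ i -> ind-cong {c} {c} {k N.+ i} {i} (trans (sym (shift i))) (trans (shift i)))) ⟩
   # 1 + S (q N.* k N.+ r) (ind c)                         ≡⟨ cong (# 1 +_) (count-blocks c q r) ⟩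
   # 1 + (# q + S r (ind c))                               ≡⟨ trans (ring 2 (\ q s -> c1 :+ (q :+ s) := (q :+ c1) :+ s)) (cong (_+ S r (ind c)) (sym (#-suc q))) ⟩
   # (suc q) + S r (ind c)                                 ∎
   where
   shift : ∀ i -> (k N.+ i) % k ≡ i % k
   shift i = cong (_% k) (P.+-comm k i) » [m+n]%n≡m%n i k
  -- Complete periods meet every class once, so only the last incomplete period can distinguish two
  -- classes.
  count-diff : ∀ c c′ M -> S M (\ m -> ind c m - ind c′ m) ± # 1
  count-diff c c′ M = subst (_± # 1) (sym (S-- M (ind c) (ind c′) » cong₂ _-_ (count c) (count c′)))
   ( lin 3 (\ q a b -> c0 ≼ a ▸ b ≼ c1 ▸ ⊢ ⊝ c1 ≼ (q :+ a) :- (q :+ b)) (nn c) (up c′)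
   , lin 3 (\ q a b -> c0 ≼ b ▸ a ≼ c1 ▸ ⊢ (q :+ a) :- (q :+ b) ≼ c1) (nn c′) (up c))
   where
   r = M % k
   count : ∀ c -> S M (ind c) ≡ # (M / k) + S r (ind c)
   count c = cong (\ z -> S z (ind c)) (m≡m%n+[m/n]*n M k » P.+-comm r (M / k N.* k)) » count-blocks c (M / k) r
   nn : ∀ c -> # 0 ≤ S r (ind c)
   nn c = S-nonneg r (\ i _ _ -> ind≥0 c i)
   up : ∀ c -> S r (ind c) ≤ # 1
   up c = S-mono-range (P.<⇒≤ (m%n<n M k)) (ind≥0 c) ≫ eq≤ (period c)
 -- In the application k is a power of ℓ, so units are the numbers prime to ℓ; `log` and `distinct`
 -- say that a, ..., a^φ represent each unit class once.
 record Cyclic (k : ℕ) {{_ : NonZero k}} (ℓ a φ : ℕ) : Set where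
  open Residues k
  field
   ℓ-prime  : Prime ℓ
   ℓ∣k      : ℓ ∣ k
   1≤φ      : 1 ≦ φ
   unit-a   : ¬ (ℓ ∣ a)
   log      : ∀ n -> ¬ (ℓ ∣ n) -> ∃ \ i -> 1 ≦ i × i ≦ φ × n ≡ₖ a N.^ i
   distinct : ∀ i j -> 1 ≦ i -> i ≦ φ -> 1 ≦ j -> j ≦ φ -> a N.^ i ≡ₖ a N.^ j -> i ≡ j
   a^φ      : a N.^ φ ≡ₖ 1
 module Progression (N : ℕ) (4≤N : 4 ≦ N) (sys : LogSystem N)
           (k : ℕ) {{nz : NonZero k}} (ℓ a φ : ℕ) (cyc : Cyclic k ℓ a φ) where
  open Contract N 4≤N sys public
  open Residues k public
  open Cyclic cyc public
  open LogSystem sys using (h; h-nonneg)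
  unit-^ : ∀ i -> ¬ (ℓ ∣ a N.^ i)
  unit-^ zero    d = <⇒≱ (prime≥2 ℓ-prime) (∣⇒≤ d)
  unit-^ (suc i) d with euclidsLemma a (a N.^ i) ℓ-prime d
  ... | inj₁ e = unit-a e
  ... | inj₂ e = unit-^ i e
  ∣-congₖ : ∀ {m n} -> m ≡ₖ n -> ℓ ∣ m -> ℓ ∣ n
  ∣-congₖ {m} {n} e d = subst (ℓ ∣_) (sym (m≡m%n+[m/n]*n n k)) (∣m∣n⇒∣m+n (subst (ℓ ∣_) e (%-presˡ-∣ d ℓ∣k)) (∣n⇒∣m*n (n / k) ℓ∣k))
  inverse : ∀ n -> ¬ (ℓ ∣ n) -> ∃ \ n′ -> n N.* n′ ≡ₖ 1
  inverse n u = a N.^ (φ N.∸ i) , trans (*-congₖ {n} {a N.^ i} {a N.^ (φ N.∸ i)} n≡ refl) (cong (_% k) (sym (^-distribˡ-+-* a i (φ N.∸ i)) » cong (a N.^_) (m+[n∸m]≡n i≤φ)) » a^φ)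
   where
   i = fst (log n u)
   i≤φ = fst (snd (snd (log n u)))
   n≡ = snd (snd (snd (log n u)))
  solve-class : ∀ d -> ¬ (ℓ ∣ d) -> ∀ c -> ∃ \ c′ -> ∀ m -> ind c (d N.* m) ≡ ind c′ m
  solve-class d u c = d′ N.* c , \ m -> ind-cong {c} {d′ N.* c} {d N.* m} {m}
    (\ e -> (cong (_% k) (sym (P.*-identityˡ m)) » *-congₖ {1} {d′ N.* d} {m} (sym d′d) refl » cong (_% k) (P.*-assoc d′ d m)) » *-congₖ {d′} {d′} {d N.* m} refl e)
    (\ e -> *-congₖ {d} {d} {m} refl e » cong (_% k) (sym (P.*-assoc d d′ c)) » *-congₖ {d N.* d′} {1} {c} dd′ refl » cong (_% k) (P.*-identityˡ c))
   where
   d′ = fst (inverse d u)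
   dd′ : d N.* d′ ≡ₖ 1
   dd′ = snd (inverse d u)
   d′d : d′ N.* d ≡ₖ 1
   d′d = cong (_% k) (P.*-comm d′ d) » dd′
  -- Λ₂ = μ ∗ log² in summed form. One logarithm is expanded by `lg-sum`; log(ej) = log e + log j
  -- splits the rest into a Möbius inversion and an instance of `μ-lg`.
  Λ₂-möbius : ∀ x (F : ℕ -> Q) -> S x (\ n -> Λ₂ n * F n) ≡ S x (\ d -> μ d * S (x ÷ d) (\ m -> lg m * (lg m * F (d N.* m))))
  Λ₂-möbius x F = sym (begin
   S x (\ d -> μ d * S (x ÷ d) (\ m -> lg m * (lg m * F (d N.* m))))
    ≡⟨ S-ext x (\ d -> cong (μ d *_) (lg-sum (x ÷ d) (\ m -> lg m * F (d N.* m))) » sym (S-*ˡ (x ÷ d) (μ d) _)) ⟩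
   S x (\ d -> S (x ÷ d) (\ e -> μ d * (Λ e * S (x ÷ d ÷ e) (\ j -> lg (e N.* j) * F (d N.* (e N.* j))))))
    ≡⟨ hyperbola-swap x _ ⟩
   S x (\ e -> S (x ÷ e) (\ d -> μ d * (Λ e * S (x ÷ d ÷ e) (\ j -> lg (e N.* j) * F (d N.* (e N.* j))))))
    ≡⟨ S-cong x (\ e 1≤e e≤x -> S-cong (x ÷ e) (\ d 1≤d _ -> ring 3 (\ a b c -> a :* (b :* c) := b :* (a :* c)) » cong (\ z -> Λ e * (μ d * z)) (inner e d 1≤e)) » S-*ˡ (x ÷ e) (Λ e) _ » outer e 1≤e e≤x) ⟩
   S x (\ e -> Λ e * lg e * F e + Λ e * S (x ÷ e) (\ j -> Λ j * F (e N.* j)))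
    ≡⟨ trans (S-+ x _ _) (cong (S x (\ e -> Λ e * lg e * F e) +_) (sym (Λ*Λ-sum x F))) ⟩
   S x (\ n -> Λ n * lg n * F n) + S x (\ n -> Λ*Λ n * F n)
    ≡⟨ trans (sym (S-+ x _ _)) (S-ext x (\ n -> ring 3 (\ a b c -> a :* c :+ b :* c := (a :+ b) :* c))) ⟩
   S x (\ n -> Λ₂ n * F n) ∎)
   where
   inner : ∀ e d -> 1 ≦ e -> S (x ÷ d ÷ e) (\ j -> lg (e N.* j) * F (d N.* (e N.* j))) ≡
    lg e * S (x ÷ e ÷ d) (\ j -> F (e N.* (d N.* j))) + S (x ÷ e ÷ d) (\ j -> lg j * F (e N.* (d N.* j)))
   inner e d 1≤e = cong (\ z -> S z (\ j -> lg (e N.* j) * F (d N.* (e N.* j)))) ((÷-÷ x d e) » cong (x ÷_) (P.*-comm d e) » sym (÷-÷ x e d)) » S-cong (x ÷ e ÷ d) (\ j 1≤j _ -> cong₂ _*_ (lg-* e j 1≤e 1≤j) (cong F (sym (P.*-assoc d e j) » cong (N._* j) (P.*-comm d e) » P.*-assoc e d j)) » ring 3 (\ a b c -> (a :+ b) :* c := a :* c :+ b :* c)) » S-+ (x ÷ e ÷ d) _ _ » cong (_+ S (x ÷ e ÷ d) (\ j -> lg j * F (e N.* (d N.* j)))) (S-*ˡ (x ÷ e ÷ d) (lg e) _)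
   outer : ∀ e -> 1 ≦ e -> e ≦ x -> Λ e * S (x ÷ e) (\ d -> μ d * (lg e * S (x ÷ e ÷ d) (\ j -> F (e N.* (d N.* j))) + S (x ÷ e ÷ d) (\ j -> lg j * F (e N.* (d N.* j))))) ≡
    Λ e * lg e * F e + Λ e * S (x ÷ e) (\ j -> Λ j * F (e N.* j))
   outer e 1≤e e≤x = cong (Λ e *_) (S-ext (x ÷ e) (\ d -> ring 4 (\ m l s t -> m :* (l :* s :+ t) := l :* (m :* s) :+ m :* t)) » S-+ (x ÷ e) _ _ » cong₂ _+_ (S-*ˡ (x ÷ e) (lg e) _ » cong (lg e *_) (möbius-inversion (x ÷ e) (\ j -> F (e N.* j)) (÷-pos 1≤e e≤x) » cong F (*-identityʳ e))) (μ-lg (x ÷ e) (\ j -> F (e N.* j)))) » ring 4 (\ a l f s -> a :* (l :* f :+ s) := a :* l :* f :+ a :* s)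
  Acls : ℕ -> ℕ -> Q
  Acls c x = S x (\ n -> Λ₂ n * ind c n)
  -- For d prime to ℓ the condition dm ≡ c is a single class for m, and two classes differ in count
  -- by at most 1. Against the increasing weight log² m this leaves 2 log²(x/d), and summing over d
  -- gives O(x). Multiples d of ℓ meet neither class.
  equidistribution : ∀ c c′ x -> ¬ (ℓ ∣ c) -> ¬ (ℓ ∣ c′) -> 1 ≦ x -> x ≦ N -> Acls c x - Acls c′ x ± # 16 * # x
  equidistribution c c′ x uc uc′ 1≤x x≤N = subst (_± # 16 * # x) (sym (Λ₂-möbius x F) » S-ext x (\ n -> ring 3 (\ l a b -> l :* (a :- b) := l :* a :- l :* b)) » S-- x _ _)
   (widen (S-± x (\ d 1≤d d≤x -> subst (μ d * S (x ÷ d) (\ m -> lg m * (lg m * F (d N.* m))) ±_) (ring 1 (\ b -> c1 :* b := b)) (±-* (±-abs (∣μ∣≤1 d)) (inner d 1≤d d≤x) (0≤# 1) (*≥0 (0≤# 2) (sq≥0 d 1≤d d≤x))))))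
   where
   F : ℕ -> Q
   F n = ind c n - ind c′ n
   l≥0 : ∀ d -> 1 ≦ d -> d ≦ x -> # 0 ≤ lg x - lg d
   l≥0 d 1≤d d≤x = lin 2 (\ a b -> a ≼ b ▸ ⊢ c0 ≼ b :- a) (lg-mono 1≤d d≤x x≤N)
   sq≥0 : ∀ d -> 1 ≦ d -> d ≦ x -> # 0 ≤ (lg x - lg d) * (lg x - lg d)
   sq≥0 d a b = *≥0 (l≥0 d a b) (l≥0 d a b)
   widen : ∀ {s} -> s ± S x (\ d -> # 2 * ((lg x - lg d) * (lg x - lg d))) -> s ± # 16 * # x
   widen (l , u) = ≤-trans (lin 2 (\ a b -> a ≼ b ▸ ⊢ ⊝ b ≼ ⊝ a) tot) l , ≤-trans u tot
    where
    tot : S x (\ d -> # 2 * ((lg x - lg d) * (lg x - lg d))) ≤ # 16 * # x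
    tot = eq≤ (S-*ˡ x (# 2) _) ≫ lin 2 (\ s x -> 2 · (s ≼ con 8 :* x) ▸ ⊢ c2 :* s ≼ con 16 :* x) (log²-sum x 1≤x x≤N)
   weigh : ∀ M -> 1 ≦ M -> M ≦ N -> ∀ (g : ℕ -> Q) -> (∀ i -> S i g ± # 1) -> S M (\ m -> lg m * (lg m * g m)) ± # 2 * # 1 * (lg M * lg M)
   weigh M 1≤M M≤N g hg = subst (_± # 2 * # 1 * (lg M * lg M)) (S-ext M (\ m -> *-assoc (lg m) (lg m) (g m))) (abel-bound M (\ m -> lg m * lg m) g (# 1) 1≤M (0≤# 1) (\ i _ _ -> hg i) (*≥0 lg1 lg1)
     (\ i 1≤i i<M -> *-mono-≤ (lg≥0 1≤i ((P.<⇒≤ i<M) ⋙ M≤N)) (lg≥0 z<s (i<M ⋙ M≤N)) (lg-mono 1≤i (n≤1+n i) (i<M ⋙ M≤N)) (lg-mono 1≤i (n≤1+n i) (i<M ⋙ M≤N))))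
    where lg1 = eq≥ lg-1
   inner : ∀ d -> 1 ≦ d -> d ≦ x -> S (x ÷ d) (\ m -> lg m * (lg m * F (d N.* m))) ± # 2 * ((lg x - lg d) * (lg x - lg d))
   inner d 1≤d d≤x = case ℓ ∣? d of \ where
      (yes p) -> subst (_± # 2 * ((lg x - lg d) * (lg x - lg d))) (sym (S-zero′ (x ÷ d) (\ m _ _ -> cong (\ z -> lg m * (lg m * z)) (cong₂ _-_ (kill p m c uc) (kill p m c′ uc′)) » ring 1 (\ a -> a :* (a :* (c0 :- c0)) := c0))))
       ( lin 1 (\ s -> 2 · (c0 ≼ s) ▸ ⊢ ⊝ (c2 :* s) ≼ c0) (sq≥0 d 1≤d d≤x) , lin 1 (\ s -> 2 · (c0 ≼ s) ▸ ⊢ c0 ≼ c2 :* s) (sq≥0 d 1≤d d≤x))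
      (no ¬p) -> let e = fst (solve-class d ¬p c) ; e′ = fst (solve-class d ¬p c′) in
       subst (_± # 2 * ((lg x - lg d) * (lg x - lg d))) (S-ext (x ÷ d) (\ m -> cong (\ z -> lg m * (lg m * z)) (cong₂ _-_ (sym (snd (solve-class d ¬p c) m)) (sym (snd (solve-class d ¬p c′) m)))))
        (grow (weigh (x ÷ d) (÷-pos 1≤d d≤x) ((÷-≤ x d) ⋙ x≤N) (\ m -> ind e m - ind e′ m) (count-diff e e′)))
    where
    kill : ℓ ∣ d -> ∀ m c -> ¬ (ℓ ∣ c) -> ind c (d N.* m) ≡ # 0
    kill p m c u = ind-0 {c} {d N.* m} (\ e -> u (∣-congₖ {d N.* m} {c} e (∣m⇒∣m*n m p)))
    lM≥0 = lg≥0 (÷-pos {x} 1≤d d≤x) ((÷-≤ x d) ⋙ x≤N)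
    lM≤ = Selberg.lg-floor x 1≤x x≤N d 1≤d d≤x
    sq : lg (x ÷ d) * lg (x ÷ d) ≤ (lg x - lg d) * (lg x - lg d)
    sq = *-mono-≤ lM≥0 (l≥0 d 1≤d d≤x) lM≤ lM≤
    grow : ∀ {s} -> s ± # 2 * # 1 * (lg (x ÷ d) * lg (x ÷ d)) -> s ± # 2 * ((lg x - lg d) * (lg x - lg d))
    grow (l , u) = lin 3 (\ s a b -> ⊝ (c2 :* c1 :* a) ≼ s ▸ 2 · (a ≼ b) ▸ ⊢ ⊝ (c2 :* b) ≼ s) l sq
           , lin 3 (\ s a b -> s ≼ c2 :* c1 :* a ▸ 2 · (a ≼ b) ▸ ⊢ s ≼ c2 :* b) u sq
  dv : ℕ -> Q
  dv n = when (does (ℓ ∣? n)) (# 1)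
  dv-yes : ∀ {n} -> ℓ ∣ n -> dv n ≡ # 1
  dv-yes {n} d = cong (\ b -> when b (# 1)) (is-yes (ℓ ∣? n) d)
  dv-no : ∀ {n} -> ¬ (ℓ ∣ n) -> dv n ≡ # 0
  dv-no {n} d = cong (\ b -> when b (# 1)) (is-no (ℓ ∣? n) d)
  dv≥0 : ∀ n -> # 0 ≤ dv n
  dv≥0 n = when-nonneg (does (ℓ ∣? n)) (0≤# 1)
  unit-sum : ∀ n -> S φ (\ i -> ind (a N.^ i) n) ≡ # 1 - dv n
  unit-sum n = case ℓ ∣? n of \ where
   (yes p) -> S-zero′ φ (\ i _ _ -> ind-0 {a N.^ i} {n} (\ e -> unit-^ i (∣-congₖ {n} {a N.^ i} e p))) » ring 0 (c0 := c1 :- c1) » cong (\ z -> # 1 - z) (sym (dv-yes p))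
   (no ¬p) -> let i₀ = fst (log n ¬p) ; 1≤i₀ = fst (snd (log n ¬p)) ; i₀≤φ = fst (snd (snd (log n ¬p))) ; n≡ = snd (snd (snd (log n ¬p))) in
    trans (S-cong φ (\ i 1≤i i≤φ -> cong (\ b -> when b (# 1)) (does-⇔ (n % k N.≟ (a N.^ i) % k) (i N.≟ i₀) (\ e -> distinct i i₀ 1≤i i≤φ 1≤i₀ i₀≤φ (sym e » n≡)) (\ { refl -> n≡ })))) (S-delta φ i₀ (\ _ -> # 1) 1≤i₀ i₀≤φ » ring 0 (c1 := c1 :- c0) » cong (\ z -> # 1 - z) (sym (dv-no ¬p)))
  prime-power-sum : ∀ x (f : ℕ -> Q) -> (∀ n -> # 0 ≤ f n) ->
   S x (\ n -> Λ n * (dv n * f n)) ≤ S x (\ j -> when (does (ℓ N.^ j N.≤? x)) (h ℓ * f (ℓ N.^ j)))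
  prime-power-sum x f f≥0 = eq≤ (Λ-sum x (\ n -> dv n * f n) » S-ext x row) ≫ (case ℓ N.≤? x of \ where
    (yes p) -> eq≤ (S-delta x ℓ (\ _ -> Z′) (prime≥1 ℓ-prime) p)
    (no ¬p) -> eq≤ (S-delta-none x ℓ (\ _ -> Z′) (\ { (_ , p) -> ¬p p })) ≫ S-nonneg x (\ j _ _ -> when-nonneg (does (ℓ N.^ j N.≤? x)) (*≥0 (h-nonneg ℓ ℓ-prime) (f≥0 _))))
   where
   Z′ = S x (\ j -> when (does (ℓ N.^ j N.≤? x)) (h ℓ * f (ℓ N.^ j)))
   row : ∀ p -> S x (\ j -> when (does (prime? p ×-dec (p N.^ j N.≤? x))) (h p * (dv (p N.^ j) * f (p N.^ j)))) ≡ when (does (p N.≟ ℓ)) Z′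
   row p = case p N.≟ ℓ of \ where
     (yes refl) -> S-cong x (\ j 1≤j _ -> cong₂ when (does-⇔ (prime? ℓ ×-dec (ℓ N.^ j N.≤? x)) (ℓ N.^ j N.≤? x) snd (\ q -> ℓ-prime , q)) (cong (h ℓ *_) (cong (_* f (ℓ N.^ j)) (dv-yes (ℓ∣ℓ^ j 1≤j)) » ring 1 (\ a -> c1 :* a := a)))) » cong (\ b -> when b Z′) (sym (is-yes (ℓ N.≟ ℓ) refl))
     (no  ne)   -> S-zero′ x (\ j _ _ -> other p ne j (prime? p)) » cong (\ b -> when b Z′) (sym (is-no (p N.≟ ℓ) ne))
    where
    ℓ∣ℓ^ : ∀ j -> 1 ≦ j -> ℓ ∣ ℓ N.^ j
    ℓ∣ℓ^ (suc j) _ = m∣m*n (ℓ N.^ j)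
    other : ∀ p -> ¬ (p ≡ ℓ) -> ∀ j (d : Dec (Prime p)) -> when (does (d ×-dec (p N.^ j N.≤? x))) (h p * (dv (p N.^ j) * f (p N.^ j))) ≡ # 0
    other p ne j (no _)   = refl
    other p ne j (yes pp) = cong (when _) (cong (\ z -> h p * (z * f (p N.^ j))) (dv-no (\ d -> ne (sym (prime-∣-^ j pp ℓ-prime d)))) » ring 2 (\ a b -> a :* (c0 :* b) := c0)) » when-0 _
  geometric : ∀ K -> S K (\ j -> inv (ℓ N.^ j)) ≤ # 1 - inv (ℓ N.^ K)
  geometric zero    = eq≤ (ring 0 (c0 := c1 :- c1)) ≫ eq≤ (cong (\ z -> # 1 - z) (sym inv-1))
  geometric (suc K) = lin 3 (\ s u v -> s ≼ c1 :- u ▸ c2 :* v ≼ u ▸ ⊢ s :+ v ≼ c1 :- v) (geometric K) (*≤ˡ (inv≥0 (ℓ N.^ suc K)) (#-mono (prime≥2 ℓ-prime)) ≫ eq≤ (cong (# ℓ *_) (inv-mul-≥1 (prime≥1 ℓ-prime) (^-≥1 K (prime≥1 ℓ-prime))) » sym (*-assoc (# ℓ) (inv ℓ) (inv (ℓ N.^ K))) » cong (_* inv (ℓ N.^ K)) (inv-cancel (prime≥1 ℓ-prime)) » ring 1 (\ a -> c1 :* a := a)))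
  lg-ℓ^ : ∀ j -> lg (ℓ N.^ j) ≡ # j * h ℓ
  lg-ℓ^ j = lg-^ ℓ j (prime≥1 ℓ-prime) » cong (# j *_) (additive-prime h ℓ-prime)
  ψℓ≤ : ∀ x -> 1 ≦ x -> x ≦ N -> S x (\ n -> Λ n * dv n) ≤ lg x
  ψℓ≤ x 1≤x x≤N = eq≤ (S-ext x (\ n -> ring 2 (\ a d -> a :* d := a :* (d :* c1)))) ≫ prime-power-sum x (\ _ -> # 1) (\ _ -> 0≤# 1) ≫ go x
   where
   go : ∀ K -> S K (\ j -> when (does (ℓ N.^ j N.≤? x)) (h ℓ * # 1)) ≤ lg x
   go zero    = lg≥0 1≤x x≤N
   go (suc K) = case ℓ N.^ suc K N.≤? x of \ where
    (yes p) -> S-mono (suc K) (\ j _ _ -> when-≤ (does (ℓ N.^ j N.≤? x)) (*≥0 (h-nonneg ℓ ℓ-prime) (0≤# 1)) ≫ eq≤ (ring 1 (\ a -> a :* c1 := a))) ≫ eq≤ (S-const (suc K) (h ℓ) » sym (lg-ℓ^ (suc K))) ≫ lg-mono (^-≥1 (suc K) (prime≥1 ℓ-prime)) p x≤N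
    (no ¬p) -> eq≤ (cong (\ b -> S K (\ j -> when (does (ℓ N.^ j N.≤? x)) (h ℓ * # 1)) + when b (h ℓ * # 1)) (is-no (ℓ N.^ suc K N.≤? x) ¬p) » ring 1 (\ a -> a :+ c0 := a)) ≫ go K
  qℓ≤ : ∀ x -> S x (\ n -> Λ n * (dv n * inv n)) ≤ h ℓ
  qℓ≤ x = prime-power-sum x inv inv≥0 ≫ S-mono x (\ j _ _ -> when-≤ (does (ℓ N.^ j N.≤? x)) (*≥0 (h-nonneg ℓ ℓ-prime) (inv≥0 _))) ≫ eq≤ (S-*ˡ x (h ℓ) _) ≫ *≤ʳ (h-nonneg ℓ ℓ-prime) (geometric x) ≫ lin 2 (\ h i -> c0 ≼ h :* i ▸ ⊢ h :* (c1 :- i) ≼ h) (*≥0 (h-nonneg ℓ ℓ-prime) (inv≥0 (ℓ N.^ x)))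
  module _ (ℓ≤N : ℓ ≦ N) where
   hℓ≤ : h ℓ ≤ # ℓ
   hℓ≤ = eq≥ (additive-prime h ℓ-prime) ≫ lg≤id ℓ (prime≥1 ℓ-prime) ℓ≤N
   -- Among multiples of ℓ, Λ lives on powers of ℓ only, with ψ-mass at most log x and ∑ Λ(n)/n at
   -- most h(ℓ). A product lies in this set only if a factor does.
   nonunits : ∀ x -> 1 ≦ x -> x ≦ N -> S x (\ n -> Λ₂ n * dv n) ≤ # (8 N.+ 12 N.* ℓ) * # x
   nonunits x 1≤x x≤N = eq≤ (S-ext x (\ n -> ring 4 (\ a l b d -> (a :* l :+ b) :* d := a :* d :* l :+ b :* d)) » S-+ x _ _) ≫ lin 7 (\ s t l u q L X -> s ≼ l :* l ▸ l :* l ≼ con 8 :* X ▸ t ≼ c2 :* u ▸ 2 · (u ≼ con 6 :* X :* q) ▸ 2 · (con 6 :* X :* q ≼ con 6 :* X :* L) ▸ ⊢ s :+ t ≼ (con 8 :+ con 12 :* L) :* X)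
      first l²≤ second third (*≤ʳ (*≥0 (0≤# 6) (0≤# x)) (qℓ≤ x ≫ hℓ≤)) ≫ eq≤ (cong (_* # x) (sym ((#-+ 8 (12 N.* ℓ)) » cong (# 8 +_) (#-* 12 ℓ))))
    where
    first : S x (\ n -> Λ n * dv n * lg n) ≤ lg x * lg x
    first = S-mono x (\ n 1≤n n≤x -> *≤ʳ (*≥0 (Λ≥0 n) (dv≥0 n)) (lg-mono 1≤n n≤x x≤N)) ≫ eq≤ (S-*ʳ x (lg x) _) ≫ *≤ˡ (lg≥0 1≤x x≤N) (ψℓ≤ x 1≤x x≤N)
    l²≤ : lg x * lg x ≤ # 8 * # x
    l²≤ = (eq≤ (ring 1 (\ l -> l :* l := (l :- c0) :* (l :- c0)) » cong (\ z -> (lg x - z) * (lg x - z)) (sym lg-1)) ≫ S-first x 1≤x (\ d -> (lg x - lg d) * (lg x - lg d)) (\ d 1≤d d≤x -> let t = lin 2 (\ a b -> a ≼ b ▸ ⊢ c0 ≼ b :- a) (lg-mono 1≤d d≤x x≤N) in *≥0 t t)) ≫ log²-sum x 1≤x x≤N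
     where
     S-first : ∀ x -> 1 ≦ x -> (f : ℕ -> Q) -> (∀ d -> 1 ≦ d -> d ≦ x -> # 0 ≤ f d) -> f 1 ≤ S x f
     S-first (suc n) _ f p = lin 2 (\ a b -> c0 ≼ b ▸ ⊢ a ≼ a :+ b) (S-nonneg n (\ i 1≤i i≤n -> p (suc i) z<s (s≤s i≤n))) ≫ eq≥ (S-shift n f)
    U = S x (\ n -> Λ n * dv n * ψ (x ÷ n))
    dv-* : ∀ m n -> dv (m N.* n) ≤ dv m + dv n
    dv-* m n = case ℓ ∣? m N.* n of \ where
     (no ¬p) -> eq≤ (dv-no ¬p) ≫ +-nonneg (dv≥0 m) (dv≥0 n)
     (yes p) -> case euclidsLemma m n ℓ-prime p of \ where
      (inj₁ d) -> lin 3 (\ a b c -> a ≼ c1 ▸ c1 ≼ b ▸ c0 ≼ c ▸ ⊢ a ≼ b :+ c) (eq≤ (dv-yes p)) (eq≥ (dv-yes d)) (dv≥0 n)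
      (inj₂ d) -> lin 3 (\ a b c -> a ≼ c1 ▸ c1 ≼ c ▸ c0 ≼ b ▸ ⊢ a ≼ b :+ c) (eq≤ (dv-yes p)) (eq≥ (dv-yes d)) (dv≥0 m)
    second : S x (\ n -> Λ*Λ n * dv n) ≤ # 2 * U
    second = eq≤ (Λ*Λ-sum x dv) ≫ S-mono x (\ m _ _ -> *≤ʳ (Λ≥0 m) (S-mono (x ÷ m) (\ j _ _ -> *≤ʳ (Λ≥0 j) (dv-* m j)))) ≫ eq≤ (S-ext x (\ m -> cong (Λ m *_) (S-ext (x ÷ m) (\ j -> ring 3 (\ a b c -> a :* (b :+ c) := b :* a :+ a :* c)) » S-+ (x ÷ m) _ _ » cong (_+ S (x ÷ m) (\ j -> Λ j * dv j)) (S-*ˡ (x ÷ m) (dv m) Λ)) » ring 4 (\ a d p t -> a :* (d :* p :+ t) := a :* d :* p :+ a :* t)) » S-+ x _ _ » cong (U +_) (S-ext x (\ m -> sym (S-*ˡ (x ÷ m) (Λ m) _)) » hyperbola-swap x (\ m j -> Λ m * (Λ j * dv j)) » S-ext x (\ j -> S-*ʳ (x ÷ j) (Λ j * dv j) Λ » *-comm _ _)) » ring 1 (\ u -> u :+ u := c2 :* u))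
    third : U ≤ # 6 * # x * S x (\ n -> Λ n * (dv n * inv n))
    third = S-mono x (\ n 1≤n _ -> *≤ʳ (*≥0 (Λ≥0 n) (dv≥0 n)) (ψ≤6 (x ÷ n) ((÷-≤ x n) ⋙ x≤N) ≫ *≤ʳ (0≤# 6) (÷-upperQ x n 1≤n))) ≫ eq≤ (S-ext x (\ n -> ring 4 (\ a d x i -> a :* d :* (con 6 :* (x :* i)) := con 6 :* x :* (a :* (d :* i)))) » S-*ˡ x (# 6 * # x) _)
   C₃ : ℕ
   C₃ = 115 N.+ (16 N.* φ N.+ (8 N.+ 12 N.* ℓ))
   #C₃ : # C₃ ≡ # 115 + (# 16 * # φ + # (8 N.+ 12 N.* ℓ))
   #C₃ = (#-+ 115 _) » cong (# 115 +_) ((#-+ (16 N.* φ) _) » cong (_+ # (8 N.+ 12 N.* ℓ)) (#-* 16 φ))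
   -- One class is compared with the average over all φ unit classes, which together make up the
   -- full `Λ₂` sum minus the multiples of ℓ.
   selberg-class : ∀ c x -> ¬ (ℓ ∣ c) -> 1 ≦ x -> x ≦ N -> # φ * Acls c x - # 2 * (# x * lg x) ± # C₃ * # x
   selberg-class c x uc 1≤x x≤N = subst (\ z -> # φ * Acls c x - # 2 * (# x * lg x) ± z * # x) (sym #C₃)
    ( lin 8 (\ p A t w n X l C -> ⊝ (p :* (con 16 :* X)) ≼ p :* A :- t ▸ w :- n ≼ t ▸ n ≼ C :* X ▸ ⊝ (con 115 :* X) ≼ w :- c2 :* (X :* l) ▸ ⊢ ⊝ ((con 115 :+ (con 16 :* p :+ C)) :* X) ≼ p :* A :- c2 :* (X :* l))
      (fst spread) (eq≥ total) (nonunits x 1≤x x≤N) (fst (Λ₂-approx x 1≤x x≤N))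
    , lin 8 (\ p A t w n X l C -> p :* A :- t ≼ p :* (con 16 :* X) ▸ t ≼ w :- n ▸ c0 ≼ n ▸ w :- c2 :* (X :* l) ≼ con 115 :* X ▸ c0 ≼ C :* X ▸ ⊢ p :* A :- c2 :* (X :* l) ≼ (con 115 :+ (con 16 :* p :+ C)) :* X)
      (snd spread) (eq≤ total) (S-nonneg x (\ n 1≤n n≤x -> *≥0 (+-nonneg (*≥0 (Λ≥0 n) (lg≥0 1≤n (n≤x ⋙ x≤N))) (Λ*Λ≥0 n)) (dv≥0 n))) (snd (Λ₂-approx x 1≤x x≤N)) (*≥0 (0≤# (8 N.+ 12 N.* ℓ)) (0≤# x)))
    where
    tot = S φ (\ i -> Acls (a N.^ i) x)
    total : tot ≡ S x Λ₂ - S x (\ n -> Λ₂ n * dv n)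
    total = S-swap φ x _ » S-ext x (\ n -> S-*ˡ φ (Λ₂ n) _ » cong (Λ₂ n *_) (unit-sum n) » ring 2 (\ a d -> a :* (c1 :- d) := a :- a :* d)) » S-- x _ _
    spread : # φ * Acls c x - tot ± # φ * (# 16 * # x)
    spread = subst₂ _±_ (S-- φ _ _ » cong (_- tot) (S-const φ (Acls c x))) (S-const φ (# 16 * # x)) (S-± φ (\ i _ _ -> equidistribution c (a N.^ i) x uc (unit-^ i) 1≤x x≤N))
   Wcls : ℕ -> ℕ -> Q
   Wcls c x = S x (\ n -> Λ₂ n * ind c n * inv n)
   C₄ : ℕ
   C₄ = 18 N.+ 5 N.* C₃
   weight-step : ∀ i -> 1 ≦ i -> # i * (inv i - inv (suc i)) ≡ inv (suc i)
   weight-step i 1≤i = ring 3 (\ n a b -> n :* (a :- b) := n :* a :- ((n :+ c1) :* b) :+ b) » cong₂ (\ u v -> u - v + inv (suc i)) (inv-cancel 1≤i) (cong (_* inv (suc i)) (sym (#-suc i)) » inv-inverse i) » ring 1 (\ b -> c1 :- c1 :+ b := b)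
   inv-drop : ∀ i -> 1 ≦ i -> # 0 ≤ inv i - inv (suc i)
   inv-drop (suc i) _ = lin 2 (\ a b -> b ≼ a ▸ ⊢ c0 ≼ a :- b) (inv-antimono {i} (n≤1+n (suc i)))
   lg-sum-bounds : ∀ m -> suc m ≦ N -> # 2 * S m (\ i -> inv (suc i) * lg i) - lg (suc m) * lg (suc m) ± # 16 * lg (suc m) + # 8
   lg-sum-bounds m x≤N =
     ≤-trans (lin 3 (\ t l s -> l :* l :- con 8 :- con 6 :* l ≼ c2 :* s ▸ 10 · (c0 ≼ l) ▸ 0 · (t ≼ t) ▸ ⊢ ⊝ (con 16 :* l :+ con 8) ≼ c2 :* s :- l :* l) lower (lg≥0 {suc m} z<s x≤N) (≤-refl {# 0})) ≤-refl
    , lin 3 (\ s t l -> 2 · (s ≼ t) ▸ c2 :* t ≼ l :* l :+ con 16 :* l :+ con 8 ▸ ⊢ c2 :* s :- l :* l ≼ con 16 :* l :+ con 8) upper (lg-inv-sum (suc m) z<s x≤N)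
    where
    x = suc m
    upper : S m (\ i -> inv (suc i) * lg i) ≤ S x (\ n -> lg n * inv n)
    upper = S-mono m (\ i 1≤i i≤m -> *≤ʳ (inv≥0 (suc i)) (lg-mono 1≤i (n≤1+n i) (s≤s i≤m ⋙ x≤N)) ≫ eq≤ (*-comm _ _)) ≫ lin 2 (\ a s -> c0 ≼ a ▸ ⊢ s ≼ a :+ s) (*≥0 (eq≥ lg-1) (inv≥0 1)) ≫ eq≥ (S-shift m (\ n -> lg n * inv n))
    cell : ∀ i -> 1 ≦ i -> i ≦ m -> (lg (suc i) * lg (suc i) - lg i * lg i) - (# 8 + # 6 * lg x) * (- inv (suc i) - - inv i) ≤ # 2 * (inv (suc i) * lg i)
    cell i 1≤i i≤m = lin 6 (\ a b j c L h -> 2 · (b :* ⊝ (c3 :* (j :- c)) ≼ b :* ((h :+ c :- a) :- (h :- b))) ▸ (a :- b) :* (a :- b) ≼ c2 :* j :* (c2 :* j) ▸ 4 · (j :* j ≼ j :* (c2 :* c)) ▸ 8 · (j :* c ≼ j :- c) ▸ 6 · (b :* (j :- c) ≼ L :* (j :- c)) ▸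
      ⊢ (a :* a :- b :* b) :- (con 8 :+ con 6 :* L) :* (⊝ c :- ⊝ j) ≼ c2 :* (c :* b)) (*≤ʳ (lg≥0 1≤i (P.<⇒≤ i<N)) (fst (A-step i 1≤i i<N))) (*-mono-≤ (Δ≥0 i 1≤i i<N) (*≥0 (0≤# 2) (inv≥0 i)) (Δ≤2inv i 1≤i i<N) (Δ≤2inv i 1≤i i<N)) (*≤ʳ (inv≥0 i) (inv≤2inv i 1≤i)) (eq≥ (inv-diff i 1≤i)) (*≤ˡ (inv-drop i 1≤i) (lg-mono 1≤i (m≤n⇒m≤1+n i≤m) x≤N))
     where i<N = P.<-≤-trans (s≤s i≤m) x≤N
    lower : lg x * lg x - # 8 - # 6 * lg x ≤ # 2 * S m (\ i -> inv (suc i) * lg i)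
    lower = lin 4 (\ l z i o -> z :* z ≼ c0 ▸ o ≼ c1 ▸ c0 ≼ (con 8 :+ con 6 :* l) :* i ▸ 7 · (c0 ≼ (c1 :- o)) ▸ 6 · (l :* o ≼ l :* c1) ▸ ⊢ l :* l :- con 8 :- con 6 :* l ≼ (l :* l :- z :* z) :- (con 8 :+ con 6 :* l) :* (⊝ i :- ⊝ o)) (eq≤ (cong (\ z -> z * z) lg-1 » ring 0 (c0 :* c0 := c0))) (eq≤ inv-1) (*≥0 (+-nonneg (0≤# 8) (*≥0 (0≤# 6) (lg≥0 {x} z<s x≤N))) (inv≥0 x)) (eq≤ (ring 0 (c0 := c1 :- c1) » cong (\ z -> # 1 - z) (sym inv-1))) (*≤ʳ (lg≥0 {x} z<s x≤N) (eq≤ inv-1)) ≫ eq≥ (S-- m _ _ » cong₂ _-_ (S-telescope m (\ i -> lg i * lg i)) (S-*ˡ m (# 8 + # 6 * lg x) _ » cong ((# 8 + # 6 * lg x) *_) (S-telescope m (\ i -> - inv i)))) ≫ S-mono m cell ≫ eq≤ (S-*ˡ m (# 2) _)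
   -- Partial summation of `selberg-class` against 1/n; the main term 2∑ log i/(i+1) is log² x up to
   -- O(log x).
   weighted : ∀ c x -> ¬ (ℓ ∣ c) -> 1 ≦ x -> x ≦ N -> # φ * Wcls c x - lg x * lg x ± # C₄ * (lg x + # 1)
   weighted c x@(suc m) uc 1≤x x≤N = subst (\ z -> # φ * Wcls c x - lg x * lg x ± z * (lg x + # 1)) (sym ((#-+ 18 (5 N.* C₃)) » cong (# 18 +_) (#-* 5 C₃)))
    ( lin 8 (\ p t u s l C h z -> t :+ u ≼ p ▸ ⊝ C ≼ t :- c2 :* l ▸ ⊝ (C :* (h :- c1)) ≼ u :- c2 :* s ▸ ⊝ (con 16 :* l :+ con 8) ≼ c2 :* s :- l :* l ▸ C :* (h :- l) ≼ C :* c4 ▸ 4 · (c0 ≼ C :* l) ▸ c0 ≼ C ▸ 4 · (c0 ≼ l) ▸ 0 · (z ≼ z) ▸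
       ⊢ ⊝ ((con 18 :+ con 5 :* C) :* (l :+ c1)) ≼ p :- l :* l) (eq≥ e) (fst top) (fst rest) (fst (lg-sum-bounds m x≤N)) Hx (*≥0 (0≤# C₃) l≥0) (0≤# C₃) l≥0 (≤-refl {# 0})
    , lin 8 (\ p t u s l C h z -> p ≼ t :+ u ▸ t :- c2 :* l ≼ C ▸ u :- c2 :* s ≼ C :* (h :- c1) ▸ c2 :* s :- l :* l ≼ con 16 :* l :+ con 8 ▸ C :* (h :- l) ≼ C :* c4 ▸ 4 · (c0 ≼ C :* l) ▸ c0 ≼ C ▸ 0 · (c0 ≼ l) ▸ 0 · (z ≼ z) ▸
       ⊢ p :- l :* l ≼ (con 18 :+ con 5 :* C) :* (l :+ c1)) (eq≤ e) (snd top) (snd rest) (snd (lg-sum-bounds m x≤N)) Hx (*≥0 (0≤# C₃) l≥0) (0≤# C₃) l≥0 (≤-refl {# 0}))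
    where
    l≥0 = lg≥0 1≤x x≤N
    Ac : ℕ -> Q
    Ac = Acls c
    Hx : # C₃ * (H x - lg x) ≤ # C₃ * # 4
    Hx = *≤ʳ (0≤# C₃) (snd (A-bound 1≤x x≤N))
    e : # φ * Wcls c x ≡ inv x * (# φ * Ac x) + S m (\ i -> (inv i - inv (suc i)) * (# φ * Ac i))
    e = cong (# φ *_) (S-ext x (\ n -> *-comm (Λ₂ n * ind c n) (inv n)) » S-abel m inv (\ n -> Λ₂ n * ind c n)) » ring 4 (\ p i a s -> p :* (i :* a :- s) := i :* (p :* a) :+ p :* ⊝ s) » cong (inv x * (# φ * Ac x) +_) (cong (# φ *_) (sym (S-neg m _)) » sym (S-*ˡ m (# φ) _) » S-ext m (\ i -> ring 4 (\ p a b c -> p :* ⊝ ((b :- a) :* c) := (a :- b) :* (p :* c))))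
    scale : ∀ {c a b} -> # 0 ≤ c -> a ± b -> c * a ± c * b
    scale h (l , u) = ≤-trans (eq≤ (ring 2 (\ c b -> ⊝ (c :* b) := c :* ⊝ b))) (*≤ʳ h l) , *≤ʳ h u
    top : inv x * (# φ * Ac x) - # 2 * lg x ± # C₃
    top = subst₂ _±_ (ring 4 (\ i p X l -> i :* (p :- c2 :* (X :* l)) := i :* p :- c2 :* ((X :* i) :* l)) » cong (\ z -> inv x * (# φ * Ac x) - # 2 * z) (cong (_* lg x) (inv-cancel 1≤x) » ring 1 (\ a -> c1 :* a := a))) (ring 3 (\ i c X -> i :* (c :* X) := c :* (X :* i)) » cong (# C₃ *_) (inv-cancel 1≤x) » ring 1 (\ a -> a :* c1 := a))
     (scale (inv≥0 x) (selberg-class c x uc 1≤x x≤N))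
    rest : S m (\ i -> (inv i - inv (suc i)) * (# φ * Ac i)) - # 2 * S m (\ i -> inv (suc i) * lg i) ± # C₃ * (H x - # 1)
    rest = subst₂ _±_ (S-- m _ _ » cong (\ z -> S m (\ i -> (inv i - inv (suc i)) * (# φ * Ac i)) - z) (S-*ˡ m (# 2) _)) (S-*ˡ m (# C₃) _ » cong (# C₃ *_) (ring 1 (\ s -> s := (c1 :+ s) :- c1) » cong (_- # 1) (cong (_+ S m (\ i -> inv (suc i))) (sym inv-1) » sym (S-shift m inv)))) (S-± m (\ i 1≤i i≤m -> subst₂ _±_ (ring 5 (\ a b p n l -> (a :- b) :* (p :- c2 :* (n :* l)) := (a :- b) :* p :- c2 :* ((n :* (a :- b)) :* l)) » cong (\ z -> (inv i - inv (suc i)) * (# φ * Ac i) - # 2 * (z * lg i)) (weight-step i 1≤i)) (ring 4 (\ a b c n -> (a :- b) :* (c :* n) := c :* (n :* (a :- b))) » cong (# C₃ *_) (weight-step i 1≤i))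
       (scale (inv-drop i 1≤i) (selberg-class c i uc 1≤i (m≤n⇒m≤1+n i≤m ⋙ x≤N)))))
   ψcls : ℕ -> ℕ -> Q
   ψcls c x = S x (\ n -> Λ n * ind c n)
   Qcls : ℕ -> ℕ -> Q
   Qcls c x = S x (\ n -> Λ n * (ind c n * inv n))
   ψcls≥0 : ∀ c x -> # 0 ≤ ψcls c x
   ψcls≥0 c x = S-nonneg x (\ n _ _ -> *≥0 (Λ≥0 n) (ind≥0 c n))
   Qcls≥0 : ∀ c x -> # 0 ≤ Qcls c x
   Qcls≥0 c x = S-nonneg x (\ n _ _ -> *≥0 (Λ≥0 n) (*≥0 (ind≥0 c n) (inv≥0 n)))
   Qcls-mono : ∀ c {x y} -> x ≦ y -> Qcls c x ≤ Qcls c y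
   Qcls-mono c h = S-mono-range h (\ n -> *≥0 (Λ≥0 n) (*≥0 (ind≥0 c n) (inv≥0 n)))
   ψcls≤ψ : ∀ c x -> ψcls c x ≤ ψ x
   ψcls≤ψ c x = S-mono x (\ n _ _ -> *≤ʳ (Λ≥0 n) (ind≤1 c n) ≫ eq≤ (ring 1 (\ a -> a :* c1 := a)))
   C₅ : ℕ
   C₅ = C₃ N.+ 12 N.* φ
   -- Dropping the nonnegative Λ ∗ Λ from the class sum leaves an upper bound of twice the expected
   -- density.
   ψcls-bound : ∀ c y -> ¬ (ℓ ∣ c) -> 1 ≦ y -> y ≦ N -> # φ * (lg y * ψcls c y) ≤ # 2 * (# y * lg y) + # C₅ * # y
   ψcls-bound c y uc 1≤y y≤N = lin 7 (\ p t A d y l C -> p :* t ≼ p :* (A :+ con 12 :* y) ▸ p :* A :- c2 :* (y :* l) ≼ C :* y ▸ 0 · (d ≼ d) ▸ ⊢ p :* t ≼ c2 :* (y :* l) :+ (C :+ con 12 :* p) :* y) (*≤ʳ (0≤# φ) split) (snd (selberg-class c y uc 1≤y y≤N)) (≤-refl {# 0}) ≫ eq≤ (cong (\ z -> # 2 * (# y * lg y) + z * # y) (sym ((#-+ C₃ (12 N.* φ)) » cong (# C₃ +_) (#-* 12 φ))))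
    where
    split : lg y * ψcls c y ≤ Acls c y + # 12 * # y
    split = eq≤ (sym (S-*ˡ y (lg y) _) » S-ext y (\ n -> ring 4 (\ l a i m -> l :* (a :* i) := a :* m :* i :+ a :* (l :- m) :* i)) » S-+ y _ _) ≫ +-mono-≤ (S-mono y (\ n 1≤n n≤y -> *≤ˡ (ind≥0 c n) (lin 2 (\ a b -> c0 ≼ b ▸ ⊢ a ≼ a :+ b) (Λ*Λ≥0 n)))) (S-mono y (\ n 1≤n n≤y -> *≤ʳ (*≥0 (Λ≥0 n) (lin 2 (\ a b -> a ≼ b ▸ ⊢ c0 ≼ b :- a) (lg-mono 1≤n n≤y y≤N))) (ind≤1 c n) ≫ eq≤ (ring 1 (\ a -> a :* c1 := a))) ≫ Λlog≤ y 1≤y y≤N)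
   module Upper (E : ℕ) (1≤E : 1 ≦ E) where
    e : Q
    e = inv E
    Y₀ KE K₆ : ℕ
    Y₀ = 2 N.^ (4 N.* (C₅ N.* E))
    KE = φ N.* (6 N.* Y₀)
    K₆ = 12 N.* φ N.+ (24 N.+ KE)
    density : ∀ c y -> ¬ (ℓ ∣ c) -> 1 ≦ y -> y ≦ N -> # φ * ψcls c y ≤ (# 2 + e) * # y + # KE
    density c y uc 1≤y y≤N = case Y₀ N.≤? y of \ where
       (yes big) -> *-cancelˡ-≤ {lg y} (lg>0 big) (lin 7 (\ l p s y C i E -> p :* (l :* s) ≼ c2 :* (y :* l) :+ C :* y ▸ y :* (C :* (E :* i)) ≼ y :* (l :* i) ▸ C :* y :* c1 ≼ C :* y :* (E :* i) ▸ ⊢ l :* (p :* s) ≼ l :* ((c2 :+ i) :* y))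
          (ψcls-bound c y uc 1≤y y≤N) (*≤ʳ (0≤# y) (eq≥ (*-assoc (# C₅) (# E) (inv E)) ≫ *≤ˡ (inv≥0 E) (lgy big))) (*≤ʳ (*≥0 (0≤# C₅) (0≤# y)) (eq≥ (inv-cancel 1≤E)))) ≫ lin 2 (\ a b -> c0 ≼ b ▸ ⊢ a ≼ a :+ b) (0≤# KE)
       (no  few) -> *≤ʳ (0≤# φ) (ψcls≤ψ c y ≫ ψ≤6 y y≤N ≫ *≤ʳ (0≤# 6) (#-mono (P.<⇒≤ (P.≰⇒> few)))) ≫ eq≥ ((#-* φ (6 N.* Y₀)) » cong (# φ *_) (#-* 6 Y₀)) ≫ lin 2 (\ a b -> c0 ≼ b ▸ ⊢ a ≼ b :+ a) (*≥0 (+-nonneg (0≤# 2) (inv≥0 E)) (0≤# y))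
     where
     lgy : Y₀ ≦ y -> # C₅ * # E ≤ lg y
     lgy big = eq≥ (#-* C₅ E) ≫ lg-2^≥ (C₅ N.* E) ≫ lg-mono (^-≥1 (4 N.* (C₅ N.* E)) z<s) big y≤N
     lg>0 : Y₀ ≦ y -> # 0 < lg y
     lg>0 big z = #-pos 0 (#-mono {1} (*-≥1 {C₅} {E} z<s 1≤E) ≫ eq≤ (#-* C₅ E) ≫ lgy big ≫ z)
    -- Partial summation of `density`, organised as the monotonicity in j of (2+e)H(j) - KE/j -
    -- φ(Q(j) - ψ(j)/j).
    interval : ∀ c y z -> ¬ (ℓ ∣ c) -> 1 ≦ z -> z ≦ y -> y ≦ N -> # φ * (Qcls c y - Qcls c z) ≤ (# 2 + e) * (lg y - lg z) + # (6 N.* φ N.+ (24 N.+ KE))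
    interval c y z uc 1≤z z≤y y≤N =
     lin 13 (\ p q z s a f h b l c K i d -> f :* b :- K :* d :- p :* (z :- a) ≼ f :* h :- K :* i :- p :* (q :- s) ▸ p :* s ≼ p :* con 6 ▸ c0 ≼ p :* a ▸ f :* (h :- b) ≼ f :* (l :- c :+ con 8) ▸ 8 · (f ≼ c3) ▸ c0 ≼ K :* i ▸ K :* d ≼ K :* c1 ▸
        ⊢ p :* (q :- z) ≼ f :* (l :- c) :+ (con 6 :* p :+ (con 24 :+ K)))
       (mono-steps (\ j -> (# 2 + e) * H j - # KE * inv j - # φ * (Qcls c j - inv j * ψcls c j)) z≤y stp) (*≤ʳ (0≤# φ) sy≤) (*≥0 (0≤# φ) (*≥0 (inv≥0 z) (ψcls≥0 c z))) (*≤ʳ f≥0 Hd) (lin 1 (\ i -> i ≼ c1 ▸ ⊢ c2 :+ i ≼ c3) (inv≤1 E)) (*≥0 (0≤# KE) (inv≥0 y)) (*≤ʳ (0≤# KE) (inv≤1 z)) ≫ eq≤ (cong ((# 2 + e) * (lg y - lg z) +_) (sym ((#-+ (6 N.* φ) _) » cong₂ _+_ (#-* 6 φ) (#-+ 24 KE))))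
     where
     f≥0 : # 0 ≤ # 2 + e
     f≥0 = +-nonneg (0≤# 2) (inv≥0 E)
     1≤y = 1≤z ⋙ z≤y
     sy≤ : inv y * ψcls c y ≤ # 6
     sy≤ = *≤ʳ (inv≥0 y) (ψcls≤ψ c y ≫ ψ≤6 y y≤N) ≫ lin 2 (\ i n -> 6 · (n :* i ≼ c1) ▸ ⊢ i :* (con 6 :* n) ≼ con 6) (eq≤ (inv-cancel 1≤y))
     Hd : H y - H z ≤ lg y - lg z + # 8
     Hd = lin 4 (\ h z l a -> h :- l ≼ c4 ▸ ⊝ c4 ≼ z :- a ▸ ⊢ h :- z ≼ l :- a :+ con 8) (snd (A-bound 1≤y y≤N)) (fst (A-bound 1≤z (z≤y ⋙ y≤N)))
     stp : ∀ j -> z ≦ j -> j N.< y -> (# 2 + e) * H j - # KE * inv j - # φ * (Qcls c j - inv j * ψcls c j) ≤ (# 2 + e) * H (suc j) - # KE * inv (suc j) - # φ * (Qcls c (suc j) - inv (suc j) * ψcls c (suc j))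
     stp j z≤j j<y = lin 11 (\ f h j a n K p q s L i -> (j :- a) :* (p :* s) ≼ (j :- a) :* (f :* n :+ K) ▸ f :* (n :* (j :- a)) ≼ f :* a ▸
       ⊢ f :* h :- K :* j :- p :* (q :- j :* s) ≼ f :* (h :+ a) :- K :* a :- p :* ((q :+ L :* (i :* a)) :- a :* (s :+ L :* i))) (*≤ʳ (inv-drop j 1≤j) (density c j uc 1≤j ((P.<⇒≤ j<y) ⋙ y≤N))) (*≤ʳ f≥0 (eq≤ (weight-step j 1≤j)))
      where 1≤j = 1≤z ⋙ z≤j
    from-one : ∀ c y -> ¬ (ℓ ∣ c) -> 1 ≦ y -> y ≦ N -> # φ * Qcls c y ≤ (# 2 + e) * lg y + # K₆
    from-one c y uc 1≤y y≤N = lin 6 (\ p q a f l K -> p :* (q :- a) ≼ f :* (l :- c0) :+ K ▸ p :* a ≼ p :* con 6 ▸ ⊢ p :* q ≼ f :* l :+ (con 6 :* p :+ K))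
      (interval c y 1 uc z<s 1≤y y≤N ≫ eq≤ (cong (\ z -> (# 2 + e) * (lg y - z) + # (6 N.* φ N.+ (24 N.+ KE))) lg-1)) (*≤ʳ (0≤# φ) q1) ≫ eq≤ (cong ((# 2 + e) * lg y +_) ((cong₂ _+_ (sym (#-* 6 φ)) (refl {x = # (6 N.* φ N.+ (24 N.+ KE))}) » sym (#-+ (6 N.* φ) _)) » cong #_ (sym (P.+-assoc (6 N.* φ) (6 N.* φ) _) » cong (N._+ (24 N.+ KE)) (sym (P.*-distribʳ-+ φ 6 6)))))
     where
     q1 : Qcls c 1 ≤ # 6
     q1 = S-mono 1 {\ n -> Λ n * (ind c n * inv n)} {\ n -> Λ n * (# 1 * # 1)} (\ n _ _ -> *≤ʳ (Λ≥0 n) (*-mono-≤ (ind≥0 c n) (0≤# 1) (ind≤1 c n) (inv≤1 n))) ≫ eq≤ (S-ext 1 {\ n -> Λ n * (# 1 * # 1)} {Λ} (\ n -> ring 1 (\ a -> a :* (c1 :* c1) := a))) ≫ ψ≤6 1 1≤N ≫ lin 0 (⊢ con 6 :* c1 ≼ con 6)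
    C₇ : ℕ
    C₇ = 2 N.* C₄ N.+ (42 N.+ 7 N.* K₆)
    -- M(i) is log i up to 7, so 2·Δ i·M(i) is at most the increment of log² plus 14·Δ i, and both
    -- telescope.
    Λinv-log : ∀ x -> 1 ≦ x -> x ≦ N -> # 2 * S x (\ n -> Λ n * inv n * (lg x - lg n)) ≤ lg x * lg x + # 14 * lg x
    Λinv-log x@(suc m) 1≤x x≤N = *≤ʳ (0≤# 2) (eq≤ (Λlog-abel m (\ n -> Λ n * inv n))) ≫ eq≥ (S-*ˡ m (# 2) _) ≫ S-mono m cell ≫ eq≤ (S-+ m _ _ » cong₂ _+_ (S-telescope m (\ i -> lg i * lg i)) (S-*ˡ m (# 14) Δ » cong (# 14 *_) (S-Δ m))) ≫ lin 2 (\ l z -> c0 ≼ z :* z ▸ ⊢ (l :* l :- z :* z) :+ con 14 :* l ≼ l :* l :+ con 14 :* l) (*≥0 (eq≥ lg-1) (eq≥ lg-1))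
     where
     cell : ∀ i -> 1 ≦ i -> i ≦ m -> # 2 * (Δ i * M i) ≤ (lg (suc i) * lg (suc i) - lg i * lg i) + # 14 * Δ i
     cell i 1≤i i≤m = lin 3 (\ a b m -> 2 · ((a :- b) :* (m :- b) ≼ (a :- b) :* con 7) ▸ c0 ≼ (a :- b) :* (a :- b) ▸ ⊢ c2 :* ((a :- b) :* m) ≼ (a :* a :- b :* b) :+ con 14 :* (a :- b)) (*≤ʳ (Δ≥0 i 1≤i i<N) (snd (mertens i 1≤i (P.<⇒≤ i<N)))) (*≥0 (Δ≥0 i 1≤i i<N) (Δ≥0 i 1≤i i<N))
      where i<N = P.<-≤-trans (s≤s i≤m) x≤N
    partner : ∀ {b c c′ n} -> ¬ (ℓ ∣ b) -> b N.* c′ ≡ₖ c -> n ≡ₖ b -> ∀ m -> ind c (n N.* m) ≡ ind c′ m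
    partner {b} {c} {c′} {n} ub e n≡b m = ind-cong {c} {c′} {n N.* m} {m}
      (\ q -> undo m » *-congₖ {b′} {b′} {b N.* m} {b N.* c′} refl (*-congₖ {b} {n} {m} (sym n≡b) refl » q » sym e) » sym (undo c′))
      (\ q -> *-congₖ {n} {b} {m} {c′} n≡b q » e)
     where
     b′ = fst (inverse b ub)
     undo : ∀ m -> m ≡ₖ b′ N.* (b N.* m)
     undo m = cong (_% k) (sym (P.*-identityˡ m)) » *-congₖ {1} {b′ N.* b} {m} (sym (cong (_% k) (P.*-comm b′ b) » snd (inverse b ub))) refl » cong (_% k) (P.*-assoc b′ b m)
    -- If class c contains few primes, then Selberg's formula forces the class c/b
    -- to have maximal density whenever the class b has positive density.
    saturation : ∀ Y c b c′ δ -> 1 ≦ Y -> Y N.* Y ≦ N -> ¬ (ℓ ∣ c) -> ¬ (ℓ ∣ b) -> ¬ (ℓ ∣ c′) -> b N.* c′ ≡ₖ c ->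
     # φ * Qcls c (Y N.* Y) ≤ δ * lg Y ->
     Qcls b Y * ((# 2 + e) * lg Y - # φ * Qcls c′ Y) ≤ (# 2 * δ + # 2 * e) * (lg Y * lg Y) + # C₇ * (lg Y + # 1)
    saturation Y c b c′ δ 1≤Y YY≤N uc ub uc′ bc′ few =
     lin 11 (\ p W l d s t q m K C i -> ⊝ (C :* ((l :+ l) :+ c1)) ≼ p :* W :- (l :+ l) :* (l :+ l) ▸ p :* W ≼ (l :+ l) :* (d :* l) :+ s ▸ s :+ q ≼ (c2 :+ i) :* t :+ K :* m ▸
        (c2 :+ i) :* t ≼ (c2 :+ i) :* (c2 :* (l :* l) :+ con 14 :* l) ▸ K :* m ≼ K :* ((l :+ l) :+ con 7) ▸ 14 · (i :* l ≼ c1 :* l) ▸ c0 ≼ C ▸ 5 · (c0 ≼ K :* l) ▸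
        ⊢ q ≼ (c2 :* d :+ c2 :* i) :* (l :* l) :+ (c2 :* C :+ (con 42 :+ con 7 :* K)) :* (l :+ c1)) (subst (\ z -> - (# C₄ * (z + # 1)) ≤ # φ * Wcls c x - z * z) lgx (fst (weighted c x uc 1≤x YY≤N))) parts summed (*≤ʳ f≥0 t≤) (*≤ʳ (0≤# K₆) M≤) (*≤ˡ l≥0 (inv≤1 E)) (0≤# C₄) (*≥0 (0≤# K₆) l≥0) ≫ eq≤ (cong (\ z -> (# 2 * δ + # 2 * e) * (lg Y * lg Y) + z * (lg Y + # 1)) (sym ((#-+ (2 N.* C₄) _) » cong₂ _+_ (#-* 2 C₄) ((#-+ 42 (7 N.* K₆)) » cong (# 42 +_) (#-* 7 K₆)))))
     where
     x : ℕ
     x = Y N.* Y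
     1≤x : 1 ≦ x
     1≤x = *-≥1 1≤Y 1≤Y
     Y≤x : Y ≦ x
     Y≤x = m≤m*n Y Y {{N.>-nonZero 1≤Y}}
     Y≤N = Y≤x ⋙ YY≤N
     lgx : lg x ≡ lg Y + lg Y
     lgx = lg-* Y Y 1≤Y 1≤Y
     l≥0 : # 0 ≤ lg Y
     l≥0 = lg≥0 1≤Y Y≤N
     f≥0 : # 0 ≤ # 2 + e
     f≥0 = +-nonneg (0≤# 2) (inv≥0 E)
     t = S x (\ n -> Λ n * inv n * (lg x - lg n))
     t≤ : t ≤ # 2 * (lg Y * lg Y) + # 14 * lg Y
     t≤ = *-cancelˡ-≤ (#-pos 1) (Λinv-log x 1≤x YY≤N ≫ eq≤ (cong (\ z -> z * z + # 14 * z) lgx » ring 1 (\ l -> (l :+ l) :* (l :+ l) :+ con 14 :* (l :+ l) := c2 :* (c2 :* (l :* l) :+ con 14 :* l))))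
     M≤ : M x ≤ (lg Y + lg Y) + # 7
     M≤ = lin 2 (\ m l -> m :- l ≼ con 7 ▸ ⊢ m ≼ l :+ con 7) (snd (mertens x 1≤x YY≤N)) ≫ eq≤ (cong (_+ # 7) lgx)
     q bb : ℕ -> Q
     q n = S (x ÷ n) (\ m -> Λ m * (ind c (n N.* m) * inv m))
     bb n = when (does (n N.≤? Y)) (ind b n)
     G : Q
     G = (# 2 + e) * lg Y - # φ * Qcls c′ Y
     second : S x (\ n -> Λ*Λ n * (ind c n * inv n)) ≡ S x (\ n -> Λ n * inv n * q n)
     second = Λ*Λ-sum x (\ n -> ind c n * inv n) » S-cong x (\ n 1≤n _ -> cong (Λ n *_) (S-cong (x ÷ n) (\ m 1≤m _ -> cong (\ z -> Λ m * (ind c (n N.* m) * z)) (inv-mul-≥1 1≤n 1≤m) » ring 4 (\ a i u v -> a :* (i :* (u :* v)) := u :* (a :* (i :* v)))) » S-*ˡ (x ÷ n) (inv n) _) » sym (*-assoc (Λ n) (inv n) (q n)))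
     parts : # φ * Wcls c x ≤ (lg Y + lg Y) * (δ * lg Y) + # φ * S x (\ n -> Λ n * inv n * q n)
     parts = eq≤ (cong (# φ *_) (S-ext x (\ n -> ring 5 (\ a l b i v -> (a :* l :+ b) :* i :* v := a :* (i :* v) :* l :+ b :* (i :* v))) » S-+ x _ _)) ≫ lin 7 (\ p a b c l d w -> p :* a ≼ w ▸ w ≼ l :* d ▸ p :* b ≼ p :* c ▸ ⊢ p :* (a :+ b) ≼ l :* d :+ p :* c) (*≤ʳ (0≤# φ) (S-mono x (\ n 1≤n n≤x -> *≤ʳ (*≥0 (Λ≥0 n) (*≥0 (ind≥0 c n) (inv≥0 n))) (lg-mono 1≤n n≤x YY≤N ≫ eq≤ lgx)) ≫ eq≤ (S-*ʳ x (lg Y + lg Y) _)) ≫ eq≤ (ring 3 (\ p s l -> p :* (s :* l) := l :* (p :* s)))) (*≤ʳ (+-nonneg l≥0 l≥0) few) (*≤ʳ (0≤# φ) (eq≤ second))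
     bound≥0 : ∀ n -> 1 ≦ n -> n ≦ x -> # 0 ≤ (# 2 + e) * (lg x - lg n) + # K₆
     bound≥0 n 1≤n n≤x = +-nonneg (*≥0 f≥0 (lin 2 (\ a b -> a ≼ b ▸ ⊢ c0 ≼ b :- a) (lg-mono 1≤n n≤x YY≤N))) (0≤# K₆)
     plain : ∀ n -> 1 ≦ n -> n ≦ x -> ¬ (ℓ ∣ n) -> # φ * q n ≤ (# 2 + e) * (lg x - lg n) + # K₆
     plain n 1≤n n≤x un = eq≤ (cong (# φ *_) (S-ext (x ÷ n) (\ m -> cong (\ z -> Λ m * (z * inv m)) (snd (solve-class n un c) m)))) ≫ from-one c″ (x ÷ n) uc″ (÷-pos 1≤n n≤x) ((÷-≤ x n) ⋙ YY≤N) ≫ +-mono-≤ (*≤ʳ f≥0 (Selberg.lg-floor x 1≤x YY≤N n 1≤n n≤x)) ≤-refl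
      where
      c″ = fst (solve-class n un c)
      n′ = fst (inverse n un)
      uc″ : ¬ (ℓ ∣ c″)
      uc″ d = case euclidsLemma n′ c ℓ-prime d of \ where
       (inj₂ e) -> uc e
       (inj₁ e) -> <⇒≱ (prime≥2 ℓ-prime) (∣⇒≤ (∣-congₖ {n N.* n′} {1} (snd (inverse n un)) (∣n⇒∣m*n n e)))
     -- For n ≤ Y in class b the cofactors m run over class c′ up to x/n ≥ Y. The density bound is
     -- then spent only on (Y, x/n], so the deficit `G` of c′ up to Y is saved.
     point : ∀ n -> 1 ≦ n -> n ≦ x -> # φ * q n + bb n * G ≤ (# 2 + e) * (lg x - lg n) + # K₆
     point n 1≤n n≤x = case ℓ ∣? n of \ where
      (yes p) -> eq≤ (cong₂ (\ u v -> # φ * u + v * G) (S-zero′ (x ÷ n) (\ m _ _ -> cong (\ z -> Λ m * (z * inv m)) (ind-0 {c} {n N.* m} (\ e -> uc (∣-congₖ {n N.* m} {c} e (∣m⇒∣m*n m p)))) » ring 2 (\ a i -> a :* (c0 :* i) := c0))) (cong (when (does (n N.≤? Y))) (ind-0 {b} {n} (\ e -> ub (∣-congₖ {n} {b} e p))) » when-0 _) » ring 2 (\ p g -> p :* c0 :+ c0 :* g := c0)) ≫ bound≥0 n 1≤n n≤x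
      (no ¬p) -> case n N.≤? Y of \ where
       (no ¬q) -> eq≤ (cong (\ z -> # φ * q n + when z (ind b n) * G) (is-no (n N.≤? Y) ¬q) » ring 3 (\ p q g -> p :* q :+ c0 :* g := p :* q)) ≫ plain n 1≤n n≤x ¬p
       (yes r) -> case n % k N.≟ b % k of \ where
        (no ¬b) -> eq≤ (cong (\ z -> # φ * q n + z * G) (cong (when (does (n N.≤? Y))) (ind-0 {b} {n} ¬b) » when-0 _) » ring 3 (\ p q g -> p :* q :+ c0 :* g := p :* q)) ≫ plain n 1≤n n≤x ¬p
        (yes n≡b) -> eq≤ (cong₂ (\ u v -> # φ * u + v * G) (S-ext (x ÷ n) (\ m -> cong (\ z -> Λ m * (z * inv m)) (partner {b} {c} {c′} {n} ub bc′ n≡b m))) (cong (\ z -> when z (ind b n)) (is-yes (n N.≤? Y) r) » ind-1 {b} {n} n≡b)) ≫ lin 8 (\ p q y f l Y K L -> p :* (q :- y) ≼ f :* (l :- Y) :+ K ▸ f :* l ≼ f :* L ▸ ⊢ p :* q :+ c1 :* (f :* Y :- p :* y) ≼ f :* L :+ K)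
          (interval c′ (x ÷ n) Y uc′ 1≤Y (÷-lower 1≤n (*-monoˡ-≤ Y r)) ((÷-≤ x n) ⋙ YY≤N) ≫ +-mono-≤ ≤-refl (#-mono (+-monoˡ-≤ (24 N.+ KE) (*-monoˡ-≤ φ {6} {12} (m≤m+n 6 6))))) (*≤ʳ f≥0 (Selberg.lg-floor x 1≤x YY≤N n 1≤n n≤x))
     summed : # φ * S x (\ n -> Λ n * inv n * q n) + Qcls b Y * G ≤ (# 2 + e) * t + # K₆ * M x
     summed = eq≥ (S-+ x _ _ » cong₂ _+_ (S-*ˡ x (# φ) _) (S-*ʳ x G _ » cong (_* G) (S-ext x (\ n -> wh (does (n N.≤? Y))) » sym (S-extend Y x (\ n -> Λ n * (ind b n * inv n)) Y≤x)))) ≫ S-mono x (\ n 1≤n n≤x -> eq≤ (ring 5 (\ p w q b g -> p :* (w :* q) :+ w :* b :* g := w :* (p :* q :+ b :* g))) ≫ *≤ʳ (*≥0 (Λ≥0 n) (inv≥0 n)) (point n 1≤n n≤x)) ≫ eq≤ (S-ext x (\ n -> ring 4 (\ w f l K -> w :* (f :* l :+ K) := f :* (w :* l) :+ K :* w)) » S-+ x _ _ » cong₂ _+_ (S-*ˡ x (# 2 + e) _) (S-*ˡ x (# K₆) _))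
      where
      wh : ∀ z {a i v} -> a * v * when z i ≡ when z (a * (i * v))
      wh true  = ring 3 (\ a i v -> a :* v :* i := a :* (i :* v))
      wh false = ring 2 (\ a v -> a :* v :* c0 := c0)

-- Contradiction from a residue class with few primes

module EmptyClass where
 open Rationals
 open Sums
 open Arithmetic
 open Logarithm
 open SelbergFormula
 open BlockDescent
 open Progressions
 open ≡-Reasoning
 module NoPrimes (N : ℕ) (4≤N : 4 ≦ N) (sys : LogSystem N)
         (k : ℕ) {{nz : NonZero k}} (ℓ a φ : ℕ) (cyc : Cyclic k ℓ a φ) (ℓ≤N : ℓ ≦ N) where
  open Progression N 4≤N sys k ℓ a φ cyc
  open LogSystem sys using (h; h-nonneg)
  lg-inv²-sum : ∀ x -> x N.< N -> S x (\ n -> lg n * (inv n * inv n)) ≤ # 6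
  lg-inv²-sum x x<N = S-mono x cell ≫ eq≤ (S-*ˡ x (# 2) _ » cong (# 2 *_) (S-telescope x (\ n -> - ((lg n + # 3) * inv n)))) ≫ lin 3 (\ g z i -> 2 · (c0 ≼ g) ▸ 2 · (z :* i ≼ c0) ▸ 6 · (i ≼ c1) ▸ ⊢ c2 :* (⊝ g :- ⊝ ((z :+ c3) :* i)) ≼ con 6)
     (*≥0 (+-nonneg (lg≥0 {suc x} z<s x<N) (0≤# 3)) (inv≥0 (suc x))) (eq≤ (cong (_* inv 1) lg-1 » ring 1 (\ a -> c0 :* a := c0))) (inv≤1 1)
   where
   cell : ∀ n -> 1 ≦ n -> n ≦ x -> lg n * (inv n * inv n) ≤ # 2 * (- ((lg (suc n) + # 3) * inv (suc n)) - - ((lg n + # 3) * inv n))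
   cell n 1≤n n≤x = lin 4 (\ l a i j -> l :* (i :* i) ≼ l :* (i :* (c2 :* j)) ▸ 2 · ((l :+ c3) :* (i :* j) ≼ (l :+ c3) :* (i :- j)) ▸ 2 · (j :* (a :- l) ≼ j :* (c2 :* i)) ▸ 2 · (c0 ≼ i :* j) ▸ 
     ⊢ l :* (i :* i) ≼ c2 :* (⊝ ((a :+ c3) :* j) :- ⊝ ((l :+ c3) :* i))) (*≤ʳ ln (*≤ʳ (inv≥0 n) (inv≤2inv n 1≤n))) (*≤ʳ (+-nonneg ln (0≤# 3)) (eq≥ (inv-diff n 1≤n))) (*≤ʳ (inv≥0 (suc n)) (Δ≤2inv n 1≤n n<N)) (*≥0 (inv≥0 n) (inv≥0 (suc n)))
    where
    n<N = P.≤-<-trans n≤x x<N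
    ln = lg≥0 1≤n (P.<⇒≤ n<N)
  powers : ∀ p -> 2 ≦ p -> ∀ K -> S K (\ j -> inv (p N.^ suc j)) ≤ # 2 * (inv p * inv p) - # 2 * inv (p N.^ suc (suc K))
  powers p 2≤p zero    = eq≤ (ring 1 (\ a -> c0 := c2 :* a :- c2 :* a) » cong (\ z -> # 2 * (inv p * inv p) - # 2 * z) (sym (cong (\ z -> inv (p N.* z)) (*-identityʳ p) » inv-mul-≥1 1≤p 1≤p)))
   where 1≤p = z<s ⋙ 2≤p
  powers p 2≤p (suc K) = lin 4 (\ s t u v -> s ≼ t :- c2 :* u ▸ c2 :* v ≼ u ▸ ⊢ s :+ u ≼ t :- c2 :* v) (powers p 2≤p K) (*≤ˡ (inv≥0 (p N.^ suc (suc (suc K)))) (#-mono 2≤p) ≫ eq≤ (cong (# p *_) (inv-mul-≥1 1≤p (^-≥1 (suc (suc K)) 1≤p)) » sym (*-assoc (# p) (inv p) _) » cong (_* inv (p N.^ suc (suc K))) (inv-cancel 1≤p) » ring 1 (\ a -> c1 :* a := a)))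
   where 1≤p = z<s ⋙ 2≤p
  -- A class without large primes has bounded ∑ Λ(n)/n: only prime powers and small primes contribute.
  Q-bounded : ∀ B x -> 1 ≦ x -> x N.< N -> (∀ p -> Prime p -> B N.< p -> p ≦ x -> ¬ (p ≡ₖ a)) -> Qcls ℓ≤N a x ≤ # (B N.+ 12)
  Q-bounded B x@(suc x′) 1≤x x<N none = eq≤ (Λ-sum x (\ n -> ind a n * inv n)) ≫ S-mono x row ≫ eq≤ (S-+ x _ _ » cong (S x (\ p -> when (does (p N.≤? B)) (# 1)) +_) (S-*ˡ x (# 2) _)) ≫ lin 3 (\ s b t -> s ≼ b ▸ 2 · (t ≼ con 6) ▸ ⊢ s :+ c2 :* t ≼ b :+ con 12) (smallcount x) (lg-inv²-sum x x<N) ≫ eq≥ (#-+ B 12)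
   where
   smallcount : ∀ x -> S x (\ p -> when (does (p N.≤? B)) (# 1)) ≤ # B
   smallcount x = case x N.≤? B of \ where
    (yes p) -> S-mono x (\ i _ _ -> when-≤ (does (i N.≤? B)) (0≤# 1)) ≫ eq≤ (S-one x) ≫ #-mono p
    (no ¬p) -> eq≤ (sym (S-extend B x (\ _ -> # 1) (P.<⇒≤ (P.≰⇒> ¬p))) » S-one B)
   row : ∀ p -> 1 ≦ p -> p ≦ x -> S x (\ j -> when (does (prime? p ×-dec (p N.^ j N.≤? x))) (h p * (ind a (p N.^ j) * inv (p N.^ j)))) ≤ when (does (p N.≤? B)) (# 1) + # 2 * (lg p * (inv p * inv p))
   row p 1≤p p≤x = go (prime? p)
    where
    rhs≥0 : # 0 ≤ when (does (p N.≤? B)) (# 1) + # 2 * (lg p * (inv p * inv p))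
    rhs≥0 = +-nonneg (when-nonneg (does (p N.≤? B)) (0≤# 1)) (*≥0 (0≤# 2) (*≥0 (lg≥0 1≤p (p≤x ⋙ (P.<⇒≤ x<N))) (*≥0 (inv≥0 p) (inv≥0 p))))
    go : (d : Dec (Prime p)) -> S x (\ j -> when (does (d ×-dec (p N.^ j N.≤? x))) (h p * (ind a (p N.^ j) * inv (p N.^ j)))) ≤ when (does (p N.≤? B)) (# 1) + # 2 * (lg p * (inv p * inv p))
    go (no _)   = eq≤ (S-zero x) ≫ rhs≥0
    go (yes pp) = eq≤ (S-shift x′ _) ≫ +-mono-≤ (when-≤ (does (p N.^ 1 N.≤? x)) (cell≥0 1) ≫ first) (S-mono x′ (\ j _ _ -> when-≤ (does (p N.^ suc j N.≤? x)) (cell≥0 (suc j)) ≫ *≤ʳ hp (*≤ˡ (inv≥0 _) (ind≤1 a _) ≫ eq≤ (ring 1 (\ a -> c1 :* a := a)))) ≫ eq≤ (S-*ˡ x′ (h p) _) ≫ *≤ʳ hp (powers p (prime≥2 pp) x′) ≫ lin 3 (\ h i j -> 2 · (c0 ≼ h :* j) ▸ ⊢ h :* (c2 :* i :- c2 :* j) ≼ c2 :* (h :* i)) (*≥0 hp (inv≥0 (p N.^ suc (suc x′)))) ≫ eq≤ (cong (\ z -> # 2 * (z * (inv p * inv p))) (sym (additive-prime h pp))))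
     where
     hp = h-nonneg p pp
     cell≥0 : ∀ j -> # 0 ≤ h p * (ind a (p N.^ j) * inv (p N.^ j))
     cell≥0 j = *≥0 hp (*≥0 (ind≥0 a _) (inv≥0 _))
     first : h p * (ind a (p N.^ 1) * inv (p N.^ 1)) ≤ when (does (p N.≤? B)) (# 1)
     first = eq≤ (cong (\ z -> h p * (ind a z * inv z)) (*-identityʳ p)) ≫ (case p N.≤? B of \ where
      (yes q) -> *-mono-≤ hp (inv≥0 p) (eq≥ (additive-prime h pp) ≫ lg≤id p 1≤p (p≤x ⋙ (P.<⇒≤ x<N))) (*≤ˡ (inv≥0 p) (ind≤1 a p) ≫ eq≤ (ring 1 (\ a -> c1 :* a := a))) ≫ eq≤ (inv-cancel 1≤p) ≫ eq≤ (cong (\ b -> when b (# 1)) (sym (is-yes (p N.≤? B) q)))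
      (no ¬q) -> eq≤ (cong (\ z -> h p * (z * inv p)) (ind-0 {a} {p} (none p pp (P.≰⇒> ¬q) p≤x)) » ring 2 (\ a b -> a :* (c0 :* b) := c0)) ≫ when-nonneg (does (p N.≤? B)) (0≤# 1))
  module Contradiction (E : ℕ) (1≤E : 1 ≦ E) (C₈ : ℕ) (Y : ℕ) (1≤Y : 1 ≦ Y) (Y⁴≤N : (Y N.* Y) N.* (Y N.* Y) ≦ N)
       (sparse : ∀ x -> 1 ≦ x -> x ≦ (Y N.* Y) N.* (Y N.* Y) -> # φ * Qcls ℓ≤N a x ≤ # C₈) where
   open Upper ℓ≤N E 1≤E
   Qc : ℕ -> ℕ -> Q
   Qc = Qcls ℓ≤N
   l : Q
   l = lg Y
   -- Call a class dense if φ·Q ≥ ½ log Y. Density passes from a^i to a^(φ-i) through the product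
   -- class 1, and on to a^(i+1) through the product class a. The climb ends at a^φ = 1, which `Q1`
   -- excludes; `empty` provides a class to start from.
   contradiction : 2 N.* φ N.* (20 N.* φ N.+ 3) N.+ 20 N.* φ N.+ 1 ≦ E -> # E * # C₈ ≤ l -> # (15 N.+ 2 N.* ℓ) ≤ l -> # E * (# 2 * # C₇) ≤ l -> ⊥
   contradiction E-big l≥C₈ l≥15 l≥C₇ = case anyUpTo? (\ i -> (1 N.≤? i) ×-dec (l ≤? # 2 * (# φ * Qc (a N.^ i) Y))) (suc φ) of \ where
     (yes (i , i<φ , 1≤i , dense)) -> climb (φ N.∸ i) i 1≤i (m+[n∸m]≡n (≤-pred i<φ)) dense
     (no none) -> empty (\ i 1≤i i≤φ -> <⇒≤ (\ d -> none (i , s≤s i≤φ , 1≤i , d)))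
    where
    Y² = Y N.* Y
    1≤Z : 1 ≦ Y²
    1≤Z = *-≥1 1≤Y 1≤Y
    Y≤Z : Y ≦ Y²
    Y≤Z = m≤m*n Y Y {{N.>-nonZero 1≤Y}}
    Z≤ZZ : Y² ≦ Y² N.* Y²
    Z≤ZZ = m≤m*n Y² Y² {{N.>-nonZero 1≤Z}}
    Z≤N = Z≤ZZ ⋙ Y⁴≤N
    Y≤N = Y≤Z ⋙ Z≤N
    lZ : lg Y² ≡ l + l
    lZ = lg-* Y Y 1≤Y 1≤Y
    l≥1 : # 1 ≤ l
    l≥1 = #-mono z<s ≫ l≥15
    l≥0 : # 0 ≤ l
    l≥0 = 0≤# 1 ≫ l≥1
    l>0 : # 0 < l
    l>0 z = #-pos 0 (l≥1 ≫ z)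
    Ee : # E * e ≡ # 1
    Ee = inv-cancel 1≤E
    e≥0 = inv≥0 E
    C₈≤ : # C₈ ≤ e * l
    C₈≤ = eq≤ (ring 1 (\ c -> c := c1 :* c) » cong (_* # C₈) (sym Ee) » ring 3 (\ n e c -> n :* e :* c := e :* (n :* c))) ≫ *≤ʳ e≥0 l≥C₈
    C₇≤ : # C₇ * (l + # 1) ≤ e * (l * l)
    C₇≤ = lin 5 (\ c l e n z -> c :* c1 ≼ c :* l ▸ c2 :* c :* l :* c1 ≼ c2 :* c :* l :* (n :* e) ▸ e :* l :* (n :* (c2 :* c)) ≼ e :* l :* l ▸ 0 · (z ≼ z) ▸ ⊢ c :* (l :+ c1) ≼ e :* (l :* l)) (*≤ʳ (0≤# C₇) l≥1) (*≤ʳ (*≥0 (*≥0 (0≤# 2) (0≤# C₇)) l≥0) (eq≥ Ee)) (*≤ʳ (*≥0 e≥0 l≥0) l≥C₇) (≤-refl {# 0})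
    u1 : ¬ (ℓ ∣ 1)
    u1 d = <⇒≱ (prime≥2 ℓ-prime) (∣⇒≤ d)
    few-a : ∀ W -> 1 ≦ W -> W ≦ Y² -> l ≤ lg W -> # φ * Qc a (W N.* W) ≤ e * lg W
    few-a W 1≤W W≤Z lW = sparse (W N.* W) (*-≥1 1≤W 1≤W) (P.*-mono-≤ W≤Z W≤Z) ≫ C₈≤ ≫ *≤ʳ e≥0 lW
    lY≤lZ : l ≤ lg Y²
    lY≤lZ = lg-mono 1≤Y Y≤Z Z≤N
    -- Saturation for the factorisation a = 1·a: class a is sparse, so as a partner its deficit is
    -- nearly 2 log, and the product inequality can hold only if class 1 is sparse. Reaching Y² for
    -- class 1 takes sparseness of a up to Y⁴.
    Q1 : Qc 1 Y² ≤ # 10 * e * l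
    Q1 = *-cancelˡ-≤ {lg Y²} (\ z -> l>0 (lY≤lZ ≫ z)) (lin 8 (\ q L p s e l C c -> q :* ((c2 :+ e) :* L :- s) ≼ (c2 :* e :+ c2 :* e) :* (L :* L) :+ C ▸ q :* s ≼ q :* L ▸ c0 ≼ q :* (e :* L) ▸ C ≼ e :* (L :* L) ▸ 0 · (p ≼ p) ▸ 0 · (l ≼ l) ▸ 0 · (c ≼ c) ▸ ⊢ L :* q ≼ con 5 :* e :* (L :* L))
      (saturation Y² a 1 a e 1≤Z Y⁴≤N unit-a u1 unit-a (cong (_% k) (P.*-identityˡ a)) (few-a Y² 1≤Z P.≤-refl lY≤lZ)) (*≤ʳ (Qcls≥0 ℓ≤N 1 Y²) (sparse Y² 1≤Z Z≤ZZ ≫ C₈≤ ≫ *-mono-≤ e≥0 (l≥0 ≫ lY≤lZ) (inv≤1 E) lY≤lZ ≫ eq≤ (ring 1 (\ a -> c1 :* a := a))))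
      (*≥0 (Qcls≥0 ℓ≤N 1 Y²) (*≥0 e≥0 (l≥0 ≫ lY≤lZ)))
      C₇Z (≤-refl {# 0}) (≤-refl {# 0}) (≤-refl {# 0}) ≫ eq≤ (cong (\ z -> # 5 * e * (lg Y² * z)) lZ » ring 3 (\ e L l -> con 5 :* e :* (L :* (l :+ l)) := L :* (con 10 :* e :* l))))
     where
     C₇Z : # C₇ * (lg Y² + # 1) ≤ e * (lg Y² * lg Y²)
     C₇Z = eq≤ (cong (\ z -> # C₇ * (z + # 1)) lZ) ≫ lin 3 (\ c l e -> 2 · (c :* (l :+ c1) ≼ e :* (l :* l)) ▸ c0 ≼ c ▸ 2 · (c0 ≼ e :* (l :* l)) ▸ ⊢ c :* ((l :+ l) :+ c1) ≼ e :* ((l :+ l) :* (l :+ l)))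
      C₇≤ (0≤# C₇) (*≥0 e≥0 (*≥0 l≥0 l≥0)) ≫ eq≤ (cong (\ z -> e * (z * z)) (sym lZ))
    -- With `E20` these are the two conditions that dictate the lower bound on E: this one serves
    -- `transfer`, the other the end of the climb.
    Ebound : # 2 * # φ * ((# 20 * # φ + # 3) * e) ≤ # 1
    Ebound = eq≤ (ring 2 (\ p e -> c2 :* p :* ((con 20 :* p :+ c3) :* e) := (c2 :* p :* (con 20 :* p :+ c3)) :* e)) ≫ *≤ˡ e≥0 (eq≥ ((#-* (2 N.* φ) (20 N.* φ N.+ 3)) » cong₂ _*_ (#-* 2 φ) ((#-+ (20 N.* φ) 3) » cong (_+ # 3) (#-* 20 φ))) ≫ #-mono ((m≤m+n _ (20 N.* φ) ⋙ m≤m+n _ 1) ⋙ E-big)) ≫ eq≤ Ee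
    E20 : # 20 * # φ * e + e ≤ # 1
    E20 = eq≤ (ring 2 (\ p e -> con 20 :* p :* e :+ e := (con 20 :* p :+ c1) :* e)) ≫ *≤ˡ e≥0 (eq≥ ((#-+ (20 N.* φ) 1) » cong (_+ # 1) (#-* 20 φ)) ≫ #-mono (+-monoˡ-≤ 1 (m≤n+m (20 N.* φ) (2 N.* φ N.* (20 N.* φ N.+ 3))) ⋙ E-big)) ≫ eq≤ Ee
    Dense : ℕ -> Set
    Dense b = l ≤ # 2 * (# φ * Qc b Y)
    -- Since φ·Q(b) ≥ ½ log Y, saturation bounds the deficit of b′ by 2φ(20φ+3)e log Y ≤ log Y. Then
    -- φ·Q(b′) ≥ (1+e) log Y, well above the threshold.
    transfer : ∀ b b′ -> Qc b Y * ((# 2 + e) * l - # φ * Qc b′ Y) ≤ (# 20 * # φ + # 3) * e * (l * l) -> Dense b -> Dense b′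
    transfer b b′ sat db = lin 4 (\ l e p q -> 2 · ((c2 :+ e) :* l :- p :* q ≼ l) ▸ c0 ≼ l ▸ 2 · (c0 ≼ e :* l) ▸ ⊢ l ≼ c2 :* (p :* q)) small l≥0 (*≥0 e≥0 l≥0)
     where
     G = (# 2 + e) * l - # φ * Qc b′ Y
     small : G ≤ l
     small = case ≤-total (# 0) G of \ where
      (inj₂ neg) -> neg ≫ l≥0
      (inj₁ pos) -> *-cancelˡ-≤ {l} l>0 (lin 7 (\ l g q p r e z -> l :* g ≼ c2 :* (p :* q) :* g ▸ c2 :* p :* (q :* g) ≼ c2 :* p :* (r :* (l :* l)) ▸ l :* l :* (c2 :* p :* r) ≼ l :* l :* c1 ▸ 0 · (e ≼ e) ▸ 0 · (z ≼ z) ▸ ⊢ l :* g ≼ l :* l) (*≤ˡ pos db) (*≤ʳ (*≥0 (0≤# 2) (0≤# φ)) sat) (*≤ʳ (*≥0 l≥0 l≥0) Ebound) (≤-refl {# 0}) (≤-refl {# 0}))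
    via-1 : ∀ b b′ -> ¬ (ℓ ∣ b) -> ¬ (ℓ ∣ b′) -> b N.* b′ ≡ₖ 1 -> Dense b -> Dense b′
    via-1 b b′ ub ub′ bb = transfer b b′ (saturation Y 1 b b′ (# 10 * # φ * e) 1≤Y Z≤N u1 ub ub′ bb (*≤ʳ (0≤# φ) Q1 ≫ eq≤ (ring 3 (\ p e l -> p :* (con 10 :* e :* l) := con 10 :* p :* e :* l))) ≫ lin 4 (\ p e l C -> C ≼ e :* (l :* l) ▸ ⊢ (c2 :* (con 10 :* p :* e) :+ c2 :* e) :* (l :* l) :+ C ≼ (con 20 :* p :+ c3) :* e :* (l :* l)) C₇≤)
    via-a : ∀ b b′ -> ¬ (ℓ ∣ b) -> ¬ (ℓ ∣ b′) -> b N.* b′ ≡ₖ a -> Dense b -> Dense b′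
    via-a b b′ ub ub′ bb = transfer b b′ (saturation Y a b b′ e 1≤Y Z≤N unit-a ub ub′ bb (few-a Y 1≤Y Y≤Z ≤-refl) ≫ lin 4 (\ p e l C -> C ≼ e :* (l :* l) ▸ 20 · (e :* (l :* l) :* c1 ≼ e :* (l :* l) :* p) ▸ 18 · (c0 ≼ e :* (l :* l)) ▸ ⊢ (c2 :* e :+ c2 :* e) :* (l :* l) :+ C ≼ (con 20 :* p :+ c3) :* e :* (l :* l)) C₇≤ (*≤ʳ (*≥0 e≥0 (*≥0 l≥0 l≥0)) (#-mono 1≤φ)) (*≥0 e≥0 (*≥0 l≥0 l≥0)))
    climb : ∀ n i -> 1 ≦ i -> i N.+ n ≡ φ -> Dense (a N.^ i) -> ⊥
    climb zero i 1≤i e′ d = l>0 (lin 5 (\ l e p q z -> l ≼ c2 :* (p :* q) ▸ 2 · (p :* q ≼ p :* (con 10 :* e :* l)) ▸ (con 20 :* p :* e :+ e) :* l ≼ c1 :* l ▸ 0 · (z ≼ z) ▸ ⊢ e :* l ≼ c0) dense1 (*≤ʳ (0≤# φ) (Qcls-mono ℓ≤N 1 Y≤Z ≫ Q1)) (*≤ˡ l≥0 E20) (≤-refl {# 0}) |> conv)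
     where
     _|>_ : ∀ {A B : Set} -> A -> (A -> B) -> B
     z |> f = f z
     conv : e * l ≤ # 0 -> l ≤ # 0
     conv h = eq≤ (ring 1 (\ l -> l := c1 :* l) » cong (_* l) (sym Ee) » *-assoc (# E) e l) ≫ *≤ʳ (0≤# E) h ≫ eq≤ (ring 1 (\ a -> a :* c0 := c0))
     i≡φ : i ≡ φ
     i≡φ = sym (P.+-identityʳ i) » e′
     dense1 : l ≤ # 2 * (# φ * Qc 1 Y)
     dense1 = d ≫ eq≤ (cong (\ z -> # 2 * (# φ * z)) (S-ext Y (\ n -> cong (\ z -> Λ n * (z * inv n)) (ind-cong {a N.^ i} {1} {n} {n} (\ q -> q » ≡1) (\ q -> q » sym ≡1)))))
      where
      ≡1 : a N.^ i ≡ₖ 1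
      ≡1 = cong (\ z -> (a N.^ z) % k) i≡φ » a^φ
    climb (suc n) i 1≤i e′ d = climb n (suc i) z<s (sym (+-suc i n) » e′)
     (via-a (a N.^ suc n) (a N.^ suc i) (unit-^ (suc n)) (unit-^ (suc i)) prod-a (via-1 (a N.^ i) (a N.^ suc n) (unit-^ i) (unit-^ (suc n)) prod-1 d))
     where
     prod-1 : a N.^ i N.* a N.^ suc n ≡ₖ 1
     prod-1 = cong (_% k) (sym (^-distribˡ-+-* a i (suc n)) » cong (a N.^_) e′) » a^φ
     prod-a : a N.^ suc n N.* a N.^ suc i ≡ₖ a
     prod-a = cong (_% k) (sym (^-distribˡ-+-* a (suc n) (suc i)) » cong (a N.^_) (+-suc (suc n) i » cong suc (P.+-comm (suc n) i » e′))) » *-congₖ {a} {a} {a N.^ φ} {1} refl a^φ » cong (_% k) (*-identityʳ a)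
    -- If every class were thin, all units together would hold at most ½ log Y, against log Y - 7
    -- less the share of ℓ by Mertens; 15 + 2ℓ ≤ log Y makes this absurd.
    empty : (∀ i -> 1 ≦ i -> i ≦ φ -> # 2 * (# φ * Qc (a N.^ i) Y) ≤ l) -> ⊥
    empty thin = #-pos 0 (lin 5 (\ s l m q L -> c2 :* s ≼ l ▸ 2 · (m :- q ≼ s) ▸ 2 · (⊝ con 7 ≼ m :- l) ▸ 2 · (q ≼ L) ▸ con 15 :+ c2 :* L ≼ l ▸ ⊢ c1 ≼ c0)
      (*-cancelˡ-≤ {# φ} (\ z -> #-pos 0 (#-mono 1≤φ ≫ z)) (eq≤ (ring 2 (\ p s -> p :* (c2 :* s) := c2 :* (p :* s)) » sym (S-*ˡ φ (# 2) _ » cong (# 2 *_) (S-*ˡ φ (# φ) _))) ≫ S-mono φ thin ≫ eq≤ (S-const φ l))) (eq≥ total) (fst (mertens Y 1≤Y Y≤N)) (qℓ≤ Y ≫ hℓ≤ ℓ≤N) (eq≥ ((#-+ 15 (2 N.* ℓ)) » cong (# 15 +_) (#-* 2 ℓ)) ≫ l≥15))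
     where
     total : S φ (\ i -> Qc (a N.^ i) Y) ≡ M Y - S Y (\ n -> Λ n * (dv n * inv n))
     total = S-swap φ Y _ » S-ext Y (\ n -> S-ext φ (\ i -> ring 3 (\ a b c -> a :* (b :* c) := a :* c :* b)) » S-*ˡ φ (Λ n * inv n) _ » cong (Λ n * inv n *_) (unit-sum n) » ring 3 (\ a i d -> a :* i :* (c1 :- d) := a :* i :- a :* (d :* i))) » S-- Y _ _

-- Logarithms from harmonic sums; primes in the class of a generator

module HarmonicLogarithm where
 open Rationals
 open Sums
 open Arithmetic
 open Logarithm
 open Progressions
 open EmptyClass
 open ≡-Reasoning
 inv-anti : ∀ {m n} -> 1 ≦ m -> m ≦ n -> inv n ≤ inv m
 inv-anti {suc m} _ h = inv-antimono h
 H-split : ∀ m j -> H (m N.+ j) - H m ≡ S j (\ i -> inv (m N.+ i))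
 H-split m j = cong (_- H m) (S-split m j inv) » ring 2 (\ a b -> a :+ b :- a := b)
 H-block-≤ : ∀ m j -> 1 ≦ m -> H (m N.+ j) - H m ≤ # j * inv m
 H-block-≤ m j 1≤m = eq≤ (H-split m j) ≫ S-mono j (\ i _ _ -> inv-anti 1≤m (m≤m+n m i)) ≫ eq≤ (S-const j (inv m))
 H-block-≥ : ∀ m j -> 1 ≦ m -> # j * inv (m N.+ j) ≤ H (m N.+ j) - H m
 H-block-≥ m j 1≤m = eq≥ (S-const j (inv (m N.+ j))) ≫ S-mono j (\ i 1≤i i≤j -> inv-anti (1≤i ⋙ m≤n+m i m) (+-monoʳ-≤ m i≤j)) ≫ eq≥ (H-split m j)
 cancel-inv : ∀ {p n} -> 1 ≦ p -> 1 ≦ n -> # p * inv (p N.* n) ≡ inv n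
 cancel-inv {p} {n} 1≤p 1≤n = cong (# p *_) (inv-mul-≥1 1≤p 1≤n) » sym (*-assoc (# p) (inv p) (inv n)) » cong (_* inv n) (inv-cancel 1≤p) » ring 1 (\ a -> c1 :* a := a)
 -- log n ≈ H(nK) − H(K); on primes this is exact by definition, and additivity holds up to 1/K.
 module Harmonic (K : ℕ) (1≤K : 1 ≦ K) where
  L : ℕ -> Q
  L n = H (n N.* K) - H K
  L≥0 : ∀ n -> 1 ≦ n -> # 0 ≤ L n
  L≥0 n 1≤n = lin 2 (\ a b -> b ≼ a ▸ ⊢ c0 ≼ a :- b) (S-mono-range (m≤n*m K n {{N.>-nonZero 1≤n}}) inv≥0)
  L-step : ∀ n -> L (suc n) - L n ≡ H (n N.* K N.+ K) - H (n N.* K)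
  L-step n = ring 3 (\ a b c -> (a :- c) :- (b :- c) := a :- b) » cong (\ z -> H z - H (n N.* K)) (P.+-comm K (n N.* K))
  L-step-≤ : ∀ n -> 1 ≦ n -> L (suc n) - L n ≤ inv n
  L-step-≤ n 1≤n = eq≤ (L-step n) ≫ H-block-≤ (n N.* K) K (*-≥1 1≤n 1≤K) ≫ eq≤ (cong (\ z -> # K * inv z) (P.*-comm n K) » cancel-inv 1≤K 1≤n)
  L-step-≥ : ∀ n -> 1 ≦ n -> inv (suc n) ≤ L (suc n) - L n
  L-step-≥ n 1≤n = eq≥ (cong (\ z -> # K * inv z) (P.+-comm (n N.* K) K » P.*-comm (suc n) K) » cancel-inv {K} {suc n} 1≤K z<s) ≫ H-block-≥ (n N.* K) K (*-≥1 1≤n 1≤K) ≫ eq≥ (L-step n)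
  -- The p terms between H(pm) and H(p(m+1)) sum to something between 1/(m+1) and 1/m. So H(pm) -
  -- H(m) increases with m, and it decreases once 1/m is added.
  ratio-step : ∀ p m -> 1 ≦ p -> 1 ≦ m -> let D = \ i -> H (p N.* i) - H i in (D m ≤ D (suc m)) × (D (suc m) + inv (suc m) ≤ D m + inv m)
  ratio-step p m 1≤p 1≤m =
    lin 5 (\ a b c d i -> i ≼ a :- b ▸ d ≼ c :+ i ▸ ⊢ b :- c ≼ a :- d) lower (≤-refl {H m + inv (suc m)})
   , lin 6 (\ a b c d i j -> a :- b ≼ j ▸ c :+ i ≼ d ▸ ⊢ (a :- d) :+ i ≼ (b :- c) :+ j) upper (≤-refl {H m + inv (suc m)})
   where
   e : p N.* suc m ≡ p N.* m N.+ p
   e = *-suc p m » P.+-comm p (p N.* m)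
   lower : inv (suc m) ≤ H (p N.* suc m) - H (p N.* m)
   lower = eq≥ (cong (\ z -> # p * inv z) (sym e) » cancel-inv {p} {suc m} 1≤p z<s) ≫ H-block-≥ (p N.* m) p (*-≥1 1≤p 1≤m) ≫ eq≤ (cong (\ z -> H z - H (p N.* m)) (sym e))
   upper : H (p N.* suc m) - H (p N.* m) ≤ inv m
   upper = eq≤ (cong (\ z -> H z - H (p N.* m)) e) ≫ H-block-≤ (p N.* m) p (*-≥1 1≤p 1≤m) ≫ eq≤ (cancel-inv 1≤p 1≤m)
  L-almost-additive : ∀ p n -> 1 ≦ p -> 1 ≦ n -> (L p + L n ≤ L (p N.* n)) × (L (p N.* n) ≤ L p + L n + inv K)
  L-almost-additive p n 1≤p 1≤n =
    lin 4 (\ a b c d -> b :- c ≼ a :- d ▸ ⊢ (b :- c) :+ (d :- c) ≼ a :- c) up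
   , lin 6 (\ a b c d i j -> a :- d :+ i ≼ b :- c :+ j ▸ c0 ≼ i ▸ ⊢ a :- c ≼ (b :- c) :+ (d :- c) :+ j) down (inv≥0 (n N.* K))
   where
   K≤nK = m≤n*m K n {{N.>-nonZero 1≤n}}
   assoc : ∀ {z} -> H (p N.* (n N.* K)) ≡ z -> H (p N.* n N.* K) ≡ z
   assoc = trans (cong H (P.*-assoc p n K))
   up : H (p N.* K) - H K ≤ H (p N.* n N.* K) - H (n N.* K)
   up = mono-steps (\ i -> H (p N.* i) - H i) K≤nK (\ i a _ -> fst (ratio-step p i 1≤p (1≤K ⋙ a))) ≫ eq≤ (cong (_- H (n N.* K)) (sym (assoc refl)))
   down : H (p N.* n N.* K) - H (n N.* K) + inv (n N.* K) ≤ H (p N.* K) - H K + inv K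
   down = eq≤ (cong (\ z -> z - H (n N.* K) + inv (n N.* K)) (assoc refl)) ≫ lin 2 (\ a b -> ⊝ a ≼ ⊝ b ▸ ⊢ b ≼ a)
    (mono-steps (\ i -> - (H (p N.* i) - H i + inv i)) K≤nK (\ i a _ -> lin 2 (\ a b -> a ≼ b ▸ ⊢ ⊝ b ≼ ⊝ a) (snd (ratio-step p i 1≤p (1≤K ⋙ a)))))
  lgK : ℕ -> Q
  lgK = additive L
  -- Each prime factor split off costs at most 1/K, and n has at most n of them.
  lgK-close : ∀ n -> 1 ≦ n -> (lgK n ≤ L n) × (L n ≤ lgK n + # n * inv K)
  lgK-close = prime-induction (\ n -> (lgK n ≤ L n) × (L n ≤ lgK n + # n * inv K))
   ( eq≤ (additive-1 L » sym L1) , lin 3 (\ a b i -> a ≼ c0 ▸ c0 ≼ b ▸ c0 ≼ i ▸ ⊢ a ≼ b :+ i) (eq≤ L1) (eq≥ (additive-1 L)) (*≥0 (0≤# 1) (inv≥0 K)))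
   (\ p n pp 1≤n ih -> let 1≤p = prime≥1 pp ; add = L-almost-additive p n 1≤p 1≤n in
     ≤-trans (eq≤ (additive-cons L pp 1≤n)) (+-mono-≤ ≤-refl (fst ih) ≫ fst add)
    , lin 8 (\ a b c d e i n m -> a ≼ b :+ c :+ i ▸ c ≼ d :+ n :* i ▸ b :+ d ≼ e ▸ (n :+ c1) :* i ≼ m :* i ▸ ⊢ a ≼ e :+ m :* i) (snd add) (snd ih) (eq≥ (additive-cons L pp 1≤n)) (*≤ˡ (inv≥0 K) (eq≥ (#-suc n) ≫ #-mono (+-monoˡ-≤ n 1≤n ⋙ P.≤-reflexive (cong (n N.+_) (sym (P.+-identityʳ n))) ⋙ *-monoˡ-≤ n (prime≥2 pp)))))
   where
   L1 : L 1 ≡ # 0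
   L1 = cong (\ z -> H z - H K) (P.*-identityˡ K) » ring 1 (\ a -> a :- a := c0)
  L-mono : ∀ {m n} -> 1 ≦ m -> m ≦ n -> L m ≤ L n
  L-mono 1≤m m≤n = lin 3 (\ a b c -> a ≼ b ▸ ⊢ a :- c ≼ b :- c) (S-mono-range (*-monoˡ-≤ K m≤n) inv≥0)
  -- Passing from `L` to its additive version shifts an increment by at most (n+1)/K. With K ≥ N⁴
  -- this is at most 1/(n²(n+1)), which fits into the tolerance 1/n².
  system : ∀ N -> (N N.* N) N.* (N N.* N) ≦ K -> LogSystem N
  system N big = record
   { h        = L
   ; h-nonneg = \ p pp -> L≥0 p (prime≥1 pp)
   ; step-≥   = \ n 1≤n n<N -> lin 8 (\ i j s t u v k m -> j ≼ s :- t ▸ s ≼ u :+ m :* k ▸ v ≼ t ▸ m :* k ≼ i :* i :* j ▸ i :* (i :* j) ≼ i :* (i :- j) ▸ i :- j ≼ i :* j ▸ ⊢ i :- i :* i ≼ u :- v)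
     (L-step-≥ n 1≤n) (snd (lgK-close (suc n) z<s)) (fst (lgK-close n 1≤n)) (tiny n 1≤n n<N) (*≤ʳ (inv≥0 n) (eq≥ (inv-diff n 1≤n))) (eq≤ (inv-diff n 1≤n))
   ; step-≤   = \ n 1≤n n<N -> lin 8 (\ i s t u v k n m -> s :- t ≼ i ▸ u ≼ s ▸ t ≼ v :+ n :* k ▸ n :* k ≼ m :* k ▸ m :* k ≼ i :* i ▸ ⊢ u :- v ≼ i :+ i :* i)
     (L-step-≤ n 1≤n) (fst (lgK-close (suc n) z<s)) (snd (lgK-close n 1≤n)) (*≤ˡ (inv≥0 K) (#-mono (n≤1+n n)))
     (tiny n 1≤n n<N ≫ *≤ʳ (*≥0 (inv≥0 n) (inv≥0 n)) (inv≤1 (suc n)) ≫ eq≤ (ring 1 (\ a -> a :* c1 := a))) }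
   where
   tiny : ∀ n -> 1 ≦ n -> n N.< N -> # (suc n) * inv K ≤ inv n * inv n * inv (suc n)
   tiny n 1≤n n<N = *≤ʳ (0≤# (suc n)) (inv-anti (*-≥1 (*-≥1 1≤n 1≤n) (*-≥1 {suc n} {suc n} z<s z<s)) (P.*-mono-≤ (P.*-mono-≤ (P.<⇒≤ n<N) (P.<⇒≤ n<N)) (P.*-mono-≤ n<N n<N) ⋙ big)) ≫ eq≤ (cong (# (suc n) *_) (inv-mul-≥1 (*-≥1 1≤n 1≤n) (*-≥1 {suc n} {suc n} z<s z<s) » cong₂ _*_ (inv-mul-≥1 1≤n 1≤n) (inv-mul-≥1 {suc n} {suc n} z<s z<s)) » ring 3 (\ m i j -> m :* (i :* i :* (j :* j)) := i :* i :* (m :* j) :* j) » cong (\ z -> inv n * inv n * z * inv (suc n)) (inv-inverse n) » ring 2 (\ i j -> i :* i :* c1 :* j := i :* i :* j))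
  -- If B < A, then `L` gains at least 1/(B+1) between them, more than the error A/K of the additive
  -- version. Hence a comparison of approximate logarithms yields an exact comparison of integers.
  reflects-≤ : ∀ A B -> 1 ≦ A -> 1 ≦ B -> suc (A N.* suc B) ≦ K -> lgK A ≤ lgK B -> A ≦ B
  reflects-≤ A B 1≤A 1≤B big le = ≮⇒≥ (\ B<A -> <⇒≱ big (#-cancel (K≤ B<A)))
   where
   gap : B N.< A -> inv (suc B) ≤ # A * inv K
   gap B<A = lin 7 (\ i l B A a b z -> i ≼ B :- l ▸ B ≼ A ▸ A ≼ a :+ z ▸ a ≼ b ▸ b ≼ l ▸ ⊢ i ≼ z)
    (L-step-≥ B 1≤B) (L-mono {suc B} z<s B<A) (snd (lgK-close A 1≤A)) le (fst (lgK-close B 1≤B))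
   K≤ : B N.< A -> # K ≤ # (A N.* suc B)
   K≤ B<A = lin 5 (\ k a b i j -> k :* b :* i ≼ k :* b :* j ▸ k :* c1 ≼ k :* (b :* i) ▸ b :* (k :* j) ≼ a ▸ ⊢ k ≼ a) (*≤ʳ (*≥0 (0≤# K) (0≤# (suc B))) (gap B<A)) (*≤ʳ (0≤# K) (eq≥ (inv-inverse B))) (eq≤ (ring 4 (\ b k a i -> b :* (k :* (a :* i)) := a :* b :* (k :* i)) » cong (# A * # (suc B) *_) (inv-cancel 1≤K) » ring 1 (\ a -> a :* c1 := a) » sym (#-* A (suc B))))
 module _ (k : ℕ) {{nz : NonZero k}} (ℓ a φ : ℕ) (cyc : Cyclic k ℓ a φ) where
  open Residues k
  dirichlet : ∀ B -> ∃ \ p -> Prime p × B N.< p × p ≡ₖ a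
  dirichlet B = case anyUpTo? (\ p -> prime? p ×-dec ((suc B N.≤? p) ×-dec (p % k N.≟ a % k))) (suc X) of \ where
    (yes (p , _ , pp , B<p , e)) -> p , pp , B<p , e
    (no none) -> ⊥-elim (Contradiction.contradiction E 1≤E C₈ Y 1≤Y X≤N
      (\ x 1≤x x≤X -> *≤ʳ (0≤# φ) (Q-bounded B x 1≤x (P.≤-<-trans x≤X (s≤s X<N)) (\ p pp B<p p≤x e -> none (p , s≤s (p≤x ⋙ x≤X) , pp , B<p , e))) ≫ eq≥ (#-* φ (B N.+ 12)))
      P.≤-refl (eq≥ (#-* E C₈) ≫ #-mono (m≤m+n (E N.* C₈) _) ≫ l≥T) (#-mono (m≤m+n (15 N.+ 2 N.* ℓ) _ ⋙ m≤n+m _ (E N.* C₈)) ≫ l≥T) (eq≥ ((#-* E (2 N.* C₇)) » cong (# E *_) (#-* 2 C₇)) ≫ #-mono (m≤n+m (E N.* (2 N.* C₇)) (15 N.+ 2 N.* ℓ) ⋙ m≤n+m _ (E N.* C₈)) ≫ l≥T))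
   where
   -- The constants of `Progression` and `Upper` are spelled out again because `N` is defined from
   -- `Y` and `Y` from them; they agree by computation.
   E C₃ C₄ C₅ KE K₆ C₇ C₈ T Y X N : ℕ
   E = 2 N.* φ N.* (20 N.* φ N.+ 3) N.+ 20 N.* φ N.+ 1
   C₃ = 115 N.+ (16 N.* φ N.+ (8 N.+ 12 N.* ℓ))
   C₄ = 18 N.+ 5 N.* C₃
   C₅ = C₃ N.+ 12 N.* φ
   KE = φ N.* (6 N.* 2 N.^ (4 N.* (C₅ N.* E)))
   K₆ = 12 N.* φ N.+ (24 N.+ KE)
   C₇ = 2 N.* C₄ N.+ (42 N.+ 7 N.* K₆)
   C₈ = φ N.* (B N.+ 12)
   T = E N.* C₈ N.+ (15 N.+ 2 N.* ℓ N.+ E N.* (2 N.* C₇))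
   Y = 2 N.^ (4 N.* T)
   X = (Y N.* Y) N.* (Y N.* Y)
   N = suc (X N.+ (ℓ N.+ 4))
   1≤E : 1 ≦ E
   1≤E = m≤n+m 1 _
   1≤Y : 1 ≦ Y
   1≤Y = ^-≥1 (4 N.* T) z<s
   X<N : X ≦ X N.+ (ℓ N.+ 4)
   X<N = m≤m+n X _
   X≤N : X ≦ N
   X≤N = m≤n⇒m≤1+n X<N
   4≤N : 4 ≦ N
   4≤N = m≤n⇒m≤1+n (m≤n+m 4 ℓ ⋙ m≤n+m (ℓ N.+ 4) X)
   ℓ≤N : ℓ ≦ N
   ℓ≤N = m≤n⇒m≤1+n (m≤m+n ℓ 4 ⋙ m≤n+m (ℓ N.+ 4) X)
   sys : LogSystem N
   sys = Harmonic.system ((N N.* N) N.* (N N.* N)) z<s N P.≤-refl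
   open NoPrimes N 4≤N sys k ℓ a φ cyc ℓ≤N
   open Progression N 4≤N sys k ℓ a φ cyc using (lg; lg-2^≥)
   l≥T : # T ≤ lg Y
   l≥T = lg-2^≥ T

-- Counting free orbits of a cyclic action

module OrbitCounting where
 open Nat
 import Data.List.Membership.DecPropositional as DecMem
 open import Relation.Binary.Definitions using (DecidableEquality)
 length-⊆ : ∀ {A : Set} {xs ys : List A} -> Unique xs -> (∀ {x} -> x ∈ xs -> x ∈ ys) -> length xs ≤ length ys
 length-⊆ {xs = []}     _ _ = z≤n
 length-⊆ {xs = x ∷ xs} (x∉ ∷ u) sub with ∈-∃++ (sub (here refl))
 ... | as , bs , refl = s≤s (length-⊆ u sub′) ⋙ ≤-reflexive (cong suc (length-++ as) » sym (+-suc (length as) (length bs)) » sym (length-++ as))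
  where
  sub′ : ∀ {y} -> y ∈ xs -> y ∈ as ++ bs
  sub′ {y} y∈ with ∈-++⁻ as (sub (there y∈))
  ... | inj₁ p         = ∈-++⁺ˡ p
  ... | inj₂ (here e)  = ⊥-elim (All.lookup x∉ y∈ (sym e))
  ... | inj₂ (there p) = ∈-++⁺ʳ as p
 length-partition : ∀ {A : Set} {P : A -> Set} (P? : ∀ x -> Dec (P x)) xs ->
  length xs ≡ length (filter P? xs) + length (filter (\ x -> ¬? (P? x)) xs)
 length-partition P? []       = refl
 length-partition P? (x ∷ xs) with P? x
 ... | yes _ = cong suc (length-partition P? xs)
 ... | no  _ = cong suc (length-partition P? xs) » sym (+-suc (length (filter P? xs)) _)
 module Iterate {A : Set} (σ : A -> A) where
  iter : ℕ -> A -> A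
  iter zero    x = x
  iter (suc n) x = σ (iter n x)
  iter-+ : ∀ m n x -> iter (m + n) x ≡ iter m (iter n x)
  iter-+ zero    n x = refl
  iter-+ (suc m) n x = cong σ (iter-+ m n x)
 iter-* : ∀ {A : Set} (f : A -> A) q k x -> Iterate.iter (Iterate.iter f q) k x ≡ Iterate.iter f (k * q) x
 iter-* f q zero    x = refl
 iter-* f q (suc k) x = cong (Iterate.iter f q) (iter-* f q k x) » sym (Iterate.iter-+ f q (k * q) x)
 module Orbits {A : Set} (_≟_ : DecidableEquality A) (σ : A -> A) (r : ℕ) (1≤r : 1 ≤ r) where
  open Iterate σ public
  open DecMem _≟_ using (_∈?_)
  -- A finite set on which the cyclic group of order r generated by σ acts freely; a list without
  -- repetitions stands for the set.
  record Free (L : List A) : Set where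
   field
    unique : Unique L
    closed : ∀ {x} -> x ∈ L -> σ x ∈ L
    period : ∀ {x} -> x ∈ L -> iter r x ≡ x
    free   : ∀ {x} -> x ∈ L -> ∀ i -> 1 ≤ i -> i < r -> iter i x ≢ x
  module _ {L : List A} (F : Free L) where
   open Free F
   iter-closed : ∀ i {x} -> x ∈ L -> iter i x ∈ L
   iter-closed zero    p = p
   iter-closed (suc i) p = closed (iter-closed i p)
   orbit : A -> List A
   orbit x = applyUpTo (\ i -> iter i x) r
   iter-multiple : ∀ q {x} -> x ∈ L -> iter (q * r) x ≡ x
   iter-multiple zero    _ = refl
   iter-multiple (suc q) p = iter-+ r (q * r) _ » cong (iter r) (iter-multiple q p) » period p
   orbit-∈ : ∀ {x} -> x ∈ L -> ∀ i -> iter i x ∈ orbit x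
   orbit-∈ {x} p i = subst (_∈ orbit x) (sym (cong (\ z -> iter z x) (m≡m%n+[m/n]*n i r) » iter-+ (i % r) (i / r * r) x » cong (iter (i % r)) (iter-multiple (i / r) p)))
     (∈-applyUpTo⁺ (\ i -> iter i x) (m%n<n i r))
    where instance _ = N.>-nonZero 1≤r
   orbit-unique : ∀ {x} -> x ∈ L -> Unique (orbit x)
   orbit-unique {x} p = UniqueP.applyUpTo⁺₁ (\ i -> iter i x) r distinct
    where
    distinct : ∀ {i j} -> i < j -> j < r -> iter i x ≢ iter j x
    distinct {i} {j} i<j j<r e = free (iter-closed i p) (j ∸ i) (m<n⇒0<n∸m i<j) (≤-<-trans (m∸n≤m j i) j<r) (sym (iter-+ (j ∸ i) i x) » cong (\ z -> iter z x) (m∸n+n≡m (<⇒≤ i<j)) » sym e)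
   rest : A -> List A
   rest x = filter (\ y -> ¬? (y ∈? orbit x)) L
   length-rest : ∀ {x} -> x ∈ L -> length L ≡ r + length (rest x)
   length-rest {x} p = length-partition (_∈? orbit x) L » cong (_+ length (rest x)) (same » length-applyUpTo (\ i -> iter i x) r)
    where
    same : length (filter (_∈? orbit x) L) ≡ length (orbit x)
    same = ≤-antisym (length-⊆ (UniqueP.filter⁺ (_∈? orbit x) unique) (\ q -> snd (∈-filter⁻ (_∈? orbit x) {xs = L} q)))
     (length-⊆ (orbit-unique p) (\ q -> ∈-filter⁺ (_∈? orbit x) (inL q) q))
     where
     inL : ∀ {y} -> y ∈ orbit x -> y ∈ L
     inL q with ∈-applyUpTo⁻ (\ i -> iter i x) {n = r} q
     ... | i , _ , refl = iter-closed i p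
   rest-free : ∀ {x} -> x ∈ L -> Free (rest x)
   rest-free {x} p = record
    { unique = UniqueP.filter⁺ (\ y -> ¬? (y ∈? orbit x)) unique
    ; closed = \ {y} q -> ∈-filter⁺ (\ y -> ¬? (y ∈? orbit x)) (closed (inL q)) (\ σy -> snd (∈-filter⁻ (\ y -> ¬? (y ∈? orbit x)) {xs = L} q) (back q σy))
    ; period = \ q -> period (inL q)
    ; free   = \ q -> free (inL q)
    }
    where
    inL : ∀ {y} -> y ∈ rest x -> y ∈ L
    inL q = fst (∈-filter⁻ (\ y -> ¬? (y ∈? orbit x)) {xs = L} q)
    -- The complement of an orbit is closed because the (r-1)-st iterate of σ inverts σ.
    back : ∀ {y} -> y ∈ rest x -> σ y ∈ orbit x -> y ∈ orbit x
    back {y} q s with ∈-applyUpTo⁻ (\ i -> iter i x) {n = r} s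
    ... | i , _ , e = subst (_∈ orbit x) (iter-+ (r ∸ 1) i x » cong (iter (r ∸ 1)) (sym e) » sym (cong (\ z -> iter z y) (sym (m∸n+n≡m 1≤r)) » iter-+ (r ∸ 1) 1 y) » period (inL q)) (orbit-∈ p (r ∸ 1 + i))
  orbit-count : ∀ L -> Free L -> r ∣ length L
  orbit-count L = go (length L) L ≤-refl
   where
   go : ∀ n L -> length L ≤ n -> Free L -> r ∣ length L
   go n       []      _  F = r ∣0
   go (suc n) L@(x ∷ _) le F = subst (r ∣_) (sym len) (∣m∣n⇒∣m+n ∣-refl (go n (rest F x) (≤-pred ((+-monoˡ-≤ (length (rest F x)) 1≤r ⋙ ≤-reflexive (sym len)) ⋙ le)) (rest-free F (here refl))))
    where len = length-rest F {x} (here refl)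

-- Primitive roots modulo powers of an odd prime

module PrimitiveRoots where
 open Nat
 open Arithmetic using (prime≥2; prime≥1; *-≥1; prime-induction; prime-∣-^; ^-≥1)
 open Progressions using (module Residues; Cyclic)
 open OrbitCounting
 open import Data.Integer as ℤ using (ℤ) renaming (+_ to pos)
 import Data.Integer.Properties as ℤP
 import Data.Integer.Divisibility.Signed as SD
 open import Data.Integer.Tactic.RingSolver using () renaming (solve-∀ to ℤsolve-∀)
 open import Data.Vec using (Vec; []; _∷_; replicate)
 open import Relation.Nullary.Decidable using (_×-dec_; decidable-stable)
 ∣m+n∣n⇒∣m : ∀ {d m n} -> d ∣ m + n -> d ∣ n -> d ∣ m
 ∣m+n∣n⇒∣m {d} {m} {n} h = ∣m+n∣m⇒∣n (subst (d ∣_) (+-comm m n) h)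
 prime-factor : ∀ n -> 2 ≤ n -> ∃ \ p -> Prime p × p ∣ n
 prime-factor n 2≤n = prime-induction (\ n -> 2 ≤ n -> ∃ \ p -> Prime p × p ∣ n) (\ { (s≤s ()) })
  (\ p m pp _ _ _ -> p , pp , m∣m*n m) n (z<s ⋙ 2≤n) 2≤n
 coprime-^ : ∀ {ℓ u} a -> Prime ℓ -> ¬ (ℓ ∣ u) -> Coprime (ℓ ^ a) u
 coprime-^ {ℓ} {u} a pℓ nd {zero}  (d₁ , d₂) = ⊥-elim (nd (subst (ℓ ∣_) (sym (0∣⇒≡0 d₂)) (ℓ ∣0)))
 coprime-^ {ℓ} {u} a pℓ nd {suc zero} _ = refl
 coprime-^ {ℓ} {u} a pℓ nd {suc (suc d)} (d₁ , d₂) with prime-factor (suc (suc d)) (s≤s z<s)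
 ... | q , pq , q∣d = ⊥-elim (nd (subst (_∣ u) (prime-∣-^ a pℓ pq (∣-trans q∣d d₁)) (∣-trans q∣d d₂)))
 cancel-^ : ∀ {ℓ u} a x -> Prime ℓ -> ¬ (ℓ ∣ u) -> ℓ ^ a ∣ u * x -> ℓ ^ a ∣ x
 cancel-^ a x pℓ nd = coprime-divisor (coprime-^ a pℓ nd)
 m<n*m : ∀ m n .{{_ : NonZero m}} -> 2 ≤ n -> m < n * m
 m<n*m m n h = <-≤-trans (m<m*n m n h) (≤-reflexive (*-comm m n))
 *-^ : ∀ x y n -> (x * y) ^ n ≡ x ^ n * y ^ n
 *-^ x y zero    = refl
 *-^ x y (suc n) = cong (x * y *_) (*-^ x y n) » lem x y (x ^ n) (y ^ n)
  where
  lem : ∀ x y u v -> x * y * (u * v) ≡ x * u * (y * v)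
  lem = solve-∀
 module Mod (k : ℕ) {{nz : NonZero k}} where
  open Residues k public using (_≡ₖ_; *-congₖ)
  ≡ₖ⇒∣ : ∀ {a b} -> a ≤ b -> a ≡ₖ b -> k ∣ b ∸ a
  ≡ₖ⇒∣ {a} {b} a≤b e = divides (b / k ∸ a / k) (cong₂ _∸_ (m≡m%n+[m/n]*n b k) (m≡m%n+[m/n]*n a k » cong (_+ a / k * k) e) » [m+n]∸[m+o]≡n∸o (b % k) (b / k * k) (a / k * k) » sym (*-distribʳ-∸ k (b / k) (a / k)))
  ∣⇒≡ₖ : ∀ {a b} -> a ≤ b -> k ∣ b ∸ a -> a ≡ₖ b
  ∣⇒≡ₖ {a} {b} a≤b (divides q e) = sym (cong (_% k) (sym (m+[n∸m]≡n a≤b) » cong (a +_) e) » [m+kn]%n≡m%n a q k)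
  ^-congₖ : ∀ {a b} n -> a ≡ₖ b -> a ^ n ≡ₖ b ^ n
  ^-congₖ zero    e = refl
  ^-congₖ {a} {b} (suc n) e = *-congₖ {a} {b} {a ^ n} {b ^ n} e (^-congₖ n e)
  1^≡ : ∀ n -> 1 ^ n ≡ₖ 1
  1^≡ n = cong (_% k) (^-zeroˡ n)
  pow-1 : ∀ {x m} -> x ^ m ≡ₖ 1 -> ∀ q -> x ^ (q * m) ≡ₖ 1
  pow-1 {x} {m} e q = cong (_% k) (cong (x ^_) (*-comm q m) » sym (^-*-assoc x m q)) » ^-congₖ {x ^ m} {1} q e » 1^≡ q
  cancelₖ : ∀ {u a b} -> (∀ x -> k ∣ u * x -> k ∣ x) -> u * a ≡ₖ u * b -> a ≡ₖ b
  cancelₖ {u} {a} {b} c e with ≤-total a b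
  ... | inj₁ a≤b = ∣⇒≡ₖ a≤b (c (b ∸ a) (subst (k ∣_) (sym (*-distribˡ-∸ u b a)) (≡ₖ⇒∣ (*-monoʳ-≤ u a≤b) e)))
  ... | inj₂ b≤a = sym (∣⇒≡ₖ b≤a (c (a ∸ b) (subst (k ∣_) (sym (*-distribˡ-∸ u a b)) (≡ₖ⇒∣ (*-monoʳ-≤ u b≤a) (sym e)))))
  -- Over ℕ Bézout reads d + tn = sm with d the gcd, or the same with m and n exchanged. In x^d ·
  -- x^(tn) = x^(sm) both known powers are 1.
  pow-gcd : ∀ {x m n} -> (∀ y -> k ∣ x * y -> k ∣ y) -> x ^ m ≡ₖ 1 -> x ^ n ≡ₖ 1 -> x ^ gcd m n ≡ₖ 1
  pow-gcd {x} {m} {n} c em en with Bézout.identity (gcd-GCD m n)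
  ... | Bézout.+- s t eq = (cong (_% k) (sym (*-identityʳ (x ^ gcd m n))) » *-congₖ {x ^ gcd m n} {x ^ gcd m n} {1} refl (sym (pow-1 {x} {n} en t))) » cong (_% k) (sym (^-distribˡ-+-* x (gcd m n) (t * n)) » cong (x ^_) eq) » pow-1 {x} {m} em s
  ... | Bézout.-+ s t eq = (cong (_% k) (sym (*-identityʳ (x ^ gcd m n))) » *-congₖ {x ^ gcd m n} {x ^ gcd m n} {1} refl (sym (pow-1 {x} {m} em s))) » cong (_% k) (sym (^-distribˡ-+-* x (gcd m n) (s * m)) » cong (x ^_) eq) » pow-1 {x} {n} en t
 least : ∀ (P : ℕ -> Set) -> (∀ n -> Dec (P n)) -> ∀ n -> P n -> ∃ \ m -> P m × (∀ i -> i < m -> ¬ P i)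
 least P P? = <-rec (\ n -> P n -> ∃ \ m -> P m × (∀ i -> i < m -> ¬ P i)) (\ n rec p -> case anyUpTo? P? n of \ where
  (yes (m , m<n , q)) -> rec m<n q
  (no none)           -> n , p , \ i i<n q -> none (i , i<n , q))
 -- Monic polynomials of degree n over ℤ, given by their n lower coefficients.
 evalM : ∀ {n} -> Vec ℤ n -> ℤ -> ℤ
 evalM []       x = pos 1
 evalM (c ∷ cs) x = c ℤ.+ x ℤ.* evalM cs x
 addMul : ∀ {n} -> Vec ℤ (suc n) -> ℤ -> Vec ℤ n -> Vec ℤ (suc n)
 addMul (c ∷ cs) a []       = (c ℤ.+ a) ∷ cs
 addMul (c ∷ cs) a (d ∷ ds) = (c ℤ.+ a ℤ.* d) ∷ addMul cs a ds
 addMul-eval : ∀ {n} (cs : Vec ℤ (suc n)) a ds x -> evalM (addMul cs a ds) x ≡ evalM cs x ℤ.+ a ℤ.* evalM ds x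
 addMul-eval (c ∷ cs) a []       x = lem c a (x ℤ.* evalM cs x)
  where
  lem : ∀ c a y -> c ℤ.+ a ℤ.+ y ≡ c ℤ.+ y ℤ.+ a ℤ.* pos 1
  lem = ℤsolve-∀
 addMul-eval (c ∷ cs) a (d ∷ ds) x = cong (\ z -> c ℤ.+ a ℤ.* d ℤ.+ x ℤ.* z) (addMul-eval cs a ds x) » lem c a d x (evalM cs x) (evalM ds x)
  where
  lem : ∀ c a d x u v -> c ℤ.+ a ℤ.* d ℤ.+ x ℤ.* (u ℤ.+ a ℤ.* v) ≡ c ℤ.+ x ℤ.* u ℤ.+ a ℤ.* (d ℤ.+ x ℤ.* v)
  lem = ℤsolve-∀
 quot : ∀ {n} -> Vec ℤ (suc n) -> ℤ -> Vec ℤ n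
 quot {zero}  (c ∷ [])        a = []
 quot {suc n} (c ∷ cs) a = addMul cs a (quot cs a)
 quot-eval : ∀ {n} (f : Vec ℤ (suc n)) a x -> evalM f x ℤ.- evalM f a ≡ (x ℤ.- a) ℤ.* evalM (quot f a) x
 quot-eval {zero}  (c ∷ []) a x = lem c a x
  where
  lem : ∀ c a x -> (c ℤ.+ x ℤ.* pos 1) ℤ.- (c ℤ.+ a ℤ.* pos 1) ≡ (x ℤ.- a) ℤ.* pos 1
  lem = ℤsolve-∀
 quot-eval {suc n} (c ∷ cs) a x = lem c a x (evalM cs x) (evalM cs a) » cong (\ z -> (x ℤ.- a) ℤ.* evalM cs x ℤ.+ a ℤ.* z) (quot-eval cs a x) » lem′ (x ℤ.- a) (evalM cs x) a (evalM (quot cs a) x) » cong ((x ℤ.- a) ℤ.*_) (sym (addMul-eval cs a (quot cs a) x))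
  where
  lem : ∀ c a x u v -> (c ℤ.+ x ℤ.* u) ℤ.- (c ℤ.+ a ℤ.* v) ≡ (x ℤ.- a) ℤ.* u ℤ.+ a ℤ.* (u ℤ.- v)
  lem = ℤsolve-∀
  lem′ : ∀ d u a q -> d ℤ.* u ℤ.+ a ℤ.* (d ℤ.* q) ≡ d ℤ.* (u ℤ.+ a ℤ.* q)
  lem′ = ℤsolve-∀
 module PrimeMod (ℓ : ℕ) (pℓ : Prime ℓ) where
  infix 4 _∣ℓ
  _∣ℓ : ℤ -> Set
  i ∣ℓ = ℓ ∣ ℤ.∣ i ∣
  instance
   nzℓ : NonZero ℓ
   nzℓ = prime⇒nonZero pℓ
  open Mod ℓ public
  ∣ℓ-sub : ∀ i j -> i ∣ℓ -> j ∣ℓ -> (i ℤ.- j) ∣ℓ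
  ∣ℓ-sub i j p q = SD.∣⇒∣ᵤ (SD.∣m∣n⇒∣m-n {pos ℓ} {i} {j} (SD.∣ᵤ⇒∣ {pos ℓ} {i} p) (SD.∣ᵤ⇒∣ {pos ℓ} {j} q))
  ∣ℓ-mul : ∀ i j -> (i ℤ.* j) ∣ℓ -> i ∣ℓ ⊎ j ∣ℓ
  ∣ℓ-mul i j p = euclidsLemma ℤ.∣ i ∣ ℤ.∣ j ∣ pℓ (subst (ℓ ∣_) (ℤP.abs-* i j) p)
  ℓ∤1 : ¬ (ℓ ∣ 1)
  ℓ∤1 d = <⇒≱ (prime≥2 pℓ) (∣⇒≤ d)
  -- Lagrange's bound by division by X - r₀. The polynomial identities hold over ℤ, and ℓ enters
  -- only through Euclid's lemma.
  root-bound : ∀ n (f : Vec ℤ n) (r : Fin (suc n) -> ℤ) -> (∀ i j -> i ≢ j -> ¬ ((r i ℤ.- r j) ∣ℓ)) -> (∀ i -> evalM f (r i) ∣ℓ) -> ⊥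
  root-bound zero    []  r dist root = ℓ∤1 (root Fin.zero)
  root-bound (suc n) f r dist root = root-bound n (quot f a) (\ i -> r (Fin.suc i)) (\ i j ne -> dist (Fin.suc i) (Fin.suc j) (\ e -> ne (FinP.suc-injective e)))
    (\ i -> case ∣ℓ-mul (r (Fin.suc i) ℤ.- a) (evalM (quot f a) (r (Fin.suc i))) (subst _∣ℓ (quot-eval f a (r (Fin.suc i))) (∣ℓ-sub (evalM f (r (Fin.suc i))) (evalM f a) (root (Fin.suc i)) (root Fin.zero))) of \ where
     (inj₁ p) -> ⊥-elim (dist (Fin.suc i) Fin.zero (\ ()) p)
     (inj₂ p) -> p)
   where a = r Fin.zero
  evalM-zeros : ∀ n y -> evalM (replicate n (pos 0)) (pos y) ≡ pos (y ^ n)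
  evalM-zeros zero    y = refl
  evalM-zeros (suc n) y = ℤP.+-identityˡ _ » cong (pos y ℤ.*_) (evalM-zeros n y) » sym (ℤP.pos-* y (y ^ n))
  absdiff : ∀ {a b} -> a ≤ b -> ℤ.∣ pos a ℤ.- pos b ∣ ≡ b ∸ a
  absdiff {a} {b} a≤b = (cong ℤ.∣_∣ (ℤP.[+m]-[+n]≡m⊖n a b)) » (ℤP.∣⊖∣-≤ a≤b)
  diff⇒≡ₖ : ∀ a b -> (pos a ℤ.- pos b) ∣ℓ -> a ≡ₖ b
  diff⇒≡ₖ a b p with ≤-total a b
  ... | inj₁ a≤b = ∣⇒≡ₖ a≤b (subst (ℓ ∣_) (absdiff a≤b) p)
  ... | inj₂ b≤a = sym (∣⇒≡ₖ b≤a (subst (ℓ ∣_) (ℤP.∣i-j∣≡∣j-i∣ (pos a) (pos b) » absdiff b≤a) p))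
  -- Otherwise X^d - 1 would have the d + 1 roots 1, ..., d + 1, which are distinct modulo ℓ because
  -- d + 1 < ℓ.
  non-root : ∀ d -> 1 ≤ d -> d < ℓ ∸ 1 -> ∃ \ y -> 1 ≤ y × y < ℓ × ¬ (y ^ d ≡ₖ 1)
  non-root (suc d) _ d<ℓ-1 = case anyUpTo? (\ y -> (1 N.≤? y) ×-dec ¬? (y ^ suc d % ℓ N.≟ 1 % ℓ)) ℓ of \ where
     (yes (y , y<ℓ , 1≤y , n)) -> y , 1≤y , y<ℓ , n
     (no none) -> ⊥-elim (root-bound (suc d) (ℤ.-[1+ 0 ] ∷ replicate d (pos 0)) (\ i -> pos (suc (toℕ i)))
       (\ i j ne p -> ne (FinP.toℕ-injective (suc-injective (sym (m<n⇒m%n≡m (bd i)) » diff⇒≡ₖ (suc (toℕ i)) (suc (toℕ j)) p » m<n⇒m%n≡m (bd j)))))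
       (\ i -> root (suc (toℕ i)) z<s (decidable-stable (suc (toℕ i) ^ suc d % ℓ N.≟ 1 % ℓ) (\ n -> none (suc (toℕ i) , bd i , s≤s z≤n , n)))))
   where
   bd : ∀ (i : Fin (suc (suc d))) -> suc (toℕ i) < ℓ
   bd i = ≤-<-trans (FinP.toℕ<n i) (≤-<-trans d<ℓ-1 (∸-monoʳ-< {ℓ} {1} {0} z<s (prime≥1 pℓ)))
   root : ∀ y -> 1 ≤ y -> y ^ suc d ≡ₖ 1 -> evalM (ℤ.-[1+ 0 ] ∷ replicate d (pos 0)) (pos y) ∣ℓ
   root y 1≤y e = subst (ℓ ∣_) (sym ((cong ℤ.∣_∣ (cong (\ z -> ℤ.-[1+ 0 ] ℤ.+ pos y ℤ.* z) (evalM-zeros d y) » cong (\ z -> ℤ.-[1+ 0 ] ℤ.+ z) (sym (ℤP.pos-* y (y ^ d))))) » abs1 (y ^ suc d) (^-≥1 (suc d) 1≤y))) (≡ₖ⇒∣ {1} {y ^ suc d} (^-≥1 (suc d) 1≤y) (sym e))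
    where
    abs1 : ∀ n -> 1 ≤ n -> ℤ.∣ ℤ.-[1+ 0 ] ℤ.+ pos n ∣ ≡ n ∸ 1
    abs1 (suc n) _ = refl
  cancelℓ : ∀ {u} -> ¬ (ℓ ∣ u) -> ∀ x -> ℓ ∣ u * x -> ℓ ∣ x
  cancelℓ {u} nd x d with euclidsLemma u x pℓ d
  ... | inj₁ p = ⊥-elim (nd p)
  ... | inj₂ p = p
  unit-pow : ∀ {u} -> ¬ (ℓ ∣ u) -> ∀ n -> ¬ (ℓ ∣ u ^ n)
  unit-pow nd zero    d = ℓ∤1 d
  unit-pow {u} nd (suc n) d = unit-pow nd n (cancelℓ nd (u ^ n) d)
  unit< : ∀ {y} -> 1 ≤ y -> y < ℓ -> ¬ (ℓ ∣ y)
  unit< 1≤y y<ℓ d = <⇒≱ y<ℓ (∣⇒≤ {{N.>-nonZero 1≤y}} d)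
  has-order : ∀ y -> ¬ (ℓ ∣ y) -> ∃ \ r -> (1 ≤ r × y ^ r ≡ₖ 1) × (∀ i -> i < r -> ¬ (1 ≤ i × y ^ i ≡ₖ 1))
  has-order y nd with FinP.pigeonhole {ℓ} {suc ℓ} ≤-refl (\ i -> fromℕ< (m%n<n (y ^ toℕ i) ℓ))
  ... | i , j , i<j , e = least (\ r -> 1 ≤ r × y ^ r ≡ₖ 1) (\ r -> (1 N.≤? r) ×-dec (y ^ r % ℓ N.≟ 1 % ℓ)) (toℕ j ∸ toℕ i)
    (m<n⇒0<n∸m i<j , sym (cancelₖ {y ^ toℕ i} {1} (cancelℓ (unit-pow nd (toℕ i))) (cong (_% ℓ) (*-identityʳ (y ^ toℕ i)) » (sym (FinP.toℕ-fromℕ< (m%n<n (y ^ toℕ i) ℓ)) » cong toℕ e » FinP.toℕ-fromℕ< (m%n<n (y ^ toℕ j) ℓ)) » cong (_% ℓ) (cong (y ^_) (sym (m+[n∸m]≡n (<⇒≤ i<j))) » ^-distribˡ-+-* y (toℕ i) (toℕ j ∸ toℕ i)))))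
  -- Multiplication by y acts on 1, ..., ℓ - 1 with free orbits of length the order of y, so this
  -- order divides ℓ - 1.
  fermat : ∀ y -> ¬ (ℓ ∣ y) -> y ^ (ℓ ∸ 1) ≡ₖ 1
  fermat y nd = sub (subst (r ∣_) (length-applyUpTo suc (ℓ ∸ 1)) (orbit-count (applyUpTo suc (ℓ ∸ 1)) free-action))
   where
   ho = has-order y nd
   r = fst ho
   1≤r = fst (fst (snd ho))
   yr = snd (fst (snd ho))
   σ : ℕ -> ℕ
   σ x = (y * x) % ℓ
   open Orbits N._≟_ σ r 1≤r
   sub : r ∣ ℓ ∸ 1 -> y ^ (ℓ ∸ 1) ≡ₖ 1
   sub (divides q e) = cong (\ z -> y ^ z % ℓ) e » pow-1 {y} {r} yr q
   iter-pow : ∀ i x -> x < ℓ -> iter i x ≡ (y ^ i * x) % ℓ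
   iter-pow zero    x x<ℓ = sym (cong (_% ℓ) (*-identityˡ x) » m<n⇒m%n≡m x<ℓ)
   iter-pow (suc i) x x<ℓ = cong (\ z -> (y * z) % ℓ) (iter-pow i x x<ℓ) » *-congₖ {y} {y} {(y ^ i * x) % ℓ} {y ^ i * x} refl (m%n%n≡m%n (y ^ i * x) ℓ) » cong (_% ℓ) (sym (*-assoc y (y ^ i) x))
   inRange : ∀ {x} -> x ∈ applyUpTo suc (ℓ ∸ 1) -> 1 ≤ x × x < ℓ
   inRange p with ∈-applyUpTo⁻ suc {n = ℓ ∸ 1} p
   ... | i , i< , refl = s≤s z≤n , <-≤-trans (s≤s i<) (≤-reflexive (m+[n∸m]≡n (prime≥1 pℓ)))
   toRange : ∀ {x} -> 1 ≤ x -> x < ℓ -> x ∈ applyUpTo suc (ℓ ∸ 1)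
   toRange {suc x} _ x<ℓ = ∈-applyUpTo⁺ suc (∸-monoˡ-≤ 1 x<ℓ)
   free-action : Free (applyUpTo suc (ℓ ∸ 1))
   free-action = record
    { unique = UniqueP.applyUpTo⁺₁ suc (ℓ ∸ 1) (\ i<j _ e -> <⇒≢ i<j (suc-injective e))
    ; closed = \ {x} p -> toRange (n≢0⇒n>0 (\ z -> unit< (fst (inRange p)) (snd (inRange p)) (cancelℓ nd x (m%n≡0⇒n∣m (y * x) ℓ z)))) (m%n<n (y * x) ℓ)
    ; period = \ {x} p -> iter-pow r x (snd (inRange p)) » *-congₖ {y ^ r} {1} {x} yr refl » cong (_% ℓ) (*-identityˡ x) » m<n⇒m%n≡m (snd (inRange p))
    ; free   = \ {x} p i 1≤i i<r e -> snd (snd ho) i i<r (1≤i , cancelₖ {x} {y ^ i} {1} (cancelℓ (unit< (fst (inRange p)) (snd (inRange p)))) (cong (_% ℓ) (*-comm x (y ^ i)) » (sym (iter-pow i x (snd (inRange p))) » e) » sym (m<n⇒m%n≡m (snd (inRange p))) » cong (_% ℓ) (sym (*-identityʳ x))))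
    }
  -- Order exactly m, tested on the quotients m/r by primes r only; `ord-divides` recovers the usual
  -- property.
  record Ord (x m : ℕ) : Set where
   field
    unit  : ¬ (ℓ ∣ x)
    kills : x ^ m ≡ₖ 1
    exact : ∀ r t -> Prime r -> m ≡ r * t -> ¬ (x ^ t ≡ₖ 1)
  ord-divides : ∀ {x m d} -> 1 ≤ m -> Ord x m -> x ^ d ≡ₖ 1 -> m ∣ d
  ord-divides {x} {m} {d} 1≤m o e with gcd[m,n]∣m m d
  ... | divides q eq = go q eq
   where
   open Ord o
   g = gcd m d
   xg : x ^ g ≡ₖ 1
   xg = pow-gcd {x} {m} {d} (cancelℓ unit) kills e
   go : ∀ q -> m ≡ q * g -> m ∣ d
   go 0 eq = ⊥-elim (<⇒≢ 1≤m (sym eq))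
   go 1 eq = subst (_∣ d) (sym (eq » *-identityˡ g)) (gcd[m,n]∣n m d)
   go q@(suc (suc _)) eq with prime-factor q (s≤s z<s)
   ... | r , pr , divides t qt = ⊥-elim (exact r (t * g) pr (eq » cong (_* g) (qt » *-comm t r) » *-assoc r t g) (pow-1 {x} {g} xg t))
  -- For q = r the exponent t is a multiple of m, so y^t = 1 and x^t = 1, against the order of x.
  -- For q ∣ m the roles of x and y are exchanged.
  ord-product : ∀ {x y r s m} -> Prime r -> ¬ (r ∣ m) -> 1 ≤ m -> Ord x (r ^ suc s) -> Ord y m -> Ord (x * y) (r ^ suc s * m)
  ord-product {x} {y} {r} {s} {m} pr r∤m 1≤m ox oy = record
   { unit  = \ d -> case euclidsLemma x y pℓ d of \ { (inj₁ p) -> Ord.unit ox p ; (inj₂ p) -> Ord.unit oy p }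
   ; kills = split (R * m) » *-congₖ {x ^ (R * m)} {1} {y ^ (R * m)} {1} (cong (\ z -> x ^ z % ℓ) (*-comm R m) » pow-1 {x} {R} (Ord.kills ox) m) (pow-1 {y} {m} (Ord.kills oy) R) » refl
   ; exact = exact
   }
   where
   R = r ^ suc s
   1≤R : 1 ≤ R
   1≤R = ^-≥1 (suc s) (prime≥1 pr)
   split : ∀ n -> (x * y) ^ n ≡ₖ x ^ n * y ^ n
   split n = cong (_% ℓ) (*-^ x y n)
   exact : ∀ q t -> Prime q -> R * m ≡ q * t -> ¬ ((x * y) ^ t ≡ₖ 1)
   exact q t pq eq e with q N.≟ r
   ... | yes refl = r∤m (*-cancelˡ-∣ (r ^ s) {{m^n≢0 r s {{prime⇒nonZero pr}}}} (subst (_∣ r ^ s * m) (*-comm r (r ^ s)) (subst (R ∣_) t≡ (ord-divides 1≤R ox xt))))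
    where
    t≡ : t ≡ r ^ s * m
    t≡ = *-cancelˡ-≡ t (r ^ s * m) r {{prime⇒nonZero pr}} (sym eq » *-assoc r (r ^ s) m)
    yt : y ^ t ≡ₖ 1
    yt = cong (\ z -> y ^ z % ℓ) t≡ » pow-1 {y} {m} (Ord.kills oy) (r ^ s)
    xt : x ^ t ≡ₖ 1
    xt = cong (_% ℓ) (sym (*-identityʳ (x ^ t))) » *-congₖ {x ^ t} {x ^ t} {1} {y ^ t} refl (sym yt) » sym (split t) » e
   ... | no q≢r with euclidsLemma R m pq (divides t (eq » *-comm q t))
   ...   | inj₁ p = q≢r (prime-∣-^ (suc s) pr pq p)
   ...   | inj₂ (divides u mu) = q≢r (prime-∣-^ (suc s) pr pq (*-cancelʳ-∣ u {{N.≢-nonZero (\ { refl -> <⇒≢ 1≤m (sym mu) })}} (subst₂ _∣_ (mu » *-comm u q) t≡ (ord-divides 1≤m oy yt))))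
    where
    t≡ : t ≡ R * u
    t≡ = *-cancelˡ-≡ t (R * u) q {{prime⇒nonZero pq}} (sym eq » cong (R *_) mu » sym (*-assoc R u q) » *-comm (R * u) q)
    xt : x ^ t ≡ₖ 1
    xt = cong (\ z -> x ^ z % ℓ) (t≡ » *-comm R u) » pow-1 {x} {R} (Ord.kills ox) u
    yt : y ^ t ≡ₖ 1
    yt = cong (_% ℓ) (sym (*-identityˡ (y ^ t))) » *-congₖ {1} {x ^ t} {y ^ t} (sym xt) refl » sym (split t) » e
  strip : ∀ r -> Prime r -> ∀ m -> 1 ≤ m -> ∃ \ s -> ∃ \ m′ -> m ≡ r ^ s * m′ × ¬ (r ∣ m′) × 1 ≤ m′
  strip r pr = <-rec (\ m -> 1 ≤ m -> ∃ \ s -> ∃ \ m′ -> m ≡ r ^ s * m′ × ¬ (r ∣ m′) × 1 ≤ m′) \ where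
   m rec 1≤m -> case r ∣? m of \ where
    (no ¬d) -> 0 , m , sym (*-identityˡ m) , ¬d , 1≤m
    (yes (divides zero eq)) -> ⊥-elim (<⇒≢ 1≤m (sym eq))
    (yes (divides q@(suc _) refl)) -> case rec {q} (m<m*n q r (prime≥2 pr)) z<s of \ where
     (s , m′ , e , nd , 1≤m′) -> suc s , m′ , trans (cong (_* r) e) (*-comm (r ^ s * m′) r » sym (*-assoc r (r ^ s) m′)) , nd , 1≤m′
  -- Built from prime powers: if r^(s+1) divides ℓ - 1 and z^((ℓ-1)/r) is not 1, then
  -- z^((ℓ-1)/r^(s+1)) has order r^(s+1), and elements of coprime orders are multiplied.
  generator : ∃ \ g -> Ord g (ℓ ∸ 1)
  generator = go (ℓ ∸ 1) (∸-monoˡ-≤ 1 (prime≥2 pℓ)) 1 (*-identityʳ (ℓ ∸ 1)) (\ r pr _ d -> <⇒≱ (prime≥2 pr) (∣⇒≤ d))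
   where
   n = ℓ ∸ 1
   go : ∀ m -> 1 ≤ m -> ∀ m′ -> m * m′ ≡ n -> (∀ r -> Prime r -> r ∣ m -> ¬ (r ∣ m′)) -> ∃ \ x -> Ord x m
   go = <-rec (\ m -> 1 ≤ m -> ∀ m′ -> m * m′ ≡ n -> (∀ r -> Prime r -> r ∣ m -> ¬ (r ∣ m′)) -> ∃ \ x -> Ord x m) \ where
     1 rec _ m′ eq cop -> 1 , record { unit = ℓ∤1 ; kills = 1^≡ 1 ; exact = \ r t pr e _ -> <⇒≱ (prime≥2 pr) (∣⇒≤ (divides {r} {1} t (e » *-comm r t))) }
     m@(suc (suc _)) rec 1≤m m′ eq cop -> case prime-factor m (s≤s z<s) of \ where
      (r , pr , r∣m) -> case strip r pr m 1≤m of \ where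
       (zero  , m₁ , e , nd , _)    -> ⊥-elim (nd (subst (r ∣_) (e » *-identityˡ m₁) r∣m))
       (suc s , m₁ , e , nd , 1≤m₁) -> build m m′ eq cop rec r pr r∣m s m₁ e nd 1≤m₁
    where
    build : ∀ m m′ -> m * m′ ≡ n -> (∀ r -> Prime r -> r ∣ m -> ¬ (r ∣ m′)) -> (∀ {m₁} -> m₁ < m -> 1 ≤ m₁ -> ∀ m′ -> m₁ * m′ ≡ n -> (∀ r -> Prime r -> r ∣ m₁ -> ¬ (r ∣ m′)) -> ∃ \ x -> Ord x m₁) ->
     ∀ r -> Prime r -> r ∣ m -> ∀ s m₁ -> m ≡ r ^ suc s * m₁ -> ¬ (r ∣ m₁) -> 1 ≤ m₁ -> ∃ \ x -> Ord x m
    build m m′ eq cop rec r pr r∣m s m₁ e nd 1≤m₁ = x * y , subst (Ord (x * y)) (sym e) (ord-product {x} {y} {r} {s} {m₁} pr nd 1≤m₁ ox oy)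
     where
     R = r ^ suc s
     2≤R : 2 ≤ R
     2≤R = prime≥2 pr ⋙ m≤m*n r (r ^ s) {{m^n≢0 r s {{prime⇒nonZero pr}}}}
     n≡ : n ≡ R * (m₁ * m′)
     n≡ = sym eq » cong (_* m′) e » *-assoc R m₁ m′
     1≤n : 1 ≤ n
     1≤n = ∸-monoˡ-≤ 1 (prime≥2 pℓ)
     w = r ^ s * (m₁ * m′)
     n≡rw : n ≡ r * w
     n≡rw = n≡ » *-assoc r (r ^ s) (m₁ * m′)
     1≤w : 1 ≤ w
     1≤w = n≢0⇒n>0 (\ z -> <⇒≢ 1≤n (sym (n≡rw » cong (r *_) z » *-zeroʳ r)))
     nr = non-root w 1≤w (subst (w <_) (sym n≡rw) (m<n*m w r {{N.>-nonZero 1≤w}} (prime≥2 pr)))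
     z = fst nr
     uz : ¬ (ℓ ∣ z)
     uz = unit< (fst (snd nr)) (fst (snd (snd nr)))
     x = z ^ (m₁ * m′)
     zpow : ∀ k -> x ^ k ≡ z ^ (k * (m₁ * m′))
     zpow k = ^-*-assoc z (m₁ * m′) k » cong (z ^_) (*-comm (m₁ * m′) k)
     ox : Ord x R
     ox = record
      { unit  = unit-pow uz (m₁ * m′)
      ; kills = cong (_% ℓ) (zpow R » cong (z ^_) (sym n≡)) » fermat z uz
      ; exact = \ q t pq eqt xt -> snd (snd (snd nr)) (cong (_% ℓ) (sym (zpow t » cong (\ u -> z ^ (u * (m₁ * m′))) (t≡ q t pq eqt))) » xt)
      }
      where
      t≡ : ∀ q t -> Prime q -> R ≡ q * t -> t ≡ r ^ s
      t≡ q t pq eqt with prime-∣-^ (suc s) pr pq (divides t (eqt » *-comm q t))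
      ... | refl = *-cancelˡ-≡ t (r ^ s) r {{prime⇒nonZero pr}} (sym eqt)
     sub : ∃ \ y -> Ord y m₁
     sub = rec {m₁} (subst (m₁ <_) (sym e) (m<n*m m₁ R {{N.>-nonZero 1≤m₁}} 2≤R)) 1≤m₁ (R * m′)
      ((sym (*-assoc m₁ R m′) » cong (_* m′) (*-comm m₁ R » sym e)) » eq)
      (\ q pq q∣m₁ d -> case euclidsLemma R m′ pq d of \ where
       (inj₁ p) -> nd (subst (_∣ m₁) (prime-∣-^ (suc s) pr pq p) q∣m₁)
       (inj₂ p) -> cop q pq (subst (q ∣_) (sym e) (∣n⇒∣m*n R q∣m₁)) p)
     y = fst sub
     oy = snd sub
 expand₁ : ∀ t n -> ∃ \ c -> (1 + t) ^ n ≡ 1 + n * t + t * t * c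
 expand₁ t zero    = 0 , sym (cong suc (*-zeroʳ (t * t)))
 expand₁ t (suc n) with expand₁ t n
 ... | c , e = c + n + t * c , trans (cong ((1 + t) *_) e) (lem t n c)
  where
  lem : ∀ t n c -> (1 + t) * (1 + n * t + t * t * c) ≡ 1 + (1 + n) * t + t * t * (c + n + t * c)
  lem = solve-∀
 triangle : ℕ -> ℕ
 triangle zero    = 0
 triangle (suc n) = triangle n + n
 expand₂ : ∀ t n -> ∃ \ c -> (1 + t) ^ n ≡ 1 + n * t + triangle n * (t * t) + t * t * t * c
 expand₂ t zero    = 0 , sym (cong suc (*-zeroʳ (t * t * t)))
 expand₂ t (suc n) with expand₂ t n
 ... | c , e = c + triangle n + t * c , trans (cong ((1 + t) *_) e) (lem t n (triangle n) c)
  where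
  lem : ∀ t n T c -> (1 + t) * (1 + n * t + T * (t * t) + t * t * t * c) ≡ 1 + (1 + n) * t + (T + n) * (t * t) + t * t * t * (c + T + t * c)
  lem = solve-∀
 triangle-double : ∀ n -> 2 * triangle n + n ≡ n * n
 triangle-double zero    = refl
 triangle-double (suc n) = lem (triangle n) n » cong (\ z -> z + (1 + 2 * n)) (triangle-double n) » lem′ n
  where
  lem : ∀ T n -> 2 * (T + n) + (1 + n) ≡ (2 * T + n) + (1 + 2 * n)
  lem = solve-∀
  lem′ : ∀ n -> n * n + (1 + 2 * n) ≡ (1 + n) * (1 + n)
  lem′ = solve-∀
 module Lift (ℓ : ℕ) (pℓ : Prime ℓ) (ℓ≢2 : ℓ ≢ 2) where
  open PrimeMod ℓ pℓ
  n : ℕ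
  n = ℓ ∸ 1
  1≤n : 1 ≤ n
  1≤n = ∸-monoˡ-≤ 1 (prime≥2 pℓ)
  suc-n : 1 + n ≡ ℓ
  suc-n = m+[n∸m]≡n (prime≥1 pℓ)
  -- Oddness of ℓ enters here: the quadratic coefficient ℓ(ℓ-1)/2 of (1 + t)^ℓ has to be divisible
  -- by ℓ.
  ℓ∣triangle : ℓ ∣ triangle ℓ
  ℓ∣triangle with euclidsLemma 2 (triangle ℓ) pℓ (∣m+n∣n⇒∣m (subst (ℓ ∣_) (sym (triangle-double ℓ)) (m∣m*n ℓ)) ∣-refl)
  ... | inj₂ d = d
  ... | inj₁ d = ⊥-elim (ℓ≢2 (≤-antisym (∣⇒≤ d) (prime≥2 pℓ)))
  -- ℓ ∤ u says that g^(ℓ-1) is not 1 modulo ℓ², the condition under which a primitive root stays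
  -- primitive modulo all higher powers.
  record Root : Set where
   field
    g u  : ℕ
    ord  : Ord g n
    g^n  : g ^ n ≡ 1 + ℓ * u
    ℓ∤u  : ¬ (ℓ ∣ u)
  root : Root
  root = case u₀-div of \ where
     (no ¬d) -> record { g = g₀ ; u = u₀ ; ord = o ; g^n = e₀ ; ℓ∤u = ¬d }
     -- If g₀^(ℓ-1) is 1 modulo ℓ², then g₀(1 + ℓ) is still a root modulo ℓ and its (ℓ-1)-st power
     -- is 1 + (ℓ-1)ℓ modulo ℓ².
     (yes (divides v eq)) -> record { g = g₀ * (1 + ℓ) ; u = n + ℓ * w v ; ord = ord′ ; g^n = e₁ v eq
      ; ℓ∤u = \ d -> unit< 1≤n (≤-reflexive suc-n) (∣m+n∣n⇒∣m {ℓ} {n} d (m∣m*n (w v))) }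
   where
   g₀ = fst generator
   o = snd generator
   div : ℓ ∣ g₀ ^ n ∸ 1
   div = ≡ₖ⇒∣ {1} {g₀ ^ n} (n≢0⇒n>0 (\ z -> unit-pow (Ord.unit o) n (subst (ℓ ∣_) (sym z) (ℓ ∣0)))) (sym (Ord.kills o))
   u₀ = quotient div
   u₀-div : Dec (ℓ ∣ u₀)
   u₀-div = ℓ ∣? u₀
   e₀ : g₀ ^ n ≡ 1 + ℓ * u₀
   e₀ = sym (m+[n∸m]≡n {1} (n≢0⇒n>0 (\ z -> unit-pow (Ord.unit o) n (subst (ℓ ∣_) (sym z) (ℓ ∣0))))) » cong suc (_∣_.equality div » *-comm u₀ ℓ)
   c = fst (expand₁ ℓ n)
   w : ℕ -> ℕ
   w v = c + v + v * n * ℓ + v * ℓ * ℓ * c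
   e₁ : ∀ v -> u₀ ≡ v * ℓ -> (g₀ * (1 + ℓ)) ^ n ≡ 1 + ℓ * (n + ℓ * w v)
   e₁ v eq = (*-^ g₀ (1 + ℓ) n) » cong₂ _*_ (e₀ » cong (\ z -> 1 + ℓ * z) eq) (snd (expand₁ ℓ n)) » lem ℓ v n c
    where
    lem : ∀ ℓ v n c -> (1 + ℓ * (v * ℓ)) * (1 + n * ℓ + ℓ * ℓ * c) ≡ 1 + ℓ * (n + ℓ * (c + v + v * n * ℓ + v * ℓ * ℓ * c))
    lem = solve-∀
   same : g₀ * (1 + ℓ) ≡ₖ g₀
   same = cong (_% ℓ) (*-distribˡ-+ g₀ 1 ℓ » cong (_+ g₀ * ℓ) (*-identityʳ g₀)) » [m+kn]%n≡m%n g₀ g₀ ℓ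
   ord′ : Ord (g₀ * (1 + ℓ)) n
   ord′ = record
    { unit  = \ d -> Ord.unit o (m%n≡0⇒n∣m g₀ ℓ (sym same » n∣m⇒m%n≡0 (g₀ * (1 + ℓ)) ℓ d))
    ; kills = ^-congₖ {g₀ * (1 + ℓ)} {g₀} n same » Ord.kills o
    ; exact = \ r t pr e x -> Ord.exact o r t pr e (sym (^-congₖ {g₀ * (1 + ℓ)} {g₀} t same) » x)
    }
  open Root root
  G : ℕ
  G = g ^ n
  level : ∀ b -> ∃ \ v -> G ^ (ℓ ^ b) ≡ 1 + ℓ ^ suc b * v × ¬ (ℓ ∣ v)
  level zero    = u , trans (*-identityʳ G) (g^n » cong (\ z -> 1 + z * u) (sym (*-identityʳ ℓ))) , ℓ∤u
  level (suc b) with level b | expand₂ (ℓ ^ suc b * fst (level b)) ℓ | ℓ∣triangle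
  ... | v , e , nd | c , x | divides τ T≡ = v * (1 + ℓ * w) , trans (cong (G ^_) (*-comm ℓ (ℓ ^ b)) » sym (^-*-assoc G (ℓ ^ b) ℓ)) (cong (_^ ℓ) e » x » cong (\ z -> 1 + ℓ * (ℓ ^ suc b * v) + z * (ℓ ^ suc b * v * (ℓ ^ suc b * v)) + ℓ ^ suc b * v * (ℓ ^ suc b * v) * (ℓ ^ suc b * v) * c) T≡ » lem ℓ (ℓ ^ b) v τ c)
    , \ d -> case euclidsLemma v (1 + ℓ * w) pℓ d of \ where
      (inj₁ p) -> nd p
      (inj₂ p) -> ℓ∤1 (∣m+n∣n⇒∣m {ℓ} {1} p (m∣m*n w))
   where
   s = ℓ ^ b * v
   w = τ * s + s * s * c
   lem : ∀ ℓ B v τ c -> 1 + ℓ * (ℓ * B * v) + τ * ℓ * (ℓ * B * v * (ℓ * B * v)) + ℓ * B * v * (ℓ * B * v) * (ℓ * B * v) * c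
    ≡ 1 + ℓ * (ℓ * B) * (v * (1 + ℓ * (τ * (B * v) + B * v * (B * v) * c)))
   lem = solve-∀
  -- For m = qℓ^b the expansion at 1 + ℓ^(b+1)v gives G^m - 1 ≡ qvℓ^(b+1) modulo ℓ^(b+2), and ℓ ∤ v,
  -- so ℓ ∣ q.
  lte : ∀ b m -> ℓ ^ suc b ∣ G ^ m ∸ 1 -> ℓ ^ b ∣ m
  lte zero    m _ = 1∣ m
  lte (suc b) m d with lte b m (∣-trans (m∣n*m ℓ {ℓ ^ suc b}) d)
   where
   m∣n*m : ∀ k {n} -> n ∣ k * n
   m∣n*m k = n∣m*n k
  ... | divides q refl with level b
  ...   | v , e , nd with expand₁ (ℓ ^ suc b * v) q
  ...     | c , x = subst (_∣ q * ℓ ^ b) refl (*-monoˡ-∣ (ℓ ^ b) ℓ∣q)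
   where
   t = ℓ ^ suc b * v
   Gm : G ^ (q * ℓ ^ b) ∸ 1 ≡ q * t + t * t * c
   Gm = cong (_∸ 1) (cong (G ^_) (*-comm q (ℓ ^ b)) » sym (^-*-assoc G (ℓ ^ b) q) » cong (_^ q) e » x)
   tt : ℓ ^ suc (suc b) ∣ t * t * c
   tt = divides (ℓ ^ b * v * v * c) (lem ℓ (ℓ ^ b) v c)
    where
    lem : ∀ ℓ B v c -> ℓ * B * v * (ℓ * B * v) * c ≡ B * v * v * c * (ℓ * (ℓ * B))
    lem = solve-∀
   qt : ℓ ^ suc b * ℓ ∣ ℓ ^ suc b * (v * q)
   qt = subst₂ _∣_ (*-comm ℓ (ℓ ^ suc b)) (lem q (ℓ ^ suc b) v) (∣m+n∣n⇒∣m {n = t * t * c} (subst (ℓ ^ suc (suc b) ∣_) Gm d) tt)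
    where
    lem : ∀ q B v -> q * (B * v) ≡ B * (v * q)
    lem = solve-∀
   ℓ∣q : ℓ ∣ q
   ℓ∣q = cancelℓ nd q (*-cancelˡ-∣ (ℓ ^ suc b) {{m^n≢0 ℓ (suc b)}} qt)
  module _ (b : ℕ) where
   k φ : ℕ
   k = ℓ ^ suc b
   φ = ℓ ^ b * n
   instance
    nzk : NonZero k
    nzk = m^n≢0 ℓ (suc b)
   module K = Mod k
   order : ∀ d -> k ∣ g ^ d ∸ 1 -> φ ∣ d
   order d h with ord-divides {g} {n} {d} 1≤n ord (sym (∣⇒≡ₖ {1} {g ^ d} 1≤gd (∣-trans (m∣m*n (ℓ ^ b)) h)))
    where
    1≤gd : 1 ≤ g ^ d
    1≤gd = n≢0⇒n>0 (\ z -> unit-pow (Ord.unit ord) d (subst (ℓ ∣_) (sym z) (ℓ ∣0)))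
   ... | divides q refl = *-monoˡ-∣ n (lte b q (subst (\ z -> k ∣ z ∸ 1) (cong (g ^_) (*-comm q n) » sym (^-*-assoc g n q)) h))
   1≤φ : 1 ≤ φ
   1≤φ = *-≥1 (^-≥1 b (prime≥1 pℓ)) 1≤n
   distinct≤ : ∀ i j -> i ≤ j -> j < i + φ -> g ^ i K.≡ₖ g ^ j -> i ≡ j
   distinct≤ i j i≤j j<i+φ e with j ∸ i in eq
   ... | zero  = ≤-antisym i≤j (m∸n≡0⇒m≤n eq)
   ... | suc m = ⊥-elim (<⇒≱ (+-cancelˡ-< i (j ∸ i) φ (subst (_< i + φ) (sym (m+[n∸m]≡n i≤j)) j<i+φ)) (∣⇒≤ {{N.>-nonZero (subst (1 ≤_) (sym eq) z<s)}} (order (j ∸ i)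
     (cancel-^ (suc b) (g ^ (j ∸ i) ∸ 1) pℓ (unit-pow (Ord.unit ord) i) (subst (k ∣_) (cong₂ _∸_ (cong (g ^_) (sym (m+[n∸m]≡n i≤j)) » ^-distribˡ-+-* g i (j ∸ i)) (sym (*-identityʳ (g ^ i))) » sym (*-distribˡ-∸ (g ^ i) (g ^ (j ∸ i)) 1)) (K.≡ₖ⇒∣ (^-monoʳ-≤ g {{N.≢-nonZero (\ z -> Ord.unit ord (subst (ℓ ∣_) (sym z) (ℓ ∣0)))}} i≤j) e))))))
   distinct : ∀ i j -> 1 ≤ i -> i ≤ φ -> 1 ≤ j -> j ≤ φ -> g ^ i K.≡ₖ g ^ j -> i ≡ j
   distinct i j 1≤i i≤φ 1≤j j≤φ e with ≤-total i j
   ... | inj₁ i≤j = distinct≤ i j i≤j (<-≤-trans (s≤s j≤φ) (+-monoˡ-≤ φ 1≤i)) e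
   ... | inj₂ j≤i = sym (distinct≤ j i j≤i (<-≤-trans (s≤s i≤φ) (+-monoˡ-≤ φ 1≤j)) (sym e))
   g^φ : g ^ φ K.≡ₖ 1
   g^φ with level b
   ... | v , e , _ = cong (_% k) ((cong (g ^_) (*-comm (ℓ ^ b) n) » sym (^-*-assoc g n (ℓ ^ b))) » e » cong (1 +_) (*-comm k v)) » [m+kn]%n≡m%n 1 v k
   q< : ∀ r -> r % k / ℓ < ℓ ^ b
   q< r = m<n*o⇒m/o<n (<-≤-trans (m%n<n r k) (≤-reflexive (*-comm ℓ (ℓ ^ b))))
   s< : ∀ r -> (r % ℓ) ∸ 1 < n
   s< r = pred< (r % ℓ) (m%n<n r ℓ)
    where
    pred< : ∀ m -> m < ℓ -> m ∸ 1 < n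
    pred< zero    _ = 1≤n
    pred< (suc m) h = ∸-monoˡ-≤ 1 h
   -- A unit modulo ℓ^(b+1) is named by its last digit in base ℓ, lowered by 1 because it is not 0,
   -- and by its remaining digits. This gives exactly φ names.
   code : ℕ -> Fin φ
   code r = Fin.combine (fromℕ< (q< r)) (fromℕ< (s< r))
   code-injective : ∀ r r′ -> ¬ (ℓ ∣ r) -> ¬ (ℓ ∣ r′) -> code r ≡ code r′ -> r K.≡ₖ r′
   code-injective r r′ ur ur′ e = m≡m%n+[m/n]*n (r % k) ℓ » cong₂ (\ x y -> x + y * ℓ) sq qq » sym (m≡m%n+[m/n]*n (r′ % k) ℓ)
    where
    parts = FinP.combine-injective (fromℕ< (q< r)) (fromℕ< (s< r)) (fromℕ< (q< r′)) (fromℕ< (s< r′)) e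
    qq : r % k / ℓ ≡ r′ % k / ℓ
    qq = sym (FinP.toℕ-fromℕ< (q< r)) » cong toℕ (fst parts) » FinP.toℕ-fromℕ< (q< r′)
    pr : (r % ℓ) ∸ 1 ≡ (r′ % ℓ) ∸ 1
    pr = sym (FinP.toℕ-fromℕ< (s< r)) » cong toℕ (snd parts) » FinP.toℕ-fromℕ< (s< r′)
    pos′ : ∀ r -> ¬ (ℓ ∣ r) -> 1 ≤ r % ℓ
    pos′ r u = n≢0⇒n>0 (\ z -> u (m%n≡0⇒n∣m r ℓ z))
    ss : r % ℓ ≡ r′ % ℓ
    ss = sym (m+[n∸m]≡n (pos′ r ur)) » cong suc pr » m+[n∸m]≡n (pos′ r′ ur′)
    red : ∀ r -> r % k % ℓ ≡ r % ℓ
    red r = sym (cong (_% ℓ) (m≡m%n+[m/n]*n r k » cong (r % k +_) (cong (r / k *_) (*-comm ℓ (ℓ ^ b)) » sym (*-assoc (r / k) (ℓ ^ b) ℓ))) » [m+kn]%n≡m%n (r % k) (r / k * ℓ ^ b) ℓ)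
    sq : r % k % ℓ ≡ r′ % k % ℓ
    sq = red r » ss » sym (red r′)
   -- Pigeonhole: m together with the φ distinct powers of g are φ + 1 units with only φ codes.
   log : ∀ m -> ¬ (ℓ ∣ m) -> ∃ \ i -> 1 ≤ i × i ≤ φ × m K.≡ₖ g ^ i
   log m um = case anyUpTo? (\ i -> (1 N.≤? i) ×-dec (m % k N.≟ g ^ i % k)) (suc φ) of \ where
      (yes (i , i<φ , 1≤i , e)) -> i , 1≤i , ≤-pred i<φ , e
      (no none) -> ⊥-elim (collide none (FinP.pigeonhole {φ} {suc φ} ≤-refl f))
    where
    f : Fin (suc φ) -> Fin φ
    f Fin.zero    = code m
    f (Fin.suc i) = code (g ^ suc (toℕ i))
    collide : ¬ (∃ \ i -> i < suc φ × 1 ≤ i × m K.≡ₖ g ^ i) -> (∃ \ i -> ∃ \ j -> i Fin.< j × f i ≡ f j) -> ⊥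
    collide none (Fin.zero  , Fin.suc j , _ , e) = none (suc (toℕ j) , s≤s (FinP.toℕ<n j) , s≤s z≤n , code-injective m (g ^ suc (toℕ j)) um (unit-pow (Ord.unit ord) (suc (toℕ j))) e)
    collide none (Fin.suc i , Fin.suc j , i<j , e) = <⇒≢ i<j (distinct (suc (toℕ i)) (suc (toℕ j)) z<s (FinP.toℕ<n i) z<s (FinP.toℕ<n j)
     (code-injective (g ^ suc (toℕ i)) (g ^ suc (toℕ j)) (unit-pow (Ord.unit ord) (suc (toℕ i))) (unit-pow (Ord.unit ord) (suc (toℕ j))) e))
   cyclic : Cyclic k ℓ g φ
   cyclic = record
    { ℓ-prime = pℓ ; ℓ∣k = m∣m*n (ℓ ^ b) ; 1≤φ = 1≤φ ; unit-a = Ord.unit ord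
    ; log = log ; distinct = distinct ; a^φ = g^φ }

-- Linear algebra over 𝔽_p by counting

module LinearAlgebra where
 open Nat
 open Arithmetic using (prime≥2; prime≥1; *-≥1; prime-∣-^; ^-≥1)
 open OrbitCounting
 open PrimitiveRoots using (prime-factor; least; module PrimeMod; module Mod)
 open import Relation.Nullary.Decidable using (map′)
 proper-divisor-^ : ∀ {ℓ g} b -> Prime ℓ -> g ∣ ℓ ^ suc b -> g ≢ ℓ ^ suc b -> g ∣ ℓ ^ b
 proper-divisor-^ {ℓ} {g} b pℓ (divides zero eq) ne = ⊥-elim (<⇒≢ (^-≥1 (suc b) (prime≥1 pℓ)) (sym eq))
 proper-divisor-^ {ℓ} {g} b pℓ (divides (suc zero) eq) ne = ⊥-elim (ne (sym (eq » *-identityˡ g)))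
 proper-divisor-^ {ℓ} {g} b pℓ (divides h@(suc (suc _)) eq) ne with prime-factor h (s≤s z<s)
 ... | q , pq , q∣h@(divides t ht) with prime-∣-^ (suc b) pℓ pq (∣-trans q∣h (divides g (eq » *-comm h g)))
 ...   | refl = divides t (*-cancelˡ-≡ (ℓ ^ b) (t * g) ℓ {{prime⇒nonZero pℓ}} (eq » cong (_* g) (ht » *-comm t ℓ) » *-assoc ℓ t g))
 funToFin-cong : ∀ {m n} {f g : Fin m -> Fin n} -> (∀ i -> f i ≡ g i) -> funToFin f ≡ funToFin g
 funToFin-cong {zero}  e = refl
 funToFin-cong {suc m} e = cong₂ Fin.combine (e Fin.zero) (funToFin-cong (e ∘ Fin.suc))
 module VectorSpace (p : ℕ) (pp : Prime p) (N : ℕ) where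
  open PrimeMod p pp public using (nzℓ; cancelℓ; cancelₖ; *-congₖ) renaming (_≡ₖ_ to _≋_)
  +-cong-≋ : ∀ {a b c d} -> a ≋ b -> c ≋ d -> a + c ≋ b + d
  +-cong-≋ {a} {b} {c} {d} e f = %-distribˡ-+ a c p » cong₂ (\ x y -> (x + y) % p) e f » sym (%-distribˡ-+ b d p)
  ∣⇒≋0 : ∀ {m} -> p ∣ m -> m ≋ 0
  ∣⇒≋0 {m} h = n∣m⇒m%n≡0 m p h » sym (m<n⇒m%n≡m (prime≥1 pp))
  neg1 : ℕ
  neg1 = p ∸ 1
  neg1-≋ : ∀ x -> neg1 * x + x ≋ 0
  neg1-≋ x = cong (_% p) (+-comm (neg1 * x) x » cong (_* x) (m+[n∸m]≡n (prime≥1 pp)) » *-comm p x) » ∣⇒≋0 (divides x refl)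
  +-cancelʳ-≋ : ∀ {a b} c -> a + c ≋ b + c -> a ≋ b
  +-cancelʳ-≋ {a} {b} c e = sym (drop a) » +-cong-≋ {a + c} {b + c} {neg1 * c} e refl » drop b
   where
   drop : ∀ a -> a + c + neg1 * c ≋ a
   drop a = cong (_% p) (+-assoc a c (neg1 * c) » cong (a +_) (+-comm c (neg1 * c))) » +-cong-≋ {a} {a} {neg1 * c + c} {0} refl (neg1-≋ c) » cong (_% p) (+-identityʳ a)
  V : Set
  V = Fin N -> ℕ
  infix  4 _≈_
  infixl 6 _⊞_
  infixl 7 _⊡_
  _≈_ : V -> V -> Set
  u ≈ v = ∀ i -> u i ≋ v i
  _⊞_ : V -> V -> V
  (u ⊞ v) i = u i + v i
  _⊡_ : ℕ -> V -> V
  (c ⊡ v) i = c * v i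
  0v : V
  0v i = 0
  ≈-refl : ∀ {u} -> u ≈ u
  ≈-refl i = refl
  ≈-sym : ∀ {u v} -> u ≈ v -> v ≈ u
  ≈-sym e i = sym (e i)
  ≈-trans : ∀ {u v w} -> u ≈ v -> v ≈ w -> u ≈ w
  ≈-trans e f i = e i » f i
  infixr 4 _⟫_
  _⟫_ : ∀ {u v w} -> u ≈ v -> v ≈ w -> u ≈ w
  _⟫_ = ≈-trans
  ≗⇒≈ : ∀ {u v : V} -> (∀ i -> u i ≡ v i) -> u ≈ v
  ≗⇒≈ e i = cong (_% p) (e i)
  ⊞-cong : ∀ {u u′ v v′} -> u ≈ u′ -> v ≈ v′ -> u ⊞ v ≈ u′ ⊞ v′
  ⊞-cong {u} {u′} {v} {v′} e f i = +-cong-≋ {u i} {u′ i} {v i} {v′ i} (e i) (f i)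
  ⊡-cong : ∀ {c d u v} -> c ≋ d -> u ≈ v -> c ⊡ u ≈ d ⊡ v
  ⊡-cong {c} {d} {u} {v} e f i = *-congₖ {c} {d} {u i} {v i} e (f i)
  ⊞-cancelʳ : ∀ {u v} w -> u ⊞ w ≈ v ⊞ w -> u ≈ v
  ⊞-cancelʳ w e i = +-cancelʳ-≋ (w i) (e i)
  _≈?_ : ∀ u v -> Dec (u ≈ v)
  u ≈? v = FinP.all? (\ i -> u i % p N.≟ v i % p)
  -- Vectors are functions compared modulo p. `canon` gives each class a name in a finite type,
  -- where equality is decidable and orbits and dimensions can be counted.
  canon : V -> Fin (p ^ N)
  canon v = funToFin (\ i -> fromℕ< (m%n<n (v i) p))
  vec : Fin (p ^ N) -> V
  vec x i = toℕ (finToFun x i)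
  vec-canon : ∀ v -> vec (canon v) ≈ v
  vec-canon v i = cong (\ z -> toℕ z % p) (FinP.finToFun-funToFin (\ i -> fromℕ< (m%n<n (v i) p)) i) » cong (_% p) (FinP.toℕ-fromℕ< (m%n<n (v i) p)) » m%n%n≡m%n (v i) p
  canon-vec : ∀ x -> canon (vec x) ≡ x
  canon-vec x = funToFin-cong (\ i -> FinP.toℕ-injective (FinP.toℕ-fromℕ< (m%n<n (vec x i) p) » m<n⇒m%n≡m (FinP.toℕ<n (finToFun x i)))) » FinP.funToFin-finToFin {N} {p} x
  canon-cong : ∀ {u v} -> u ≈ v -> canon u ≡ canon v
  canon-cong {u} {v} e = funToFin-cong (\ i -> FinP.toℕ-injective (FinP.toℕ-fromℕ< (m%n<n (u i) p) » e i » sym (FinP.toℕ-fromℕ< (m%n<n (v i) p))))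
  canon-injective : ∀ {u v} -> canon u ≡ canon v -> u ≈ v
  canon-injective {u} {v} e = ≈-sym (vec-canon u) ⟫ (≗⇒≈ (\ i -> cong (\ z -> vec z i) e)) ⟫ vec-canon v
  inverse-≋ : ∀ {c} -> ¬ (p ∣ c) -> ∃ \ d -> d * c ≋ 1
  inverse-≋ {c} nd with Bézout.identity (gcd-GCD c p)
  ... | Bézout.+- x y eq = x , trans (cong (_% p) (sym eq)) ([m+kn]%n≡m%n (gcd c p) y p » cong (_% p) g≡1)
   where
   g≡1 : gcd c p ≡ 1
   g≡1 with prime⇒irreducible pp (gcd[m,n]∣n c p)
   ... | inj₁ e = e
   ... | inj₂ e = ⊥-elim (nd (subst (_∣ c) e (gcd[m,n]∣m c p)))
  ... | Bézout.-+ x y eq = neg1 * x , trans (cong (_% p) (*-assoc neg1 x c)) (+-cancelʳ-≋ {neg1 * (x * c)} {1} (x * c) (neg1-≋ (x * c) » sym (cong (_% p) (cong (_+ x * c) (sym g≡1) » eq) » ∣⇒≋0 (divides y refl))))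
   where
   g≡1 : gcd c p ≡ 1
   g≡1 with prime⇒irreducible pp (gcd[m,n]∣n c p)
   ... | inj₁ e = e
   ... | inj₂ e = ⊥-elim (nd (subst (_∣ c) e (gcd[m,n]∣m c p)))
  record Linear (T : V -> V) : Set where
   field
    cong-≈ : ∀ {u v} -> u ≈ v -> T u ≈ T v
    add    : ∀ u v -> T (u ⊞ v) ≈ T u ⊞ T v
    scale  : ∀ c v -> T (c ⊡ v) ≈ c ⊡ T v
  Lin-zero : ∀ {T} -> Linear T -> T 0v ≈ 0v
  Lin-zero {T} L = Linear.cong-≈ L {0v} {0 ⊡ 0v} ≈-refl ⟫ Linear.scale L 0 0v ⟫ ≈-refl
  module Operator (T : V -> V) (L : Linear T) where
   open Linear L
   open Iterate T public renaming (iter to Tⁿ; iter-+ to Tⁿ-+)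
   Tⁿ-cong : ∀ n {u v} -> u ≈ v -> Tⁿ n u ≈ Tⁿ n v
   Tⁿ-cong zero    e = e
   Tⁿ-cong (suc n) e = cong-≈ (Tⁿ-cong n e)
   Tⁿ-add : ∀ n u v -> Tⁿ n (u ⊞ v) ≈ Tⁿ n u ⊞ Tⁿ n v
   Tⁿ-add zero    u v = ≈-refl
   Tⁿ-add (suc n) u v = cong-≈ (Tⁿ-add n u v) ⟫ add (Tⁿ n u) (Tⁿ n v)
   Tⁿ-scale : ∀ n c v -> Tⁿ n (c ⊡ v) ≈ c ⊡ Tⁿ n v
   Tⁿ-scale zero    c v = ≈-refl
   Tⁿ-scale (suc n) c v = cong-≈ (Tⁿ-scale n c v) ⟫ scale c (Tⁿ n v)
   Tⁿ-linear : ∀ n -> Linear (Tⁿ n)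
   Tⁿ-linear n = record { cong-≈ = Tⁿ-cong n ; add = Tⁿ-add n ; scale = Tⁿ-scale n }
   -- The polynomial ∑ c_i T^i applied to w, in Horner form.
   comb : ∀ {d} -> (Fin d -> ℕ) -> V -> V
   comb {zero}  c w = 0v
   comb {suc d} c w = c Fin.zero ⊡ w ⊞ T (comb (c ∘ Fin.suc) w)
   comb-cong : ∀ {d} {c c′ : Fin d -> ℕ} {w w′} -> (∀ i -> c i ≋ c′ i) -> w ≈ w′ -> comb c w ≈ comb c′ w′
   comb-cong {zero}  e f = ≈-refl
   comb-cong {suc d} {c} {c′} {w} {w′} e f = ⊞-cong {c Fin.zero ⊡ w} {c′ Fin.zero ⊡ w′} (⊡-cong {c Fin.zero} {c′ Fin.zero} {w} {w′} (e Fin.zero) f) (cong-≈ (comb-cong (e ∘ Fin.suc) f))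
   comb-0 : ∀ {d} (c : Fin d -> ℕ) -> comb c 0v ≈ 0v
   comb-0 {zero}  c = ≈-refl
   comb-0 {suc d} c = ⊞-cong {c Fin.zero ⊡ 0v} {0v} {T (comb (c ∘ Fin.suc) 0v)} {0v} (≗⇒≈ (\ i -> *-zeroʳ (c Fin.zero))) (cong-≈ (comb-0 (c ∘ Fin.suc)) ⟫ Lin-zero L) ⟫ ≈-refl
   comb-snoc : ∀ d (c : Fin (suc d) -> ℕ) w -> comb c w ≈ comb (c ∘ inject₁) w ⊞ c (fromℕ d) ⊡ Tⁿ d w
   comb-snoc zero    c w = ⊞-cong {c Fin.zero ⊡ w} {c Fin.zero ⊡ w} {T 0v} {0v} ≈-refl (Lin-zero L) ⟫ (≗⇒≈ (\ i -> +-identityʳ _ » sym (+-identityˡ _)))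
   comb-snoc (suc d) c w = ⊞-cong {c Fin.zero ⊡ w} {c Fin.zero ⊡ w} ≈-refl (cong-≈ (comb-snoc d (c ∘ Fin.suc) w) ⟫ add (comb (c ∘ Fin.suc ∘ inject₁) w) (c (Fin.suc (fromℕ d)) ⊡ Tⁿ d w) ⟫ ⊞-cong {T (comb (c ∘ Fin.suc ∘ inject₁) w)} {T (comb (c ∘ Fin.suc ∘ inject₁) w)} ≈-refl (scale (c (Fin.suc (fromℕ d))) (Tⁿ d w))) ⟫ (≗⇒≈ (\ i -> sym (+-assoc (c Fin.zero * w i) _ _)))
   comb-add : ∀ {d} (b c : Fin d -> ℕ) w -> comb (\ i -> b i + c i) w ≈ comb b w ⊞ comb c w
   comb-add {zero}  b c w = ≈-refl
   comb-add {suc d} b c w = ⊞-cong {(b Fin.zero + c Fin.zero) ⊡ w} {(b Fin.zero + c Fin.zero) ⊡ w} ≈-refl (cong-≈ (comb-add (b ∘ Fin.suc) (c ∘ Fin.suc) w) ⟫ add (comb (b ∘ Fin.suc) w) (comb (c ∘ Fin.suc) w)) ⟫ (≗⇒≈ (\ i -> lem (b Fin.zero) (c Fin.zero) (w i) (T (comb (b ∘ Fin.suc) w) i) (T (comb (c ∘ Fin.suc) w) i)))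
    where
    lem : ∀ b c w x y -> (b + c) * w + (x + y) ≡ b * w + x + (c * w + y)
    lem = solve-∀
   comb-scale : ∀ {d} a (c : Fin d -> ℕ) w -> comb (\ i -> a * c i) w ≈ a ⊡ comb c w
   comb-scale {zero}  a c w = ≗⇒≈ (\ i -> sym (*-zeroʳ a))
   comb-scale {suc d} a c w = ⊞-cong {(a * c Fin.zero) ⊡ w} {(a * c Fin.zero) ⊡ w} ≈-refl (cong-≈ (comb-scale a (c ∘ Fin.suc) w) ⟫ scale a (comb (c ∘ Fin.suc) w)) ⟫ (≗⇒≈ (\ i -> lem a (c Fin.zero) (w i) (T (comb (c ∘ Fin.suc) w) i)))
    where
    lem : ∀ a c w x -> a * c * w + a * x ≡ a * (c * w + x)
    lem = solve-∀
   comb-map : ∀ {A} -> Linear A -> (∀ v -> A (T v) ≈ T (A v)) -> ∀ {d} (c : Fin d -> ℕ) w -> A (comb c w) ≈ comb c (A w)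
   comb-map LA com {zero}  c w = Lin-zero LA
   comb-map {A} LA com {suc d} c w = Linear.add LA (c Fin.zero ⊡ w) (T (comb (c ∘ Fin.suc) w)) ⟫ ⊞-cong {A (c Fin.zero ⊡ w)} {c Fin.zero ⊡ A w} (Linear.scale LA (c Fin.zero) w)
    (com (comb (c ∘ Fin.suc) w) ⟫ cong-≈ (comb-map LA com (c ∘ Fin.suc) w))
   module Span (w : V) where
    Coeff : ℕ -> Set
    Coeff d = Fin d -> Fin p
    combF : ∀ {d} -> Coeff d -> V
    combF c = comb (\ i -> toℕ (c i)) w
    reduce : ∀ {d} -> (Fin d -> ℕ) -> Coeff d
    reduce c i = fromℕ< (m%n<n (c i) p)
    comb-reduce : ∀ {d} (c : Fin d -> ℕ) -> combF (reduce c) ≈ comb c w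
    comb-reduce c = comb-cong (\ i -> cong (_% p) (FinP.toℕ-fromℕ< (m%n<n (c i) p)) » m%n%n≡m%n (c i) p) ≈-refl
    Indep : ℕ -> Set
    Indep d = ∀ (c c′ : Coeff d) -> combF c ≈ combF c′ -> ∀ i -> c i ≡ c′ i
    -- Coefficient vectors are encoded in `Fin (p ^ d)` so that membership in the span is decidable
    -- by search.
    InSpan : ℕ -> Set
    InSpan d = ∃ \ (x : Fin (p ^ d)) -> combF {d} (finToFun x) ≈ Tⁿ d w
    inSpan? : ∀ d -> Dec (InSpan d)
    inSpan? d = FinP.any? (\ x -> combF {d} (finToFun x) ≈? Tⁿ d w)
    toSpan : ∀ d (c : Fin d -> ℕ) -> comb c w ≈ Tⁿ d w -> InSpan d
    toSpan d c e = funToFin (reduce c) , ≈-trans (comb-cong {d} {\ i -> toℕ (finToFun {p} (funToFin (reduce c)) i)} (\ i -> cong (\ z -> toℕ z % p) (FinP.finToFun-funToFin (reduce c) i)) ≈-refl) (comb-reduce c ⟫ e)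
    indep-zero : Indep 0
    indep-zero c c′ e ()
    -- If the top coefficients of two equal combinations differ, their difference is invertible
    -- modulo p and T^d w can be solved for; if they agree, the top terms cancel.
    indep-suc : ∀ d -> Indep d -> ¬ InSpan d -> Indep (suc d)
    indep-suc d ind out c c′ e with c (fromℕ d) FinP.≟ c′ (fromℕ d)
    ... | yes eq = snoc-ext (ind (c ∘ inject₁) (c′ ∘ inject₁) (⊞-cancelʳ (toℕ (c (fromℕ d)) ⊡ Tⁿ d w) (≈-sym (comb-snoc d (toℕ ∘ c) w) ⟫ e ⟫ comb-snoc d (toℕ ∘ c′) w ⟫ (≗⇒≈ (\ i -> cong (\ z -> combF (c′ ∘ inject₁) i + toℕ z * Tⁿ d w i) (sym eq)))))) eq
     where
     snoc-ext : ∀ {d} {c c′ : Coeff (suc d)} -> (∀ j -> c (inject₁ j) ≡ c′ (inject₁ j)) -> c (fromℕ d) ≡ c′ (fromℕ d) -> ∀ i -> c i ≡ c′ i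
     snoc-ext {zero}  h l Fin.zero    = l
     snoc-ext {suc d} h l Fin.zero    = h Fin.zero
     snoc-ext {suc d} {c} {c′} h l (Fin.suc i) = snoc-ext {d} {c ∘ Fin.suc} {c′ ∘ Fin.suc} (\ j -> h (Fin.suc j)) l i
    ... | no ne = ⊥-elim (out (toSpan d coeffs solved))
     where
     x = toℕ (c (fromℕ d))
     x′ = toℕ (c′ (fromℕ d))
     δ = x + neg1 * x′
     δ-unit : ¬ (p ∣ δ)
     δ-unit h = ne (FinP.toℕ-injective (sym (m<n⇒m%n≡m (FinP.toℕ<n (c (fromℕ d)))) » +-cancelʳ-≋ {x} {x′} (neg1 * x′) (∣⇒≋0 h » sym (cong (_% p) (+-comm x′ (neg1 * x′)) » neg1-≋ x′)) » m<n⇒m%n≡m (FinP.toℕ<n (c′ (fromℕ d)))))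
     ι = fst (inverse-≋ δ-unit)
     C C′ coeffs : Fin d -> ℕ
     C i = toℕ (c (inject₁ i))
     C′ i = toℕ (c′ (inject₁ i))
     coeffs i = ι * (C′ i + neg1 * C i)
     u = combF (c ∘ inject₁)
     u′ = combF (c′ ∘ inject₁)
     t = Tⁿ d w
     eqn : u ⊞ x ⊡ t ≈ u′ ⊞ x′ ⊡ t
     eqn = ≈-sym (comb-snoc d (toℕ ∘ c) w) ⟫ e ⟫ comb-snoc d (toℕ ∘ c′) w
     moved : δ ⊡ t ≈ u′ ⊞ neg1 ⊡ u
     moved i = +-cancelʳ-≋ (u i + x′ * t i) (cong (_% p) (lem₁ x neg1 x′ (t i) (u i)) » +-cong-≋ {neg1 * (x′ * t i) + x′ * t i} {0} {u i + x * t i} {u′ i + x′ * t i} (neg1-≋ (x′ * t i)) (eqn i) » sym (cong (_% p) (lem₂ (u′ i) neg1 (u i) (x′ * t i)) » +-cong-≋ {neg1 * u i + u i} {0} {u′ i + x′ * t i} (neg1-≋ (u i)) refl))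
      where
      lem₁ : ∀ x n y t u -> (x + n * y) * t + (u + y * t) ≡ n * (y * t) + y * t + (u + x * t)
      lem₁ = solve-∀
      lem₂ : ∀ v n u y -> v + n * u + (u + y) ≡ n * u + u + (v + y)
      lem₂ = solve-∀
     solved : comb coeffs w ≈ t
     solved = comb-scale ι (\ i -> C′ i + neg1 * C i) w ⟫ ⊡-cong {ι} {ι} refl (comb-add C′ (\ i -> neg1 * C i) w ⟫ ⊞-cong {u′} {u′} ≈-refl (comb-scale neg1 C w)) ⟫ ⊡-cong {ι} {ι} refl (≈-sym moved) ⟫ (\ i -> cong (_% p) (sym (*-assoc ι δ (t i))) » *-congₖ {ι * δ} {1} {t i} (snd (inverse-≋ δ-unit)) refl » cong (_% p) (*-identityˡ (t i)))
    indep-≤ : ∀ d -> Indep d -> p ^ d ≤ p ^ N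
    indep-≤ d ind = FinP.injective⇒≤ {f = \ x -> canon (combF {d} (finToFun {p} x))} (\ {x} {y} e -> sym (FinP.funToFin-finToFin {d} {p} x) » funToFin-cong (ind (finToFun x) (finToFun y) (canon-injective e)) » FinP.funToFin-finToFin {d} {p} y)
    p^-cancel : ∀ {m n} -> p ^ m ≤ p ^ n -> m ≤ n
    p^-cancel {m} {n} h = ≮⇒≥ (\ n<m -> <⇒≱ (^-monoʳ-< p (prime≥2 pp) n<m) h)
    -- The least d with T^d w in the span of the lower powers. Minimality gives independence, and
    -- existence follows because N + 1 independent vectors would give p^(N+1) ≤ p^N.
    dimension : ∃ \ d -> InSpan d × Indep d
    dimension = d , fst (snd found) , below d (\ e e<d s -> snd (snd found) e e<d s)
     where
     below : ∀ d -> (∀ e -> e < d -> ¬ InSpan e) -> Indep d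
     below zero    _ = indep-zero
     below (suc d) h = indep-suc d (below d (\ e e<d -> h e (m≤n⇒m≤1+n e<d))) (h d ≤-refl)
     some : ∃ InSpan
     some = case anyUpTo? inSpan? (suc N) of \ where
      (yes (e , _ , s)) -> e , s
      (no none) -> ⊥-elim (1+n≰n (p^-cancel {suc N} {N} (indep-≤ (suc N) (below (suc N) (\ e e< s -> none (e , e< , s))))))
     found = least InSpan inSpan? (fst some) (snd some)
     d = fst found

-- Cyclic subspaces and the order of an operator

module CyclicSubspaces where
 open Nat
 open Arithmetic using (prime≥2; prime≥1; *-≥1; prime-∣-^; ^-≥1)
 open OrbitCounting
 open LinearAlgebra
 open PrimitiveRoots using (prime-factor; least; module PrimeMod; module Mod)
 import Function
 open import Function using (case_of_; _∘_)
 -- The T-span of w is a free ⟨T⟩-set away from 0, because 1 + s + … + s^(ℓ−1) kills it (s = T^(ℓ^b)) while p ∤ ℓ.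
 module CyclicSpace (p : ℕ) (pp : Prime p) (N : ℕ) (T : VectorSpace.V p pp N -> VectorSpace.V p pp N) (L : VectorSpace.Linear p pp N T)
  (ℓ b : ℕ) (pℓ : Prime ℓ) (p∤ℓ : ¬ (p ∣ ℓ)) where
  open VectorSpace p pp N
  open Linear L
  open Operator T L public
  r : ℕ
  r = ℓ ^ suc b
  s : V -> V
  s = Tⁿ (ℓ ^ b)
  norm : ℕ -> V -> V
  norm zero    u = 0v
  norm (suc k) u = u ⊞ s (norm k u)
  Tⁿ-comm : ∀ m v -> Tⁿ m (T v) ≡ T (Tⁿ m v)
  Tⁿ-comm zero    v = refl
  Tⁿ-comm (suc m) v = cong T (Tⁿ-comm m v)
  eq≈ : ∀ {u v} -> u ≡ v -> u ≈ v
  eq≈ refl = ≈-refl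
  norm-linear : ∀ k -> Linear (norm k)
  norm-linear zero    = record { cong-≈ = \ _ -> ≈-refl ; add = \ _ _ -> ≈-refl ; scale = \ c v -> ≗⇒≈ (\ i -> sym (*-zeroʳ c)) }
  norm-linear (suc k) = record
   { cong-≈ = \ {u} {v} e -> ⊞-cong {u} {v} e (Tⁿ-cong (ℓ ^ b) (Linear.cong-≈ (norm-linear k) e))
   ; add = \ u v -> ⊞-cong {u ⊞ v} {u ⊞ v} ≈-refl (Tⁿ-cong (ℓ ^ b) (Linear.add (norm-linear k) u v) ⟫ Tⁿ-add (ℓ ^ b) (norm k u) (norm k v)) ⟫ (≗⇒≈ (\ i -> swap (u i) (v i) (s (norm k u) i) (s (norm k v) i)))
   ; scale = \ c v -> ⊞-cong {c ⊡ v} {c ⊡ v} ≈-refl (Tⁿ-cong (ℓ ^ b) (Linear.scale (norm-linear k) c v) ⟫ Tⁿ-scale (ℓ ^ b) c (norm k v)) ⟫ (≗⇒≈ (\ i -> sym (*-distribˡ-+ c (v i) (s (norm k v) i))))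
   }
   where
   swap : ∀ a b c d -> a + b + (c + d) ≡ a + c + (b + d)
   swap = solve-∀
  norm-comm : ∀ k v -> norm k (T v) ≈ T (norm k v)
  norm-comm zero    v = ≈-sym (Lin-zero L)
  norm-comm (suc k) v = ⊞-cong {T v} {T v} ≈-refl (Tⁿ-cong (ℓ ^ b) (norm-comm k v) ⟫ eq≈ (Tⁿ-comm (ℓ ^ b) (norm k v))) ⟫ ≈-sym (add v (s (norm k v)))
  norm-fixed : ∀ k {u} -> s u ≈ u -> norm k u ≈ k ⊡ u
  norm-fixed zero    e = ≈-refl
  norm-fixed (suc k) {u} e = ⊞-cong {u} {u} ≈-refl (Tⁿ-cong (ℓ ^ b) (norm-fixed k e) ⟫ Tⁿ-scale (ℓ ^ b) k u ⟫ ⊡-cong {k} {k} refl e)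
  fixed-multiple : ∀ {i u} -> Tⁿ i u ≈ u -> ∀ x -> Tⁿ (x * i) u ≈ u
  fixed-multiple e zero    = ≈-refl
  fixed-multiple {i} {u} e (suc x) = eq≈ (Tⁿ-+ i (x * i) u) ⟫ Tⁿ-cong i (fixed-multiple e x) ⟫ e
  fixed-gcd : ∀ {i j u} -> Tⁿ i u ≈ u -> Tⁿ j u ≈ u -> Tⁿ (gcd i j) u ≈ u
  fixed-gcd {i} {j} {u} e f with Bézout.identity (gcd-GCD i j)
  ... | Bézout.+- x y eq = Tⁿ-cong (gcd i j) (≈-sym (fixed-multiple f y)) ⟫ eq≈ (sym (Tⁿ-+ (gcd i j) (y * j) u) » cong (\ n -> Tⁿ n u) eq) ⟫ fixed-multiple e x
  ... | Bézout.-+ x y eq = Tⁿ-cong (gcd i j) (≈-sym (fixed-multiple e x)) ⟫ eq≈ (sym (Tⁿ-+ (gcd i j) (x * i) u) » cong (\ n -> Tⁿ n u) eq) ⟫ fixed-multiple f y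
  kernel : ∀ n {u} -> 1 ≤ n -> Tⁿ n u ≈ u -> T u ≈ 0v -> u ≈ 0v
  kernel (suc n) {u} _ e z = ≈-sym e ⟫ eq≈ (sym (Tⁿ-comm n u)) ⟫ Tⁿ-cong n z ⟫ Lin-zero (Tⁿ-linear n)
  ≋0⇒∣ : ∀ {x} -> x ≋ 0 -> p ∣ x
  ≋0⇒∣ {x} e = m%n≡0⇒n∣m x p (e » m<n⇒m%n≡m (prime≥1 pp))
  module _ (period : ∀ v -> Tⁿ r v ≈ v) (w : V) (w≉0 : ¬ (w ≈ 0v)) (norm-w : norm ℓ w ≈ 0v) where
   open Span w public
   module Counting (d : ℕ) (span : InSpan d) (ind : Indep d) where
    σ : Fin (p ^ N) -> Fin (p ^ N)
    σ x = canon (T (vec x))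
    r≥1 : 1 ≤ r
    r≥1 = ^-≥1 (suc b) (prime≥1 pℓ)
    open Orbits FinP._≟_ σ r r≥1
    vec-iter : ∀ n x -> vec (iter n x) ≈ Tⁿ n (vec x)
    vec-iter zero    x = ≈-refl
    vec-iter (suc n) x = vec-canon (T (vec (iter n x))) ⟫ cong-≈ (vec-iter n x)
    element : Fin (p ^ d) -> Fin (p ^ N)
    element x = canon (combF {d} (finToFun x))
    shift : ∀ (c : Coeff d) -> ∃ \ (c′ : Coeff d) -> T (combF c) ≈ combF c′
    shift c = reduce c″ , ≈-sym (comb-reduce c″ ⟫ ≈-sym ((≗⇒≈ (\ i -> refl)) ⟫ comb-snoc d pad w ⟫ ⊞-cong {comb (pad ∘ inject₁) w} {comb (pad ∘ inject₁) w} ≈-refl (⊡-cong {lead} {lead} refl (≈-sym (snd span)) ⟫ ≈-sym (comb-scale lead f w)) ⟫ ≈-sym (comb-add (pad ∘ inject₁) (\ i -> lead * f i) w)))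
     where
     pad : Fin (suc d) -> ℕ
     pad Fin.zero    = 0
     pad (Fin.suc i) = toℕ (c i)
     lead = pad (fromℕ d)
     f c″ : Fin d -> ℕ
     f i = toℕ (finToFun {p} {d} (fst span) i)
     c″ i = pad (inject₁ i) + lead * f i
    L₀ L₁ : List (Fin (p ^ N))
    L₀ = map element (allFin (p ^ d))
    zero? : ∀ x -> Dec (x ≡ canon 0v)
    zero? x = x FinP.≟ canon 0v
    L₁ = filter (\ x -> ¬? (zero? x)) L₀
    element-∈ : ∀ (c : Coeff d) -> canon (combF c) ∈ L₀
    element-∈ c = subst (_∈ L₀) (canon-cong (comb-cong {d} {\ i -> toℕ (finToFun {p} (funToFin c) i)} (\ i -> cong (\ z -> toℕ z % p) (FinP.finToFun-funToFin c i)) ≈-refl)) (∈-map⁺ element (∈-allFin (funToFin c)))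
    ∈-element : ∀ {x} -> x ∈ L₀ -> ∃ \ (c : Coeff d) -> vec x ≈ combF c
    ∈-element x∈ with ∈-map⁻ element x∈
    ... | y , _ , refl = finToFun y , vec-canon (combF {d} (finToFun y))
    unique₀ : Unique L₀
    unique₀ = UniqueP.map⁺ (\ {x} {y} e -> sym (FinP.funToFin-finToFin {d} {p} x) » funToFin-cong (ind (finToFun x) (finToFun y) (canon-injective e)) » FinP.funToFin-finToFin {d} {p} y) (UniqueP.allFin⁺ (p ^ d))
    zero-∈ : canon 0v ∈ L₀
    zero-∈ = subst (_∈ L₀) (canon-cong (comb-reduce {d} (\ _ -> 0) ⟫ comb-scale {d} 0 (\ _ -> 0) w)) (element-∈ (reduce (\ _ -> 0)))
    zeros : length (filter zero? L₀) ≡ 1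
    zeros = ≤-antisym (length-⊆ {ys = canon 0v ∷ []} (UniqueP.filter⁺ zero? unique₀) (\ x∈ -> here (snd (∈-filter⁻ zero? {xs = L₀} x∈))))
     (length-⊆ {xs = canon 0v ∷ []} ([] ∷ []) (\ { (here refl) -> ∈-filter⁺ zero? zero-∈ refl }))
    length-L₁ : length L₁ ≡ p ^ d ∸ 1
    length-L₁ = cong (\ n -> n ∸ 1) (cong (_+ length L₁) (sym zeros) » sym (length-partition zero? L₀)) » cong (\ n -> n ∸ 1) (length-map element (allFin (p ^ d)) » length-tabulate {n = p ^ d} Function.id)
    nonzero : ∀ {x} -> x ∈ L₁ -> ¬ (vec x ≈ 0v)
    nonzero {x} x∈ e = snd (∈-filter⁻ (\ x -> ¬? (zero? x)) {xs = L₀} x∈) (sym (canon-vec x) » canon-cong e)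
    in₀ : ∀ {x} -> x ∈ L₁ -> x ∈ L₀
    in₀ x∈ = fst (∈-filter⁻ (\ x -> ¬? (zero? x)) {xs = L₀} x∈)
    no-fixed : ∀ {x} -> x ∈ L₁ -> ¬ (s (vec x) ≈ vec x)
    no-fixed {x} x∈ e = nonzero x∈ (\ i -> ∣⇒≋0 (cancelℓ p∤ℓ (vec x i) (≋0⇒∣ (killed i))))
     where
     c = fst (∈-element (in₀ x∈))
     killed : ℓ ⊡ vec x ≈ 0v
     killed = ≈-sym (norm-fixed ℓ e) ⟫ Linear.cong-≈ (norm-linear ℓ) (snd (∈-element (in₀ x∈))) ⟫ comb-map (norm-linear ℓ) (norm-comm ℓ) (\ i -> toℕ (c i)) w ⟫ comb-cong {d} {\ i -> toℕ (c i)} (\ i -> refl) norm-w ⟫ comb-0 {d} (\ i -> toℕ (c i))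
    free : Free L₁
    free = record
     { unique = UniqueP.filter⁺ (\ x -> ¬? (zero? x)) unique₀
     ; closed = \ {x} x∈ -> ∈-filter⁺ (\ x -> ¬? (zero? x)) (subst (_∈ L₀) (canon-cong (≈-sym (cong-≈ (snd (∈-element (in₀ x∈))) ⟫ snd (shift (fst (∈-element (in₀ x∈))))))) (element-∈ (fst (shift (fst (∈-element (in₀ x∈)))))))
       (\ e -> nonzero x∈ (kernel r r≥1 (period (vec x)) (canon-injective e)))
     ; period = \ {x} x∈ -> sym (canon-vec (iter r x)) » canon-cong (vec-iter r x ⟫ period (vec x)) » canon-vec x
     -- A vector fixed by T^i with i < r is fixed by T^gcd(i,r). This gcd is a proper divisor of
     -- ℓ^(b+1), hence divides ℓ^b, so s would fix the vector.
     ; free   = \ {x} x∈ i 1≤i i<r e -> no-fixed x∈ (fixed-divides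
       (proper-divisor-^ b pℓ (gcd[m,n]∣n i r) (\ g≡r -> <⇒≱ i<r (subst (_≤ i) g≡r (∣⇒≤ {{N.>-nonZero 1≤i}} (gcd[m,n]∣m i r)))))
       (fixed-gcd {i} {r} (≈-sym (vec-iter i x) ⟫ eq≈ (cong vec e)) (period (vec x))))
     }
     where
     fixed-divides : ∀ {m n u} -> m ∣ n -> Tⁿ m u ≈ u -> Tⁿ n u ≈ u
     fixed-divides (divides x refl) e = fixed-multiple e x
    divides-count : r ∣ p ^ d ∸ 1
    divides-count = subst (r ∣_) length-L₁ (orbit-count L₁ free)
   cyclic-dimension : ∃ \ d -> 1 ≤ d × Indep d × r ∣ p ^ d ∸ 1
   cyclic-dimension with dimension
   ... | d , span , ind = d , positive (snd span) , ind , Counting.divides-count d span ind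
    where
    positive : ∀ {d} {c : Coeff d} -> combF {d} c ≈ Tⁿ d w -> 1 ≤ d
    positive {zero}  e = ⊥-elim (w≉0 (≈-sym e))
    positive {suc d} e = s≤s z≤n
  module Difference (period : ∀ v -> Tⁿ r v ≈ v) (v₀ : V) (moved : ¬ (s v₀ ≈ v₀)) where
   -- The difference s v₀ - v₀ is used in place of v₀ since the norm kills it: the sum telescopes to
   -- T^r v₀ - v₀.
   w₀ : V
   w₀ = s v₀ ⊞ neg1 ⊡ v₀
   minus-plus : ∀ u v -> u ⊞ neg1 ⊡ v ⊞ v ≈ u
   minus-plus u v i = cong (_% p) (+-assoc (u i) (neg1 * v i) (v i)) » +-cong-≋ {u i} {u i} {neg1 * v i + v i} {0} refl (neg1-≋ (v i)) » cong (_% p) (+-identityʳ (u i))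
   w₀≉0 : ¬ (w₀ ≈ 0v)
   w₀≉0 e = moved (≈-sym (minus-plus (s v₀) v₀) ⟫ ⊞-cong {w₀} {0v} {v₀} {v₀} e ≈-refl)
   telescope : ∀ k -> norm k w₀ ⊞ v₀ ≈ Iterate.iter s k v₀
   telescope zero    = ≈-refl
   telescope (suc k) = (≗⇒≈ (\ i -> lem (s v₀ i) (neg1 * v₀ i) (s (norm k w₀) i) (v₀ i))) ⟫ ⊞-cong {s v₀ ⊞ neg1 ⊡ v₀ ⊞ v₀} {s v₀} {s (norm k w₀)} (minus-plus (s v₀) v₀) ≈-refl ⟫ ≈-sym (Tⁿ-add (ℓ ^ b) v₀ (norm k w₀)) ⟫ Tⁿ-cong (ℓ ^ b) ((≗⇒≈ (\ i -> +-comm (v₀ i) (norm k w₀ i))) ⟫ telescope k)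
    where
    lem : ∀ x y z v -> x + y + z + v ≡ x + y + v + z
    lem = solve-∀
   norm-w₀ : norm ℓ w₀ ≈ 0v
   norm-w₀ = ⊞-cancelʳ v₀ (telescope ℓ ⟫ eq≈ (iter-* T (ℓ ^ b) ℓ v₀) ⟫ period v₀)
   dimension-bound : ∃ \ d -> 1 ≤ d × d ≤ N × r ∣ p ^ d ∸ 1
   dimension-bound = bound (cyclic-dimension period w₀ w₀≉0 norm-w₀)
    where
    bound : (∃ \ d -> 1 ≤ d × Span.Indep w₀ d × r ∣ p ^ d ∸ 1) -> ∃ \ d -> 1 ≤ d × d ≤ N × r ∣ p ^ d ∸ 1
    bound (d , 1≤d , ind , h) = d , 1≤d , Span.p^-cancel w₀ {d} {N} (Span.indep-≤ w₀ d ind) , h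

-- The standard symplectic form

module SymplecticForm where
 open Nat
 open Sums using (is-yes; is-no)
 open Arithmetic using (prime≥2; prime≥1; *-≥1; prime-∣-^; ^-≥1)
 open OrbitCounting
 open LinearAlgebra
 open CyclicSubspaces
 sum-ext : ∀ {m} {f h : Fin m -> ℕ} -> (∀ i -> f i ≡ h i) -> sumF f ≡ sumF h
 sum-ext {zero}  e = refl
 sum-ext {suc m} e = cong₂ _+_ (e Fin.zero) (sum-ext (e ∘ Fin.suc))
 sumF-+ : ∀ {m} (f h : Fin m -> ℕ) -> sumF (\ i -> f i + h i) ≡ sumF f + sumF h
 sumF-+ {zero}  f h = refl
 sumF-+ {suc m} f h = cong (f Fin.zero + h Fin.zero +_) (sumF-+ (f ∘ Fin.suc) (h ∘ Fin.suc)) » lem (f Fin.zero) (h Fin.zero) _ _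
  where
  lem : ∀ a b c d -> a + b + (c + d) ≡ a + c + (b + d)
  lem = solve-∀
 sumF-*ˡ : ∀ {m} c (f : Fin m -> ℕ) -> sumF (\ i -> c * f i) ≡ c * sumF f
 sumF-*ˡ {zero}  c f = sym (*-zeroʳ c)
 sumF-*ˡ {suc m} c f = cong (c * f Fin.zero +_) (sumF-*ˡ c (f ∘ Fin.suc)) » sym (*-distribˡ-+ c (f Fin.zero) _)
 sumF-*ʳ : ∀ {m} c (f : Fin m -> ℕ) -> sumF (\ i -> f i * c) ≡ sumF f * c
 sumF-*ʳ c f = sum-ext (\ i -> *-comm (f i) c) » sumF-*ˡ c f » *-comm c (sumF f)
 sumF-0 : ∀ m -> sumF {m} (\ _ -> 0) ≡ 0
 sumF-0 zero    = refl
 sumF-0 (suc m) = sumF-0 m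
 sumF-swap : ∀ {m n} (f : Fin m -> Fin n -> ℕ) -> sumF (\ i -> sumF (f i)) ≡ sumF (\ j -> sumF (\ i -> f i j))
 sumF-swap {zero}  {n} f = sym (sumF-0 n)
 sumF-swap {suc m} {n} f = cong (sumF (f Fin.zero) +_) (sumF-swap (f ∘ Fin.suc)) » sym (sumF-+ (f Fin.zero) (\ j -> sumF (\ i -> f (Fin.suc i) j)))
 sumF-↑ : ∀ m {n} (f : Fin (m + n) -> ℕ) -> sumF f ≡ sumF (\ k -> f (k ↑ˡ n)) + sumF (\ k -> f (m ↑ʳ k))
 sumF-↑ zero    f = refl
 sumF-↑ (suc m) f = cong (f Fin.zero +_) (sumF-↑ m (f ∘ Fin.suc)) » sym (+-assoc (f Fin.zero) _ _)
 sumF-idM : ∀ {m} i (v : Fin m -> ℕ) -> sumF (\ k -> idM i k * v k) ≡ v i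
 sumF-idM {suc m} Fin.zero    v = cong₂ _+_ (*-identityˡ (v Fin.zero)) (sumF-0 m) » +-identityʳ _
 sumF-idM {suc m} (Fin.suc i) v = sumF-idM i (v ∘ Fin.suc)
 idM-sym : ∀ {m} (i j : Fin m) -> idM i j ≡ idM j i
 idM-sym Fin.zero    Fin.zero    = refl
 idM-sym Fin.zero    (Fin.suc j) = refl
 idM-sym (Fin.suc i) Fin.zero    = refl
 idM-sym (Fin.suc i) (Fin.suc j) = idM-sym i j
 apply : ∀ {m} -> Mat m -> (Fin m -> ℕ) -> Fin m -> ℕ
 apply M v i = sumF (\ j -> M i j * v j)
 apply-⊗ : ∀ {m} (A B : Mat m) v i -> apply (A ⊗ B) v i ≡ apply A (apply B v) i
 apply-⊗ A B v i = begin
  sumF (\ j -> sumF (\ k -> A i k * B k j) * v j)   ≡⟨ sum-ext (\ j -> sym (sumF-*ʳ (v j) (\ k -> A i k * B k j))) ⟩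
  sumF (\ j -> sumF (\ k -> A i k * B k j * v j))   ≡⟨ sumF-swap (\ j k -> A i k * B k j * v j) ⟩
  sumF (\ k -> sumF (\ j -> A i k * B k j * v j))   ≡⟨ sum-ext (\ k -> sum-ext (\ j -> *-assoc (A i k) (B k j) (v j)) » sumF-*ˡ (A i k) (\ j -> B k j * v j)) ⟩
  sumF (\ k -> A i k * apply B v k)                ∎
  where open ≡-Reasoning
 basis : ∀ {m} -> Fin m -> Fin m -> ℕ
 basis j i = idM i j
 apply-basis : ∀ {m} (M : Mat m) j i -> apply M (basis j) i ≡ M i j
 apply-basis M j i = sum-ext (\ k -> *-comm (M i k) (idM k j) » cong (_* M i k) (idM-sym k j)) » sumF-idM j (M i)
 ⟨_,_⟩ : ∀ {m} -> (Fin m -> ℕ) -> (Fin m -> ℕ) -> ℕ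
 ⟨ u , v ⟩ = sumF (\ i -> u i * v i)
 adjoint : ∀ {m} (M : Mat m) u v -> ⟨ apply M u , v ⟩ ≡ ⟨ u , apply (transpose M) v ⟩
 adjoint M u v = begin
  sumF (\ i -> sumF (\ j -> M i j * u j) * v i)   ≡⟨ sum-ext (\ i -> sym (sumF-*ʳ (v i) (\ j -> M i j * u j)) » sum-ext (\ j -> lem (M i j) (u j) (v i))) ⟩
  sumF (\ i -> sumF (\ j -> u j * (M i j * v i))) ≡⟨ sumF-swap (\ i j -> u j * (M i j * v i)) ⟩
  sumF (\ j -> sumF (\ i -> u j * (M i j * v i))) ≡⟨ sum-ext (\ j -> sumF-*ˡ (u j) (\ i -> M i j * v i)) ⟩
  ⟨ u , apply (transpose M) v ⟩                 ∎
  where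
  open ≡-Reasoning
  lem : ∀ a b c -> a * b * c ≡ b * (a * c)
  lem = solve-∀
 Jform-lo : ∀ p g (k : Fin g) j -> Jform p g (k ↑ˡ g) j ≡ idM (g ↑ʳ k) j
 Jform-lo p g k j rewrite FinP.toℕ-↑ˡ k g | FinP.toℕ-↑ʳ g k = case toℕ j N.≟ toℕ k + g of \ where
  (yes e) -> cong (if_then 1 else (if does (toℕ k N.≟ toℕ j + g) then p ∸ 1 else 0)) (is-yes (toℕ j N.≟ toℕ k + g) e) » sym (cong (if_then 1 else 0) (is-yes (g + toℕ k N.≟ toℕ j) (+-comm g (toℕ k) » sym e)))
  (no ne) -> cong (if_then 1 else (if does (toℕ k N.≟ toℕ j + g) then p ∸ 1 else 0)) (is-no (toℕ j N.≟ toℕ k + g) ne) » cong (if_then p ∸ 1 else 0) (is-no (toℕ k N.≟ toℕ j + g) (\ e -> <⇒≱ (FinP.toℕ<n k) (subst (g ≤_) (sym e) (m≤n+m g (toℕ j))))) » sym (cong (if_then 1 else 0) (is-no (g + toℕ k N.≟ toℕ j) (\ e -> ne (sym e » +-comm g (toℕ k)))))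
 Jform-hi : ∀ p g (k : Fin g) j -> Jform p g (g ↑ʳ k) j ≡ (p ∸ 1) * idM (k ↑ˡ g) j
 Jform-hi p g k j rewrite FinP.toℕ-↑ˡ k g | FinP.toℕ-↑ʳ g k = cong (if_then 1 else (if does (g + toℕ k N.≟ toℕ j + g) then p ∸ 1 else 0)) (is-no (toℕ j N.≟ g + toℕ k + g) (\ e -> <⇒≱ (FinP.toℕ<n j) (subst (g + g ≤_) (sym e) (+-monoˡ-≤ g (m≤m+n g (toℕ k)))))) » (case toℕ k N.≟ toℕ j of \ where
   (yes e) -> cong (if_then p ∸ 1 else 0) (is-yes (g + toℕ k N.≟ toℕ j + g) (+-comm g (toℕ k) » cong (_+ g) e)) » sym (cong (\ b -> (p ∸ 1) * (if b then 1 else 0)) (is-yes (toℕ k N.≟ toℕ j) e) » *-identityʳ (p ∸ 1))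
   (no ne) -> cong (if_then p ∸ 1 else 0) (is-no (g + toℕ k N.≟ toℕ j + g) (\ e -> ne (+-cancelʳ-≡ g (toℕ k) (toℕ j) (+-comm (toℕ k) g » e)))) » sym (cong (\ b -> (p ∸ 1) * (if b then 1 else 0)) (is-no (toℕ k N.≟ toℕ j) ne) » *-zeroʳ (p ∸ 1)))
 module Symplectic (p : ℕ) (pp : Prime p) (g : ℕ) where
  open VectorSpace p pp (g + g) public
  sumF-≋ : ∀ {m} {f h : Fin m -> ℕ} -> (∀ i -> f i ≋ h i) -> sumF f ≋ sumF h
  sumF-≋ {zero}  e = refl
  sumF-≋ {suc m} {f} {h} e = +-cong-≋ {f Fin.zero} {h Fin.zero} {sumF (f ∘ Fin.suc)} (e Fin.zero) (sumF-≋ (e ∘ Fin.suc))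
  ⟨⟩-cong : ∀ {u u′ v v′ : V} -> u ≈ u′ -> v ≈ v′ -> ⟨ u , v ⟩ ≋ ⟨ u′ , v′ ⟩
  ⟨⟩-cong {u} {u′} {v} {v′} e f = sumF-≋ (\ i -> *-congₖ {u i} {u′ i} {v i} {v′ i} (e i) (f i))
  apply-cong : ∀ {A B : Mat (g + g)} {u v} -> A ≈[ p ] B -> u ≈ v -> apply A u ≈ apply B v
  apply-cong {A} {B} {u} {v} e f i = sumF-≋ (\ j -> *-congₖ {A i j} {B i j} {u j} {v j} (e i j) (f j))
  apply-linear : ∀ M -> Linear (apply M)
  apply-linear M = record
   { cong-≈ = apply-cong {M} (\ i j -> refl)
   ; add    = \ u v -> ≗⇒≈ (\ i -> sum-ext (\ j -> *-distribˡ-+ (M i j) (u j) (v j)) » sumF-+ (\ j -> M i j * u j) (\ j -> M i j * v j))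
   ; scale  = \ c v -> ≗⇒≈ (\ i -> sum-ext (\ j -> lem (M i j) c (v j)) » sumF-*ˡ c (\ j -> M i j * v j))
   }
   where
   lem : ∀ a b c -> a * (b * c) ≡ b * (a * c)
   lem = solve-∀
  apply-pow : ∀ M k v -> apply (matPow M k) v ≈ Iterate.iter (apply M) k v
  apply-pow M zero    v = ≗⇒≈ (\ i -> sumF-idM i v)
  apply-pow M (suc k) v = (≗⇒≈ (apply-⊗ M (matPow M k) v)) ⟫ apply-cong {M} (\ i j -> refl) (apply-pow M k v)
  J : V -> V
  J = apply (Jform p g)
  J-lo : ∀ v k -> J v (k ↑ˡ g) ≡ v (g ↑ʳ k)
  J-lo v k = sum-ext (\ j -> cong (_* v j) (Jform-lo p g k j)) » sumF-idM (g ↑ʳ k) v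
  J-hi : ∀ v k -> J v (g ↑ʳ k) ≡ neg1 * v (k ↑ˡ g)
  J-hi v k = sum-ext (\ j -> cong (_* v j) (Jform-hi p g k j) » *-assoc neg1 (idM (k ↑ˡ g) j) (v j)) » sumF-*ˡ neg1 (\ j -> idM (k ↑ˡ g) j * v j) » cong (neg1 *_) (sumF-idM (k ↑ˡ g) v)
  ω : V -> V -> ℕ
  ω u v = ⟨ u , J v ⟩
  ω-split : ∀ u v -> ω u v ≡ sumF (\ k -> u (k ↑ˡ g) * v (g ↑ʳ k)) + neg1 * sumF (\ k -> u (g ↑ʳ k) * v (k ↑ˡ g))
  ω-split u v = sumF-↑ g (\ i -> u i * J v i) » cong₂ _+_ (sum-ext (\ k -> cong (u (k ↑ˡ g) *_) (J-lo v k)))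
    (sum-ext (\ k -> cong (u (g ↑ʳ k) *_) (J-hi v k) » lem (u (g ↑ʳ k)) neg1 (v (k ↑ˡ g))) » sumF-*ˡ neg1 (\ k -> u (g ↑ʳ k) * v (k ↑ˡ g)))
   where
   lem : ∀ a b c -> a * (b * c) ≡ b * (a * c)
   lem = solve-∀
  ω-cong : ∀ {u u′ v v′} -> u ≈ u′ -> v ≈ v′ -> ω u v ≋ ω u′ v′
  ω-cong {u} {u′} e f = ⟨⟩-cong {u} {u′} e (Linear.cong-≈ (apply-linear (Jform p g)) f)
  Preserves : (V -> V) -> Set
  Preserves f = ∀ u v -> ω (f u) (f v) ≋ ω u v
  ω-invariant : ∀ {M} -> InSp p g M -> Preserves (apply M)
  ω-invariant {M} sp u v = cong (_% p) (adjoint M u (J (apply M v)) » sum-ext (\ i -> cong (u i *_) (sym (apply-⊗ (transpose M) (Jform p g ⊗ M) v i » sum-ext (\ j -> cong (M j i *_) (apply-⊗ (Jform p g) M v j)))))) » ⟨⟩-cong {u} {u} ≈-refl (apply-cong {transpose M ⊗ (Jform p g ⊗ M)} {Jform p g} {v} {v} sp ≈-refl)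
  entry : ∀ (A : Mat (g + g)) i j -> ⟨ basis i , apply A (basis j) ⟩ ≡ A i j
  entry A i j = sum-ext (\ k -> cong₂ _*_ (idM-sym k i) (apply-basis A j k)) » sumF-idM i (\ k -> A k j)
  invariant⇒InSp : ∀ {M} -> Preserves (apply M) -> InSp p g M
  invariant⇒InSp {M} inv i j = cong (_% p) (sym ((adjoint M (basis i) (J (apply M (basis j))) » sum-ext (\ k -> cong (basis i k *_) (sym (apply-⊗ (transpose M) (Jform p g ⊗ M) (basis j) k » sum-ext (\ l -> cong (M l k *_) (apply-⊗ (Jform p g) M (basis j) l)))))) » entry (transpose M ⊗ (Jform p g ⊗ M)) i j)) » inv (basis i) (basis j) » cong (_% p) (entry (Jform p g) i j)
  J² : ∀ v i -> J (J v) i ≡ neg1 * v i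
  J² v i with Fin.splitAt g i in eq
  ... | inj₁ k = subst (\ z -> J (J v) z ≡ neg1 * v z) (FinP.splitAt⁻¹-↑ˡ eq) (J-lo (J v) k » J-hi v k)
  ... | inj₂ k = subst (\ z -> J (J v) z ≡ neg1 * v z) (FinP.splitAt⁻¹-↑ʳ eq) (J-hi (J v) k » cong (neg1 *_) (J-lo v k))
  -- J² = -1, so pairing u with J applied to a basis vector reads off a coordinate of -u.
  nondegenerate : ∀ u -> ¬ (u ≈ 0v) -> ∃ \ y -> ¬ (ω u y ≋ 0)
  nondegenerate u u≉0 with FinP.¬∀⟶∃¬ (g + g) _ (\ i -> u i % p N.≟ 0 % p) u≉0
  ... | i , uᵢ≢0 = J (basis i) , \ e -> uᵢ≢0 (∣⇒≋0 (cancelℓ neg1-unit (u i) (m%n≡0⇒n∣m _ p (cong (_% p) (sym value) » e » m<n⇒m%n≡m (prime≥1 pp)))))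
   where
   neg1-unit : ¬ (p ∣ neg1)
   neg1-unit h = <⇒≱ (∸-monoʳ-< {p} z<s (prime≥1 pp)) (∣⇒≤ {{N.>-nonZero (m<n⇒0<n∸m (prime≥2 pp))}} h)
   lem : ∀ a b c -> a * (b * c) ≡ b * (c * a)
   lem = solve-∀
   value : ω u (J (basis i)) ≡ neg1 * u i
   value = sum-ext (\ k -> cong (u k *_) (J² (basis i) k » cong (neg1 *_) (idM-sym k i)) » lem (u k) neg1 (idM i k)) » sumF-*ˡ neg1 (\ k -> idM i k * u k) » cong (neg1 *_) (sumF-idM i u)

-- Matrices whose order is divisible by a prime power

module MatrixOrder where
 open Nat
 open Sums using (is-yes; is-no)
 open Arithmetic using (prime≥2; prime≥1; *-≥1; prime-∣-^; ^-≥1)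
 open OrbitCounting
 open PrimitiveRoots using (m<n*m)
 open LinearAlgebra
 open CyclicSubspaces
 open SymplecticForm
 module PrimePowerOrder (p : ℕ) (pp : Prime p) (g : ℕ) (M : Mat (g + g)) (n : ℕ) (ord : HasOrder p {{prime⇒nonZero pp}} M n)
  (ℓ b : ℕ) (pℓ : Prime ℓ) (p∤ℓ : ¬ (p ∣ ℓ)) (r∣n : ℓ ^ suc b ∣ n) where
  open Symplectic p pp g public
  q : ℕ
  q = quotient r∣n
  -- The power of M with exponent n/ℓ^(b+1), whose order is exactly ℓ^(b+1).
  T : V -> V
  T = Iterate.iter (apply M) q
  T-linear : Linear T
  T-linear = Operator.Tⁿ-linear (apply M) (apply-linear M) q
  open CyclicSpace p pp (g + g) T T-linear ℓ b pℓ p∤ℓ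
  Tⁿ-matPow : ∀ k v -> Tⁿ k v ≈ apply (matPow M (k * q)) v
  Tⁿ-matPow k v = eq≈ (iter-* (apply M) q k v) ⟫ ≈-sym (apply-pow M (k * q) v)
  period : ∀ v -> Tⁿ r v ≈ v
  period v = Tⁿ-matPow r v ⟫ apply-cong {matPow M (r * q)} {idM} {v} {v} pow-r ≈-refl ⟫ (≗⇒≈ (\ i -> sumF-idM i v))
   where
   pow-r : ∀ i j -> matPow M (r * q) i j % p ≡ idM i j % p
   pow-r i j = cong (\ k -> matPow M k i j % p) (sym (_∣_.equality r∣n » *-comm q r)) » fst (snd ord) i j
  -- The operator s is M^(n/ℓ), which differs from the identity because n is the order; so some
  -- basis vector is not fixed.
  moved : ∃ \ v -> ¬ (s v ≈ v)
  moved = let (j , h) = FinP.¬∀⟶∃¬ (g + g) _ (\ j -> s (basis j) ≈? basis j) all-fixed in basis j , h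
   where
   n≡ : n ≡ ℓ * (ℓ ^ b * q)
   n≡ = _∣_.equality r∣n » *-comm q r » *-assoc ℓ (ℓ ^ b) q
   k≥1 : 1 ≤ ℓ ^ b * q
   k≥1 = case ℓ ^ b * q N.≟ 0 of \ where
    (yes e) -> ⊥-elim (<⇒≢ (fst ord) (sym (n≡ » cong (ℓ *_) e » *-zeroʳ ℓ)))
    (no ne) -> n≢0⇒n>0 ne
   k<n : ℓ ^ b * q < n
   k<n = subst (ℓ ^ b * q <_) (sym n≡) (m<n*m (ℓ ^ b * q) ℓ {{N.>-nonZero k≥1}} (prime≥2 pℓ))
   all-fixed : ¬ (∀ j -> s (basis j) ≈ basis j)
   all-fixed h = snd (snd ord) (ℓ ^ b * q) k≥1 k<n (\ i j -> cong (_% p) (sym (apply-basis (matPow M (ℓ ^ b * q)) j i)) » sym (Tⁿ-matPow (ℓ ^ b) (basis j) i) » h j i)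
  dimension-bound : ∃ \ d -> 1 ≤ d × d ≤ g + g × r ∣ p ^ d ∸ 1
  dimension-bound = Difference.dimension-bound period (fst moved) (snd moved)

-- Splitting of Y⁴ + 1 on a symplectic space

module QuarticSplitting where
 open Nat
 open Sums using (is-yes; is-no)
 open Arithmetic using (prime≥2; prime≥1; *-≥1; prime-∣-^; ^-≥1)
 open OrbitCounting
 open PrimitiveRoots using (m<n*m)
 open LinearAlgebra
 open CyclicSubspaces
 open SymplecticForm
 -- Over 𝔽_p with σ² = −2 = τ², σ = −τ, the polynomial Y⁴ + 1 splits as (Y² + σY − 1)(Y² + τY − 1).
 module Quartic (p : ℕ) (pp : Prime p) (g : ℕ) (Y : VectorSpace.V p pp (g + g) -> VectorSpace.V p pp (g + g)) (LY : VectorSpace.Linear p pp (g + g) Y)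
  (ω-Y : Symplectic.Preserves p pp g Y)
  (Y⁸ : ∀ v -> VectorSpace._≈_ p pp (g + g) (Iterate.iter Y 8 v) v) (p∤2 : ¬ (p ∣ 2)) where
  open Symplectic p pp g
  open Linear LY
  open Iterate Y using (iter)
  infix 4 _≅_
  -- A boxed congruence: `_≋_` unfolds to an equation between remainders, from which unification
  -- cannot recover the two numbers.
  record _≅_ (a b : ℕ) : Set where
   constructor mk
   field un : a ≋ b
  open _≅_ public
  rfl : ∀ {a} -> a ≅ a
  rfl = mk refl
  infixl 6 _⊹_
  _⊹_ : ∀ {a b c d} -> a ≅ b -> c ≅ d -> a + c ≅ b + d
  _⊹_ {a} {b} {c} {d} (mk e) (mk f) = mk (+-cong-≋ {a} {b} {c} {d} e f)
  infixr 7 _⋆_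
  _⋆_ : ∀ c {a b} -> a ≅ b -> c * a ≅ c * b
  _⋆_ c {a} {b} (mk e) = mk (*-congₖ {c} {c} {a} {b} refl e)
  flip : ∀ {a b} -> a ≅ b -> b ≅ a
  flip (mk e) = mk (sym e)
  infixr 5 _⊙_
  _⊙_ : ∀ {a b c} -> a ≅ b -> b ≅ c -> a ≅ c
  mk e ⊙ mk f = mk (e » f)
  -- The certificate format of this part: known congruences are scaled and added to one x ≅ y, and
  -- the goal follows from a semiring identity over ℕ, so negative terms never occur.
  from : ∀ {x y a b} -> x ≅ y -> a + y ≡ b + x -> a ≅ b
  from {x} {y} {a} {b} (mk e) eq = mk (+-cancelʳ-≋ {a} {b} y (cong (_% p) eq » +-cong-≋ {b} {b} {x} {y} refl e))
  n : ℕ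
  n = neg1
  n+1 : n + 1 ≅ 0
  n+1 = mk (∣⇒≋0 (subst (p ∣_) (sym (m+[n∸m]≡n (prime≥1 pp)) » +-comm 1 n) ∣-refl))
  cancel-≅ : ∀ {c x} -> ¬ (p ∣ c) -> c * x ≅ 0 -> x ≅ 0
  cancel-≅ {c} {x} u (mk e) = mk (∣⇒≋0 (cancelℓ u x (m%n≡0⇒n∣m (c * x) p (e » m<n⇒m%n≡m (prime≥1 pp)))))
  ω-addʳ : ∀ u v w -> ω u (v ⊞ w) ≅ ω u v + ω u w
  ω-addʳ u v w = mk (⟨⟩-cong {u} {u} ≈-refl (Linear.add (apply-linear (Jform p g)) v w) » cong (_% p) (sum-ext (\ i -> *-distribˡ-+ (u i) (J v i) (J w i)) » sumF-+ (\ i -> u i * J v i) (\ i -> u i * J w i)))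
  ω-scaleʳ : ∀ u c v -> ω u (c ⊡ v) ≅ c * ω u v
  ω-scaleʳ u c v = mk (⟨⟩-cong {u} {u} ≈-refl (Linear.scale (apply-linear (Jform p g)) c v) » cong (_% p) (sum-ext (\ i -> lem (u i) c (J v i)) » sumF-*ˡ c (\ i -> u i * J v i)))
   where
   lem : ∀ a b c -> a * (b * c) ≡ b * (a * c)
   lem = solve-∀
  ω-addˡ : ∀ u v w -> ω (u ⊞ v) w ≅ ω u w + ω v w
  ω-addˡ u v w = mk (cong (_% p) (sum-ext (\ i -> *-distribʳ-+ (J w i) (u i) (v i)) » sumF-+ (\ i -> u i * J w i) (\ i -> v i * J w i)))
  ω-scaleˡ : ∀ c u v -> ω (c ⊡ u) v ≅ c * ω u v
  ω-scaleˡ c u v = mk (cong (_% p) (sum-ext (\ i -> *-assoc c (u i) (J v i)) » sumF-*ˡ c (\ i -> u i * J v i)))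
  ω-0ˡ : ∀ v -> ω 0v v ≅ 0
  ω-0ˡ v = mk (cong (_% p) (sumF-0 (g + g)))
  ω-cong≅ : ∀ {u u′ v v′} -> u ≈ u′ -> v ≈ v′ -> ω u v ≅ ω u′ v′
  ω-cong≅ {u} {u′} {v} {v′} e f = mk (ω-cong {u} {u′} {v} {v′} e f)
  ω-iter : ∀ j u v -> ω (iter j u) (iter j v) ≅ ω u v
  ω-iter zero    u v = rfl
  ω-iter (suc j) u v = mk (ω-Y (iter j u) (iter j v)) ⊙ ω-iter j u v
  A : ℕ -> V -> V
  A c v = Y (Y v) ⊞ (c ⊡ Y v ⊞ n ⊡ v)
  A-linear : ∀ c -> Linear (A c)
  A-linear c = record
   { cong-≈ = \ {u} {v} e -> ⊞-cong {Y (Y u)} {Y (Y v)} (cong-≈ (cong-≈ e)) (⊞-cong {c ⊡ Y u} {c ⊡ Y v} (⊡-cong {c} {c} refl (cong-≈ e)) (⊡-cong {n} {n} {u} {v} refl e))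
   ; add = \ u v -> ⊞-cong {Y (Y (u ⊞ v))} {Y (Y u) ⊞ Y (Y v)} (cong-≈ (add u v) ⟫ add (Y u) (Y v)) (⊞-cong {c ⊡ Y (u ⊞ v)} {c ⊡ (Y u ⊞ Y v)} {n ⊡ (u ⊞ v)} (⊡-cong {c} {c} refl (add u v)) ≈-refl) ⟫ (≗⇒≈ (\ i -> lem₁ (Y (Y u) i) (Y (Y v) i) c (Y u i) (Y v i) n (u i) (v i)))
   ; scale = \ k v -> ⊞-cong {Y (Y (k ⊡ v))} {k ⊡ Y (Y v)} (cong-≈ (scale k v) ⟫ scale k (Y v)) (⊞-cong {c ⊡ Y (k ⊡ v)} {c ⊡ (k ⊡ Y v)} {n ⊡ (k ⊡ v)} (⊡-cong {c} {c} refl (scale k v)) ≈-refl) ⟫ (≗⇒≈ (\ i -> lem₂ k (Y (Y v) i) c (Y v i) n (v i)))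
   }
   where
   lem₁ : ∀ a b c d e n x y -> a + b + (c * (d + e) + n * (x + y)) ≡ a + (c * d + n * x) + (b + (c * e + n * y))
   lem₁ = solve-∀
   lem₂ : ∀ k a c d n x -> k * a + (c * (k * d) + n * (k * x)) ≡ k * (a + (c * d + n * x))
   lem₂ = solve-∀
  A-comm : ∀ c v -> Y (A c v) ≈ A c (Y v)
  A-comm c v = add (Y (Y v)) (c ⊡ Y v ⊞ n ⊡ v) ⟫ ⊞-cong {Y (Y (Y v))} {Y (Y (Y v))} ≈-refl (add (c ⊡ Y v) (n ⊡ v) ⟫ ⊞-cong {Y (c ⊡ Y v)} {c ⊡ Y (Y v)} (scale c (Y v)) (scale n v))
  coord : ∀ {u v} -> u ≈ v -> ∀ i -> u i ≅ v i
  coord e i = mk (e i)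
  kernel-Y : ∀ {u} -> Y u ≈ 0v -> u ≈ 0v
  kernel-Y {u} e = ≈-sym (Y⁸ u) ⟫ Operator.Tⁿ-cong Y LY 7 e ⟫ Lin-zero (Operator.Tⁿ-linear Y LY 7)
  module Factor (σ τ : ℕ) (στ : σ + τ ≅ 0) (σσ : σ * σ + 2 ≅ 0) (ττ : τ * τ + 2 ≅ 0) (p∤σ : ¬ (p ∣ σ)) where
   A-product : ∀ z -> A σ (A τ z) ≈ iter 4 z ⊞ z
   A-product z i = un ((coord (cong-≈ (A-comm τ z) ⟫ A-comm τ (Y z)) i ⊹ ((σ ⋆ coord (A-comm τ z) i) ⊹ rfl))
     ⊙ from ((x₃ ⋆ στ) ⊹ ((2 * x₂) ⋆ n+1) ⊹ ((σ * x₂) ⋆ στ) ⊹ (x₂ ⋆ flip σσ) ⊹ ((n * x₁) ⋆ στ) ⊹ ((n * x₀) ⋆ n+1) ⊹ (x₀ ⋆ flip n+1)) (lem σ τ n x₀ x₁ x₂ x₃ (iter 4 z i)))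
    where
    x₀ = z i
    x₁ = Y z i
    x₂ = Y (Y z) i
    x₃ = Y (Y (Y z)) i
    lem : ∀ σ τ n x₀ x₁ x₂ x₃ x₄ ->
     (x₄ + (τ * x₃ + n * x₂)) + (σ * (x₃ + (τ * x₂ + n * x₁)) + n * (x₂ + (τ * x₁ + n * x₀)))
      + (x₃ * 0 + 2 * x₂ * 0 + σ * x₂ * 0 + x₂ * (σ * σ + 2) + n * x₁ * 0 + n * x₀ * 0 + x₀ * (n + 1))
     ≡ (x₄ + x₀) + (x₃ * (σ + τ) + 2 * x₂ * (n + 1) + σ * x₂ * (σ + τ) + x₂ * 0 + n * x₁ * (σ + τ) + n * x₀ * (n + 1) + x₀ * 0)
    lem = solve-∀
   quarter : ∀ {v} -> A τ v ≈ 0v -> iter 4 v ⊞ v ≈ 0v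
   quarter {v} e = ≈-sym (A-product v) ⟫ Linear.cong-≈ (A-linear σ) e ⟫ Lin-zero (A-linear σ)
   -- The two quadratic factors differ by 2σY, and 2, σ and Y are invertible.
   disjoint : ∀ {u} -> A τ u ≈ 0v -> A σ u ≈ 0v -> u ≈ 0v
   disjoint {u} e f = kernel-Y (\ i -> un (cancel-≅ p∤2 (cancel-≅ {σ} p∤σ (from {a = σ * (2 * Y u i)} (coord f i ⊹ flip (coord e i) ⊹ (Y u i ⋆ στ)) (lem σ τ n (u i) (Y u i) (Y (Y u) i))))))
    where
    lem : ∀ σ τ n x₀ x₁ x₂ -> σ * (2 * x₁) + (0 + (x₂ + (τ * x₁ + n * x₀)) + x₁ * 0) ≡ 0 + (x₂ + (σ * x₁ + n * x₀) + 0 + x₁ * (σ + τ))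
    lem = solve-∀
   first : ∀ {w} -> ¬ (w ≈ 0v) -> iter 4 w ⊞ w ≈ 0v -> ∃ \ w₁ -> ¬ (w₁ ≈ 0v) × (A σ w₁ ≈ 0v ⊎ A τ w₁ ≈ 0v)
   first {w} w≉0 e with A τ w ≈? 0v
   ... | yes z = w , w≉0 , inj₂ z
   ... | no nz = A τ w , nz , inj₁ (A-product w ⟫ e)
   -- ω(w, (Y² + τY − 1)(Y⁴ − 1)y) = ω(4σ(Y − σ)w, y), because Y⁸ = 1 turns ω(w, Yʲy) into ω(Y⁸⁻ʲw, y).
   module Partner (w : V) (w≉0 : ¬ (w ≈ 0v)) (Aw : A τ w ≈ 0v) where
    u : V
    u = Y w ⊞ τ ⊡ w
    -- Y u = Y²w + τY w = w because Y² + τY - 1 kills w; thus u is Y⁻¹w.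
    u≉0 : ¬ (u ≈ 0v)
    u≉0 e = w≉0 (\ i -> un (from {a = w i} ((flip (coord (add (Y w) (τ ⊡ w)) i) ⊙ coord (cong-≈ e ⟫ Lin-zero LY) i) ⊹ flip (coord Aw i) ⊹ (τx i) ⊹ (w i ⋆ n+1)) (lem τ n (w i) (Y w i) (Y (Y w) i) (Y (τ ⊡ w) i))))
     where
     τx : ∀ i -> τ * Y w i ≅ Y (τ ⊡ w) i
     τx i = flip (coord (scale τ w) i)
     lem : ∀ τ n x₀ x₁ x₂ y -> x₀ + (0 + (x₂ + (τ * x₁ + n * x₀)) + y + x₀ * 0) ≡ 0 + (x₂ + y + 0 + τ * x₁ + x₀ * (n + 1))
     lem = solve-∀
    y z w′ : V
    y = fst (nondegenerate u u≉0)
    z = iter 4 y ⊞ n ⊡ y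
    w′ = A τ z
    Aw′ : A σ w′ ≈ 0v
    Aw′ = A-product z ⟫ (\ i -> un ((coord (Operator.Tⁿ-add Y LY 4 (iter 4 y) (n ⊡ y) ⟫ ⊞-cong {iter 8 y} {y} (Y⁸ y) (Operator.Tⁿ-scale Y LY 4 n y)) i ⊹ rfl)
      ⊙ from (((y i + iter 4 y i) ⋆ n+1)) (lem n (y i) (iter 4 y i))))
     where
     lem : ∀ n y x -> (y + n * x) + (x + n * y) + ((y + x) * 0) ≡ 0 + (y + x) * (n + 1)
     lem = solve-∀
    b : ℕ -> ℕ
    b k = ω (iter k w) y
    recurrence : ∀ u -> A τ u ≈ 0v -> ω (Y (Y u)) y + (τ * ω (Y u) y + n * ω u y) ≅ 0
    recurrence u e = (rfl {ω (Y (Y u)) y} ⊹ ((flip (ω-scaleˡ τ (Y u) y) ⊹ flip (ω-scaleˡ n u y)) ⊙ flip (ω-addˡ (τ ⊡ Y u) (n ⊡ u) y))) ⊙ flip (ω-addˡ (Y (Y u)) (τ ⊡ Y u ⊞ n ⊡ u) y) ⊙ ω-cong≅ {A τ u} {0v} {y} {y} e ≈-refl ⊙ ω-0ˡ y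
    killed : ∀ k -> A τ (iter k w) ≈ 0v
    killed zero    = Aw
    killed (suc k) = ≈-sym (A-comm τ (iter k w)) ⟫ cong-≈ (killed k) ⟫ Lin-zero LY
    b₂ : b 2 + (τ * b 1 + n * b 0) ≅ 0
    b₂ = recurrence w Aw
    b₃ : b 3 + (τ * b 2 + n * b 1) ≅ 0
    b₃ = recurrence (Y w) (killed 1)
    b₊₄ : ∀ k -> b (4 + k) + b k ≅ 0
    b₊₄ k = flip (ω-addˡ (iter 4 (iter k w)) (iter k w) y) ⊙ ω-cong≅ {iter 4 (iter k w) ⊞ iter k w} {0v} {y} {y} (quarter (killed k)) ≈-refl ⊙ ω-0ˡ y
    a : ∀ j k -> iter j (iter k w) ≈ w -> ω w (iter j y) ≅ b k
    a j k e = ω-cong≅ {w} {iter j (iter k w)} {iter j y} (≈-sym e) ≈-refl ⊙ ω-iter j (iter k w) y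
    a-z : ∀ j k -> iter (4 + j) (iter k w) ≈ w -> iter j (iter (4 + k) w) ≈ w -> ω w (iter j z) ≅ b k + n * b (4 + k)
    a-z j k e f = ω-cong≅ {w} {w} {iter j z} ≈-refl (Operator.Tⁿ-add Y LY j (iter 4 y) (n ⊡ y) ⟫ ⊞-cong {iter j (iter 4 y)} {iter (4 + j) y} (\ i -> cong (\ v -> v i % p) (sym (Iterate.iter-+ Y j 4 y) » cong (\ m -> iter m y) (+-comm j 4))) (Operator.Tⁿ-scale Y LY j n y))
     ⊙ ω-addʳ w (iter (4 + j) y) (n ⊡ iter j y) ⊙ (a (4 + j) k e ⊹ (ω-scaleʳ w n (iter j y) ⊙ (n ⋆ a j (4 + k) f)))
    pairing : ω w w′ ≅ 4 * (σ * ω u y)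
    pairing = ω-addʳ w (Y (Y z)) (τ ⊡ Y z ⊞ n ⊡ z) ⊙ (a-z 2 2 (Y⁸ w) (Y⁸ w) ⊹ (ω-addʳ w (τ ⊡ Y z) (n ⊡ z) ⊙ ((ω-scaleʳ w τ (Y z) ⊙ (τ ⋆ a-z 1 3 (Y⁸ w) (Y⁸ w))) ⊹ (ω-scaleʳ w n z ⊙ (n ⋆ a-z 0 4 (Y⁸ w) (Y⁸ w))))))
      ⊙ from {a = (b 2 + n * b 6) + (τ * (b 3 + n * b 7) + n * (b 4 + n * b 8))} {2 * b 2 + 2 * (τ * b 3) + 2 * b 0}
       ((n ⋆ b₊₄ 2) ⊹ ((τ * n) ⋆ b₊₄ 3) ⊹ (n ⋆ b₊₄ 0) ⊹ ((n * n) ⋆ b₊₄ 4) ⊹ ((n * n) ⋆ flip (b₊₄ 0)) ⊹ ((b 2 + τ * b 3 + 2 * b 0) ⋆ flip n+1) ⊹ ((n * b 0) ⋆ n+1)) (lem₁ τ n (b 0) (b 2) (b 3) (b 4) (b 6) (b 7) (b 8))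
      ⊙ from {b = 4 * (σ * (b 1 + τ * b 0))}
       ((2 ⋆ b₂) ⊹ ((2 * τ) ⋆ b₃) ⊹ ((2 * τ * τ) ⋆ flip b₂) ⊹ ((2 * τ * b 1) ⋆ flip n+1) ⊹ ((2 * τ * b 1) ⋆ ττ) ⊹ ((4 * b 1) ⋆ flip στ) ⊹ ((2 * b 0) ⋆ flip n+1)
        ⊹ ((2 * τ * τ * b 0) ⋆ n+1) ⊹ ((2 * b 0) ⋆ ττ) ⊹ ((4 * τ * b 0) ⋆ flip στ)) (lem₂ σ τ n (b 0) (b 1) (b 2) (b 3))
      ⊙ (4 ⋆ σ ⋆ flip (ω-addˡ (Y w) (τ ⊡ w) y ⊙ (rfl ⊹ ω-scaleˡ τ w y)))
     where
     lem₁ : ∀ τ n b₀ b₂ b₃ b₄ b₆ b₇ b₈ -> (b₂ + n * b₆) + (τ * (b₃ + n * b₇) + n * (b₄ + n * b₈))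
       + (n * 0 + τ * n * 0 + n * 0 + n * n * 0 + n * n * (b₄ + b₀) + (b₂ + τ * b₃ + 2 * b₀) * (n + 1) + n * b₀ * 0)
      ≡ (2 * b₂ + 2 * (τ * b₃) + 2 * b₀) + (n * (b₆ + b₂) + τ * n * (b₇ + b₃) + n * (b₄ + b₀) + n * n * (b₈ + b₄) + n * n * 0 + (b₂ + τ * b₃ + 2 * b₀) * 0 + n * b₀ * (n + 1))
     lem₁ = solve-∀
     lem₂ : ∀ σ τ n b₀ b₁ b₂ b₃ -> (2 * b₂ + 2 * (τ * b₃) + 2 * b₀)
       + (2 * 0 + 2 * τ * 0 + 2 * τ * τ * (b₂ + (τ * b₁ + n * b₀)) + 2 * τ * b₁ * (n + 1) + 2 * τ * b₁ * 0 + 4 * b₁ * (σ + τ) + 2 * b₀ * (n + 1)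
        + 2 * τ * τ * b₀ * 0 + 2 * b₀ * 0 + 4 * τ * b₀ * (σ + τ))
      ≡ 4 * (σ * (b₁ + τ * b₀)) + (2 * (b₂ + (τ * b₁ + n * b₀)) + 2 * τ * (b₃ + (τ * b₂ + n * b₁)) + 2 * τ * τ * 0 + 2 * τ * b₁ * 0 + 2 * τ * b₁ * (τ * τ + 2) + 4 * b₁ * 0 + 2 * b₀ * 0
        + 2 * τ * τ * b₀ * (n + 1) + 2 * b₀ * (τ * τ + 2) + 4 * τ * b₀ * 0)
     lem₂ = solve-∀
    w′≉0 : ¬ (w′ ≈ 0v)
    w′≉0 e = snd (nondegenerate u u≉0) (un (cancel-≅ {σ} p∤σ (cancel-≅ {2} p∤2 (cancel-≅ {2} p∤2 ((mk (cong (_% p) (lem (σ * ω u y)))) ⊙ flip pairing ⊙ ω-cong≅ {w} {w} {w′} {0v} ≈-refl e ⊙ mk (cong (_% p) (sym (lem₀))) ⊙ ω-scaleʳ w 0 0v)))))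
     where
     lem : ∀ x -> 2 * (2 * x) ≡ 4 * x
     lem = solve-∀
     lem₀ : ω w (0 ⊡ 0v) ≡ ω w 0v
     lem₀ = refl

-- Two independent subspaces for powers of 2

module TwoPart where
 open Nat
 open Sums using (is-yes; is-no)
 open Arithmetic using (prime≥2; prime≥1; *-≥1; prime-∣-^; ^-≥1)
 open OrbitCounting
 open PrimitiveRoots using (m<n*m)
 open LinearAlgebra
 open CyclicSubspaces
 open SymplecticForm
 open MatrixOrder
 open QuarticSplitting
 open HarmonicLogarithm using (dirichlet)
 open PrimitiveRoots using (module Lift; module Mod; expand₁; ∣m+n∣n⇒∣m)
 prime-2 : Prime 2
 prime-2 = prime[2]
 module TwoPower (p : ℕ) (pp : Prime p) (g : ℕ) (T : VectorSpace.V p pp (g + g) -> VectorSpace.V p pp (g + g)) (LT : VectorSpace.Linear p pp (g + g) T)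
  (ω-T : Symplectic.Preserves p pp g T) (p∤2 : ¬ (p ∣ 2)) (c : ℕ) (σ τ : ℕ) (στ : p ∣ σ + τ) (σσ : p ∣ σ * σ + 2) (ττ : p ∣ τ * τ + 2) (p∤σ : ¬ (p ∣ σ)) (p∤τ : ¬ (p ∣ τ)) where
  open Symplectic p pp g
  open CyclicSpace p pp (g + g) T LT 2 (2 + c) prime-2 p∤2
  open Linear LT
  -- The power for which T^(2^(c+3)) = 1 reads Y⁸ = 1. For ℓ = 2 the norm is then 1 + Y⁴, the
  -- quartic to be split.
  Y : V -> V
  Y = Tⁿ (2 ^ c)
  LY : Linear Y
  LY = Tⁿ-linear (2 ^ c)
  ω-Tⁿ : ∀ k -> Preserves (Tⁿ k)
  ω-Tⁿ zero    u v = refl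
  ω-Tⁿ (suc k) u v = ω-T (Tⁿ k u) (Tⁿ k v) » ω-Tⁿ k u v
  module _ (period : ∀ v -> Tⁿ r v ≈ v) (v₀ : V) (moved : ¬ (s v₀ ≈ v₀)) where
   Y⁸ : ∀ v -> Iterate.iter Y 8 v ≈ v
   Y⁸ v = eq≈ (iter-* T (2 ^ c) 8 v » cong (\ k -> Tⁿ k v) (lem (2 ^ c))) ⟫ period v
    where
    lem : ∀ x -> 8 * x ≡ 2 * (2 * (2 * x))
    lem = solve-∀
   Y⁴ : ∀ v -> Iterate.iter Y 4 v ≈ s v
   Y⁴ v = eq≈ (iter-* T (2 ^ c) 4 v » cong (\ k -> Tⁿ k v) (lem (2 ^ c)))
    where
    lem : ∀ x -> 4 * x ≡ 2 * (2 * x)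
    lem = solve-∀
   open Quartic p pp g Y LY (ω-Tⁿ (2 ^ c)) Y⁸ p∤2
   module Fσ = Factor σ τ (mk (∣⇒≋0 στ)) (mk (∣⇒≋0 σσ)) (mk (∣⇒≋0 ττ)) p∤σ
   module Fτ = Factor τ σ (mk (∣⇒≋0 (subst (p ∣_) (+-comm σ τ) στ))) (mk (∣⇒≋0 ττ)) (mk (∣⇒≋0 σσ)) p∤τ
   norm₂ : ∀ w -> norm 2 w ≈ Iterate.iter Y 4 w ⊞ w
   norm₂ w = ⊞-cong {w} {w} ≈-refl (Tⁿ-cong (2 ^ (2 + c)) (⊞-cong {w} {w} ≈-refl (Lin-zero (Tⁿ-linear (2 ^ (2 + c)))) ⟫ (≗⇒≈ (\ i -> +-identityʳ (w i))))) ⟫ (≗⇒≈ (\ i -> +-comm (w i) (s w i))) ⟫ ⊞-cong {s w} {Iterate.iter Y 4 w} {w} (≈-sym (Y⁴ w)) ≈-refl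
   A-T : ∀ β v -> A β (T v) ≈ T (A β v)
   A-T β v = eq≈ (cong₂ (\ x y -> x ⊞ (β ⊡ y ⊞ n ⊡ T v)) (cong Y (Tⁿ-comm (2 ^ c) v) » Tⁿ-comm (2 ^ c) (Y v)) (Tⁿ-comm (2 ^ c) v)) ⟫ ≈-sym (add (Y (Y v)) (β ⊡ Y v ⊞ n ⊡ v) ⟫ ⊞-cong {T (Y (Y v))} {T (Y (Y v))} ≈-refl (add (β ⊡ Y v) (n ⊡ v) ⟫ ⊞-cong {T (β ⊡ Y v)} {β ⊡ T (Y v)} (scale β (Y v)) (scale n v)))
   Two : Set
   Two = ∃ \ d₁ -> ∃ \ d₂ -> 1 ≤ d₁ × 1 ≤ d₂ × d₁ + d₂ ≤ g + g × r ∣ p ^ d₁ ∸ 1 × r ∣ p ^ d₂ ∸ 1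
   -- The T-spans of w₁ and w₂ stay inside two kernels that meet only in 0. Pairs of coefficient
   -- vectors therefore embed into 𝔽_p^(2g), so the two dimensions add up to at most 2g.
   module Pair (α β : ℕ) (disjoint : ∀ {u} -> A β u ≈ 0v -> A α u ≈ 0v -> u ≈ 0v) (w₁ w₂ : V) (Aw₁ : A β w₁ ≈ 0v) (Aw₂ : A α w₂ ≈ 0v) where
    killed : ∀ γ {w} -> A γ w ≈ 0v -> ∀ {d} (x : Fin d -> ℕ) -> A γ (comb x w) ≈ 0v
    killed γ {w} e {d} x = comb-map (A-linear γ) (A-T γ) x w ⟫ comb-cong {d} {x} (\ i -> refl) e ⟫ comb-0 x
    killed-minus : ∀ γ {u v} -> A γ u ≈ 0v -> A γ v ≈ 0v -> A γ (u ⊞ n ⊡ v) ≈ 0v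
    killed-minus γ {u} {v} e f = Linear.add (A-linear γ) u (n ⊡ v) ⟫ ⊞-cong {A γ u} {0v} e (Linear.scale (A-linear γ) n v ⟫ ⊡-cong {n} {n} refl f) ⟫ (≗⇒≈ (\ i -> *-zeroʳ n))
    separate : ∀ {d₁ d₂} (x x′ : Fin d₁ -> ℕ) (y y′ : Fin d₂ -> ℕ) -> comb x w₁ ⊞ comb y w₂ ≈ comb x′ w₁ ⊞ comb y′ w₂ -> comb x w₁ ≈ comb x′ w₁ × comb y w₂ ≈ comb y′ w₂
    separate x x′ y y′ e = e₁ , \ i -> un (from (coord e i ⊹ flip (coord e₁ i)) (lem′ (comb x w₁ i) (comb x′ w₁ i) (comb y w₂ i) (comb y′ w₂ i)))
     where
     lem : ∀ n u u′ v v′ -> u + n * u′ + (u′ + v′ + u′ * 0 + v * (n + 1)) ≡ v′ + n * v + (u + v + u′ * (n + 1) + v * 0)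
     lem = solve-∀
     lem′ : ∀ u u′ v v′ -> v + (u′ + v′ + u) ≡ v′ + (u + v + u′)
     lem′ = solve-∀
     D = comb x w₁ ⊞ n ⊡ comb x′ w₁
     D≈ : D ≈ comb y′ w₂ ⊞ n ⊡ comb y w₂
     D≈ i = un (from (coord e i ⊹ (comb x′ w₁ i ⋆ n+1) ⊹ (comb y w₂ i ⋆ flip n+1)) (lem n (comb x w₁ i) (comb x′ w₁ i) (comb y w₂ i) (comb y′ w₂ i)))
     D≈0 : D ≈ 0v
     D≈0 = disjoint (killed-minus β {comb x w₁} {comb x′ w₁} (killed β Aw₁ x) (killed β Aw₁ x′)) (Linear.cong-≈ (A-linear α) D≈ ⟫ killed-minus α {comb y′ w₂} {comb y w₂} (killed α Aw₂ y′) (killed α Aw₂ y))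
     e₁ : comb x w₁ ≈ comb x′ w₁
     e₁ i = un (from (coord D≈0 i ⊹ (comb x′ w₁ i ⋆ flip n+1)) (lem″ n (comb x w₁ i) (comb x′ w₁ i)))
      where
      lem″ : ∀ n u u′ -> u + (0 + u′ * (n + 1)) ≡ u′ + (u + n * u′ + u′ * 0)
      lem″ = solve-∀
    count : ∀ d₁ d₂ -> Span.Indep w₁ d₁ -> Span.Indep w₂ d₂ -> d₁ + d₂ ≤ g + g
    count d₁ d₂ ind₁ ind₂ = Span.p^-cancel w₁ {d₁ + d₂} {g + g} (subst (_≤ p ^ (g + g)) (sym (^-distribˡ-+-* p d₁ d₂)) (FinP.injective⇒≤ {f = f} injective))
     where
     c₁ : Fin (p ^ d₁ * p ^ d₂) -> Fin (p ^ d₁)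
     c₁ x = fst (Fin.remQuot {p ^ d₁} (p ^ d₂) x)
     c₂ : Fin (p ^ d₁ * p ^ d₂) -> Fin (p ^ d₂)
     c₂ x = snd (Fin.remQuot {p ^ d₁} (p ^ d₂) x)
     v₁ : Fin (p ^ d₁ * p ^ d₂) -> V
     v₁ x = comb {d₁} (\ i -> toℕ (finToFun {p} {d₁} (c₁ x) i)) w₁
     v₂ : Fin (p ^ d₁ * p ^ d₂) -> V
     v₂ x = comb {d₂} (\ i -> toℕ (finToFun {p} {d₂} (c₂ x) i)) w₂
     f : Fin (p ^ d₁ * p ^ d₂) -> Fin (p ^ (g + g))
     f x = canon (v₁ x ⊞ v₂ x)
     code-injective : ∀ {d} (x y : Fin (p ^ d)) -> (∀ i -> finToFun {p} {d} x i ≡ finToFun y i) -> x ≡ y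
     code-injective {d} x y e = sym (FinP.funToFin-finToFin {d} {p} x) » funToFin-cong e » FinP.funToFin-finToFin {d} {p} y
     injective : ∀ {x y} -> f x ≡ f y -> x ≡ y
     injective {x} {y} e = sym (FinP.combine-remQuot {p ^ d₁} (p ^ d₂) x) » cong₂ Fin.combine
       (code-injective {d₁} (c₁ x) (c₁ y) (ind₁ (finToFun (c₁ x)) (finToFun (c₁ y)) (fst sep)))
       (code-injective {d₂} (c₂ x) (c₂ y) (ind₂ (finToFun (c₂ x)) (finToFun (c₂ y)) (snd sep))) » FinP.combine-remQuot {p ^ d₁} (p ^ d₂) y
      where
      sep = separate (\ i -> toℕ (finToFun {p} {d₁} (c₁ x) i)) (\ i -> toℕ (finToFun {p} {d₁} (c₁ y) i)) (\ i -> toℕ (finToFun {p} {d₂} (c₂ x) i)) (\ i -> toℕ (finToFun {p} {d₂} (c₂ y) i)) (canon-injective e)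
    two : ¬ (w₁ ≈ 0v) -> ¬ (w₂ ≈ 0v) -> norm 2 w₁ ≈ 0v -> norm 2 w₂ ≈ 0v -> Two
    two nz₁ nz₂ n₁ n₂ = go (cyclic-dimension period w₁ nz₁ n₁) (cyclic-dimension period w₂ nz₂ n₂)
     where
     go : (∃ \ d -> 1 ≤ d × Span.Indep w₁ d × r ∣ p ^ d ∸ 1) -> (∃ \ d -> 1 ≤ d × Span.Indep w₂ d × r ∣ p ^ d ∸ 1) -> Two
     go (d₁ , a₁ , i₁ , h₁) (d₂ , a₂ , i₂ , h₂) = d₁ , d₂ , a₁ , a₂ , count d₁ d₂ i₁ i₂ , h₁ , h₂
   open Difference period v₀ moved
   -- Whichever factor kills a nonzero vector, its symplectic partner is a nonzero vector killed by
   -- the other factor.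
   two-spaces : Two
   two-spaces = go (Fσ.first w₀≉0 (≈-sym (norm₂ w₀) ⟫ norm-w₀))
    where
    go : (∃ \ w₁ -> ¬ (w₁ ≈ 0v) × (A σ w₁ ≈ 0v ⊎ A τ w₁ ≈ 0v)) -> Two
    go (w₁ , nz , inj₂ e) = Pair.two σ τ Fσ.disjoint w₁ w′ e Aw′ nz w′≉0 (norm₂ w₁ ⟫ Fσ.quarter e) (norm₂ w′ ⟫ Fτ.quarter Aw′)
     where open Fσ.Partner w₁ nz e
    go (w₁ , nz , inj₁ e) = Pair.two τ σ Fτ.disjoint w₁ w′ e Aw′ nz w′≉0 (norm₂ w₁ ⟫ Fτ.quarter e) (norm₂ w′ ⟫ Fσ.quarter Aw′)
     where open Fτ.Partner w₁ nz e

-- Upper bound for the prime powers dividing an element order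

module OrderBound where
 open Nat
 open Sums using (is-yes; is-no)
 open Arithmetic using (prime≥2; prime≥1; *-≥1; prime-∣-^; ^-≥1)
 open OrbitCounting
 open PrimitiveRoots using (m<n*m)
 open LinearAlgebra
 open CyclicSubspaces
 open SymplecticForm
 open MatrixOrder
 open QuarticSplitting
 open TwoPart
 open HarmonicLogarithm using (dirichlet)
 open PrimitiveRoots using (module Lift; module Mod; expand₁; ∣m+n∣n⇒∣m)
 -- Lifting the exponent at 2 from bases that are 1 modulo 4: the linear term forces e to be even,
 -- and squaring the base raises its exponent of 2 by one while the cofactor stays odd.
 lte₂ : ∀ t j v e -> ¬ (2 ∣ v) -> 2 ^ (t + (2 + j)) ∣ (1 + 2 ^ (2 + j) * v) ^ e ∸ 1 -> 2 ^ t ∣ e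
 lte₂ zero    j v e odd h = 1∣ e
 lte₂ (suc t) j v e odd h = halve even
  where
  x = 2 ^ (2 + j) * v
  X = 2 ^ j
  c = fst (expand₁ x e)
  even : 2 ∣ e
  even = case euclidsLemma e v prime-2 (*-cancelˡ-∣ (2 ^ (2 + j)) {{m^n≢0 2 (2 + j)}} (subst₂ _∣_ (*-comm 2 (2 ^ (2 + j))) (lem₁ e (2 ^ (2 + j)) v)
     (∣m+n∣n⇒∣m (subst (2 * 2 ^ (2 + j) ∣_) (cong (\ z -> z ∸ 1) (snd (expand₁ x e)) » refl) (∣-trans (subst (2 ^ (3 + j) ∣_) (sym (cong (\ z -> 2 ^ suc z) (+-comm t (2 + j)) » ^-distribˡ-+-* 2 (3 + j) t)) (m∣m*n (2 ^ t))) h))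
      (divides (2 * X * v * v * c) (lem₂ X v c))))) of \ where
    (inj₁ d) -> d
    (inj₂ d) -> ⊥-elim (odd d)
   where
   lem₁ : ∀ e A v -> e * (A * v) ≡ A * (e * v)
   lem₁ = solve-∀
   lem₂ : ∀ X v c -> 2 * (2 * X) * v * (2 * (2 * X) * v) * c ≡ 2 * X * v * v * c * (2 * (2 * (2 * X)))
   lem₂ = solve-∀
  halve : 2 ∣ e -> 2 ^ suc t ∣ e
  halve (divides e′ refl) = subst (2 ^ suc t ∣_) (*-comm 2 e′) (*-monoʳ-∣ 2 (lte₂ t (suc j) v′ e′ odd′ (subst₂ (\ a b -> 2 ^ a ∣ b ∸ 1) (lem₅ t j) power h)))
   where
   v′ = v + 2 * X * v * v
   odd′ : ¬ (2 ∣ v′)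
   odd′ d = odd (∣m+n∣n⇒∣m d (divides (X * v * v) (lem₃ X v)))
    where
    lem₃ : ∀ X v -> 2 * X * v * v ≡ X * v * v * 2
    lem₃ = solve-∀
   lem₄ : ∀ X v -> (1 + 2 * (2 * X) * v) * ((1 + 2 * (2 * X) * v) * 1) ≡ 1 + 2 * (2 * (2 * X)) * (v + 2 * X * v * v)
   lem₄ = solve-∀
   lem₅ : ∀ t j -> suc t + (2 + j) ≡ t + (2 + suc j)
   lem₅ = solve-∀
   power : (1 + x) ^ (e′ * 2) ≡ (1 + 2 ^ (3 + j) * v′) ^ e′
   power = cong ((1 + x) ^_) (*-comm e′ 2) » sym (^-*-assoc (1 + x) 2 e′) » cong (_^ e′) (lem₄ X v)
 -- An odd power of p is 3 modulo 8, so d is even, and p² = 1 + 8v with v odd starts the lifting.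
 order-of-3-mod-8 : ∀ p v -> p % 8 ≡ 3 -> p * p ≡ 1 + 4 * (2 * v) -> ¬ (2 ∣ v) -> ∀ c d -> 2 ^ (3 + c) ∣ p ^ d ∸ 1 -> 2 ^ suc c ∣ d
 order-of-3-mod-8 p v p≡3 p² odd c d h = go (d % 2) refl (m%n<n d 2)
  where
  module K = Mod 8
  e = d / 2
  1≤p : 1 ≤ p
  1≤p = n≢0⇒n>0 (\ { refl -> case p≡3 of \ () })
  square : ∀ e -> (p * p) ^ e K.≡ₖ 1
  square e = K.^-congₖ {p * p} {1} e (cong (_% 8) (p² » cong (1 +_) (lem v)) » [m+kn]%n≡m%n 1 v 8) » cong (_% 8) (^-zeroˡ e)
   where
   lem : ∀ v -> 4 * (2 * v) ≡ v * 8
   lem = solve-∀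
  p^2e : ∀ e -> p ^ (e * 2) ≡ (p * p) ^ e
  p^2e e = cong (p ^_) (*-comm e 2) » sym (^-*-assoc p 2 e) » cong (\ z -> (p * z) ^ e) (*-identityʳ p)
  go : ∀ s -> d % 2 ≡ s -> s < 2 -> 2 ^ suc c ∣ d
  go (suc zero) eq _ = case trans (sym p≡3) (sym (K.*-congₖ {p} {p} {p ^ (e * 2)} {1} refl (cong (_% 8) (p^2e e) » square e) » cong (_% 8) (*-identityʳ p)) » cong (\ z -> p ^ z % 8) (sym (m≡m%n+[m/n]*n d 2 » cong (_+ e * 2) eq)) » sym (K.∣⇒≡ₖ {1} {p ^ d} (^-≥1 d 1≤p) (∣-trans (subst (8 ∣_) (sym (^-distribˡ-+-* 2 3 c)) (m∣m*n (2 ^ c))) h))) of \ ()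
  go (suc (suc _)) eq (s≤s (s≤s ()))
  go zero eq _ = subst (2 ^ suc c ∣_) (sym d≡) (subst (2 ^ suc c ∣_) (*-comm 2 e) (*-monoʳ-∣ 2 (lte₂ c 1 v e odd (subst₂ (\ a b -> 2 ^ a ∣ b ∸ 1) (+-comm 3 c) (cong (p ^_) d≡ » p^2e e » cong (_^ e) (p² » cong (1 +_) (lem v))) h))))
   where
   d≡ : d ≡ e * 2
   d≡ = m≡m%n+[m/n]*n d 2 » cong (_+ e * 2) eq
   lem : ∀ v -> 4 * (2 * v) ≡ 2 * (2 * (2 * 1)) * v
   lem = solve-∀
 two-power-bound : ∀ g c n p -> (pp : Prime p) -> ∀ v σ τ -> p % 8 ≡ 3 -> p * p ≡ 1 + 4 * (2 * v) -> ¬ (2 ∣ v) -> ¬ (p ∣ 2) ->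
  p ∣ σ + τ -> p ∣ σ * σ + 2 -> p ∣ τ * τ + 2 -> ¬ (p ∣ σ) -> ¬ (p ∣ τ) ->
  SpHasOrder p g {{prime⇒nonZero pp}} n -> 2 ^ (3 + c) ∣ n -> 2 ^ (2 + c) ≤ g + g
 two-power-bound g c n p pp v σ τ p≡3 p² odd p∤2 στ σσ ττ p∤σ p∤τ (M , sp , ord) r∣n = bound (two-spaces period (fst moved) (snd moved))
  where
  open PrimePowerOrder p pp g M n ord 2 (2 + c) prime-2 p∤2 r∣n using (T; T-linear; period; moved; q; Preserves; ω-invariant)
  ω-pow : ∀ k -> Preserves (Iterate.iter (apply M) k)
  ω-pow zero    u v = refl
  ω-pow (suc k) u v = ω-invariant {M} sp (Iterate.iter (apply M) k u) (Iterate.iter (apply M) k v) » ω-pow k u v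
  open TwoPower p pp g T T-linear (ω-pow q) p∤2 c σ τ στ σσ ττ p∤σ p∤τ using (two-spaces)
  at-least : ∀ {d} -> 1 ≤ d -> 2 ^ (3 + c) ∣ p ^ d ∸ 1 -> 2 ^ suc c ≤ d
  at-least {d} 1≤d h = ∣⇒≤ {{N.>-nonZero 1≤d}} (order-of-3-mod-8 p v p≡3 p² odd c d h)
  bound : (∃ \ d₁ -> ∃ \ d₂ -> 1 ≤ d₁ × 1 ≤ d₂ × d₁ + d₂ ≤ g + g × 2 ^ (3 + c) ∣ p ^ d₁ ∸ 1 × 2 ^ (3 + c) ∣ p ^ d₂ ∸ 1) -> 2 ^ (2 + c) ≤ g + g
  bound (d₁ , d₂ , a₁ , a₂ , le , h₁ , h₂) = +-mono-≤ (at-least a₁ h₁) (≤-reflexive (+-identityʳ _) ⋙ at-least a₂ h₂) ⋙ le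
 odd-prime-bound : ∀ g n -> Admissible g n -> ∀ ℓ b -> Prime ℓ -> ℓ ≢ 2 -> ℓ ^ suc b ∣ n -> ℓ ^ b * (ℓ ∸ 1) ≤ g + g
 -- The bound 2 + q + ℓ makes p odd and different from the exceptional prime q and from ℓ at once.
 odd-prime-bound g n (1≤n , q , has) ℓ b pℓ ℓ≢2 r∣n = go (dirichlet (ℓ ^ suc b) {{nzk b}} ℓ root-g (φ b) (cyclic b) (2 + q + ℓ))
  where
  open Lift ℓ pℓ ℓ≢2 using (k; φ; cyclic; order; nzk; root; module Root)
  root-g = Root.g root
  instance
   nz-k : NonZero (ℓ ^ suc b)
   nz-k = nzk b
  module K = Mod (ℓ ^ suc b)
  go : (∃ \ p -> Prime p × 2 + q + ℓ < p × p K.≡ₖ root-g) -> ℓ ^ b * (ℓ ∸ 1) ≤ g + g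
  go (p , pp , big , p≡g) = bound (PrimePowerOrder.dimension-bound p pp g M n ord ℓ b pℓ (\ d -> <⇒≱ (≤-<-trans (m≤n+m ℓ (2 + q)) big) (∣⇒≤ {{prime⇒nonZero pℓ}} d)) r∣n)
   where
   odd : ¬ (2 ∣ p)
   odd h = case prime⇒irreducible pp h of \ where
    (inj₂ refl) -> <⇒≱ big (m≤m+n 2 q ⋙ m≤m+n (2 + q) ℓ)
   sp = has p pp odd (\ { refl -> <⇒≱ big (m≤n+m q 2 ⋙ m≤m+n (2 + q) ℓ) })
   M = fst sp
   ord = snd (snd sp)
   bound : (∃ \ d -> 1 ≤ d × d ≤ g + g × ℓ ^ suc b ∣ p ^ d ∸ 1) -> ℓ ^ b * (ℓ ∸ 1) ≤ g + g
   bound (d , 1≤d , d≤ , h) = (∣⇒≤ {{N.>-nonZero 1≤d}} (order b d (K.≡ₖ⇒∣ 1≤g^d (sym g^d≡1 » refl)))) ⋙ d≤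
    where
    g^d≡1 : root-g ^ d K.≡ₖ 1
    g^d≡1 = sym (K.^-congₖ {p} {root-g} d p≡g) » sym (K.∣⇒≡ₖ {1} {p ^ d} (^-≥1 d (prime≥1 pp)) h)
    1≤g^d : 1 ≤ root-g ^ d
    1≤g^d = n≢0⇒n>0 (\ z -> case trans (sym g^d≡1) (cong (_% (ℓ ^ suc b)) z) of \ e -> <⇒≢ (prime≥2 pℓ) (sym (≤-antisym (m≤m*n ℓ (ℓ ^ b) {{m^n≢0 ℓ b {{prime⇒nonZero pℓ}}}} ⋙ (∣⇒≤ (m%n≡0⇒n∣m 1 (ℓ ^ suc b) (e » m<n⇒m%n≡m (^-≥1 (suc b) (prime≥1 pℓ)))))) (prime≥1 pℓ))))
 prime-power-bound : ∀ g n -> 1 ≤ g -> Admissible g n -> ∀ ℓ b -> Prime ℓ -> ℓ ^ suc b ∣ n -> ℓ ^ b * (ℓ ∸ 1) ≤ g + g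
 prime-power-bound g n 1≤g adm@(_ , q , has) ℓ b pℓ r∣n with ℓ N.≟ 2
 ... | no ne    = odd-prime-bound g n adm ℓ b pℓ ne r∣n
 ... | yes refl = power-of-2 b r∣n
  where
  power-of-2 : ∀ b -> 2 ^ suc b ∣ n -> 2 ^ b * 1 ≤ g + g
  power-of-2 0 _ = 1≤g ⋙ m≤m+n g g
  power-of-2 1 _ = +-mono-≤ 1≤g 1≤g
  power-of-2 (suc (suc c)) h = subst (_≤ g + g) (sym (*-identityʳ (2 ^ (2 + c)))) (case q N.≟ 3 of \ where
   -- The square roots of -2 are 1, 2 modulo 3 and 3, 8 modulo 11, and 9 = 1 + 8·1, 121 = 1 + 8·15.
   -- The prime 11 takes over when 3 is the exceptional prime.
   (no q≢3) -> two-power-bound g c n 3 prime-3 1 1 2 refl refl (toWitnessFalse {a? = 2 ∣? 1} _) (toWitnessFalse {a? = 3 ∣? 2} _)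
    (toWitness {a? = 3 ∣? 3} _) (toWitness {a? = 3 ∣? 3} _) (toWitness {a? = 3 ∣? 6} _) (toWitnessFalse {a? = 3 ∣? 1} _) (toWitnessFalse {a? = 3 ∣? 2} _) (has 3 prime-3 (toWitnessFalse {a? = 2 ∣? 3} _) (\ e -> q≢3 (sym e))) h
   (yes refl) -> two-power-bound g c n 11 prime-11 15 3 8 refl refl (toWitnessFalse {a? = 2 ∣? 15} _) (toWitnessFalse {a? = 11 ∣? 2} _)
    (toWitness {a? = 11 ∣? 11} _) (toWitness {a? = 11 ∣? 11} _) (toWitness {a? = 11 ∣? 66} _) (toWitnessFalse {a? = 11 ∣? 3} _) (toWitnessFalse {a? = 11 ∣? 8} _) (has 11 prime-11 (toWitnessFalse {a? = 2 ∣? 11} _) (\ ())) h)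
   where
   prime-3 : Prime 3
   prime-3 = toWitness {a? = prime? 3} _
   prime-11 : Prime 11
   prime-11 = toWitness {a? = prime? 11} _

-- Symplectic maps from a block shift and a wave step

module BlockShift where
 open Nat
 open Sums using (is-yes; is-no)
 open Arithmetic using (prime≥2; prime≥1; *-≥1; prime-∣-^; ^-≥1)
 open OrbitCounting
 open PrimitiveRoots using (m<n*m)
 open LinearAlgebra
 open CyclicSubspaces
 open SymplecticForm
 open MatrixOrder
 pick : ∀ {P A : Set} -> Dec P -> A -> A -> A
 pick (yes _) a b = a
 pick (no _)  a b = b
 pick-yes : ∀ {P A : Set} (d : Dec P) {a b : A} -> P -> pick d a b ≡ a
 pick-yes (yes _) p = refl
 pick-yes (no ¬p) p = ⊥-elim (¬p p)
 pick-no : ∀ {P A : Set} (d : Dec P) {a b : A} -> ¬ P -> pick d a b ≡ b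
 pick-no (yes p) ¬p = ⊥-elim (¬p p)
 pick-no (no _)  ¬p = refl
 pick-⇔ : ∀ {P Q A : Set} (d : Dec P) (e : Dec Q) {a b : A} -> (P -> Q) -> (Q -> P) -> pick d a b ≡ pick e a b
 pick-⇔ (yes p) e f g = sym (pick-yes e (f p))
 pick-⇔ (no ¬p) e f g = sym (pick-no e (\ q -> ¬p (g q)))
 eq : ℕ -> ℕ -> ℕ
 eq i j = pick (i N.≟ j) 1 0
 eq-sym : ∀ i j -> eq i j ≡ eq j i
 eq-sym i j = pick-⇔ (i N.≟ j) (j N.≟ i) sym sym
 eq-suc : ∀ i j -> eq (suc i) (suc j) ≡ eq i j
 eq-suc i j = pick-⇔ (suc i N.≟ suc j) (i N.≟ j) suc-injective (cong suc)
 idM-eq : ∀ {m} (i j : Fin m) -> idM i j ≡ eq (toℕ i) (toℕ j)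
 idM-eq i j with toℕ i N.≟ toℕ j
 ... | yes e = cong (if_then 1 else 0) (is-yes (toℕ i N.≟ toℕ j) e)
 ... | no ne = cong (if_then 1 else 0) (is-no (toℕ i N.≟ toℕ j) ne)
 -- Exchange of two adjacent blocks of lengths a and b. For a = h₀ and b = m·h₀ it is the cyclic
 -- rotation of m + 1 blocks of length h₀.
 rot : ℕ -> ℕ -> ℕ -> ℕ
 rot a b i = pick (i N.<? a) (b + i) (pick (i N.<? a + b) (i ∸ a) i)
 rot-lo : ∀ a b {i} -> i < a -> rot a b i ≡ b + i
 rot-lo a b {i} h = pick-yes (i N.<? a) h
 rot-mid : ∀ a b {i} -> i < b -> rot a b (a + i) ≡ i
 rot-mid a b {i} h = pick-no (a + i N.<? a) (≤⇒≯ (m≤m+n a i)) » pick-yes (a + i N.<? a + b) (+-monoʳ-< a h) » m+n∸m≡n a i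
 rot-hi : ∀ a b {i} -> a + b ≤ i -> rot a b i ≡ i
 rot-hi a b {i} h = pick-no (i N.<? a) (≤⇒≯ (m≤m+n a b ⋙ h)) » pick-no (i N.<? a + b) (≤⇒≯ h)
 data Segment (a b i : ℕ) : Set where
  lo-seg  : i < a -> Segment a b i
  mid-seg : ∀ j -> j < b -> i ≡ a + j -> Segment a b i
  hi-seg  : a + b ≤ i -> Segment a b i
 segment : ∀ a b i -> Segment a b i
 segment a b i with i N.<? a | i N.<? a + b
 ... | yes h | _     = lo-seg h
 ... | no ¬h | yes k = mid-seg (i ∸ a) (+-cancelˡ-< a _ _ (subst (_< a + b) (sym (m+[n∸m]≡n (≮⇒≥ ¬h))) k)) (sym (m+[n∸m]≡n (≮⇒≥ ¬h)))
 ... | no _  | no ¬k = hi-seg (≮⇒≥ ¬k)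
 rot-inverse : ∀ a b i -> rot b a (rot a b i) ≡ i
 rot-inverse a b i with segment a b i
 ... | lo-seg h         = cong (rot b a) (rot-lo a b h) » rot-mid b a h
 ... | mid-seg j h refl = cong (rot b a) (rot-mid a b h) » rot-lo b a h
 ... | hi-seg h         = cong (rot b a) (rot-hi a b h) » rot-hi b a (subst (_≤ i) (+-comm a b) h)
 rot-< : ∀ a b {g i} -> a + b ≤ g -> i < g -> rot a b i < g
 rot-< a b {g} {i} le i<g with segment a b i
 ... | lo-seg h         = subst (_< g) (sym (rot-lo a b h)) (<-≤-trans (+-monoʳ-< b h) (subst (_≤ g) (+-comm a b) le))
 ... | mid-seg j h refl = subst (_< g) (sym (rot-mid a b h)) (≤-<-trans (m≤n+m j a) i<g)
 ... | hi-seg h         = subst (_< g) (sym (rot-hi a b h)) i<g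
 sumF-permute : ∀ {m} (ρ ρ⁻¹ : Fin m -> Fin m) -> (∀ i -> ρ⁻¹ (ρ i) ≡ i) -> (∀ i -> ρ (ρ⁻¹ i) ≡ i) -> ∀ (f : Fin m -> ℕ) -> sumF (\ i -> f (ρ i)) ≡ sumF f
 sumF-permute ρ ρ⁻¹ li ri f = begin
  sumF (\ i -> f (ρ i))                       ≡⟨ sum-ext (\ i -> sym (sumF-idM (ρ i) f)) ⟩
  sumF (\ i -> sumF (\ j -> idM (ρ i) j * f j)) ≡⟨ sumF-swap (\ i j -> idM (ρ i) j * f j) ⟩
  sumF (\ j -> sumF (\ i -> idM (ρ i) j * f j)) ≡⟨ sum-ext (\ j -> sum-ext (\ i -> cong (_* f j) (move i j)) » sumF-idM (ρ⁻¹ j) (\ _ -> f j)) ⟩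
  sumF f                                     ∎
  where
  open ≡-Reasoning
  move : ∀ i j -> idM (ρ i) j ≡ idM (ρ⁻¹ j) i
  move i j = idM-eq (ρ i) j » pick-⇔ (toℕ (ρ i) N.≟ toℕ j) (toℕ (ρ⁻¹ j) N.≟ toℕ i)
   (\ e -> cong toℕ (cong ρ⁻¹ (sym (FinP.toℕ-injective e)) » li i)) (\ e -> cong toℕ (cong ρ (sym (FinP.toℕ-injective e)) » ri j)) » sym (idM-eq (ρ⁻¹ j) i)
 module Construct (p : ℕ) (pp : Prime p) (g h₀ d loop : ℕ) (h≤g : h₀ + d ≤ g) where
  open Symplectic p pp g
  n : ℕ
  n = neg1
  lo hi : V -> Fin g -> ℕ
  lo x k = x (k ↑ˡ g)
  hi x k = x (g ↑ʳ k)
  join : (Fin g -> ℕ) -> (Fin g -> ℕ) -> V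
  join u v i = [ u , v ]′ (Fin.splitAt g i)
  lo-join : ∀ u v k -> lo (join u v) k ≡ u k
  lo-join u v k = cong [ u , v ]′ (FinP.splitAt-↑ˡ g k g)
  hi-join : ∀ u v k -> hi (join u v) k ≡ v k
  hi-join u v k = cong [ u , v ]′ (FinP.splitAt-↑ʳ g g k)
  split-≈ : ∀ {x y} -> (∀ k -> lo x k ≋ lo y k) -> (∀ k -> hi x k ≋ hi y k) -> x ≈ y
  split-≈ {x} {y} l h i with Fin.splitAt g i in e
  ... | inj₁ k = subst (\ z -> x z ≋ y z) (FinP.splitAt⁻¹-↑ˡ e) (l k)
  ... | inj₂ k = subst (\ z -> x z ≋ y z) (FinP.splitAt⁻¹-↑ʳ e) (h k)
  split-≡ : ∀ {x y} -> (∀ k -> lo x k ≡ lo y k) -> (∀ k -> hi x k ≡ hi y k) -> x ≈ y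
  split-≡ {x} {y} l h = split-≈ {x} {y} (\ k -> cong (_% p) (l k)) (\ k -> cong (_% p) (h k))
  ρ ρ⁻¹ : Fin g -> Fin g
  ρ k = fromℕ< (rot-< h₀ d h≤g (FinP.toℕ<n k))
  ρ⁻¹ k = fromℕ< (rot-< d h₀ (subst (_≤ g) (+-comm h₀ d) h≤g) (FinP.toℕ<n k))
  toℕ-ρ : ∀ k -> toℕ (ρ k) ≡ rot h₀ d (toℕ k)
  toℕ-ρ k = FinP.toℕ-fromℕ< _
  toℕ-ρ⁻¹ : ∀ k -> toℕ (ρ⁻¹ k) ≡ rot d h₀ (toℕ k)
  toℕ-ρ⁻¹ k = FinP.toℕ-fromℕ< _
  shift : V -> V
  shift x = join (\ k -> lo x (ρ k)) (\ k -> hi x (ρ k))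
  shift-linear : Linear shift
  shift-linear = record
   { cong-≈ = \ {u} {v} e -> split-≈ {shift u} {shift v} (\ k -> cong (_% p) (lo-join _ _ k) » e (ρ k ↑ˡ g) » cong (_% p) (sym (lo-join _ _ k))) (\ k -> cong (_% p) (hi-join _ _ k) » e (g ↑ʳ ρ k) » cong (_% p) (sym (hi-join _ _ k)))
   ; add = \ u v -> split-≡ {shift (u ⊞ v)} {shift u ⊞ shift v} (\ k -> lo-join _ _ k » sym (cong₂ _+_ (lo-join _ _ k) (lo-join _ _ k))) (\ k -> hi-join _ _ k » sym (cong₂ _+_ (hi-join _ _ k) (hi-join _ _ k)))
   ; scale = \ c v -> split-≡ {shift (c ⊡ v)} {c ⊡ shift v} (\ k -> lo-join _ _ k » sym (cong (c *_) (lo-join _ _ k))) (\ k -> hi-join _ _ k » sym (cong (c *_) (hi-join _ _ k)))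
   }
  shift-ω : Preserves shift
  shift-ω x y = cong (_% p) (ω-split (shift x) (shift y) » cong₂ (\ a b -> a + n * b)
    (sum-ext (\ k -> cong₂ _*_ (lo-join _ _ k) (hi-join _ _ k)) » sumF-permute ρ ρ⁻¹ li ri (\ k -> lo x k * hi y k))
    (sum-ext (\ k -> cong₂ _*_ (hi-join _ _ k) (lo-join _ _ k)) » sumF-permute ρ ρ⁻¹ li ri (\ k -> hi x k * lo y k)) » sym (ω-split x y))
   where
   li : ∀ i -> ρ⁻¹ (ρ i) ≡ i
   li i = FinP.toℕ-injective (toℕ-ρ⁻¹ (ρ i) » cong (rot d h₀) (toℕ-ρ i) » rot-inverse h₀ d (toℕ i))
   ri : ∀ i -> ρ (ρ⁻¹ i) ≡ i
   ri i = FinP.toℕ-injective (toℕ-ρ (ρ⁻¹ i) » cong (rot h₀ d) (toℕ-ρ⁻¹ i) » rot-inverse d h₀ (toℕ i))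
  -- Adjacency matrix of the path on h₀ points with a loop of weight `loop` at the last point; the
  -- loop determines how a wave is reflected there.
  σ : ℕ -> ℕ -> ℕ
  σ i j = pick (i N.<? h₀) (pick (j N.<? h₀) (eq (suc i) j + eq (suc j) i + loop * (eq i j * eq (suc i) h₀)) 0) 0
  σ-in : ∀ {i j} -> i < h₀ -> j < h₀ -> σ i j ≡ eq (suc i) j + eq (suc j) i + loop * (eq i j * eq (suc i) h₀)
  σ-in {i} {j} a b = pick-yes (i N.<? h₀) a » pick-yes (j N.<? h₀) b
  σ-outˡ : ∀ {i j} -> ¬ (i < h₀) -> σ i j ≡ 0
  σ-outˡ {i} a = pick-no (i N.<? h₀) a
  σ-outʳ : ∀ {i j} -> ¬ (j < h₀) -> σ i j ≡ 0
  σ-outʳ {i} {j} b with i N.<? h₀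
  ... | yes _ = pick-no (j N.<? h₀) b
  ... | no _  = refl
  σ-sym : ∀ i j -> σ i j ≡ σ j i
  σ-sym i j = case (i N.<? h₀) of \ where
    (no a)  -> σ-outˡ a » sym (σ-outʳ {j} {i} a)
    (yes a) -> case (j N.<? h₀) of \ where
     (no b)  -> σ-outʳ {i} {j} b » sym (σ-outˡ b)
     (yes b) -> σ-in a b » cong₂ _+_ (+-comm (eq (suc i) j) (eq (suc j) i)) (cong (loop *_) (diag i j)) » sym (σ-in b a)
   where
   diag : ∀ i j -> eq i j * eq (suc i) h₀ ≡ eq j i * eq (suc j) h₀
   diag i j = case (i N.≟ j) of \ where
    (yes refl) -> refl
    (no ne) -> cong (_* eq (suc i) h₀) (pick-no (i N.≟ j) ne) » sym (cong (_* eq (suc j) h₀) (pick-no (j N.≟ i) (ne ∘ sym)))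
  S : Mat g
  S i j = σ (toℕ i) (toℕ j)
  choose : ∀ (k : Fin g) -> ℕ -> ℕ -> ℕ
  choose k = pick (toℕ k N.<? h₀)
  -- One time step of the wave equation u(t+1) + u(t-1) = S u(t) on the first h₀ coordinate pairs,
  -- where `lo` holds u(t-1) and `hi` holds u(t).
  twist : V -> V
  twist x = join (\ k -> choose k (hi x k) (lo x k)) (\ k -> choose k (n * lo x k) (hi x k) + apply S (hi x) k)
  choose-cong : ∀ k {a a′ b b′} -> a ≋ a′ -> b ≋ b′ -> choose k a b ≋ choose k a′ b′
  choose-cong k e f with toℕ k N.<? h₀
  ... | yes _ = e
  ... | no _  = f
  choose-+ : ∀ k a a′ b b′ -> choose k (a + a′) (b + b′) ≡ choose k a b + choose k a′ b′
  choose-+ k a a′ b b′ with toℕ k N.<? h₀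
  ... | yes _ = refl
  ... | no _  = refl
  choose-* : ∀ k c a b -> choose k (c * a) (c * b) ≡ c * choose k a b
  choose-* k c a b with toℕ k N.<? h₀
  ... | yes _ = refl
  ... | no _  = refl
  twist-linear : Linear twist
  twist-linear = record
   { cong-≈ = \ {u} {v} e -> split-≈ {twist u} {twist v}
     (\ k -> cong (_% p) (lo-join _ _ k) » choose-cong k (e (g ↑ʳ k)) (e (k ↑ˡ g)) » cong (_% p) (sym (lo-join _ _ k)))
     (\ k -> cong (_% p) (hi-join _ _ k) » +-cong-≋ {choose k (n * lo u k) (hi u k)} {choose k (n * lo v k) (hi v k)} {apply S (hi u) k} {apply S (hi v) k} (choose-cong k {n * lo u k} {n * lo v k} (*-congₖ {n} {n} {lo u k} {lo v k} refl (e (k ↑ˡ g))) (e (g ↑ʳ k)))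
      (sumF-≋ (\ j -> *-congₖ {S k j} {S k j} {hi u j} {hi v j} refl (e (g ↑ʳ j)))) » cong (_% p) (sym (hi-join _ _ k)))
   ; add = \ u v -> split-≡ {twist (u ⊞ v)} {twist u ⊞ twist v}
     (\ k -> lo-join _ _ k » choose-+ k (hi u k) (hi v k) (lo u k) (lo v k) » sym (cong₂ _+_ (lo-join _ _ k) (lo-join _ _ k)))
     (\ k -> hi-join _ _ k » cong₂ _+_ (cong (\ z -> choose k z (hi u k + hi v k)) (*-distribˡ-+ n (lo u k) (lo v k)) » choose-+ k (n * lo u k) (n * lo v k) (hi u k) (hi v k))
       (sum-ext (\ j -> *-distribˡ-+ (S k j) (hi u j) (hi v j)) » sumF-+ (\ j -> S k j * hi u j) (\ j -> S k j * hi v j)) » lem (choose k (n * lo u k) (hi u k)) (choose k (n * lo v k) (hi v k)) (apply S (hi u) k) (apply S (hi v) k) » sym (cong₂ _+_ (hi-join _ _ k) (hi-join _ _ k)))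
   ; scale = \ c v -> split-≡ {twist (c ⊡ v)} {c ⊡ twist v}
     (\ k -> lo-join _ _ k » choose-* k c (hi v k) (lo v k) » sym (cong (c *_) (lo-join _ _ k)))
     (\ k -> hi-join _ _ k » cong₂ _+_ (cong (\ z -> choose k z (c * hi v k)) (swap n c (lo v k)) » choose-* k c (n * lo v k) (hi v k)) (sum-ext (\ j -> swap (S k j) c (hi v j)) » sumF-*ˡ c (\ j -> S k j * hi v j)) » sym (*-distribˡ-+ c (choose k (n * lo v k) (hi v k)) (apply S (hi v) k)) » sym (cong (c *_) (hi-join _ _ k)))
   }
   where
   lem : ∀ a b c d -> a + b + (c + d) ≡ a + c + (b + d)
   lem = solve-∀
   swap : ∀ a b c -> a * (b * c) ≡ b * (a * c)
   swap = solve-∀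
  n+1≋0 : n + 1 ≋ 0
  n+1≋0 = ∣⇒≋0 (subst (p ∣_) (sym (m+[n∸m]≡n (prime≥1 pp)) » +-comm 1 n) ∣-refl)
  -- The defect hx·sy - sx·hy at a single coordinate vanishes after summation over all coordinates,
  -- because S is symmetric.
  twist-local : ∀ {P : Set} (D : Dec P) lx hx ly hy sx sy -> (¬ P -> sx ≡ 0) -> (¬ P -> sy ≡ 0) ->
   pick D hx lx * (pick D (n * ly) hy + sy) + n * ((pick D (n * lx) hx + sx) * pick D hy ly) ≋ (lx * hy + n * (hx * ly)) + (hx * sy + n * (sx * hy))
  twist-local (yes _) lx hx ly hy sx sy _ _ = +-cancelʳ-≋ ((n + 1) * (lx * hy)) (cong (_% p) (lem n lx hx ly hy sx sy) » +-cong-≋ {r} {r} {n * (lx * hy) * (n + 1)} {(n + 1) * (lx * hy)} refl (zero-left (n * (lx * hy)) » sym (cong (_% p) (*-comm (n + 1) (lx * hy)) » zero-left (lx * hy))))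
   where
   r = (lx * hy + n * (hx * ly)) + (hx * sy + n * (sx * hy))
   zero-left : ∀ c -> c * (n + 1) ≋ 0
   zero-left c = *-congₖ {c} {c} {n + 1} {0} refl n+1≋0 » cong (_% p) (*-zeroʳ c)
   lem : ∀ n lx hx ly hy sx sy -> hx * (n * ly + sy) + n * ((n * lx + sx) * hy) + (n + 1) * (lx * hy)
    ≡ (lx * hy + n * (hx * ly)) + (hx * sy + n * (sx * hy)) + n * (lx * hy) * (n + 1)
   lem = solve-∀
  twist-local (no h) lx hx ly hy sx sy z z′ rewrite z h | z′ h = cong (_% p) (lem n lx hx ly hy)
   where
   lem : ∀ n lx hx ly hy -> lx * (hy + 0) + n * ((hx + 0) * ly) ≡ lx * hy + n * (hx * ly) + (hx * 0 + n * (0 * hy))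
   lem = solve-∀
  twist-ω : Preserves twist
  twist-ω x y = cong (_% p) (ω-split (twist x) (twist y) » cong₂ _+_ (sum-ext (\ k -> cong₂ _*_ (lo-join _ _ k) (hi-join _ _ k))) (cong (n *_) (sum-ext (\ k -> cong₂ _*_ (hi-join _ _ k) (lo-join _ _ k)))) » cong (sumF a +_) (sym (sumF-*ˡ n b)) » sym (sumF-+ a (\ k -> n * b k))) » sumF-≋ local » cong (_% p) (sumF-+ (\ k -> lo x k * hi y k + n * (hi x k * lo y k)) (\ k -> Q k + n * Q′ k) » cong₂ _+_ (sumF-+ (\ k -> lo x k * hi y k) (\ k -> n * (hi x k * lo y k)) » cong (sumF (\ k -> lo x k * hi y k) +_) (sumF-*ˡ n (\ k -> hi x k * lo y k)))
       (sumF-+ Q (\ k -> n * Q′ k) » cong (sumF Q +_) (sumF-*ˡ n Q′ » cong (n *_) (sym symmetric)))) » +-cong-≋ {W} {W} {sumF Q + n * sumF Q} {0} refl (cong (_% p) (+-comm (sumF Q) (n * sumF Q)) » neg1-≋ (sumF Q)) » cong (_% p) (+-identityʳ W » sym (ω-split x y))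
   where
   W = sumF (\ k -> lo x k * hi y k) + n * sumF (\ k -> hi x k * lo y k)
   a b Q Q′ : Fin g -> ℕ
   a k = choose k (hi x k) (lo x k) * (choose k (n * lo y k) (hi y k) + apply S (hi y) k)
   b k = (choose k (n * lo x k) (hi x k) + apply S (hi x) k) * choose k (hi y k) (lo y k)
   Q k = hi x k * apply S (hi y) k
   Q′ k = apply S (hi x) k * hi y k
   symmetric : sumF Q ≡ sumF Q′
   symmetric = sym (adjoint S (hi x) (hi y) » sum-ext (\ k -> cong (hi x k *_) (sum-ext (\ j -> cong (_* hi y j) (σ-sym (toℕ j) (toℕ k))))))
   S-out : ∀ {k} v -> ¬ (toℕ k < h₀) -> apply S v k ≡ 0
   S-out {k} v h = sum-ext (\ j -> cong (_* v j) (σ-outˡ {toℕ k} {toℕ j} h)) » sumF-0 g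
   local : ∀ k -> a k + n * b k ≋ (lo x k * hi y k + n * (hi x k * lo y k)) + (Q k + n * Q′ k)
   local k = twist-local (toℕ k N.<? h₀) (lo x k) (hi x k) (lo y k) (hi y k) (apply S (hi x) k) (apply S (hi y) k) (S-out (hi x)) (S-out (hi y))
  -- On the rotating blocks this is an (m+1)-st root of the wave step: a vector meets the twist once
  -- per lap. It raises the order by the factor m + 1 while remaining symplectic.
  f : V -> V
  f x = twist (shift x)
  f-linear : Linear f
  f-linear = record
   { cong-≈ = \ e -> Linear.cong-≈ twist-linear (Linear.cong-≈ shift-linear e)
   ; add = \ u v -> Linear.cong-≈ twist-linear (Linear.add shift-linear u v) ⟫ Linear.add twist-linear (shift u) (shift v)
   ; scale = \ c v -> Linear.cong-≈ twist-linear (Linear.scale shift-linear c v) ⟫ Linear.scale twist-linear c (shift v)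
   }
  f-ω : Preserves f
  f-ω x y = twist-ω (shift x) (shift y) » shift-ω x y

-- Matrices of linear maps; the wave map on coordinate vectors

module WaveMatrix where
 open Nat
 open Sums using (is-yes; is-no)
 open Arithmetic using (prime≥2; prime≥1; *-≥1; prime-∣-^; ^-≥1)
 open OrbitCounting
 open PrimitiveRoots using (m<n*m)
 open LinearAlgebra
 open CyclicSubspaces
 open SymplecticForm
 open MatrixOrder
 open BlockShift
 module Realize (p : ℕ) (pp : Prime p) (g : ℕ) (f : VectorSpace.V p pp (g + g) -> VectorSpace.V p pp (g + g)) (Lf : VectorSpace.Linear p pp (g + g) f) where
  open Symplectic p pp g
  open Linear Lf
  open Iterate f
  linear-sum : ∀ {m} (c : Fin m -> V) -> f (\ i -> sumF (\ j -> c j i)) ≈ \ i -> sumF (\ j -> f (c j) i)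
  linear-sum {zero}  c = Lin-zero Lf
  linear-sum {suc m} c = add (c Fin.zero) (\ i -> sumF (\ j -> c (Fin.suc j) i)) ⟫ ⊞-cong {f (c Fin.zero)} {f (c Fin.zero)} ≈-refl (linear-sum (c ∘ Fin.suc))
  matrix : Mat (g + g)
  matrix i j = f (basis j) i
  apply-matrix : ∀ x -> apply matrix x ≈ f x
  apply-matrix x = ≈-sym (cong-≈ (≗⇒≈ (\ i -> sym (sumF-idM i x) » sum-ext (\ j -> *-comm (idM i j) (x j)))) ⟫ linear-sum (\ j -> x j ⊡ basis j) ⟫ (\ i -> sumF-≋ (\ j -> scale (x j) (basis j) i » cong (_% p) (*-comm (x j) (f (basis j) i)))))
  apply-matPow : ∀ k x -> apply (matPow matrix k) x ≈ iter k x
  apply-matPow k x = apply-pow matrix k x ⟫ go k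
   where
   go : ∀ k -> Iterate.iter (apply matrix) k x ≈ iter k x
   go zero    = ≈-refl
   go (suc k) = apply-matrix _ ⟫ cong-≈ (go k)
  -- A smaller exponent k giving the identity would fix x, and so would gcd(k, ℓ^(b+1)), which
  -- divides ℓ^b; but the ℓ^b-th power moves x.
  prime-power-order : ∀ ℓ b -> Prime ℓ -> ¬ (p ∣ ℓ) -> Preserves f -> (∀ j -> iter (ℓ ^ suc b) (basis j) ≈ basis j) ->
   ∀ x -> ¬ (iter (ℓ ^ b) x ≈ x) -> SpHasOrder p g {{prime⇒nonZero pp}} (ℓ ^ suc b)
  prime-power-order ℓ b pℓ p∤ℓ ωf period x moved = matrix , invariant⇒InSp {matrix} (\ u v -> ω-cong {apply matrix u} {f u} (apply-matrix u) (apply-matrix v) » ωf u v) , ^-≥1 (suc b) (prime≥1 pℓ) , is-one , minimal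
   where
   open CyclicSpace p pp (g + g) f Lf ℓ b pℓ p∤ℓ using (fixed-gcd; fixed-multiple)
   is-one : ∀ i j -> matPow matrix (ℓ ^ suc b) i j % p ≡ idM i j % p
   is-one i j = cong (_% p) (sym (apply-basis (matPow matrix (ℓ ^ suc b)) j i)) » apply-matPow (ℓ ^ suc b) (basis j) i » period j i
   one⇒fixed : ∀ k -> (∀ i j -> matPow matrix k i j % p ≡ idM i j % p) -> iter k x ≈ x
   one⇒fixed k e = ≈-sym (apply-matPow k x) ⟫ apply-cong {matPow matrix k} {idM} {x} {x} e ≈-refl ⟫ (≗⇒≈ (\ i -> sumF-idM i x))
   minimal : ∀ k -> 1 ≤ k -> k < ℓ ^ suc b -> ¬ (∀ i j -> matPow matrix k i j % p ≡ idM i j % p)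
   minimal k 1≤k k<r e = moved (fixed-divides (proper-divisor-^ b pℓ (gcd[m,n]∣n k (ℓ ^ suc b)) (\ g≡r -> <⇒≱ k<r (subst (_≤ k) g≡r (∣⇒≤ {{N.>-nonZero 1≤k}} (gcd[m,n]∣m k (ℓ ^ suc b))))))
     (fixed-gcd {k} {ℓ ^ suc b} (one⇒fixed k e) (one⇒fixed (ℓ ^ suc b) is-one)))
    where
    fixed-divides : ∀ {m n u} -> m ∣ n -> iter m u ≈ u -> iter n u ≈ u
    fixed-divides (divides y refl) e = fixed-multiple e y
 module Waves (p : ℕ) (pp : Prime p) (g h₀ m loop : ℕ) (1≤h₀ : 1 ≤ h₀) (h≤g : h₀ + m * h₀ ≤ g) where
  d : ℕ
  d = m * h₀
  open Symplectic p pp g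
  open Construct p pp g h₀ d loop h≤g
  open Iterate f
  open Operator f f-linear using (Tⁿ-cong; Tⁿ-linear)
  δ : ℕ -> Fin g -> ℕ
  δ a k = eq (suc (toℕ k)) a
  δ-ne : ∀ {a k} -> suc (toℕ k) ≢ a -> δ a k ≡ 0
  δ-ne {a} {k} ne = pick-no (suc (toℕ k) N.≟ a) ne
  -- Unit vectors of the two Lagrangian halves, numbered from 1. Then E 0 and F 0 are 0, which
  -- encodes the boundary condition at the left end of the path.
  E F : ℕ -> V
  E a = join (\ _ -> 0) (δ a)
  F a = join (δ a) (\ _ -> 0)
  δ-ρ : ∀ a k -> δ (suc a) (ρ k) ≡ δ (suc (rot d h₀ a)) k
  δ-ρ a k = pick-⇔ (suc (toℕ (ρ k)) N.≟ suc a) (suc (toℕ k) N.≟ suc (rot d h₀ a))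
   (\ e -> cong suc (sym (rot-inverse h₀ d (toℕ k)) » cong (rot d h₀) (sym (toℕ-ρ k) » suc-injective e)))
   (\ e -> cong suc (toℕ-ρ k » cong (rot h₀ d) (suc-injective e) » rot-inverse d h₀ a))
  shift-E : ∀ a -> shift (E (suc a)) ≈ E (suc (rot d h₀ a))
  shift-E a = split-≡ {shift (E (suc a))} {E (suc (rot d h₀ a))} (\ k -> lo-join _ _ k » lo-join _ _ (ρ k) » sym (lo-join _ _ k)) (\ k -> hi-join _ _ k » hi-join _ _ (ρ k) » δ-ρ a k » sym (hi-join _ _ k))
  shift-F : ∀ a -> shift (F (suc a)) ≈ F (suc (rot d h₀ a))
  shift-F a = split-≡ {shift (F (suc a))} {F (suc (rot d h₀ a))} (\ k -> lo-join _ _ k » lo-join _ _ (ρ k) » δ-ρ a k » sym (lo-join _ _ k)) (\ k -> hi-join _ _ k » hi-join _ _ (ρ k) » sym (hi-join _ _ k))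
  sumF-zero : ∀ {m} {c : Fin m -> ℕ} -> (∀ j -> c j ≡ 0) -> sumF c ≡ 0
  sumF-zero {m} e = sum-ext e » sumF-0 m
  S-F : ∀ a k -> apply S (hi (F a)) k ≡ 0
  S-F a k = sumF-zero (\ j -> cong (S k j *_) (hi-join (δ a) (\ _ -> 0) j) » *-zeroʳ (S k j))
  S-E-out : ∀ b k -> h₀ ≤ b -> apply S (hi (E (suc b))) k ≡ 0
  S-E-out b k h = sumF-zero (\ j -> cong (S k j *_) (hi-join (\ _ -> 0) (δ (suc b)) j) » term j)
   where
   term : ∀ j -> S k j * δ (suc b) j ≡ 0
   term j = case toℕ j N.≟ b of \ where
    (yes e) -> cong (_* δ (suc b) j) (σ-outʳ {toℕ k} {toℕ j} (\ l -> <⇒≱ l (subst (h₀ ≤_) (sym e) h)))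
    (no ne) -> cong (S k j *_) (δ-ne (\ e -> ne (suc-injective e))) » *-zeroʳ (S k j)
  S-E-in : ∀ b k -> b < h₀ -> apply S (hi (E (suc b))) k ≡ σ (toℕ k) b
  S-E-in b k h = sum-ext (\ j -> cong (S k j *_) (hi-join (\ _ -> 0) (δ (suc b)) j » eq-suc (toℕ j) b » cong (eq (toℕ j)) (sym (FinP.toℕ-fromℕ< b<g)) » sym (idM-eq j (fromℕ< b<g)))) » apply-basis S (fromℕ< b<g) k » cong (σ (toℕ k)) (FinP.toℕ-fromℕ< b<g)
   where
   b<g : b < g
   b<g = <-≤-trans h (m≤m+n h₀ d ⋙ h≤g)
  choose-≡ : ∀ (k : Fin g) {a b c} -> (toℕ k < h₀ -> a ≡ c) -> (¬ (toℕ k < h₀) -> b ≡ c) -> choose k a b ≡ c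
  choose-≡ k e f with toℕ k N.<? h₀
  ... | yes h = e h
  ... | no ¬h = f ¬h
  far : ∀ {b k} -> h₀ ≤ b -> toℕ k < h₀ -> δ (suc b) k ≡ 0
  far h l = δ-ne (\ e -> <⇒≱ l (subst (h₀ ≤_) (sym (suc-injective e)) h))
  near : ∀ {b k} -> b < h₀ -> ¬ (toℕ k < h₀) -> δ (suc b) k ≡ 0
  near h l = δ-ne (\ e -> l (subst (_< h₀) (sym (suc-injective e)) h))
  lo-twist : ∀ x k -> lo (twist x) k ≡ choose k (hi x k) (lo x k)
  lo-twist x k = lo-join (\ k -> choose k (hi x k) (lo x k)) (\ k -> choose k (n * lo x k) (hi x k) + apply S (hi x) k) k
  hi-twist : ∀ x k -> hi (twist x) k ≡ choose k (n * lo x k) (hi x k) + apply S (hi x) k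
  hi-twist x k = hi-join (\ k -> choose k (hi x k) (lo x k)) (\ k -> choose k (n * lo x k) (hi x k) + apply S (hi x) k) k
  lo-E : ∀ a k -> lo (E a) k ≡ 0
  lo-E a k = lo-join (\ _ -> 0) (δ a) k
  hi-E : ∀ a k -> hi (E a) k ≡ δ a k
  hi-E a k = hi-join (\ _ -> 0) (δ a) k
  lo-F : ∀ a k -> lo (F a) k ≡ δ a k
  lo-F a k = lo-join (δ a) (\ _ -> 0) k
  hi-F : ∀ a k -> hi (F a) k ≡ 0
  hi-F a k = hi-join (δ a) (\ _ -> 0) k
  n*0 : ∀ {x} -> x ≡ 0 -> n * x ≡ 0
  n*0 e = cong (n *_) e » *-zeroʳ n
  twist-E-out : ∀ b -> h₀ ≤ b -> twist (E (suc b)) ≈ E (suc b)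
  twist-E-out b h = split-≡ {twist (E (suc b))} {E (suc b)}
   (\ k -> lo-twist (E (suc b)) k » choose-≡ k (\ l -> hi-E (suc b) k » far h l) (\ _ -> lo-E (suc b) k) » sym (lo-E (suc b) k))
   (\ k -> hi-twist (E (suc b)) k » cong₂ _+_ (choose-≡ k {c = δ (suc b) k} (\ l -> n*0 (lo-E (suc b) k) » sym (far h l)) (\ _ -> hi-E (suc b) k)) (S-E-out b k h) » +-identityʳ _ » sym (hi-E (suc b) k))
  twist-F-out : ∀ b -> h₀ ≤ b -> twist (F (suc b)) ≈ F (suc b)
  twist-F-out b h = split-≡ {twist (F (suc b))} {F (suc b)}
   (\ k -> lo-twist (F (suc b)) k » choose-≡ k {c = δ (suc b) k} (\ l -> hi-F (suc b) k » sym (far h l)) (\ _ -> lo-F (suc b) k) » sym (lo-F (suc b) k))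
   (\ k -> hi-twist (F (suc b)) k » cong₂ _+_ (choose-≡ k {c = 0} (\ l -> n*0 (lo-F (suc b) k » far h l)) (\ _ -> hi-F (suc b) k)) (S-F (suc b) k) » sym (hi-F (suc b) k))
  twist-F-in : ∀ b -> b < h₀ -> twist (F (suc b)) ≈ n ⊡ E (suc b)
  twist-F-in b h = split-≡ {twist (F (suc b))} {n ⊡ E (suc b)}
   (\ k -> lo-twist (F (suc b)) k » choose-≡ k {c = 0} (\ _ -> hi-F (suc b) k) (\ l -> lo-F (suc b) k » near h l) » sym (n*0 (lo-E (suc b) k)))
   (\ k -> hi-twist (F (suc b)) k » cong₂ _+_ (choose-≡ k {c = n * δ (suc b) k} (\ _ -> cong (n *_) (lo-F (suc b) k)) (\ l -> hi-F (suc b) k » sym (n*0 (near h l)))) (S-F (suc b) k) » +-identityʳ _ » cong (n *_) (sym (hi-E (suc b) k)))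
  twist-E-in : ∀ b -> b < h₀ -> ∀ {y} -> (∀ k -> lo y k ≡ 0) -> (∀ k -> hi y k ≡ σ (toℕ k) b) -> twist (E (suc b)) ≈ F (suc b) ⊞ y
  twist-E-in b h {y} ly hy = split-≡ {twist (E (suc b))} {F (suc b) ⊞ y}
   (\ k -> lo-twist (E (suc b)) k » choose-≡ k {c = δ (suc b) k} (\ _ -> hi-E (suc b) k) (\ l -> lo-E (suc b) k » sym (near h l)) » sym (cong₂ _+_ (lo-F (suc b) k) (ly k) » +-identityʳ _))
   (\ k -> hi-twist (E (suc b)) k » cong₂ _+_ (choose-≡ k {c = 0} (\ _ -> n*0 (lo-E (suc b) k)) (\ l -> hi-E (suc b) k » near h l)) (S-E-in b k h) » sym (cong₂ _+_ (hi-F (suc b) k) (hy k)))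
  twist-E-interior : ∀ b -> suc b < h₀ -> twist (E (suc b)) ≈ F (suc b) ⊞ (E b ⊞ E (2 + b))
  twist-E-interior b h = twist-E-in b (<⇒≤ h) {E b ⊞ E (2 + b)} (\ k -> cong₂ _+_ (lo-E b k) (lo-E (2 + b) k)) (\ k -> cong₂ _+_ (hi-E b k) (hi-E (2 + b) k) » value k)
   where
   value : ∀ k -> δ b k + δ (2 + b) k ≡ σ (toℕ k) b
   value k = case toℕ k N.<? h₀ of \ where
     (yes l) -> sym (σ-in l (<⇒≤ h) » cong₂ _+_ (cong (eq (suc (toℕ k)) b +_) (eq-sym (suc b) (toℕ k) » sym (eq-suc (toℕ k) (suc b)))) (cong (loop *_) diag » *-zeroʳ loop) » +-identityʳ _)
     (no ¬l) -> cong₂ _+_ (δ-ne (\ e -> ¬l (≤-reflexive e ⋙ (<⇒≤ (<⇒≤ h))))) (near h ¬l) » sym (σ-outˡ ¬l)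
    where
    diag : eq (toℕ k) b * eq (suc (toℕ k)) h₀ ≡ 0
    diag = case toℕ k N.≟ b of \ where
     (yes e) -> cong (eq (toℕ k) b *_) (pick-no (suc (toℕ k) N.≟ h₀) (\ e′ -> <⇒≢ h (cong suc (sym e) » e′))) » *-zeroʳ (eq (toℕ k) b)
     (no ne) -> cong (_* eq (suc (toℕ k)) h₀) (pick-no (toℕ k N.≟ b) ne)
  twist-E-end : ∀ b -> suc b ≡ h₀ -> twist (E (suc b)) ≈ F (suc b) ⊞ (E b ⊞ loop ⊡ E (suc b))
  twist-E-end b h = twist-E-in b b<h₀ {E b ⊞ loop ⊡ E (suc b)} (\ k -> cong₂ _+_ (lo-E b k) (cong (loop *_) (lo-E (suc b) k) » *-zeroʳ loop)) (\ k -> cong₂ _+_ (hi-E b k) (cong (loop *_) (hi-E (suc b) k)) » value k)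
   where
   b<h₀ : b < h₀
   b<h₀ = ≤-reflexive h
   value : ∀ k -> δ b k + loop * δ (suc b) k ≡ σ (toℕ k) b
   value k = case toℕ k N.<? h₀ of \ where
     (yes l) -> sym (σ-in l b<h₀ » cong₂ _+_ (cong (eq (suc (toℕ k)) b +_) (pick-no (suc b N.≟ toℕ k) (\ e -> <⇒≢ l (sym e » h))) » +-identityʳ _) (cong (loop *_) diag))
     (no ¬l) -> cong₂ _+_ (δ-ne (\ e -> ¬l (≤-reflexive e ⋙ (<⇒≤ b<h₀)))) (cong (loop *_) (near b<h₀ ¬l) » *-zeroʳ loop) » sym (σ-outˡ ¬l)
    where
    diag : eq (toℕ k) b * eq (suc (toℕ k)) h₀ ≡ δ (suc b) k
    diag = case toℕ k N.≟ b of \ where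
     (yes e) -> cong (eq (toℕ k) b *_) (pick-yes (suc (toℕ k) N.≟ h₀) (cong suc e » h)) » *-identityʳ _ » sym (eq-suc (toℕ k) b)
     (no ne) -> cong (_* eq (suc (toℕ k)) h₀) (pick-no (toℕ k N.≟ b) ne) » sym (eq-suc (toℕ k) b » pick-no (toℕ k N.≟ b) ne)

-- Periods of the wave map; elements of 2-power order

module WavePeriod where
 open Nat
 open Sums using (is-yes; is-no)
 open Arithmetic using (prime≥2; prime≥1; *-≥1; prime-∣-^; ^-≥1)
 open OrbitCounting
 open PrimitiveRoots using (m<n*m)
 open LinearAlgebra
 open CyclicSubspaces
 open SymplecticForm
 open MatrixOrder
 open BlockShift
 open WaveMatrix
 module Period (p : ℕ) (pp : Prime p) (g h₀ m loop : ℕ) (1≤h₀ : 1 ≤ h₀) (h≤g : h₀ + m * h₀ ≤ g) where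
  open Symplectic p pp g public
  open Construct p pp g h₀ (m * h₀) loop h≤g public
  open Waves p pp g h₀ m loop 1≤h₀ h≤g public
  open Operator f f-linear public
  Tⁿ-swap : ∀ j k x -> Tⁿ j (Tⁿ k x) ≈ Tⁿ k (Tⁿ j x)
  Tⁿ-swap j k x i = cong (\ v -> v i % p) (sym (Tⁿ-+ j k x) » cong (\ z -> Tⁿ z x) (+-comm j k) » Tⁿ-+ k j x)
  module Track (G : ℕ -> V) (shift-G : ∀ a -> shift (G (suc a)) ≈ G (suc (rot d h₀ a))) (twist-G : ∀ b -> h₀ ≤ b -> twist (G (suc b)) ≈ G (suc b)) where
   step : ∀ a {b} -> rot d h₀ a ≡ b -> f (G (suc a)) ≈ twist (G (suc b))
   step a refl = Linear.cong-≈ twist-linear (shift-G a)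
   step-lo : ∀ a -> a < d -> f (G (suc a)) ≈ G (suc (h₀ + a))
   step-lo a h = step a (rot-lo d h₀ h) ⟫ twist-G (h₀ + a) (m≤m+n h₀ a)
   step-hi : ∀ a -> d + h₀ ≤ a -> f (G (suc a)) ≈ G (suc a)
   step-hi a h = step a (rot-hi d h₀ h) ⟫ twist-G a (m≤n+m h₀ d ⋙ h)
   travel : ∀ j i -> j ≤ m -> i < h₀ -> Tⁿ j (G (suc i)) ≈ G (suc (j * h₀ + i))
   travel zero    i _ _ = ≈-refl
   travel (suc j) i j<m i<h = Linear.cong-≈ f-linear (travel j i (<⇒≤ j<m) i<h) ⟫ step-lo (j * h₀ + i) (<-≤-trans (+-monoʳ-< (j * h₀) i<h) (≤-reflexive (+-comm (j * h₀) h₀) ⋙ *-monoˡ-≤ h₀ j<m)) ⟫ (\ k -> cong (\ z -> G (suc z) k % p) (sym (+-assoc h₀ (j * h₀) i)))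
   lap : ∀ i -> i < h₀ -> Tⁿ (suc m) (G (suc i)) ≈ twist (G (suc i))
   lap i h = Linear.cong-≈ f-linear (travel m i ≤-refl h) ⟫ step (d + i) (rot-mid d h₀ h)
   -- A coordinate vector of any rotating block is the image of one in the starting block under a
   -- power of the map, and powers commute. Coordinates outside the blocks are fixed.
   spread : ∀ r -> (∀ i -> i < h₀ -> Tⁿ r (G (suc i)) ≈ G (suc i)) -> ∀ a -> Tⁿ r (G (suc a)) ≈ G (suc a)
   spread r base a = case a N.<? d + h₀ of \ where
     (no ¬h) -> constant r (≮⇒≥ ¬h)
     (yes h) -> Tⁿ-cong r (≈-sym (landing h)) ⟫ Tⁿ-swap r (a / h₀) (G (suc (a % h₀))) ⟫ Tⁿ-cong (a / h₀) (base (a % h₀) (m%n<n a h₀)) ⟫ landing h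
    where
    instance
     nz : NonZero h₀
     nz = N.>-nonZero 1≤h₀
    constant : ∀ r -> d + h₀ ≤ a -> Tⁿ r (G (suc a)) ≈ G (suc a)
    constant zero    _ = ≈-refl
    constant (suc r) h = Linear.cong-≈ f-linear (constant r h) ⟫ step-hi a h
    landing : a < d + h₀ -> Tⁿ (a / h₀) (G (suc (a % h₀))) ≈ G (suc a)
    landing h = travel (a / h₀) (a % h₀) (≤-pred (m<n*o⇒m/o<n (subst (a <_) (+-comm d h₀) h))) (m%n<n a h₀) ⟫ (\ k -> cong (\ z -> G (suc z) k % p) (sym (m≡m%n+[m/n]*n a h₀ » +-comm (a % h₀) (a / h₀ * h₀))))
  module TE = Track E shift-E twist-E-out
  module TF = Track F shift-F twist-F-out
  N : V -> V
  N = Tⁿ (suc m)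
  N-linear : Linear N
  N-linear = Tⁿ-linear (suc m)
  open Operator N N-linear public using () renaming (Tⁿ to Nⁿ; Tⁿ-cong to Nⁿ-cong; Tⁿ-add to Nⁿ-add; Tⁿ-scale to Nⁿ-scale; Tⁿ-+ to Nⁿ-+; Tⁿ-linear to Nⁿ-linear)
  Nⁿ≡ : ∀ k x -> Nⁿ k x ≡ Tⁿ (k * suc m) x
  Nⁿ≡ k x = iter-* f (suc m) k x
  basis-E : ∀ k -> basis (g ↑ʳ k) ≈ E (suc (toℕ k))
  basis-E k = split-≡ {basis (g ↑ʳ k)} {E (suc (toℕ k))}
   (\ j -> idM-eq (j ↑ˡ g) (g ↑ʳ k) » pick-no (toℕ (j ↑ˡ g) N.≟ toℕ (g ↑ʳ k)) (\ e -> <⇒≱ (FinP.toℕ<n j) (subst (g ≤_) (sym (sym (FinP.toℕ-↑ˡ j g) » e » FinP.toℕ-↑ʳ g k)) (m≤m+n g (toℕ k)))) » sym (lo-E (suc (toℕ k)) j))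
   (\ j -> idM-eq (g ↑ʳ j) (g ↑ʳ k) » cong₂ eq (FinP.toℕ-↑ʳ g j) (FinP.toℕ-↑ʳ g k) » pick-⇔ (g + toℕ j N.≟ g + toℕ k) (suc (toℕ j) N.≟ suc (toℕ k)) (\ e -> cong suc (+-cancelˡ-≡ g _ _ e)) (\ e -> cong (g +_) (suc-injective e)) » sym (hi-E (suc (toℕ k)) j))
  basis-F : ∀ k -> basis (k ↑ˡ g) ≈ F (suc (toℕ k))
  basis-F k = split-≡ {basis (k ↑ˡ g)} {F (suc (toℕ k))}
   (\ j -> idM-eq (j ↑ˡ g) (k ↑ˡ g) » cong₂ eq (FinP.toℕ-↑ˡ j g) (FinP.toℕ-↑ˡ k g) » sym (eq-suc (toℕ j) (toℕ k)) » sym (lo-F (suc (toℕ k)) j))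
   (\ j -> idM-eq (g ↑ʳ j) (k ↑ˡ g) » pick-no (toℕ (g ↑ʳ j) N.≟ toℕ (k ↑ˡ g)) (\ e -> <⇒≱ (FinP.toℕ<n k) (subst (g ≤_) (sym (sym (FinP.toℕ-↑ˡ k g) » sym e » FinP.toℕ-↑ʳ g j)) (m≤m+n g (toℕ j)))) » sym (hi-F (suc (toℕ k)) j))
  basis-period : ∀ r -> (∀ i -> i < h₀ -> Tⁿ r (E (suc i)) ≈ E (suc i)) -> (∀ i -> i < h₀ -> Tⁿ r (F (suc i)) ≈ F (suc i)) -> ∀ j -> Tⁿ r (basis j) ≈ basis j
  basis-period r e f j with Fin.splitAt g j in eq′
  ... | inj₁ k = subst (\ z -> Tⁿ r (basis z) ≈ basis z) (FinP.splitAt⁻¹-↑ˡ eq′) (Tⁿ-cong r (basis-F k) ⟫ TF.spread r f (toℕ k) ⟫ ≈-sym (basis-F k))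
  ... | inj₂ k = subst (\ z -> Tⁿ r (basis z) ≈ basis z) (FinP.splitAt⁻¹-↑ʳ eq′) (Tⁿ-cong r (basis-E k) ⟫ TE.spread r e (toℕ k) ⟫ ≈-sym (basis-E k))
  E-0 : E 0 ≈ 0v
  E-0 = split-≡ {E 0} {0v} (\ k -> lo-E 0 k) (\ k -> hi-E 0 k)
  F-0 : F 0 ≈ 0v
  F-0 = split-≡ {F 0} {0v} (\ k -> lo-F 0 k) (\ k -> hi-F 0 k)
  N-F : ∀ a -> a ≤ h₀ -> N (F a) ≈ n ⊡ E a
  N-F zero    _ = Linear.cong-≈ N-linear F-0 ⟫ Lin-zero N-linear ⟫ ≈-sym (⊡-cong {n} {n} refl E-0 ⟫ (≗⇒≈ (\ i -> *-zeroʳ n)))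
  N-F (suc b) h = TF.lap b h ⟫ twist-F-in b h
  N-E : ∀ b -> suc b < h₀ -> N (E (suc b)) ≈ F (suc b) ⊞ (E b ⊞ E (2 + b))
  N-E b h = TE.lap b (<⇒≤ h) ⟫ twist-E-interior b h
  N-E-end : ∀ b -> suc b ≡ h₀ -> N (E (suc b)) ≈ F (suc b) ⊞ (E b ⊞ loop ⊡ E (suc b))
  N-E-end b h = TE.lap b (≤-reflexive h) ⟫ twist-E-end b h
  first : 1 ≤ g -> Fin g
  first h = fromℕ< h
  F₁-lo : ∀ (h : 1 ≤ g) -> lo (F 1) (first h) ≡ 1
  F₁-lo h = lo-F 1 (first h) » pick-yes (suc (toℕ (first h)) N.≟ 1) (cong suc (FinP.toℕ-fromℕ< h))
 -- With one point and no loop a lap is (u, v) ↦ (v, -u), of order 4; 2^b blocks multiply this by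
 -- 2^b.
 order-2^ : ∀ p (pp : Prime p) g b -> ¬ (p ∣ 2) -> 2 ^ b ≤ g -> SpHasOrder p g {{prime⇒nonZero pp}} (2 ^ (2 + b))
 order-2^ p pp g b p∤2 le = Realize.prime-power-order p pp g f f-linear 2 (suc b) prime[2] p∤2 f-ω
   (basis-period (2 ^ (2 + b)) (\ { 0 _ -> E-period ; (suc i) (s≤s ()) }) (\ { 0 _ -> F-period ; (suc i) (s≤s ()) })) (F 1) moved
  where
  m : ℕ
  m = 2 ^ b ∸ 1
  m≡ : suc m ≡ 2 ^ b
  m≡ = m+[n∸m]≡n (^-≥1 b z<s)
  open Period p pp g 1 m 0 ≤-refl (≤-reflexive (cong (1 +_) (*-identityʳ m) » m≡) ⋙ le)
  NF : N (F 1) ≈ n ⊡ E 1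
  NF = N-F 1 ≤-refl
  NE : N (E 1) ≈ F 1
  NE = N-E-end 0 refl ⟫ ⊞-cong {F 1} {F 1} ≈-refl (⊞-cong {E 0} {0v} {0 ⊡ E 1} {0v} E-0 ≈-refl) ⟫ (≗⇒≈ (\ i -> +-identityʳ (F 1 i)))
  nn : ∀ x -> n ⊡ (n ⊡ x) ≈ x
  nn x i = +-cancelʳ-≋ {n * (n * x i)} {x i} (n * x i) (neg1-≋ (n * x i) » sym (cong (_% p) (+-comm (x i) (n * x i)) » neg1-≋ (x i)))
  N²F : Nⁿ 2 (F 1) ≈ n ⊡ F 1
  N²F = Nⁿ-cong 1 NF ⟫ Nⁿ-scale 1 n (E 1) ⟫ ⊡-cong {n} {n} refl NE
  N²E : Nⁿ 2 (E 1) ≈ n ⊡ E 1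
  N²E = Nⁿ-cong 1 NE ⟫ NF
  fourth : ∀ {x} -> Nⁿ 2 x ≈ n ⊡ x -> Nⁿ 4 x ≈ x
  fourth {x} e = Nⁿ-cong 2 e ⟫ Nⁿ-scale 2 n x ⟫ ⊡-cong {n} {n} refl e ⟫ nn x
  through : ∀ k {r x y} -> k * suc m ≡ r -> Nⁿ k x ≈ y -> Tⁿ r x ≈ y
  through k {x = x} refl e = (\ i -> cong (\ v -> v i % p) (sym (Nⁿ≡ k x))) ⟫ e
  four : 4 * suc m ≡ 2 ^ (2 + b)
  four = cong (4 *_) m≡ » lem (2 ^ b)
   where
   lem : ∀ x -> 4 * x ≡ 2 * (2 * x)
   lem = solve-∀
  E-period : Tⁿ (2 ^ (2 + b)) (E 1) ≈ E 1
  E-period = through 4 four (fourth N²E)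
  F-period : Tⁿ (2 ^ (2 + b)) (F 1) ≈ F 1
  F-period = through 4 four (fourth N²F)
  1≤g : 1 ≤ g
  1≤g = ^-≥1 b z<s ⋙ le
  moved : ¬ (Tⁿ (2 ^ suc b) (F 1) ≈ F 1)
  moved e = p∤2 (m%n≡0⇒n∣m 2 p (+-cong-≋ {1} {n} {1} {1} (sym 1≋n) refl » (n+1≋0) » m<n⇒m%n≡m (prime≥1 pp)))
   where
   at = first 1≤g ↑ˡ g
   1≋n : n ≋ 1
   1≋n = cong (_% p) (sym (*-identityʳ n) » cong (n *_) (sym (F₁-lo 1≤g))) » sym (≈-trans (through 2 (cong (2 *_) m≡) N²F) ≈-refl at) » e at » cong (_% p) (F₁-lo 1≤g)

-- Elements of odd prime power order

module OddOrder where
 open Nat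
 open Sums using (is-yes; is-no)
 open Arithmetic using (prime≥2; prime≥1; *-≥1; prime-∣-^; ^-≥1)
 open OrbitCounting
 open PrimitiveRoots using (m<n*m)
 open LinearAlgebra
 open CyclicSubspaces
 open SymplecticForm
 open MatrixOrder
 open BlockShift
 open WaveMatrix
 open WavePeriod
 -- A pulse on a path of h = (ℓ-1)/2 points runs to the far end, is reflected with a change of sign
 -- by the loop -1, runs back and changes sign again at the left boundary. It returns to its start
 -- after 2h + 1 = ℓ laps, and ℓ^b blocks raise the order to ℓ^(b+1).
 order-odd : ∀ p (pp : Prime p) g ℓ h b -> Prime ℓ -> ℓ ≡ suc (h + h) -> 1 ≤ h -> ¬ (p ∣ ℓ) -> ℓ ^ b * h ≤ g -> SpHasOrder p g {{prime⇒nonZero pp}} (ℓ ^ suc b)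
 order-odd p pp g ℓ h b pℓ ℓ≡ 1≤h p∤ℓ le = Realize.prime-power-order p pp g f f-linear ℓ b pℓ p∤ℓ f-ω
   (basis-period (ℓ ^ suc b) (\ i i<h -> through ℓ ℓm (fst (all-periodic (suc i) i<h))) (\ i i<h -> through ℓ ℓm (snd (all-periodic (suc i) i<h)))) (F 1) moved
  where
  m : ℕ
  m = ℓ ^ b ∸ 1
  m≡ : suc m ≡ ℓ ^ b
  m≡ = m+[n∸m]≡n (^-≥1 b (prime≥1 pℓ))
  open Period p pp g h m (p ∸ 1) 1≤h (≤-reflexive (cong (_* h) m≡) ⋙ le)
  ℓm : ℓ * suc m ≡ ℓ ^ suc b
  ℓm = cong (ℓ *_) m≡
  through : ∀ k {r x y} -> k * suc m ≡ r -> Nⁿ k x ≈ y -> Tⁿ r x ≈ y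
  through k {x = x} refl e = (\ i -> cong (\ v -> v i % p) (sym (Nⁿ≡ k x))) ⟫ e
  n-cancel : ∀ x -> n ⊡ x ⊞ x ≈ 0v
  n-cancel x i = neg1-≋ (x i)
  N-add : ∀ x y -> N (x ⊞ y) ≈ N x ⊞ N y
  N-add = Linear.add N-linear
  N-next : ∀ a -> suc a < h -> N (F a ⊞ E (suc a)) ≈ F (suc a) ⊞ E (2 + a)
  N-next a l = N-add (F a) (E (suc a)) ⟫ ⊞-cong {N (F a)} {n ⊡ E a} (N-F a (n≤1+n a ⋙ (<⇒≤ l))) (N-E a l) ⟫ (≗⇒≈ (\ i -> lem (n * E a i) (F (suc a) i) (E a i) (E (2 + a) i))) ⟫ ⊞-cong {n ⊡ E a ⊞ E a} {0v} {F (suc a) ⊞ E (2 + a)} (n-cancel (E a)) ≈-refl ⟫ ≈-refl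
   where
   lem : ∀ x f e e′ -> x + (f + (e + e′)) ≡ x + e + (f + e′)
   lem = solve-∀
  up : ∀ a -> a < h -> Nⁿ a (E 1) ≈ F a ⊞ E (suc a)
  up zero    _ = ≈-sym (⊞-cong {F 0} {0v} {E 1} F-0 ≈-refl)
  up (suc a) l = Linear.cong-≈ N-linear (up a (<⇒≤ l)) ⟫ N-next a l
  h-1 : ℕ
  h-1 = h ∸ 1
  suc-h-1 : suc h-1 ≡ h
  suc-h-1 = m+[n∸m]≡n 1≤h
  top : Nⁿ (suc h-1) (E 1) ≈ F (suc h-1) ⊞ n ⊡ E (suc h-1)
  top = Linear.cong-≈ N-linear (up h-1 (≤-reflexive suc-h-1)) ⟫ N-add (F h-1) (E (suc h-1)) ⟫ ⊞-cong {N (F h-1)} {n ⊡ E h-1} (N-F h-1 (n≤1+n h-1 ⋙ ≤-reflexive suc-h-1)) (N-E-end h-1 suc-h-1) ⟫ (≗⇒≈ (\ i -> lem (n * E h-1 i) (F (suc h-1) i) (E h-1 i) (n * E (suc h-1) i))) ⟫ ⊞-cong {n ⊡ E h-1 ⊞ E h-1} {0v} {F (suc h-1) ⊞ n ⊡ E (suc h-1)} (n-cancel (E h-1)) ≈-refl ⟫ ≈-refl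
   where
   lem : ∀ x f e e′ -> x + (f + (e + e′)) ≡ x + e + (f + e′)
   lem = solve-∀
  turn : Nⁿ (suc (suc h-1)) (E 1) ≈ n ⊡ (F (suc h-1) ⊞ E h-1)
  turn = Linear.cong-≈ N-linear top ⟫ N-add (F (suc h-1)) (n ⊡ E (suc h-1)) ⟫ ⊞-cong {N (F (suc h-1))} {n ⊡ E (suc h-1)} (N-F (suc h-1) (≤-reflexive suc-h-1)) (Linear.scale N-linear n (E (suc h-1)) ⟫ ⊡-cong {n} {n} refl (N-E-end h-1 suc-h-1)) ⟫ (≗⇒≈ (\ i -> lem n (F (suc h-1) i) (E h-1 i) (E (suc h-1) i))) ⟫ ⊞-cong {n ⊡ (n ⊡ E (suc h-1)) ⊞ n ⊡ E (suc h-1)} {0v} {n ⊡ (F (suc h-1) ⊞ E h-1)} (n-cancel (n ⊡ E (suc h-1))) ≈-refl ⟫ ≈-refl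
   where
   lem : ∀ n f e e′ -> n * e′ + n * (f + (e + n * e′)) ≡ n * (n * e′) + n * e′ + n * (f + e)
   lem = solve-∀
  down : ∀ t a -> t + suc a ≡ suc h-1 -> Nⁿ (t + suc (suc h-1)) (E 1) ≈ n ⊡ (F (suc a) ⊞ E a)
  down zero    a refl = turn
  down (suc t) a e = Linear.cong-≈ N-linear (down t (suc a) (+-suc t (suc a) » e)) ⟫ Linear.scale N-linear n (F (2 + a) ⊞ E (suc a)) ⟫ ⊡-cong {n} {n} refl
    (N-add (F (2 + a)) (E (suc a)) ⟫ ⊞-cong {N (F (2 + a))} {n ⊡ E (2 + a)} (N-F (2 + a) l) (N-E a l) ⟫ (≗⇒≈ (\ i -> lem (n * E (2 + a) i) (F (suc a) i) (E a i) (E (2 + a) i))) ⟫ ⊞-cong {n ⊡ E (2 + a) ⊞ E (2 + a)} {0v} {F (suc a) ⊞ E a} (n-cancel (E (2 + a))) ≈-refl ⟫ ≈-refl)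
   where
   l : 2 + a ≤ h
   l = (s≤s (m≤n+m (suc a) t) ⋙ ≤-reflexive e) ⋙ ≤-reflexive suc-h-1
   lem : ∀ x f e e′ -> x + (f + (e + e′)) ≡ x + e′ + (f + e)
   lem = solve-∀
  Periodic : V -> Set
  Periodic x = Nⁿ ℓ x ≈ x
  nn : ∀ x -> n ⊡ (n ⊡ x) ≈ x
  nn x i = +-cancelʳ-≋ {n * (n * x i)} {x i} (n * x i) (neg1-≋ (n * x i) » sym (cong (_% p) (+-comm (x i) (n * x i)) » neg1-≋ (x i)))
  E₁-periodic : Periodic (E 1)
  E₁-periodic = (\ i -> cong (\ z -> Nⁿ z (E 1) i % p) ℓ-steps) ⟫ Linear.cong-≈ N-linear (down h-1 0 (+-comm h-1 1)) ⟫ Linear.scale N-linear n (F 1 ⊞ E 0) ⟫ ⊡-cong {n} {n} refl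
    (Linear.cong-≈ N-linear (⊞-cong {F 1} {F 1} ≈-refl E-0 ⟫ (≗⇒≈ (\ i -> +-identityʳ (F 1 i)))) ⟫ N-F 1 1≤h) ⟫ nn (E 1)
   where
   ℓ-steps : ℓ ≡ suc (h-1 + suc (suc h-1))
   ℓ-steps = ℓ≡ » cong suc (cong₂ _+_ (sym suc-h-1) (sym suc-h-1) » sym (+-suc h-1 (suc h-1)))
  periodic-cong : ∀ {x y} -> x ≈ y -> Periodic x -> Periodic y
  periodic-cong e h = Nⁿ-cong ℓ (≈-sym e) ⟫ h ⟫ e
  periodic-N : ∀ j {x} -> Periodic x -> Periodic (Nⁿ j x)
  periodic-N j {x} h = (\ i -> cong (\ v -> v i % p) (sym (Nⁿ-+ ℓ j x) » cong (\ z -> Nⁿ z x) (+-comm ℓ j) » Nⁿ-+ j ℓ x)) ⟫ Nⁿ-cong j h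
  periodic-scale : ∀ {x} -> Periodic x -> Periodic (n ⊡ x)
  periodic-scale {x} h = Nⁿ-scale ℓ n x ⟫ ⊡-cong {n} {n} refl h
  periodic-right : ∀ {x y} -> Periodic (x ⊞ y) -> Periodic x -> Periodic y
  periodic-right {x} {y} h hx = ⊞-cancelʳ x (⊞-cong {Nⁿ ℓ y} {Nⁿ ℓ y} ≈-refl (≈-sym hx) ⟫ (≗⇒≈ (\ i -> +-comm (Nⁿ ℓ y i) (Nⁿ ℓ x i))) ⟫ ≈-sym (Nⁿ-add ℓ x y) ⟫ h ⟫ (≗⇒≈ (\ i -> +-comm (x i) (y i))))
  -- The outgoing pulse consists of F a and E (a+1), the returning one of F (a+1) and E a.
  -- Subtracting what is already known to be periodic isolates E (a+1) and F (a+1) in turn.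
  all-periodic : ∀ a -> a ≤ h -> Periodic (E a) × Periodic (F a)
  all-periodic zero    _ = periodic-cong (≈-sym E-0) (Lin-zero (Nⁿ-linear ℓ)) , periodic-cong (≈-sym F-0) (Lin-zero (Nⁿ-linear ℓ))
  all-periodic (suc a) l = periodic-right (periodic-cong (up a l) (periodic-N a E₁-periodic)) (snd ih)
    , periodic-right {E a} {F (suc a)} (periodic-cong (nn (F (suc a) ⊞ E a) ⟫ (≗⇒≈ (\ i -> +-comm (F (suc a) i) (E a i)))) (periodic-scale (periodic-cong (down t a t≡) (periodic-N (t + suc (suc h-1)) E₁-periodic)))) (fst ih)
   where
   ih = all-periodic a (n≤1+n a ⋙ l)
   t = h ∸ suc a
   t≡ : t + suc a ≡ suc h-1
   t≡ = m∸n+n≡m l » sym suc-h-1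
  1≤g : 1 ≤ g
  1≤g = *-≥1 (^-≥1 b (prime≥1 pℓ)) 1≤h ⋙ le
  moved : ¬ (Tⁿ (ℓ ^ b) (F 1) ≈ F 1)
  moved e = case trans (sym (m<n⇒m%n≡m (prime≥2 pp))) (1≋0 » m<n⇒m%n≡m (prime≥1 pp)) of \ ()
   where
   at = first 1≤g ↑ˡ g
   step₁ : Tⁿ (ℓ ^ b) (F 1) ≈ n ⊡ E 1
   step₁ = (\ i -> cong (\ z -> Tⁿ z (F 1) i % p) (sym m≡)) ⟫ N-F 1 1≤h
   1≋0 : 1 ≋ 0
   1≋0 = cong (_% p) (sym (F₁-lo 1≤g)) » sym (e at) » step₁ at » cong (_% p) (cong (n *_) (lo-E 1 (first 1≤g)) » *-zeroʳ n)

-- The least common multiple equals the product formula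

module LcmFormula where
 open Nat
 open Sums using (is-yes; is-no)
 open Arithmetic using (prime≥2; prime≥1; *-≥1; prime-∣-^; ^-≥1; n<p^n; p≤p^k)
 open PrimitiveRoots using (prime-factor; least; cancel-^; m<n*m; module PrimeMod)
 open OrderBound using (prime-power-bound)
 open WavePeriod using (order-2^)
 open OddOrder using (order-odd)
 open import Data.Nat.ListAction.Properties using (product-++)
 ∣-by-prime-powers : ∀ n m -> 1 ≤ n -> (∀ ℓ a -> Prime ℓ -> ℓ ^ suc a ∣ n -> ℓ ^ suc a ∣ m) -> n ∣ m
 ∣-by-prime-powers = <-rec _ step
  where
  step : ∀ n -> (∀ {k} -> k < n -> ∀ m -> 1 ≤ k -> (∀ ℓ a -> Prime ℓ -> ℓ ^ suc a ∣ k -> ℓ ^ suc a ∣ m) -> k ∣ m) ->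
   ∀ m -> 1 ≤ n -> (∀ ℓ a -> Prime ℓ -> ℓ ^ suc a ∣ n -> ℓ ^ suc a ∣ m) -> n ∣ m
  step (suc zero) rec m _ h = 1∣ m
  step n@(suc (suc _)) rec m 1≤n h with prime-factor n (s≤s z<s)
  ... | ℓ , pℓ , ℓ∣n with PrimeMod.strip ℓ pℓ ℓ pℓ n 1≤n
  ...   | zero  , n′ , e , nd , _ = ⊥-elim (nd (subst (ℓ ∣_) (e » *-identityˡ n′) ℓ∣n))
  ...   | suc s , n′ , e , nd , 1≤n′ with rec (subst (n′ <_) (sym e) (m<n*m n′ (ℓ ^ suc s) {{N.>-nonZero 1≤n′}} (prime≥2 pℓ ⋙ p≤p^k {k = suc s} (prime≥1 pℓ) z<s))) m 1≤n′ (\ q a pq d -> h q a pq (subst (q ^ suc a ∣_) (sym e) (∣n⇒∣m*n (ℓ ^ suc s) d)))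
  ...     | divides c m≡ = subst (_∣ m) (sym e) (subst (ℓ ^ suc s * n′ ∣_) (sym m≡) (*-monoˡ-∣ n′ (cancel-^ (suc s) c pℓ nd (subst (ℓ ^ suc s ∣_) (m≡ » *-comm c n′) (h ℓ s pℓ (subst (ℓ ^ suc s ∣_) (sym e) (m∣m*n n′)))))))
 no-common-prime⇒coprime : ∀ {a b} -> (∀ q -> Prime q -> q ∣ a -> q ∣ b -> ⊥) -> Coprime a b
 no-common-prime⇒coprime h {zero} (da , db) = ⊥-elim (h 2 prime[2] (∣-trans (2 ∣0) da) (∣-trans (2 ∣0) db))
 no-common-prime⇒coprime h {suc zero} _ = refl
 no-common-prime⇒coprime h {d@(suc (suc _))} (da , db) with prime-factor d (s≤s z<s)
 ... | q , pq , q∣d = ⊥-elim (h q pq (∣-trans q∣d da) (∣-trans q∣d db))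
 coprime-product : ∀ {a b m} -> Coprime a b -> a ∣ m -> b ∣ m -> a * b ∣ m
 coprime-product {a} {b} cop a∣m (divides c refl) = *-monoˡ-∣ b (coprime-divisor cop (subst (a ∣_) (*-comm c b) a∣m))
 prime∣product : ∀ {A : Set} (f : A -> ℕ) {q} -> Prime q -> ∀ xs -> q ∣ product (map f xs) -> ∃ \ x -> x ∈ xs × q ∣ f x
 prime∣product f pq []       d = ⊥-elim (¬prime[1] (subst Prime (∣1⇒≡1 d) pq))
 prime∣product f pq (x ∷ xs) d with euclidsLemma (f x) (product (map f xs)) pq d
 ... | inj₁ d′ = x , here refl , d′
 ... | inj₂ d′ with prime∣product f pq xs d′
 ...   | y , y∈ , e = y , there y∈ , e
 coprime-factors : ∀ {A : Set} (f : A -> ℕ) {m} -> (∀ x y -> x ≢ y -> Coprime (f x) (f y)) -> (∀ x -> f x ∣ m) -> ∀ xs -> Unique xs -> product (map f xs) ∣ m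
 coprime-factors f {m} cop divs []       _        = 1∣ m
 coprime-factors f {m} cop divs (x ∷ xs) (x∉ ∷ u) = coprime-product (no-common-prime⇒coprime (\ q pq d e -> case prime∣product f pq xs e of \ where
   (y , y∈ , e′) -> ¬prime[1] (subst Prime (cop x y (All.lookup x∉ y∈) (d , e′)) pq))) (divs x) (coprime-factors f cop divs xs u)
 product-concatMap : ∀ {A : Set} (F : A -> List ℕ) xs -> product (concatMap F xs) ≡ product (map (product ∘ F) xs)
 product-concatMap F []       = refl
 product-concatMap F (x ∷ xs) = product-++ (F x) (concatMap F xs) » cong (product (F x) *_) (product-concatMap F xs)
 factor∣product : ∀ {A : Set} (f : A -> ℕ) {x xs} -> x ∈ xs -> f x ∣ product (map f xs)
 factor∣product f {xs = y ∷ xs} (here refl) = m∣m*n (product (map f xs))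
 factor∣product f {xs = y ∷ xs} (there x∈)  = ∣n⇒∣m*n (f y) (factor∣product f x∈)
 Top : ℕ -> ℕ -> ℕ -> Set
 Top g p n = Prime p × 1 ≤ n × (p ∸ 1) * p ^ (n ∸ 1) ≤ 2 * g × 2 * g < (p ∸ 1) * p ^ n
 top? : ∀ g p n -> Dec (Top g p n)
 top? g p n = prime? p ×-dec (1 N.≤? n) ×-dec ((p ∸ 1) * p ^ (n ∸ 1) N.≤? 2 * g) ×-dec (2 * g N.<? (p ∸ 1) * p ^ n)
 ppTerm-top : ∀ {g p n} -> Top g p n -> ppTerm g p n ≡ p ^ n
 ppTerm-top {g} {p} {n} t = cong (if_then p ^ n else 1) (is-yes (top? g p n) t)
 ppTerm-1 : ∀ {g p n} -> ¬ Top g p n -> ppTerm g p n ≡ 1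
 ppTerm-1 {g} {p} {n} t = cong (if_then p ^ n else 1) (is-no (top? g p n) t)
 top-unique : ∀ {g p n n′} -> Top g p n -> Top g p n′ -> ¬ (n < n′)
 top-unique {g} {p} {n} {suc n′} (pp , _ , _ , gt) (_ , _ , le , _) (s≤s n≤n′) = <⇒≱ gt (*-monoʳ-≤ (p ∸ 1) (^-monoʳ-≤ p {{prime⇒nonZero pp}} n≤n′) ⋙ le)
 row : ℕ -> ℕ -> ℕ
 row g p = product (map (ppTerm g p) (upTo (2 * g + 2)))
 formula≡ : ∀ g -> formula g ≡ product (map (row g) (upTo (2 * g + 2)))
 formula≡ g = product-concatMap (\ p -> map (ppTerm g p) (upTo (2 * g + 2))) (upTo (2 * g + 2))
 -- The factors are pairwise coprime: those in different rows belong to different primes, and within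
 -- a row at most one exponent satisfies `Top`.
 formula-∣ : ∀ g m -> (∀ p n -> Top g p n -> p ^ n ∣ m) -> formula g ∣ m
 formula-∣ g m h = subst (_∣ m) (sym (formula≡ g)) (coprime-factors (row g) rows (\ p -> coprime-factors (ppTerm g p) (terms p) (term p) (upTo (2 * g + 2)) (UniqueP.upTo⁺ (2 * g + 2))) (upTo (2 * g + 2)) (UniqueP.upTo⁺ (2 * g + 2)))
  where
  term : ∀ p n -> ppTerm g p n ∣ m
  term p n = case top? g p n of \ where
   (yes t) -> subst (_∣ m) (sym (ppTerm-top {g} {p} {n} t)) (h p n t)
   (no ¬t) -> subst (_∣ m) (sym (ppTerm-1 {g} {p} {n} ¬t)) (1∣ m)
  divisor : ∀ {p n q} -> Prime q -> q ∣ ppTerm g p n -> q ≡ p × Top g p n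
  divisor {p} {n} {q} pq d = case top? g p n of \ where
   (yes t) -> prime-∣-^ n (fst t) pq (subst (q ∣_) (ppTerm-top {g} {p} {n} t) d) , t
   (no ¬t) -> ⊥-elim (¬prime[1] (subst Prime (∣1⇒≡1 (subst (q ∣_) (ppTerm-1 {g} {p} {n} ¬t) d)) pq))
  terms : ∀ p n n′ -> n ≢ n′ -> Coprime (ppTerm g p n) (ppTerm g p n′)
  terms p n n′ ne = no-common-prime⇒coprime (\ q pq d d′ -> case <-cmp′ of \ where
    (inj₁ l) -> top-unique {g} {p} {n} {n′} (snd (divisor pq d)) (snd (divisor pq d′)) l
    (inj₂ l) -> top-unique {g} {p} {n′} {n} (snd (divisor pq d′)) (snd (divisor pq d)) l)
   where
   <-cmp′ : n < n′ ⊎ n′ < n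
   <-cmp′ = case n N.<? n′ of \ where
    (yes l) -> inj₁ l
    (no ¬l) -> inj₂ (≤∧≢⇒< (≮⇒≥ ¬l) (ne ∘ sym))
  rows : ∀ p p′ -> p ≢ p′ -> Coprime (row g p) (row g p′)
  rows p p′ ne = no-common-prime⇒coprime (\ q pq d d′ -> ne (sym (of-row p pq d) » of-row p′ pq d′))
   where
   of-row : ∀ p {q} -> Prime q -> q ∣ row g p -> q ≡ p
   of-row p pq d = case prime∣product (ppTerm g p) pq (upTo (2 * g + 2)) d of \ where
    (n , _ , e) -> fst (divisor {p} {n} pq e)
 ∣-formula : ∀ g p n -> Top g p n -> p ^ n ∣ formula g
 ∣-formula g p n@(suc n′) t@(pp , _ , le , _) = subst₂ _∣_ (ppTerm-top {g} {p} {n} t) (sym (formula≡ g)) (∣-trans (factor∣product (ppTerm g p) (∈-applyUpTo⁺ (\ i -> i) n<)) (factor∣product (row g) (∈-applyUpTo⁺ (\ i -> i) p<)))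
  where
  p-1≥1 : 1 ≤ p ∸ 1
  p-1≥1 = ∸-monoˡ-≤ 1 (prime≥2 pp)
  p< : p < 2 * g + 2
  p< = subst (_≤ 2 * g + 2) (cong suc (m+[n∸m]≡n (prime≥1 pp))) (≤-reflexive (+-comm 2 (p ∸ 1)) ⋙ +-monoˡ-≤ 2 (m≤m*n (p ∸ 1) (p ^ n′) {{m^n≢0 p n′ {{prime⇒nonZero pp}}}} ⋙ le))
  n< : n < 2 * g + 2
  n< = ≤-reflexive (+-comm 2 n′) ⋙ +-monoˡ-≤ 2 ((<⇒≤ (n<p^n (prime≥2 pp) n′)) ⋙ m≤n*m (p ^ n′) (p ∸ 1) {{N.>-nonZero p-1≥1}} ⋙ le)
 top-exponent : ∀ g p b -> Prime p -> (p ∸ 1) * p ^ b ≤ 2 * g -> ∃ \ n -> Top g p n × suc b ≤ n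
 top-exponent g p b pp le with least (\ k -> 2 * g < (p ∸ 1) * p ^ k) (\ k -> 2 * g N.<? (p ∸ 1) * p ^ k) (2 * g) (<-≤-trans (n<p^n (prime≥2 pp) (2 * g)) (m≤n*m (p ^ (2 * g)) (p ∸ 1) {{N.>-nonZero (∸-monoˡ-≤ 1 (prime≥2 pp))}}))
 ... | n , gt , below = n , (pp , ≤-trans z<s b<n , ≮⇒≥ (below (n ∸ 1) (≤-reflexive (m+[n∸m]≡n (z<s ⋙ b<n)))) , gt) , b<n
  where
  b<n : b < n
  b<n = ≰⇒> (\ n≤b -> <⇒≱ gt (*-monoʳ-≤ (p ∸ 1) (^-monoʳ-≤ p {{prime⇒nonZero pp}} n≤b) ⋙ le))
 admissible-∣ : ∀ g -> 1 ≤ g -> ∀ n -> Admissible g n -> n ∣ formula g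
 admissible-∣ g 1≤g n adm = ∣-by-prime-powers n (formula g) (fst adm) \ ℓ a pℓ d ->
  case top-exponent g ℓ a pℓ (≤-reflexive (*-comm (ℓ ∸ 1) (ℓ ^ a)) ⋙ prime-power-bound g n 1≤g adm ℓ a pℓ d ⋙ ≤-reflexive (cong (g +_) (sym (+-identityʳ g)))) of \ where
   (t , top , a<t) -> ∣-trans (pow-∣ ℓ a<t) (∣-formula g ℓ t top)
  where
  pow-∣ : ∀ ℓ {a t} -> a ≤ t -> ℓ ^ a ∣ ℓ ^ t
  pow-∣ ℓ {a} {t} le = subst (ℓ ^ a ∣_) (sym (^-distribˡ-+-* ℓ a (t ∸ a)) » cong (ℓ ^_) (m+[n∸m]≡n le)) (m∣m*n (ℓ ^ (t ∸ a)))
 prime-∤ : ∀ {p q} -> Prime p -> Prime q -> p ≢ q -> ¬ (p ∣ q)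
 prime-∤ pp pq ne d with prime⇒irreducible pq d
 ... | inj₁ refl = ¬prime[1] pp
 ... | inj₂ e    = ne e
 top-admissible : ∀ g -> 1 ≤ g -> ∀ ℓ n -> Top g ℓ n -> Admissible g (ℓ ^ n)
 top-admissible g 1≤g ℓ (suc b) (pℓ , _ , le , gt) with ℓ N.≟ 2
 ... | yes refl = ^-≥1 (suc b) z<s , 2 , \ p pp odd p≢2 -> two b le gt p pp (prime-∤ pp prime[2] p≢2)
  where
  two : ∀ b -> 1 * 2 ^ b ≤ 2 * g -> 2 * g < 1 * 2 ^ suc b -> ∀ p (pp : Prime p) -> ¬ (p ∣ 2) -> SpHasOrder p g {{prime⇒nonZero pp}} (2 ^ suc b)
  -- Exponent 1 is never the top exponent of 2, as this would mean 2g < 2.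
  two zero    _  gt p pp _   = ⊥-elim (<⇒≱ gt (*-monoʳ-≤ 2 1≤g))
  two (suc b) le _  p pp p∤2 = order-2^ p pp g b p∤2 (*-cancelˡ-≤ 2 (≤-reflexive (sym (*-identityˡ (2 * 2 ^ b))) ⋙ le))
 ... | no ℓ≢2 = ^-≥1 (suc b) (prime≥1 pℓ) , ℓ , \ p pp odd p≢ℓ -> order-odd p pp g ℓ h b pℓ ℓ≡ 1≤h (prime-∤ pp pℓ p≢ℓ)
   (*-cancelˡ-≤ 2 (≤-reflexive (lem (ℓ ^ b) h » cong (\ z -> (z ∸ 1) * ℓ ^ b) (sym ℓ≡)) ⋙ le))
  where
  h : ℕ
  h = ℓ / 2
  lem : ∀ x h -> 2 * (x * h) ≡ (h + h) * x
  lem = solve-∀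
  ℓ≡ : ℓ ≡ suc (h + h)
  ℓ≡ = case (ℓ % 2 N.≟ 0) of \ where
    (yes e) -> ⊥-elim (prime-∤ prime[2] pℓ (ℓ≢2 ∘ sym) (m%n≡0⇒n∣m ℓ 2 e))
    (no ne) -> m≡m%n+[m/n]*n ℓ 2 » cong₂ _+_ (≤-antisym (≤-pred (m%n<n ℓ 2)) (n≢0⇒n>0 ne)) (double h)
   where
   double : ∀ h -> h * 2 ≡ h + h
   double = solve-∀
  1≤h : 1 ≤ h
  1≤h = n≢0⇒n>0 (\ z -> ¬prime[1] (subst Prime (ℓ≡ » cong (\ z -> suc (z + z)) z) pℓ))
 formula-is-lcm : ∀ g -> 1 ≤ g -> IsLcmOf (Admissible g) (formula g)
 formula-is-lcm g 1≤g = admissible-∣ g 1≤g , \ m h -> formula-∣ g m (\ p n t -> h (p ^ n) (top-admissible g 1≤g p n t))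
 lcm-unique : ∀ {P : ℕ -> Set} {c d} -> IsLcmOf P c -> IsLcmOf P d -> c ≡ d
 lcm-unique (c-ub , c-least) (d-ub , d-least) = ∣-antisym (c-least _ d-ub) (d-least _ c-ub)

-- Exponential growth of the product

module LogarithmicGrowth where
 open import Defs hiding (_⊗_)
 open Rationals
 open Sums
 open Arithmetic
 open Logarithm
 open SelbergFormula
 open BlockDescent
 open PrimeNumberTheorem
 open HarmonicLogarithm
 open LcmFormula
 -- The integer exp Λ(n): the prime p at positive powers of p, and 1 elsewhere.
 record PrimePowerBase (n : ℕ) : Set where
  field
   base      : ℕ
   positive  : 1 ≦ base
   of-power  : ∀ p k -> Prime p -> p N.^ suc k ≡ n -> base ≡ p
   trivial   : base ≡ 1 ⊎ ∃ \ p -> ∃ \ k -> Prime p × p N.^ suc k ≡ n × base ≡ p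
 prime-power-base : ∀ n -> PrimePowerBase n
 prime-power-base n = case anyUpTo? (\ p -> prime? p ×-dec anyUpTo? (\ k -> p N.^ suc k N.≟ n) n) (suc n) of \ where
  (yes (p , _ , pp , k , _ , e)) -> record
   { base = p ; positive = prime≥1 pp
   ; of-power = \ q j pq e′ -> prime-∣-^ (suc j) pq pp (subst (p ∣_) (e » sym e′) (m∣m*n (p N.^ k)))
   ; trivial = inj₂ (p , k , pp , e , refl) }
  (no none) -> record
   { base = 1 ; positive = P.≤-refl
   ; of-power = \ p k pp e -> ⊥-elim (none (p , s≤s (subst (p N.≤_) e (p≤p^k {k = suc k} (prime≥1 pp) z<s)) , pp , k , subst (suc k N.≤_) e (P.<⇒≤ (n<p^n (prime≥2 pp) (suc k))) , e))
   ; trivial = inj₁ refl }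
 module _ (n : ℕ) where
  open PrimePowerBase (prime-power-base n) public using () renaming (base to ppBase; positive to ppBase≥1; of-power to ppBase-power; trivial to ppBase-trivial)
 -- The least common multiple of 1, …, x, so that log Lcm x = ψ x.
 Lcm : ℕ -> ℕ
 Lcm zero    = 1
 Lcm (suc x) = Lcm x N.* ppBase (suc x)
 Lcm≥1 : ∀ x -> 1 ≦ Lcm x
 Lcm≥1 zero    = P.≤-refl
 Lcm≥1 (suc x) = *-≥1 (Lcm≥1 x) (ppBase≥1 (suc x))
 Lcm-∣ : ∀ x j -> Lcm x ∣ Lcm (j N.+ x)
 Lcm-∣ x zero    = ∣-refl
 Lcm-∣ x (suc j) = ∣-trans (Lcm-∣ x j) (m∣m*n (ppBase (suc (j N.+ x))))
 prime-power∣Lcm : ∀ {p} -> Prime p -> ∀ k {x} -> p N.^ k ≦ x -> p N.^ k ∣ Lcm x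
 prime-power∣Lcm pp zero    {x} _ = 1∣ Lcm x
 prime-power∣Lcm {p} pp (suc k) {x} le = ∣-trans at-power (subst (\ z -> Lcm (p N.^ suc k) ∣ Lcm z) (m∸n+n≡m le) (Lcm-∣ (p N.^ suc k) (x N.∸ p N.^ suc k)))
  where
  y = p N.^ suc k N.∸ 1
  suc-y : suc y ≡ p N.^ suc k
  suc-y = m+[n∸m]≡n (^-≥1 (suc k) (prime≥1 pp))
  at-power : p N.^ suc k ∣ Lcm (p N.^ suc k)
  at-power = subst₂ _∣_ (P.*-comm (p N.^ k) p) (cong Lcm suc-y) (subst (\ z -> p N.^ k N.* p ∣ Lcm y N.* z) (sym (ppBase-power (suc y) p k pp (sym suc-y))) (*-monoˡ-∣ p (prime-power∣Lcm pp k (≤-pred (subst (suc (p N.^ k) N.≤_) (sym suc-y) (^-monoʳ-< p (prime≥2 pp) (n<1+n k)))))))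
 -- p − 1 ≤ 2g for n = 1 and p(p − 1) ≤ 2g for n ≥ 2 leave only p = 2g + 1 and small p outside Lcm (2g).
 module Multiple (D : ℕ) (1≤D : 1 ≦ D) (g : ℕ) where
  r multiple : ℕ
  r = (2 N.* g) ÷ D N.+ D N.+ 1
  multiple = (2 N.* g N.+ 1) N.* (Lcm r N.* Lcm (2 N.* g))
  multiple≥1 : 1 ≦ multiple
  multiple≥1 = *-≥1 (m≤n+m 1 (2 N.* g)) (*-≥1 (Lcm≥1 r) (Lcm≥1 (2 N.* g)))
  small : ∀ p -> 1 ≦ p -> (p N.∸ 1) N.* p ≦ 2 N.* g -> p ≦ r
  small p 1≤p le = ≮⇒≥ (\ r<p -> <⇒≱ (<-÷ (2 N.* g) 1≤D) (P.*-mono-≤ (D≤ r<p) (q< r<p) ⋙ le))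
   where
   q = (2 N.* g) ÷ D
   D≤ : r N.< p -> D ≦ p N.∸ 1
   D≤ h = (m≤n+m D q ⋙ m≤m+n (q N.+ D) 1) ⋙ ∸-monoˡ-≤ 1 h
   q< : r N.< p -> suc q ≦ p
   q< h = s≤s (m≤m+n q D ⋙ m≤m+n (q N.+ D) 1) ⋙ h
  top∣ : ∀ p n -> Top g p n -> p N.^ n ∣ multiple
  top∣ p (suc zero) (pp , _ , le , _) = case p N.≤? 2 N.* g of \ where
    (yes h) -> ∣n⇒∣m*n (2 N.* g N.+ 1) (∣n⇒∣m*n (Lcm r) (prime-power∣Lcm pp 1 (subst (N._≤ 2 N.* g) (sym (*-identityʳ p)) h)))
    (no ¬h) -> ∣-trans (∣-reflexive (*-identityʳ p » P.≤-antisym p≤ (subst (N._≤ p) (P.+-comm 1 (2 N.* g)) (P.≰⇒> ¬h)))) (m∣m*n (Lcm r N.* Lcm (2 N.* g)))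
   where
   p≤ : p ≦ 2 N.* g N.+ 1
   p≤ = P.≤-reflexive (sym (m∸n+n≡m (prime≥1 pp)) » cong (N._+ 1) (sym (*-identityʳ (p N.∸ 1)))) ⋙ +-monoˡ-≤ 1 le
  top∣ p (suc (suc n)) (pp , _ , le , _) = ∣n⇒∣m*n (2 N.* g N.+ 1) (*-pres-∣ (subst (_∣ Lcm r) (*-identityʳ p) (prime-power∣Lcm pp 1 (subst (N._≤ r) (sym (*-identityʳ p)) (small p (prime≥1 pp) (*-monoʳ-≤ (p N.∸ 1) (p≤p^k {k = suc n} (prime≥1 pp) z<s) ⋙ le)))))
   (prime-power∣Lcm pp (suc n) (m≤n*m (p N.^ suc n) (p N.∸ 1) {{N.>-nonZero (∸-monoˡ-≤ 1 (prime≥2 pp))}} ⋙ le)))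
  formula∣multiple : formula g ∣ multiple
  formula∣multiple = formula-∣ g multiple top∣
 -- An integer lower bound for q∑(1/n - 1/n²) over m < n ≤ m + j, each term q(n-1)/n² being rounded
 -- down. By `step-≥` it stays below q times a difference of logarithms, and it can be evaluated.
 fraction-sum : ℕ -> ℕ -> ℕ -> ℕ
 fraction-sum q m zero    = 0
 fraction-sum q m (suc j) = fraction-sum q m j N.+ (q N.* (m N.+ j)) / (suc (m N.+ j) N.* suc (m N.+ j))
 module LogBounds (N : ℕ) (4≤N : 4 ≦ N) (sys : LogSystem N) where
  open Contract N 4≤N sys public
  open LogSystem sys
  term≤S : ∀ n {f : ℕ -> Q} k -> 1 ≦ k -> k ≦ n -> (∀ i -> # 0 ≤ f i) -> f k ≤ S n f
  term≤S n {f} k 1≤k k≤n pos = eq≥ (S-delta n k f 1≤k k≤n) ≫ S-mono n (\ i _ _ -> when-≤ (does (i N.≟ k)) (pos i))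
  h≤Λ : ∀ p k -> Prime p -> h p ≤ Λ (p N.^ suc k)
  h≤Λ p k pp = eq≥ (cong (\ b -> when b (h p)) (is-yes (pk? p (suc k) n) (pp , refl))) ≫ term≤S n (suc k) z<s (P.<⇒≤ (n<p^n (prime≥2 pp) (suc k))) (\ i -> cell p i) ≫ term≤S n p (prime≥1 pp) (p≤p^k {k = suc k} (prime≥1 pp) z<s) (\ q -> S-nonneg n (\ i _ _ -> cell q i)) ≫ eq≥ (Λ-range P.≤-refl)
   where
   n = p N.^ suc k
   cell : ∀ q i -> # 0 ≤ when (does (pk? q i n)) (h q)
   cell q i = go (pk? q i n)
    where
    go : ∀ (d : Dec (Prime q × q N.^ i ≡ n)) -> # 0 ≤ when (does d) (h q)
    go (yes (pq , _)) = h-nonneg q pq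
    go (no _)         = ≤-refl
  lg-ppBase : ∀ n -> lg (ppBase n) ≤ Λ n
  lg-ppBase n = case ppBase-trivial n of \ where
   (inj₁ e) -> eq≤ (cong lg e » lg-1) ≫ Λ≥0 n
   (inj₂ (p , k , pp , e , b)) -> eq≤ (cong lg b » additive-prime h pp) ≫ h≤Λ p k pp ≫ eq≤ (cong Λ e)
  lg-Lcm : ∀ x -> lg (Lcm x) ≤ ψ x
  lg-Lcm zero    = eq≤ lg-1
  lg-Lcm (suc x) = eq≤ (lg-* (Lcm x) (ppBase (suc x)) (Lcm≥1 x) (ppBase≥1 (suc x))) ≫ lin 4 (\ a b c d -> a ≼ b ▸ c ≼ d ▸ ⊢ a :+ c ≼ b :+ d) (lg-Lcm x) (lg-ppBase (suc x))
  lg-∣ : ∀ {a b} -> 1 ≦ b -> b ≦ N -> a ∣ b -> lg a ≤ lg b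
  lg-∣ {a} {b} 1≤b b≤N a∣b = lg-mono (n≢0⇒n>0 (\ { refl -> <⇒≢ 1≤b (sym (0∣⇒≡0 a∣b)) })) (∣⇒≤ {{N.>-nonZero 1≤b}} a∣b) b≤N
  -- Beyond 2D the increments are at most 2/n ≤ 1/D; up to 2D the trivial bound log x ≤ x is enough.
  lg-sublinear : ∀ D -> 1 ≦ D -> ∀ x -> 1 ≦ x -> x ≦ N -> lg x ≤ # x * inv D + # (2 N.* D)
  lg-sublinear D 1≤D (suc x) _ x≤N = case suc x N.≤? 2 N.* D of \ where
   (yes le) -> lin 3 (\ l e f -> l ≼ f ▸ c0 ≼ e ▸ ⊢ l ≼ e :+ f) (lg≤id (suc x) z<s x≤N ≫ #-mono le) (*≥0 (0≤# (suc x)) (inv≥0 D))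
   (no ¬le) -> let 2D≤x = ≤-pred (P.≰⇒> ¬le) ; 1≤x = P.≤-trans (*-≥1 {2} z<s 1≤D) 2D≤x in
    lin 7 (\ l a X e f i b -> l ≼ X :* e :+ f ▸ a :- l ≼ c2 :* i ▸ c2 :* i ≼ e ▸ X :* e :+ e ≼ b :* e ▸ ⊢ a ≼ b :* e :+ f)
     (lg-sublinear D 1≤D x 1≤x (P.<⇒≤ x≤N)) (Δ≤2inv x 1≤x x≤N) (*≤ʳ (0≤# 2) (inv-anti (*-≥1 {2} z<s 1≤D) 2D≤x) ≫ eq≤ (cancel-inv {2} {D} z<s 1≤D)) (eq≤ (ring 2 (\ X e -> X :* e :+ e := (X :+ c1) :* e) » cong (_* inv D) (sym (#-suc x))))
  fraction-sum≤ : ∀ q m j -> suc (m N.+ j) ≦ N -> # (fraction-sum q m j) ≤ # q * (lg (suc (m N.+ j)) - lg (suc m))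
  fraction-sum≤ q m zero    _ = eq≥ (cong (\ z -> # q * (lg (suc z) - lg (suc m))) (P.+-identityʳ m) » ring 2 (\ q l -> q :* (l :- l) := c0))
  fraction-sum≤ q m (suc j) le = eq≤ (#-+ (fraction-sum q m j) t) ≫ lin 7 (\ a t q l b c w -> a ≼ q :* (l :- b) ▸ t ≼ q :* w ▸ q :* w ≼ q :* (c :- l) ▸ ⊢ a :+ t ≼ q :* (c :- b))
    (fraction-sum≤ q m j (n≤1+n _ ⋙ le′)) floor-bound (*≤ʳ (0≤# q) (step-≥ n z<s le′ ≫ eq≤ (cong (\ z -> lg z - lg n) (cong suc (sym (+-suc m j))))))
   where
   n = suc (m N.+ j)
   t = (q N.* (m N.+ j)) / (n N.* n)
   le′ : suc n ≦ N
   le′ = subst (\ z -> suc z ≦ N) (+-suc m j) le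
   c : # n * inv n ≡ # 1
   c = inv-inverse (m N.+ j)
   scaled : # t * (# n * # n) ≤ # q * (# n - # 1)
   scaled = eq≥ ((#-* t (n N.* n)) » cong (# t *_) (#-* n n)) ≫ #-mono (m/n*n≤m (q N.* (m N.+ j)) (n N.* n)) ≫ eq≤ ((#-* q (m N.+ j)) » cong (# q *_) (ring 1 (\ x -> x := (x :+ c1) :- c1) » cong (_- # 1) (sym (#-suc (m N.+ j)))))
   floor-bound : # t ≤ # q * (inv n - inv n * inv n)
   floor-bound = eq≤ ((ring 1 (\ t -> t := t :* (c1 :* c1)) » cong (\ z -> # t * (z * z)) (sym c)) » ring 3 (\ t n i -> t :* ((n :* i) :* (n :* i)) := i :* i :* (t :* (n :* n)))) ≫ *≤ʳ (*≥0 (inv≥0 n) (inv≥0 n)) scaled ≫ eq≤ (ring 3 (\ i q n -> i :* i :* (q :* (n :- c1)) := q :* ((n :* i) :* i :- i :* i)) » cong (\ z -> # q * (z * inv n - inv n * inv n)) c » ring 2 (\ q i -> q :* (c1 :* i :- i :* i) := q :* (i :- i :* i)))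
  -- log 7.4 = log 7400 − log 1000 is the sum of the increments of log, and 2.001 < log 7.4.
  log-37/5 : 7400 ≦ N -> # 2 + inv 1000 ≤ lg 37 - lg 5
  log-37/5 le = *-cancelˡ-≤ {# q} (#-pos 999999999) (eq≤ left ≫ #-mono numeric ≫ fraction-sum≤ q 999 6400 le ≫ eq≤ (cong (# q *_) right))
   where
   m q : ℕ
   m = 1000000
   q = m N.* 1000
   numeric : m N.* 2001 ≦ fraction-sum q 999 6400
   numeric = toWitness {a? = m N.* 2001 N.≤? fraction-sum q 999 6400} _
   left : # q * (# 2 + inv 1000) ≡ # (m N.* 2001)
   left = cong (_* (# 2 + inv 1000)) (#-* m 1000) » ring 3 (\ m t i -> m :* t :* (c2 :+ i) := m :* (c2 :* t :+ t :* i)) » cong (\ z -> # m * (# 2 * # 1000 + z)) (inv-inverse 999) » cong (\ z -> # m * (z + # 1)) (sym (#-* 2 1000)) » cong (# m *_) (sym (#-+ 2000 1)) » sym (#-* m 2001)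
   right : lg 7400 - lg 1000 ≡ lg 37 - lg 5
   right = cong₂ _-_ (lg-* 200 37 z<s z<s) (lg-* 200 5 z<s z<s) » ring 3 (\ a b c -> (a :+ b) :- (a :+ c) := b :- c)
 -- c_g · 5^g ≤ C · 37^g is read off from its logarithm: log c_g ≤ (2 + 22/D) g + O(1) and 2 + 22/D ≤ log 7.4.
 formula≥1 : ∀ g -> 1 ≦ formula g
 formula≥1 g = n≢0⇒n>0 (\ z -> <⇒≢ (multiple≥1) (sym (0∣⇒≡0 (subst (_∣ multiple) z formula∣multiple))))
  where open Multiple 1 z<s g
 B C₀ C : ∀ D -> 2 ≦ D -> ℕ
 B D 2≤D = fst (Descent.pnt D 2≤D)
 C₀ D 2≤D = B D 2≤D N.+ 8 N.* D N.+ 7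
 C D 2≤D = 2 N.^ (4 N.* C₀ D 2≤D)
 module LogGrowth (D : ℕ) (2≤D : 2 ≦ D) (big : 22 N.* 1000 ≦ D) (1≤D : 1 ≦ D) (g : ℕ) (1≤g : 1 ≦ g) (N : ℕ) (4≤N : 4 ≦ N) (sys : LogSystem N)
  (7400≤N : 7400 ≦ N) (c2g≤N : Descent.c D 2≤D N.* (2 N.* g) ≦ N) (r≤N : Multiple.r D 1≤D g ≦ N) (multiple≤N : Multiple.multiple D 1≤D g ≦ N) where
  open Multiple D 1≤D g
  A A′ : ℕ
  A = formula g N.* 5 N.^ g
  A′ = C D 2≤D N.* 37 N.^ g
  open LogBounds N 4≤N sys using (ψ; R; ψ≤6; lg; lg-*; lg-sublinear; lg-Lcm; lg-∣; lg-^; lg-2^≥; log-37/5)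
  2g+1≤N : 2 N.* g N.+ 1 ≦ N
  2g+1≤N = m≤m*n (2 N.* g N.+ 1) (Lcm r N.* Lcm (2 N.* g)) {{N.>-nonZero (*-≥1 (Lcm≥1 r) (Lcm≥1 (2 N.* g)))}} ⋙ multiple≤N
  d : Q
  d = inv D
  #2g : # (2 N.* g) ≡ # 2 * # g
  #2g = #-* 2 g
  ψ-main : ψ (2 N.* g) ≤ # 2 * # g + # 8 * # g * d + # (B D 2≤D)
  ψ-main = lin 4 (\ p G e b -> p :- c2 :* G ≼ c4 :* e :* (c2 :* G) :+ b ▸ ⊢ p ≼ c2 :* G :+ con 8 :* G :* e :+ b) (eq≤ (cong (\ z -> ψ (2 N.* g) - z) (sym #2g)) ≫ (≤∣∣ (R (2 N.* g))) ≫ snd (Descent.pnt D 2≤D) N 4≤N sys (2 N.* g) (*-≥1 {2} z<s 1≤g) c2g≤N ≫ eq≤ (cong (\ z -> # 4 * inv D * z + # (B D 2≤D)) #2g))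
  lg-2g+1 : lg (2 N.* g N.+ 1) ≤ # 2 * # g * d + d + # 2 * # D
  lg-2g+1 = lg-sublinear D 1≤D (2 N.* g N.+ 1) (m≤n+m 1 (2 N.* g)) 2g+1≤N ≫ eq≤ (cong₂ (\ x y -> x * d + y) ((#-+ (2 N.* g) 1) » cong (_+ # 1) #2g) (#-* 2 D) » ring 3 (\ G e X -> (c2 :* G :+ c1) :* e :+ c2 :* X := c2 :* G :* e :+ e :+ c2 :* X))
  ψ-r : ψ r ≤ # 12 * # g * d + # 6 * # D + # 6
  ψ-r = ψ≤6 r r≤N ≫ eq≤ (cong (# 6 *_) ((#-+ (q N.+ D) 1) » cong (_+ # 1) (#-+ q D))) ≫ lin 4 (\ q X G e -> 6 · (q ≼ c2 :* G :* e) ▸ ⊢ con 6 :* (q :+ X :+ c1) ≼ con 12 :* G :* e :+ con 6 :* X :+ con 6) q≤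
   where
   q = (2 N.* g) ÷ D
   q≤ : # q ≤ # 2 * # g * d
   q≤ = eq≤ ((ring 1 (\ q -> q := q :* c1) » cong (# q *_) (sym (inv-cancel 1≤D))) » ring 3 (\ q X e -> q :* (X :* e) := (X :* q) :* e)) ≫ *≤ˡ (inv≥0 D) (eq≥ (#-* D q) ≫ #-mono (÷-upper {2 N.* g} {D} {q} 1≤D P.≤-refl) ≫ eq≤ #2g)
  -- 22 = 8 + 2 + 12: twice the 4/D of the prime number theorem at 2g, the sublinear bound for
  -- log(2g + 1), and Chebyshev's 6 at r ≈ 2g/D.
  lg-formula : lg (formula g) ≤ # 2 * # g + # 22 * # g * d + # (C₀ D 2≤D)
  lg-formula = lg-∣ multiple≥1 multiple≤N formula∣multiple ≫ eq≤ (lg-* (2 N.* g N.+ 1) (Lcm r N.* Lcm (2 N.* g)) (m≤n+m 1 (2 N.* g)) (*-≥1 (Lcm≥1 r) (Lcm≥1 (2 N.* g))) » cong (lg (2 N.* g N.+ 1) +_) (lg-* (Lcm r) (Lcm (2 N.* g)) (Lcm≥1 r) (Lcm≥1 (2 N.* g)))) ≫ lin 9 (\ a l c p d G e X b -> a ≼ c2 :* G :* e :+ e :+ c2 :* X ▸ l ≼ p ▸ p ≼ con 12 :* G :* e :+ con 6 :* X :+ con 6 ▸ c ≼ d ▸ d ≼ c2 :* G :+ con 8 :* G :* e :+ b ▸ e ≼ c1 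
      ▸ ⊢ a :+ (l :+ c) ≼ c2 :* G :+ con 22 :* G :* e :+ (b :+ con 8 :* X :+ con 7)) lg-2g+1 (lg-Lcm r) ψ-r (lg-Lcm (2 N.* g)) ψ-main (inv≤1 D) ≫ eq≤ (cong (# 2 * # g + # 22 * # g * d +_) (sym ((#-+ (B D 2≤D N.+ 8 N.* D) 7) » cong (_+ # 7) ((#-+ (B D 2≤D) (8 N.* D)) » cong (# (B D 2≤D) +_) (#-* 8 D)))))
  22d≤ : # 22 * d ≤ inv 1000
  22d≤ = *≤ʳ (0≤# 22) (inv-anti {22 N.* 1000} z<s big) ≫ eq≤ (cancel-inv {22} {1000} z<s z<s)
  lg-A : lg A ≤ lg A′
  lg-A = eq≤ (lg-* (formula g) (5 N.^ g) (formula≥1 g) (^-≥1 g z<s) » cong (lg (formula g) +_) (lg-^ 5 g z<s)) ≫ lin 8 (\ l G e c i a b C -> l ≼ c2 :* G :+ con 22 :* G :* e :+ c ▸ G :* (con 22 :* e) ≼ G :* i ▸ G :* (c2 :+ i) ≼ G :* (b :- a) ▸ c ≼ C ▸ ⊢ l :+ G :* a ≼ C :+ G :* b)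
     lg-formula (*≤ʳ (0≤# g) 22d≤) (*≤ʳ (0≤# g) (log-37/5 7400≤N)) (lg-2^≥ (C₀ D 2≤D)) ≫ eq≥ (lg-* (C D 2≤D) (37 N.^ g) (^-≥1 (4 N.* C₀ D 2≤D) z<s) (^-≥1 g z<s) » cong (lg (C D 2≤D) +_) (lg-^ 37 g z<s))
 module Growth (D : ℕ) (2≤D : 2 ≦ D) (big : 22 N.* 1000 ≦ D) (1≤D : 1 ≦ D) where
  formula-growth : ∀ g -> 1 ≦ g -> formula g N.* 5 N.^ g ≦ C D 2≤D N.* 37 N.^ g
  formula-growth g 1≤g = Harmonic.reflects-≤ K 1≤K A A′ (*-≥1 (formula≥1 g) (^-≥1 g z<s)) (*-≥1 (^-≥1 (4 N.* C₀ D 2≤D) z<s) (^-≥1 g z<s)) (m≤n+m (suc (A N.* suc A′)) ((N N.* N) N.* (N N.* N)))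
    (LogGrowth.lg-A D 2≤D big 1≤D g 1≤g N (s≤s (s≤s (s≤s z<s)) ⋙ 7400≤N) (Harmonic.system K 1≤K N (m≤m+n ((N N.* N) N.* (N N.* N)) (suc (A N.* suc A′))))
     7400≤N (m≤m+n x (r N.+ multiple) ⋙ m≤m+n (x N.+ (r N.+ multiple)) 7400) (m≤m+n r multiple ⋙ r+m≤N) (m≤n+m multiple r ⋙ r+m≤N))
   where
   r multiple x A A′ N K : ℕ
   r = Multiple.r D 1≤D g
   multiple = Multiple.multiple D 1≤D g
   x = Descent.c D 2≤D N.* (2 N.* g)
   A = formula g N.* 5 N.^ g
   A′ = C D 2≤D N.* 37 N.^ g
   N = (x N.+ (r N.+ multiple)) N.+ 7400
   -- The first summand N⁴ is what `system` asks for, and the second lets `reflects-≤` turn the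
   -- comparison of logarithms into A ≤ A′.
   K = (N N.* N) N.* (N N.* N) N.+ suc (A N.* suc A′)
   1≤K : 1 ≦ K
   1≤K = z<s ⋙ m≤n+m (suc (A N.* suc A′)) ((N N.* N) N.* (N N.* N))
   7400≤N : 7400 ≦ N
   7400≤N = m≤n+m 7400 (x N.+ (r N.+ multiple))
   r+m≤N : r N.+ multiple ≦ N
   r+m≤N = m≤n+m (r N.+ multiple) x ⋙ m≤m+n (x N.+ (r N.+ multiple)) 7400
  growth-bound : ∃ \ C -> ∀ g -> 1 ≦ g -> formula g N.* 5 N.^ g ≦ C N.* 37 N.^ g
  growth-bound = C D 2≤D , formula-growth
 growth : ∃ \ C -> ∀ g -> 1 ≦ g -> formula g N.* 5 N.^ g ≦ C N.* 37 N.^ g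
 growth = Growth.growth-bound (22 N.* 1000) (s≤s z<s) P.≤-refl z<s

open LcmFormula
open import Defs
open import Data.Nat using (_*_; _^_; _≤_)

mainTheorem8 :
  ((g : ℕ) → 1 ≤ g → IsLcmOf (Admissible g) (formula g))
  × IsLcmOf (Admissible 1) 12
  × ∃ (λ C → (g : ℕ) → 1 ≤ g → (c : ℕ) → IsLcmOf (Admissible g) c →
      (c * 5 ^ g ≤ C * 37 ^ g) × (C * 37 ^ g ≤ C * 40 ^ g))
-- `formula 1` evaluates to 12, so the second component is an instance of the first.
mainTheorem8 = formula-is-lcm , formula-is-lcm 1 z<s , bounded LogarithmicGrowth.growth
  where
  bounded : ∃ (λ C → ∀ g → 1 ≤ g → formula g * 5 ^ g ≤ C * 37 ^ g) →
    ∃ (λ C → (g : ℕ) → 1 ≤ g → (c : ℕ) → IsLcmOf (Admissible g) c → (c * 5 ^ g ≤ C * 37 ^ g) × (C * 37 ^ g ≤ C * 40 ^ g))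
  bounded (C , bound) = C , λ g 1≤g c is-lcm →
      subst (λ z → z * 5 ^ g ≤ C * 37 ^ g) (lcm-unique (formula-is-lcm g 1≤g) is-lcm) (bound g 1≤g)
    -- With 5^g cleared, 7.4 = 37/5 and 8 = 40/5 make this the comparison of 37 with 40.
    , *-monoʳ-≤ C (^-monoˡ-≤ g (m≤m+n 37 3))
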